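{- Let $d, k$ be fixed integers with $d \geq 0$ and $k \geq 3$. Then there are at most finitely many pairs of integers $(m,n)$, with $m \geq 0$ and $n \geq -(k-2)$, such that \[ F_n^{(k)} + F_{n+1}^{(k)} + \cdots + F_{n+d}^{(k)} = F_m. \]
   Context: $(F_m)_{m\geq 0}$ denotes the Fibonacci sequence: $F_0=0$, $F_1=1$, $F_{m+2}=F_{m+1}+F_m$. For an integer $k\geq 2$, the $k$-generalized Fibonacci sequence $(F^{(k)}_n)_{n\geq -(k-2)}$ is defined by the initial values $F^{(k)}_{ -k+2}=F^{(k)}_{ -k+3}=\cdots=F^{(k)}_0=0$, $F^{(k)}_1=1$, and the recurrence $F^{(k)}_{n+k}=F^{(k)}_{n+k-1}+F^{(k)}_{n+k-2}+\cdots+F^{(k)}_{n}$ for $n\geq 0$ (each term is the sum of the $k$ preceding terms). -}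

module Defs where

open import Data.Nat using (ℕ; zero; suc; _+_; _∸_; _<_; _≤?_)
open import Data.List using (List; []; _∷_; take; upTo; map)
open import Data.Nat.ListAction using (sum)
open import Relation.Nullary.Decidable using (does)
open import Data.Bool using (if_then_else_)

fib : ℕ → ℕ
fib zero = 0
fib (suc zero) = 1
fib (suc (suc m)) = fib (suc m) + fib m

-- Shifted indexing: kfibList k j = [G (j), G (j-1), ..., G 0] (most recent first),
-- where G j = F^{(k)}_{j - (k-2)}, i.e. G j is the k-generalized Fibonacci number
-- with index n = j - (k - 2).  Thus G 0 .. G (k-2) are 0, G (k-1) = 1, and for
-- j ≥ k, G j = G (j-1) + ... + G (j-k).
kgen : ℕ → ℕ → List ℕ
kstep : ℕ → ℕ → List ℕ → ℕ

kstep k j prev = if does (j ≤? k ∸ 2) then 0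
                 else (if does (j ≤? k ∸ 1) then 1 else sum (take k prev))

kgen k zero = kstep k zero [] ∷ []
kgen k (suc j) = let prev = kgen k j in kstep k (suc j) prev ∷ prev

-- G k j = F^{(k)}_{j - (k-2)}  (valid for k ≥ 2)
G : ℕ → ℕ → ℕ
G k j with kgen k j
... | x ∷ _ = x
... | [] = 0

-- F^{(k)}_n + F^{(k)}_{n+1} + ... + F^{(k)}_{n+d}, with n = j - (k-2)
windowSum : ℕ → ℕ → ℕ → ℕ
windowSum k d j = sum (map (λ i → G k (j + i)) (upTo (suc d)))

{-# OPTIONS --safe #-}
module Submission where

-- Let α be the dominant root of xᵏ = xᵏ⁻¹ + ⋯ + 1 and φ the golden ratio. A solution (m, j) makes
-- γ₁ αʲ / (γ₂ φᵐ) exponentially close to 1 for fixed γ₁, γ₂ in ℤ[α,φ]. Fix η = αⁿ/φᵐ′ = 1 + w with w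
-- small (pigeonhole) but nonzero (α and φ are multiplicatively independent), and divide j by n: then
-- ηˡ is extremely close to some θ in ℚ(α,φ) whose height is small compared with ℓ. By the pigeonhole
-- principle some nonzero G = Σ q x^(r + ℓ s), r < R, s < S, with small integer coefficients vanishes to
-- order at least RS/2 at 1; its exact order K there is less than RS, the number of its terms. The Taylor
-- coefficients of G at η of order less than K/2 are tiny because |w| is small. Replacing ηˡ by θ turns
-- them into elements of ℤ[α,φ], which must vanish by a Liouville inequality. Hermite–Padé interpolation
-- between 1 and η now bounds the K-th Taylor coefficient of G at 1, a nonzero integer, by 1/2.
-- The Liouville inequality is a consequence of α being a Pisot number. Everything is effective and only
-- rational approximations to α and φ are used.

open import Algebra.Bundles using (CommutativeRing)
import Algebra.Properties.Ring
import Algebra.Solver.Ring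
import Algebra.Solver.Ring.AlmostCommutativeRing as ACR
open import Algebra.Structures using (IsCommutativeRing)
open import Data.Empty using (⊥; ⊥-elim)
import Data.Fin as Fin
import Data.Fin.Properties as Fin
open import Data.Integer as ℤ using (ℤ; +_; -[1+_])
import Data.Integer.Properties as ℤ
open import Data.Integer.Solver using (module +-*-Solver)
open import Data.Maybe using (Maybe; just; nothing)
open import Data.Nat as ℕ using (ℕ; zero; suc; z≤n; s≤s)
import Data.Nat.Properties as ℕ
open import Data.Nat.Tactic.RingSolver using (solve-∀)
open import Data.Product using (Σ; _×_; _,_; proj₁; proj₂)
open import Data.Sum using (_⊎_; inj₁; inj₂)
open import Level using (0ℓ)
open import Relation.Binary.Definitions using (tri<; tri≈; tri>)
open import Relation.Binary.PropositionalEquality hiding (resp)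
open import Relation.Binary.Structures using (IsDecTotalOrder)
open import Relation.Nullary using (¬_; Dec; yes; no)

-- Count bits in units of U = RS/2. For ℓ = 2^p R the heights of all auxiliary numbers and the cost
-- of the Liouville inequality are O(pU), whereas θ agrees with ηˡ to about 2^(p-1) U bits. An
-- exponential in p beats a linear function of p; this is the whole source of the contradiction. The
-- parameter p is tied to w from both sides: |w| ≤ 2^(-cc p) makes vanishing at 1 felt at η, and |w|
-- ≥ 2^(-2 cc p) keeps the power |w|^K above the error of θ. One small η yields such a p, and an
-- explicit form of multiplicative independence bounds p in advance, so that the bound on j depends
-- on d and k alone. Two obstacles shape the presentation. And η and p are found by comparing
-- rational approximations whose required precision depends on η and p; since both range over a
-- fixed finite box, one precision is chosen for all of them beforehand.

record OrderedField : Set₁ where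
  infix  8 -_
  infixl 7 _*_
  infixl 6 _+_
  infix  4 _≤_
  field
    Carrier           : Set
    _+_ _*_           : Carrier → Carrier → Carrier
    -_                : Carrier → Carrier
    0# 1#             : Carrier
    isCommutativeRing : IsCommutativeRing _≡_ _+_ _*_ -_ 0# 1#
    _≤_               : Carrier → Carrier → Set
    isDecTotalOrder   : IsDecTotalOrder _≡_ _≤_
    +-monoʳ-≤         : ∀ z {x y} → x ≤ y → z + x ≤ z + y
    *-nonneg          : ∀ {x y} → 0# ≤ x → 0# ≤ y → 0# ≤ x * y
    1≰0               : ¬ (1# ≤ 0#)
    inverse           : ∀ x → ¬ (x ≤ 0#) → Σ Carrier (λ y → 0# ≤ y × x * y ≡ 1#)

-- Integer sequences, binomial coefficients and Siegel's lemma.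

module IntegerSequences where
  -- Recursing in this way makes `drop (suc N) t` the one-step shift of `drop N t` by computation,
  -- so one-step identities apply anywhere along a sequence without transport.
  drop : {A : Set} → ℕ → (ℕ → A) → ℕ → A
  drop zero    t i = t i
  drop (suc N) t i = drop N t (suc i)

  drop-≡ : ∀ {A : Set} N (t : ℕ → A) i → drop N t i ≡ t (N ℕ.+ i)
  drop-≡ zero    t i = refl
  drop-≡ (suc N) t i = trans (drop-≡ N t (suc i)) (cong t (ℕ.+-suc N i))

  Sumℤ : ℕ → (ℕ → ℤ) → ℤ
  Sumℤ zero f    = + 0
  Sumℤ (suc n) f = f 0 ℤ.+ Sumℤ n (λ i → f (suc i))

  Sumℤ-cong : ∀ n {f h} → (∀ i → f i ≡ h i) → Sumℤ n f ≡ Sumℤ n h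
  Sumℤ-cong zero p    = refl
  Sumℤ-cong (suc n) p = cong₂ ℤ._+_ (p 0) (Sumℤ-cong n (λ i → p (suc i)))

  Sumℤ-+ : ∀ n f h → Sumℤ n (λ i → f i ℤ.+ h i) ≡ Sumℤ n f ℤ.+ Sumℤ n h
  Sumℤ-+ zero f h = refl
  Sumℤ-+ (suc n) f h = trans (cong (λ z → f 0 ℤ.+ h 0 ℤ.+ z) (Sumℤ-+ n _ _))
    (+-*-Solver.solve 4 (λ a b c d → a Z.:+ b Z.:+ (c Z.:+ d) Z.:= a Z.:+ c Z.:+ (b Z.:+ d)) refl (f 0) (h 0) _ _)
    where module Z = +-*-Solver

  Sumℤ-* : ∀ n c f → Sumℤ n (λ i → c ℤ.* f i) ≡ c ℤ.* Sumℤ n f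
  Sumℤ-* zero c f = sym (ℤ.*-zeroʳ c)
  Sumℤ-* (suc n) c f = trans (cong (λ z → c ℤ.* f 0 ℤ.+ z) (Sumℤ-* n c _)) (sym (ℤ.*-distribˡ-+ c _ _))

  Sumℤ-0 : ∀ n f → (∀ i → i ℕ.< n → f i ≡ + 0) → Sumℤ n f ≡ + 0
  Sumℤ-0 zero f h = refl
  Sumℤ-0 (suc n) f h = cong₂ ℤ._+_ (h 0 (s≤s z≤n)) (Sumℤ-0 n _ (λ i p → h (suc i) (s≤s p)))

  Recℤ : ℕ → (ℕ → ℤ) → Set
  Recℤ k t = ∀ N → drop N t k ≡ Sumℤ k (drop N t)

module Combinatorics where
  open import Data.Fin using (Fin; toℕ; fromℕ<; funToFin; finToFun; combine)
  open import Data.Fin.Properties using (pigeonhole; toℕ<n; toℕ-fromℕ<; toℕ-injective; fromℕ<-toℕ; funToFin-finToFin; finToFun-funToFin)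
  open IntegerSequences

  bin : ℕ → ℕ → ℕ
  bin _ zero          = 1
  bin zero (suc j)    = 0
  bin (suc e) (suc j) = bin e j ℕ.+ bin e (suc j)

  -- This is (e - j) C(e,j) = (j + 1) C(e,j+1) without subtraction. It describes the effect of x
  -- d/dx on Taylor coefficients at 1.
  bin-absorb : ∀ e j → e ℕ.* bin e j ≡ suc j ℕ.* bin e (suc j) ℕ.+ j ℕ.* bin e j
  bin-absorb zero zero    = refl
  bin-absorb zero (suc j) = sym (trans (cong₂ ℕ._+_ (ℕ.*-zeroʳ (suc (suc j))) (ℕ.*-zeroʳ (suc j))) refl)
  bin-absorb (suc e) zero = trans (cong suc (trans (bin-absorb e 0) (ℕ.+-identityʳ _))) (lemma (bin e 1))
    where
    lemma : ∀ x → suc (1 ℕ.* x) ≡ 1 ℕ.* (1 ℕ.+ x) ℕ.+ 0 ℕ.* 1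
    lemma = solve-∀
  bin-absorb (suc e) (suc j) = trans (lemma₁ e (bin e j) (bin e (suc j)))
    (trans (cong₂ (λ x y → x ℕ.+ y ℕ.+ (bin e j ℕ.+ bin e (suc j))) (bin-absorb e j) (bin-absorb e (suc j)))
      (lemma₂ j (bin e j) (bin e (suc j)) (bin e (suc (suc j)))))
    where
    lemma₁ : ∀ e x y → suc e ℕ.* (x ℕ.+ y) ≡ e ℕ.* x ℕ.+ e ℕ.* y ℕ.+ (x ℕ.+ y)
    lemma₁ = solve-∀
    lemma₂ : ∀ j x y z → suc j ℕ.* y ℕ.+ j ℕ.* x ℕ.+ (suc (suc j) ℕ.* z ℕ.+ suc j ℕ.* y) ℕ.+ (x ℕ.+ y) ≡
                         suc (suc j) ℕ.* (y ℕ.+ z) ℕ.+ suc j ℕ.* (x ℕ.+ y)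
    lemma₂ = solve-∀

  -- The j-th Taylor coefficient at 1 of Σ qᵢ x^(e i).
  moment : ℕ → (ℕ → ℤ) → (ℕ → ℕ) → ℕ → ℤ
  moment N q e j = Sumℤ N (λ i → q i ℤ.* + bin (e i) j)

  -- A polynomial with N terms cannot vanish to order N at 1.
  moments-zero : ∀ N q e → (∀ i i′ → i ℕ.< N → i′ ℕ.< N → e i ≡ e i′ → i ≡ i′) →
                 (∀ j → j ℕ.< N → moment N q e j ≡ + 0) → ∀ i → i ℕ.< N → q i ≡ + 0
  moments-zero (suc N) q e inj z = λ { zero _ → q₀ ; (suc i) (s≤s p) → tail i p }
    where
    open +-*-Solver using (con; _:+_; _:*_; _:-_; _:=_) renaming (solve to solveℤ)
    -- These are the coefficients of (x d/dx - e 0) applied to the polynomial. The first term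
    -- disappears, the others survive because the exponents are distinct, and the order of vanishing
    -- drops by at most one.
    q′ : ℕ → ℤ
    q′ i = q (suc i) ℤ.* (+ e (suc i) ℤ.- + e 0)
    e′ : ℕ → ℕ
    e′ i = e (suc i)
    absorb : ∀ e j → + e ℤ.* + bin e j ≡ + suc j ℤ.* + bin e (suc j) ℤ.+ + j ℤ.* + bin e j
    absorb e j = trans (sym (ℤ.pos-* e (bin e j))) (trans (cong +_ (bin-absorb e j))
      (trans (ℤ.pos-+ (suc j ℕ.* bin e (suc j)) (j ℕ.* bin e j)) (cong₂ ℤ._+_ (ℤ.pos-* (suc j) (bin e (suc j))) (ℤ.pos-* j (bin e j)))))
    term : ∀ j i → q i ℤ.* (+ e i ℤ.- + e 0) ℤ.* + bin (e i) j ≡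
                   + suc j ℤ.* (q i ℤ.* + bin (e i) (suc j)) ℤ.+ (+ j ℤ.- + e 0) ℤ.* (q i ℤ.* + bin (e i) j)
    term j i = trans (solveℤ 4 (λ q x y b → q :* (x :- y) :* b := q :* (x :* b) :- y :* (q :* b)) refl (q i) (+ e i) (+ e 0) (+ bin (e i) j))
      (trans (cong (λ w → q i ℤ.* w ℤ.- + e 0 ℤ.* (q i ℤ.* + bin (e i) j)) (absorb (e i) j))
        (solveℤ 6 (λ q y b s c j → q :* (s :* c :+ j :* b) :- y :* (q :* b) := s :* (q :* c) :+ (j :- y) :* (q :* b)) refl (q i) (+ e 0) (+ bin (e i) j) (+ suc j) (+ bin (e i) (suc j)) (+ j)))
    moment′ : ∀ j → j ℕ.< N → moment N q′ e′ j ≡ + 0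
    moment′ j j<N = begin
      moment N q′ e′ j                                          ≡⟨ ℤ.+-identityˡ _ ⟨
      + 0 ℤ.+ moment N q′ e′ j                                  ≡⟨ cong (λ w → w ℤ.+ moment N q′ e′ j) (solveℤ 3 (λ q y b → con (+ 0) := q :* (y :- y) :* b) refl (q 0) (+ e 0) (+ bin (e 0) j)) ⟩
      Sumℤ (suc N) (λ i → q i ℤ.* (+ e i ℤ.- + e 0) ℤ.* + bin (e i) j) ≡⟨ Sumℤ-cong (suc N) (term j) ⟩
      Sumℤ (suc N) (λ i → + suc j ℤ.* (q i ℤ.* + bin (e i) (suc j)) ℤ.+ (+ j ℤ.- + e 0) ℤ.* (q i ℤ.* + bin (e i) j)) ≡⟨ Sumℤ-+ (suc N) (λ i → + suc j ℤ.* (q i ℤ.* + bin (e i) (suc j))) (λ i → (+ j ℤ.- + e 0) ℤ.* (q i ℤ.* + bin (e i) j)) ⟩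
      Sumℤ (suc N) (λ i → + suc j ℤ.* (q i ℤ.* + bin (e i) (suc j))) ℤ.+ Sumℤ (suc N) (λ i → (+ j ℤ.- + e 0) ℤ.* (q i ℤ.* + bin (e i) j))
        ≡⟨ cong₂ ℤ._+_ (Sumℤ-* (suc N) (+ suc j) (λ i → q i ℤ.* + bin (e i) (suc j))) (Sumℤ-* (suc N) (+ j ℤ.- + e 0) (λ i → q i ℤ.* + bin (e i) j)) ⟩
      + suc j ℤ.* moment (suc N) q e (suc j) ℤ.+ (+ j ℤ.- + e 0) ℤ.* moment (suc N) q e j
        ≡⟨ cong₂ (λ x y → + suc j ℤ.* x ℤ.+ (+ j ℤ.- + e 0) ℤ.* y) (z (suc j) (s≤s j<N)) (z j (ℕ.m<n⇒m<1+n j<N)) ⟩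
      + suc j ℤ.* + 0 ℤ.+ (+ j ℤ.- + e 0) ℤ.* + 0               ≡⟨ cong₂ ℤ._+_ (ℤ.*-zeroʳ (+ suc j)) (ℤ.*-zeroʳ (+ j ℤ.- + e 0)) ⟩
      + 0                                                       ∎
      where open ≡-Reasoning
    tail : ∀ i → i ℕ.< N → q (suc i) ≡ + 0
    tail i i<N = cancel (ℤ.i*j≡0⇒i≡0∨j≡0 (q (suc i)) (moments-zero N q′ e′
                   (λ i i′ p p′ eq → ℕ.suc-injective (inj (suc i) (suc i′) (s≤s p) (s≤s p′) eq)) moment′ i i<N))
      where
      cancel : (q (suc i) ≡ + 0) ⊎ (+ e (suc i) ℤ.- + e 0 ≡ + 0) → q (suc i) ≡ + 0
      cancel (inj₁ p) = p
      cancel (inj₂ p) = ⊥-elim (ℕ.1+n≢0 (inj (suc i) 0 (s≤s i<N) (s≤s z≤n) (ℤ.+-injective (ℤ.i-j≡0⇒i≡j (+ e (suc i)) (+ e 0) p))))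
    q₀ : q 0 ≡ + 0
    q₀ = begin
      q 0                                                        ≡⟨ ℤ.*-identityʳ (q 0) ⟨
      q 0 ℤ.* + 1                                                ≡⟨ ℤ.+-identityʳ _ ⟨
      q 0 ℤ.* + 1 ℤ.+ + 0                                        ≡⟨ cong (λ w → q 0 ℤ.* + 1 ℤ.+ w) (Sumℤ-0 N _ (λ i p → cong (λ w → w ℤ.* + 1) (tail i p))) ⟨
      moment (suc N) q e 0                                       ≡⟨ z 0 (s≤s z≤n) ⟩
      + 0                                                        ∎
      where open ≡-Reasoning

  SumN : ℕ → (ℕ → ℕ) → ℕ
  SumN zero f    = 0
  SumN (suc n) f = f 0 ℕ.+ SumN n (λ i → f (suc i))

  SumN-mono : ∀ n {f h} → (∀ i → i ℕ.< n → f i ℕ.≤ h i) → SumN n f ℕ.≤ SumN n h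
  SumN-mono zero p    = z≤n
  SumN-mono (suc n) p = ℕ.+-mono-≤ (p 0 (s≤s z≤n)) (SumN-mono n (λ i q → p (suc i) (s≤s q)))

  SumN-const : ∀ n c → SumN n (λ _ → c) ≡ n ℕ.* c
  SumN-const zero c    = refl
  SumN-const (suc n) c = cong (c ℕ.+_) (SumN-const n c)

  private
    funToFin-cong : ∀ {m n} {f h : Fin m → Fin n} → (∀ i → f i ≡ h i) → funToFin f ≡ funToFin h
    funToFin-cong {zero} p = refl
    funToFin-cong {suc m} p = cong₂ combine (p Fin.zero) (funToFin-cong (λ i → p (Fin.suc i)))

    Sumℤ-difference : ∀ n (x y c : ℕ → ℕ) → Sumℤ n (λ i → (+ x i ℤ.- + y i) ℤ.* + c i) ≡
                      + SumN n (λ i → x i ℕ.* c i) ℤ.- + SumN n (λ i → y i ℕ.* c i)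
    Sumℤ-difference zero x y c = refl
    Sumℤ-difference (suc n) x y c = trans (cong (λ w → (+ x 0 ℤ.- + y 0) ℤ.* + c 0 ℤ.+ w) (Sumℤ-difference n (λ i → x (suc i)) (λ i → y (suc i)) (λ i → c (suc i))))
      (trans (solveℤ 5 (λ x y c X Y → (x :- y) :* c :+ (X :- Y) := (x :* c :+ X) :- (y :* c :+ Y)) refl (+ x 0) (+ y 0) (+ c 0)
         (+ SumN n (λ i → x (suc i) ℕ.* c (suc i))) (+ SumN n (λ i → y (suc i) ℕ.* c (suc i))))
        (cong₂ (λ p q → (p ℤ.+ + SumN n (λ i → x (suc i) ℕ.* c (suc i))) ℤ.- (q ℤ.+ + SumN n (λ i → y (suc i) ℕ.* c (suc i))))
          (sym (ℤ.pos-* (x 0) (c 0))) (sym (ℤ.pos-* (y 0) (c 0)))))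
      where open +-*-Solver using (_:+_; _:*_; _:-_; _:=_) renaming (solve to solveℤ)

  module Siegel (N M h H : ℕ) (c : ℕ → ℕ → ℕ) (0<h : 0 ℕ.< h)
                (bound : ∀ (x : ℕ → ℕ) → (∀ i → x i ℕ.< h) → ∀ j → j ℕ.< M → SumN N (λ i → x i ℕ.* c i j) ℕ.< H)
                (room : H ℕ.^ M ℕ.< h ℕ.^ N) where
    private
      ext : (Fin N → Fin h) → ℕ → ℕ
      ext f i with i ℕ.<? N
      ... | yes p = toℕ (f (fromℕ< p))
      ... | no _  = 0

      ext< : ∀ f i → ext f i ℕ.< h
      ext< f i with i ℕ.<? N
      ... | yes p = toℕ<n (f (fromℕ< p))
      ... | no _  = 0<h

      ext-toℕ : ∀ f i → ext f (toℕ i) ≡ toℕ (f i)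
      ext-toℕ f i with toℕ i ℕ.<? N
      ... | yes p = cong (λ z → toℕ (f z)) (fromℕ<-toℕ i p)
      ... | no ¬p = ⊥-elim (¬p (toℕ<n i))

      values : (Fin N → Fin h) → Fin M → Fin H
      values f j = fromℕ< (bound (ext f) (ext< f) (toℕ j) (toℕ<n j))

      encode : Fin (h ℕ.^ N) → Fin (H ℕ.^ M)
      encode z = funToFin (values (finToFun z))

    record Relation : Set where
      field
        q       : ℕ → ℤ
        q-bound : ∀ i → ℤ.∣ q i ∣ ℕ.< h
        nonzero : ¬ (∀ i → i ℕ.< N → q i ≡ + 0)
        vanish  : ∀ j → j ℕ.< M → Sumℤ N (λ i → q i ℤ.* + c i j) ≡ + 0

    -- Siegel's lemma in its simplest form: there are more coefficient vectors with entries in [0,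
    -- h) than vectors of values, so two of them collide, and their difference has entries below h
    -- in absolute value.
    relation : Relation
    relation = build (pigeonhole room encode)
      where
      build : (Σ (Fin (h ℕ.^ N)) λ z → Σ (Fin (h ℕ.^ N)) λ z′ → z Fin.< z′ × encode z ≡ encode z′) → Relation
      build (z , z′ , z<z′ , eq) = record { q = q ; q-bound = q-bound ; nonzero = nonzero ; vanish = vanish }
        where
        f = finToFun {h} {N} z
        f′ = finToFun {h} {N} z′
        q : ℕ → ℤ
        q i = + ext f i ℤ.- + ext f′ i
        q-bound : ∀ i → ℤ.∣ q i ∣ ℕ.< h
        q-bound i = ℕ.≤-<-trans (ℕ.≤-trans (ℕ.≤-reflexive (cong ℤ.∣_∣ (ℤ.[+m]-[+n]≡m⊖n (ext f i) (ext f′ i)))) (ℤ.∣m⊝n∣≤m⊔n (ext f i) (ext f′ i)))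
          (ℕ.⊔-pres-<m (ext< f i) (ext< f′ i))
        nonzero : ¬ (∀ i → i ℕ.< N → q i ≡ + 0)
        nonzero all = Fin.<-irrefl z≡z′ z<z′
          where
          z≡z′ : z ≡ z′
          z≡z′ = trans (sym (funToFin-finToFin {N} {h} z)) (trans (funToFin-cong (λ i → toℕ-injective
              (trans (sym (ext-toℕ f i)) (trans (ℤ.+-injective (ℤ.i-j≡0⇒i≡j (+ ext f (toℕ i)) (+ ext f′ (toℕ i)) (all (toℕ i) (toℕ<n i)))) (ext-toℕ f′ i)))))
            (funToFin-finToFin {N} {h} z′))
        vanish : ∀ j → j ℕ.< M → Sumℤ N (λ i → q i ℤ.* + c i j) ≡ + 0
        vanish j j<M = trans (Sumℤ-difference N (ext f) (ext f′) (λ i → c i j)) (ℤ.i≡j⇒i-j≡0 (cong +_ same))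
          where
          jᶠ = fromℕ< j<M
          sameᶠ : values f jᶠ ≡ values f′ jᶠ
          sameᶠ = trans (sym (finToFun-funToFin (values f) jᶠ)) (trans (cong (λ w → finToFun {H} {M} w jᶠ) eq) (finToFun-funToFin (values f′) jᶠ))
          same : SumN N (λ i → ext f i ℕ.* c i j) ≡ SumN N (λ i → ext f′ i ℕ.* c i j)
          same = subst (λ j → SumN N (λ i → ext f i ℕ.* c i j) ≡ SumN N (λ i → ext f′ i ℕ.* c i j)) (toℕ-fromℕ< j<M)
            (trans (sym (toℕ-fromℕ< (bound (ext f) (ext< f) (toℕ jᶠ) (toℕ<n jᶠ)))) (trans (cong toℕ sameᶠ) (toℕ-fromℕ< (bound (ext f′) (ext< f′) (toℕ jᶠ) (toℕ<n jᶠ)))))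

  first-nonzero : ∀ (f : ℕ → ℤ) N → (∀ j → j ℕ.< N → f j ≡ + 0) ⊎
                  (Σ ℕ λ K → K ℕ.< N × ¬ (f K ≡ + 0) × (∀ j → j ℕ.< K → f j ≡ + 0))
  first-nonzero f zero = inj₁ (λ _ ())
  first-nonzero f (suc N) with first-nonzero f N
  ... | inj₂ (K , K<N , nz , z) = inj₂ (K , ℕ.m<n⇒m<1+n K<N , nz , z)
  ... | inj₁ z with f N ℤ.≟ + 0
  ... | no nz = inj₂ (N , ℕ.≤-refl , nz , z)
  ... | yes eq = inj₁ go
    where
    go : ∀ j → j ℕ.< suc N → f j ≡ + 0
    go j (s≤s j≤N) with ℕ.m≤n⇒m<n∨m≡n j≤N
    ... | inj₁ p    = z j p
    ... | inj₂ refl = eq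

module Rational where
  open import Data.Rational using (_≤_; _*_; 1/_; *≤*; nonNegative; positive)
  open import Data.Rational.Properties
  import Data.Integer as ℤ

  ℚ-orderedField : OrderedField
  ℚ-orderedField = record
    { isCommutativeRing = +-*-isCommutativeRing
    ; isDecTotalOrder   = ≤-isDecTotalOrder
    ; +-monoʳ-≤         = λ z → +-monoʳ-≤ z
    ; *-nonneg          = λ {x} {y} 0≤x 0≤y →
        subst (_≤ x * y) (*-zeroʳ x) (*-monoˡ-≤-nonNeg x {{nonNegative 0≤x}} 0≤y)
    ; 1≰0               = λ { (*≤* (ℤ.+≤+ ())) }
    ; inverse           = λ x x≰0 →
        let instance _ = positive (≰⇒> x≰0)
                     _ = pos⇒nonZero x
        in 1/ x , nonNegative⁻¹ (1/ x) {{pos⇒nonNeg (1/ x) {{1/pos⇒pos x}}}} , *-inverseʳ x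
    }

-- Arithmetic in an ordered field and dyadic estimates.

module FieldTheory (𝔽 : OrderedField) where
  open IntegerSequences using (Sumℤ)

  open OrderedField 𝔽 public
  open IsDecTotalOrder isDecTotalOrder public using (_≤?_)
    renaming (refl to ≤-refl; trans to ≤-trans; antisym to ≤-antisym; total to ≤-total; reflexive to ≤-reflexive)

  private
    ring : CommutativeRing 0ℓ 0ℓ
    ring = record { isCommutativeRing = isCommutativeRing }

  module R = CommutativeRing ring
  module RP = Algebra.Properties.Ring R.ring

  infixl 6 _-_
  _-_ : Carrier → Carrier → Carrier
  x - y = x + - y

  -- The separate clause for 1 makes `ι (+ 1)` compute to `1#`, as the morphism of the ring solver
  -- requires, and keeps numerals such as `2#` free of a trailing `0#`.
  ιℕ : ℕ → Carrier
  ιℕ 0 = 0#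
  ιℕ 1 = 1#
  ιℕ (suc (suc n)) = 1# + ιℕ (suc n)

  ι : ℤ → Carrier
  ι (+ n)      = ιℕ n
  ι -[1+ n ]   = - ιℕ (suc n)

  ιℕ-suc : ∀ n → ιℕ (suc n) ≡ 1# + ιℕ n
  ιℕ-suc zero    = sym (R.+-identityʳ 1#)
  ιℕ-suc (suc n) = refl

  ιℕ-+ : ∀ m n → ιℕ (m ℕ.+ n) ≡ ιℕ m + ιℕ n
  ιℕ-+ zero n = sym (R.+-identityˡ _)
  ιℕ-+ (suc m) n = begin
    ιℕ (suc (m ℕ.+ n))     ≡⟨ ιℕ-suc (m ℕ.+ n) ⟩
    1# + ιℕ (m ℕ.+ n)      ≡⟨ cong (_+_ 1#) (ιℕ-+ m n) ⟩
    1# + (ιℕ m + ιℕ n)     ≡⟨ R.+-assoc 1# _ _ ⟨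
    1# + ιℕ m + ιℕ n       ≡⟨ cong (_+ ιℕ n) (ιℕ-suc m) ⟨
    ιℕ (suc m) + ιℕ n      ∎
    where open ≡-Reasoning

  ιℕ-* : ∀ m n → ιℕ (m ℕ.* n) ≡ ιℕ m * ιℕ n
  ιℕ-* zero n = sym (R.zeroˡ _)
  ιℕ-* (suc m) n = begin
    ιℕ (n ℕ.+ m ℕ.* n)       ≡⟨ ιℕ-+ n (m ℕ.* n) ⟩
    ιℕ n + ιℕ (m ℕ.* n)      ≡⟨ cong₂ _+_ (sym (R.*-identityˡ _)) (ιℕ-* m n) ⟩
    1# * ιℕ n + ιℕ m * ιℕ n  ≡⟨ R.distribʳ (ιℕ n) 1# (ιℕ m) ⟨
    (1# + ιℕ m) * ιℕ n       ≡⟨ cong (_* ιℕ n) (ιℕ-suc m) ⟨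
    ιℕ (suc m) * ιℕ n        ∎
    where open ≡-Reasoning

  ι-neg : ∀ i → ι (ℤ.- i) ≡ - ι i
  ι-neg (+ zero)   = sym RP.-0#≈0#
  ι-neg (+ suc n)  = refl
  ι-neg -[1+ n ]   = sym (RP.-‿involutive _)

  ι-⊖ : ∀ m n → ι (m ℤ.⊖ n) ≡ ιℕ m - ιℕ n
  ι-⊖ m zero = sym (trans (cong (_+_ _) RP.-0#≈0#) (R.+-identityʳ _))
  ι-⊖ zero (suc n) = sym (R.+-identityˡ _)
  ι-⊖ (suc m) (suc n) = begin
    ι (suc m ℤ.⊖ suc n)              ≡⟨ cong ι (ℤ.[1+m]⊖[1+n]≡m⊖n m n) ⟩
    ι (m ℤ.⊖ n)                      ≡⟨ ι-⊖ m n ⟩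
    ιℕ m - ιℕ n                      ≡⟨ R.+-identityˡ _ ⟨
    0# + (ιℕ m - ιℕ n)               ≡⟨ cong (_+ (ιℕ m - ιℕ n)) (R.-‿inverseʳ 1#) ⟨
    (1# - 1#) + (ιℕ m - ιℕ n)        ≡⟨ R.+-assoc 1# _ _ ⟩
    1# + (- 1# + (ιℕ m - ιℕ n))      ≡⟨ cong (_+_ 1#) (trans (sym (R.+-assoc _ _ _)) (trans (cong (_- ιℕ n) (R.+-comm _ _)) (R.+-assoc _ _ _))) ⟩
    1# + (ιℕ m + (- 1# - ιℕ n))      ≡⟨ R.+-assoc 1# _ _ ⟨
    1# + ιℕ m + (- 1# - ιℕ n)        ≡⟨ cong₂ _+_ (sym (ιℕ-suc m)) (trans (RP.-‿+-comm 1# (ιℕ n)) (cong -_ (sym (ιℕ-suc n)))) ⟩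
    ιℕ (suc m) - ιℕ (suc n)          ∎
    where open ≡-Reasoning

  ι-+ : ∀ i j → ι (i ℤ.+ j) ≡ ι i + ι j
  ι-+ (+ m) (+ n) = ιℕ-+ m n
  ι-+ (+ m) -[1+ n ] = ι-⊖ m (suc n)
  ι-+ -[1+ m ] (+ n) = trans (ι-⊖ n (suc m)) (R.+-comm _ _)
  ι-+ -[1+ m ] -[1+ n ] = begin
    - ιℕ (suc (suc (m ℕ.+ n)))       ≡⟨ cong (λ z → - ιℕ z) (sym (ℕ.+-suc (suc m) n)) ⟩
    - ιℕ (suc m ℕ.+ suc n)           ≡⟨ cong -_ (ιℕ-+ (suc m) (suc n)) ⟩
    - (ιℕ (suc m) + ιℕ (suc n))      ≡⟨ RP.-‿+-comm _ _ ⟨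
    - ιℕ (suc m) - ιℕ (suc n)        ∎
    where open ≡-Reasoning

  private
    ι-*⁺ : ∀ m j → ι (+ m ℤ.* j) ≡ ιℕ m * ι j
    ι-*⁺ m (+ n) = trans (cong ι (sym (ℤ.pos-* m n))) (ιℕ-* m n)
    ι-*⁺ m -[1+ n ] = begin
      ι (+ m ℤ.* ℤ.- (+ suc n))      ≡⟨ cong ι (sym (ℤ.neg-distribʳ-* (+ m) (+ suc n))) ⟩
      ι (ℤ.- (+ m ℤ.* + suc n))      ≡⟨ ι-neg (+ m ℤ.* + suc n) ⟩
      - ι (+ m ℤ.* + suc n)          ≡⟨ cong -_ (ι-*⁺ m (+ suc n)) ⟩
      - (ιℕ m * ιℕ (suc n))          ≡⟨ RP.-‿distribʳ-* _ _ ⟩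
      ιℕ m * - ιℕ (suc n)            ∎
      where open ≡-Reasoning

  ι-* : ∀ i j → ι (i ℤ.* j) ≡ ι i * ι j
  ι-* (+ m) j = ι-*⁺ m j
  ι-* -[1+ m ] j = begin
    ι (ℤ.- (+ suc m) ℤ.* j)    ≡⟨ cong ι (sym (ℤ.neg-distribˡ-* (+ suc m) j)) ⟩
    ι (ℤ.- (+ suc m ℤ.* j))    ≡⟨ ι-neg (+ suc m ℤ.* j) ⟩
    - ι (+ suc m ℤ.* j)        ≡⟨ cong -_ (ι-*⁺ (suc m) j) ⟩
    - (ιℕ (suc m) * ι j)       ≡⟨ RP.-‿distribˡ-* _ _ ⟩
    - ιℕ (suc m) * ι j         ∎
    where open ≡-Reasoning

  private
    acr : ACR.AlmostCommutativeRing 0ℓ 0ℓ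
    acr = ACR.fromCommutativeRing ring

    ι-morphism : CommutativeRing.rawRing ℤ.+-*-commutativeRing ACR.-Raw-AlmostCommutative⟶ acr
    ι-morphism = record
      { ⟦_⟧ = ι ; +-homo = ι-+ ; *-homo = ι-* ; -‿homo = ι-neg ; 0-homo = refl ; 1-homo = refl }

    decι : ∀ i j → Maybe (ι i ≡ ι j)
    decι i j with i ℤ.≟ j
    ... | yes eq = just (cong ι eq)
    ... | no _   = nothing

  module Solver = Algebra.Solver.Ring (CommutativeRing.rawRing ℤ.+-*-commutativeRing) acr ι-morphism decι
  open Solver public using (solve; _:=_; _:+_; _:*_; _:-_; :-_; con)

  c0 c1 c2 c3 : ∀ {n} → Solver.Polynomial n
  c0 = con (+ 0)
  c1 = con (+ 1)
  c2 = con (+ 2)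
  c3 = con (+ 3)

  2# 3# : Carrier
  2# = ιℕ 2
  3# = ιℕ 3

  infixr 1 _⟨≤⟩_
  _⟨≤⟩_ : ∀ {x y z} → x ≤ y → y ≤ z → x ≤ z
  _⟨≤⟩_ = ≤-trans

  ≡⇒≤ : ∀ {x y} → x ≡ y → x ≤ y
  ≡⇒≤ = ≤-reflexive

  ≤-resp : ∀ {x y x′ y′} → x ≡ x′ → y ≡ y′ → x ≤ y → x′ ≤ y′
  ≤-resp refl refl p = p

  +-mono-≤ : ∀ {x y u v} → x ≤ y → u ≤ v → x + u ≤ y + v
  +-mono-≤ {x} {y} {u} {v} p q =
    +-monoʳ-≤ x q ⟨≤⟩ ≤-resp (R.+-comm v x) (R.+-comm v y) (+-monoʳ-≤ v p)

  +-monoˡ-≤ : ∀ z {x y} → x ≤ y → x + z ≤ y + z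
  +-monoˡ-≤ z p = +-mono-≤ p ≤-refl

  ≤⇒0≤- : ∀ {x y} → x ≤ y → 0# ≤ y - x
  ≤⇒0≤- {x} {y} p = ≤-resp (R.-‿inverseʳ x) refl (+-monoˡ-≤ (- x) p)

  0≤-⇒≤ : ∀ {x y} → 0# ≤ y - x → x ≤ y
  0≤-⇒≤ {x} {y} p = ≤-resp (solve 1 (λ x → c0 :+ x := x) refl x)
    (solve 2 (λ x y → (y :- x) :+ x := y) refl x y) (+-monoˡ-≤ x p)

  -- Splits an inequality into the nonnegativity of an explicit certificate and a ring identity for
  -- the solver; many estimates below are certified in this form.
  by-diff : ∀ {x y} d → 0# ≤ d → y - x ≡ d → x ≤ y
  by-diff d p eq = 0≤-⇒≤ (≤-resp refl (sym eq) p)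

  neg-mono : ∀ {x y} → x ≤ y → - y ≤ - x
  neg-mono {x} {y} p = by-diff (y - x) (≤⇒0≤- p)
    (solve 2 (λ x y → :- x :- (:- y) := y :- x) refl x y)

  +-nonneg : ∀ {x y} → 0# ≤ x → 0# ≤ y → 0# ≤ x + y
  +-nonneg p q = ≤-resp (R.+-identityʳ 0#) refl (+-mono-≤ p q)

  *-monoʳ-≤ : ∀ {z x y} → 0# ≤ z → x ≤ y → z * x ≤ z * y
  *-monoʳ-≤ {z} {x} {y} 0≤z p = by-diff (z * (y - x)) (*-nonneg 0≤z (≤⇒0≤- p))
    (solve 3 (λ x y z → z :* y :- z :* x := z :* (y :- x)) refl x y z)

  *-monoˡ-≤ : ∀ {z x y} → 0# ≤ z → x ≤ y → x * z ≤ y * z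
  *-monoˡ-≤ {z} 0≤z p = ≤-resp (R.*-comm z _) (R.*-comm z _) (*-monoʳ-≤ 0≤z p)

  *-mono-≤ : ∀ {x y u v} → 0# ≤ x → x ≤ y → 0# ≤ u → u ≤ v → x * u ≤ y * v
  *-mono-≤ 0≤x p 0≤u q = *-monoˡ-≤ 0≤u p ⟨≤⟩ *-monoʳ-≤ (0≤x ⟨≤⟩ p) q

  0≤1 : 0# ≤ 1#
  0≤1 with ≤-total 0# 1#
  ... | inj₁ p = p
  ... | inj₂ p = ≤-resp refl (solve 0 ((:- c1) :* (:- c1) := c1) refl) (*-nonneg 0≤-1 0≤-1)
    where
    0≤-1 : 0# ≤ - 1#
    0≤-1 = ≤-resp RP.-0#≈0# refl (neg-mono p)

  0≤ιℕ : ∀ n → 0# ≤ ιℕ n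
  0≤ιℕ zero    = ≤-refl
  0≤ιℕ (suc n) = ≤-resp refl (sym (ιℕ-suc n)) (+-nonneg 0≤1 (0≤ιℕ n))

  ιℕ-mono : ∀ {m n} → m ℕ.≤ n → ιℕ m ≤ ιℕ n
  ιℕ-mono {n = n} z≤n = 0≤ιℕ n
  ιℕ-mono {suc m} {suc n} (s≤s p) = ≤-resp (sym (ιℕ-suc m)) (sym (ιℕ-suc n)) (+-monoʳ-≤ 1# (ιℕ-mono p))

  *-cancelˡ-≤ : ∀ z {x y} → ¬ (z ≤ 0#) → z * x ≤ z * y → x ≤ y
  *-cancelˡ-≤ z {x} {y} z≰0 p with inverse z z≰0
  ... | z⁻¹ , 0≤z⁻¹ , eq = ≤-resp (undo x) (undo y) (*-monoʳ-≤ 0≤z⁻¹ p)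
    where
    undo : ∀ x → z⁻¹ * (z * x) ≡ x
    undo x = trans (solve 3 (λ u z x → u :* (z :* x) := (z :* u) :* x) refl z⁻¹ z x)
                   (trans (cong (_* x) eq) (R.*-identityˡ x))

  1≤⇒≰0 : ∀ {x} → 1# ≤ x → ¬ (x ≤ 0#)
  1≤⇒≰0 p q = 1≰0 (p ⟨≤⟩ q)

  infix 9 ∣_∣
  ∣_∣ : Carrier → Carrier
  ∣ x ∣ with ≤-total 0# x
  ... | inj₁ _ = x
  ... | inj₂ _ = - x

  abs-cases : ∀ x → (0# ≤ x × ∣ x ∣ ≡ x) ⊎ (x ≤ 0# × ∣ x ∣ ≡ - x)
  abs-cases x with ≤-total 0# x
  ... | inj₁ p = inj₁ (p , refl)
  ... | inj₂ p = inj₂ (p , refl)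

  0≤-neg : ∀ {x} → x ≤ 0# → 0# ≤ - x
  0≤-neg p = ≤-resp RP.-0#≈0# refl (neg-mono p)

  0≤abs : ∀ x → 0# ≤ ∣ x ∣
  0≤abs x with ≤-total 0# x
  ... | inj₁ p = p
  ... | inj₂ p = 0≤-neg p

  ≤abs : ∀ x → x ≤ ∣ x ∣
  ≤abs x with ≤-total 0# x
  ... | inj₁ p = ≤-refl
  ... | inj₂ p = p ⟨≤⟩ 0≤-neg p

  -≤abs : ∀ x → - x ≤ ∣ x ∣
  -≤abs x with ≤-total 0# x
  ... | inj₁ p = ≤-resp refl RP.-0#≈0# (neg-mono p) ⟨≤⟩ p
  ... | inj₂ p = ≤-refl

  abs-≤ : ∀ {x m} → x ≤ m → - x ≤ m → ∣ x ∣ ≤ m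
  abs-≤ {x} p q with ≤-total 0# x
  ... | inj₁ _ = p
  ... | inj₂ _ = q

  abs-nonneg : ∀ {x} → 0# ≤ x → ∣ x ∣ ≡ x
  abs-nonneg {x} p = ≤-antisym (abs-≤ ≤-refl (≤-resp refl RP.-0#≈0# (neg-mono p) ⟨≤⟩ p)) (≤abs x)

  abs-neg : ∀ x → ∣ - x ∣ ≡ ∣ x ∣
  abs-neg x = ≤-antisym (abs-≤ (-≤abs x) (≤-resp (sym (RP.-‿involutive x)) refl (≤abs x)))
    (abs-≤ (≤-resp (RP.-‿involutive x) refl (-≤abs (- x))) (≤abs (- x)))

  abs-+ : ∀ x y → ∣ x + y ∣ ≤ ∣ x ∣ + ∣ y ∣
  abs-+ x y = abs-≤ (+-mono-≤ (≤abs x) (≤abs y))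
    (≤-resp (RP.-‿+-comm x y) refl (+-mono-≤ (-≤abs x) (-≤abs y)))

  abs-* : ∀ x y → ∣ x * y ∣ ≡ ∣ x ∣ * ∣ y ∣
  abs-* x y with abs-cases x | abs-cases y
  ... | inj₁ (p , e) | inj₁ (q , f) = trans (abs-nonneg (*-nonneg p q)) (cong₂ _*_ (sym e) (sym f))
  ... | inj₁ (p , e) | inj₂ (q , f) = trans (trans (sym (abs-neg (x * y)))
      (trans (cong ∣_∣ (RP.-‿distribʳ-* x y)) (abs-nonneg (*-nonneg p (0≤-neg q))))) (cong₂ _*_ (sym e) (sym f))
  ... | inj₂ (p , e) | inj₁ (q , f) = trans (trans (sym (abs-neg (x * y)))
      (trans (cong ∣_∣ (RP.-‿distribˡ-* x y)) (abs-nonneg (*-nonneg (0≤-neg p) q)))) (cong₂ _*_ (sym e) (sym f))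
  ... | inj₂ (p , e) | inj₂ (q , f) = trans (trans (cong ∣_∣ (solve 2 (λ x y → x :* y := (:- x) :* (:- y)) refl x y))
      (abs-nonneg (*-nonneg (0≤-neg p) (0≤-neg q)))) (cong₂ _*_ (sym e) (sym f))

  abs-- : ∀ x y → ∣ x - y ∣ ≤ ∣ x ∣ + ∣ y ∣
  abs-- x y = abs-+ x (- y) ⟨≤⟩ ≡⇒≤ (cong (_+_ ∣ x ∣) (abs-neg y))

  abs-sym : ∀ x y → ∣ x - y ∣ ≡ ∣ y - x ∣
  abs-sym x y = trans (cong ∣_∣ (solve 2 (λ x y → x :- y := :- (y :- x)) refl x y)) (abs-neg _)

  infixr 9 _^_
  _^_ : Carrier → ℕ → Carrier
  x ^ zero  = 1#
  x ^ suc n = x * x ^ n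

  ^-+ : ∀ x m n → x ^ (m ℕ.+ n) ≡ x ^ m * x ^ n
  ^-+ x zero n    = sym (R.*-identityˡ _)
  ^-+ x (suc m) n = trans (cong (_*_ x) (^-+ x m n)) (sym (R.*-assoc x _ _))

  ^-distrib-* : ∀ x y n → (x * y) ^ n ≡ x ^ n * y ^ n
  ^-distrib-* x y zero    = sym (R.*-identityˡ _)
  ^-distrib-* x y (suc n) = trans (cong (_*_ (x * y)) (^-distrib-* x y n))
    (solve 4 (λ x y u v → x :* y :* (u :* v) := x :* u :* (y :* v)) refl x y _ _)

  1^ : ∀ n → 1# ^ n ≡ 1#
  1^ zero = refl
  1^ (suc n) = trans (R.*-identityˡ _) (1^ n)

  ^-* : ∀ x m n → x ^ (m ℕ.* n) ≡ (x ^ m) ^ n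
  ^-* x zero n    = sym (1^ n)
  ^-* x (suc m) n = trans (^-+ x n (m ℕ.* n)) (trans (cong (_*_ (x ^ n)) (^-* x m n)) (sym (^-distrib-* x (x ^ m) n)))

  ^-nonneg : ∀ {x} n → 0# ≤ x → 0# ≤ x ^ n
  ^-nonneg zero p    = 0≤1
  ^-nonneg (suc n) p = *-nonneg p (^-nonneg n p)

  ^-mono : ∀ {x y} n → 0# ≤ x → x ≤ y → x ^ n ≤ y ^ n
  ^-mono zero p q    = ≤-refl
  ^-mono (suc n) p q = *-mono-≤ p q (^-nonneg n p) (^-mono n p q)

  1≤^ : ∀ {x} n → 1# ≤ x → 1# ≤ x ^ n
  1≤^ n p = ≤-resp (1^ n) refl (^-mono n 0≤1 p)

  ^≤1 : ∀ {x} n → 0# ≤ x → x ≤ 1# → x ^ n ≤ 1#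
  ^≤1 n p q = ≤-resp refl (1^ n) (^-mono n p q)

  ^-monoʳ : ∀ {x m n} → 1# ≤ x → m ℕ.≤ n → x ^ m ≤ x ^ n
  ^-monoʳ {n = n} p z≤n = 1≤^ n p
  ^-monoʳ p (s≤s q) = *-monoʳ-≤ (0≤1 ⟨≤⟩ p) (^-monoʳ p q)

  ^-antiʳ : ∀ {x m n} → 0# ≤ x → x ≤ 1# → m ℕ.≤ n → x ^ n ≤ x ^ m
  ^-antiʳ {n = n} p p′ z≤n = ^≤1 n p p′
  ^-antiʳ p p′ (s≤s q) = *-monoʳ-≤ p (^-antiʳ p p′ q)

  abs-^ : ∀ x n → ∣ x ^ n ∣ ≡ ∣ x ∣ ^ n
  abs-^ x zero = abs-nonneg 0≤1
  abs-^ x (suc n) = trans (abs-* x _) (cong (_*_ ∣ x ∣) (abs-^ x n))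

  ιℕ-^ : ∀ m n → ιℕ (m ℕ.^ n) ≡ ιℕ m ^ n
  ιℕ-^ m zero    = refl
  ιℕ-^ m (suc n) = trans (ιℕ-* m (m ℕ.^ n)) (cong (_*_ (ιℕ m)) (ιℕ-^ m n))

  1≤2 : 1# ≤ 2#
  1≤2 = ιℕ-mono {1} {2} (s≤s z≤n)

  0≤2 : 0# ≤ 2#
  0≤2 = 0≤ιℕ 2

  ½ : Carrier
  ½ = proj₁ (inverse 2# (1≤⇒≰0 1≤2))

  2*½ : 2# * ½ ≡ 1#
  2*½ = proj₂ (proj₂ (inverse 2# (1≤⇒≰0 1≤2)))

  0≤½ : 0# ≤ ½
  0≤½ = proj₁ (proj₂ (inverse 2# (1≤⇒≰0 1≤2)))

  ½+½ : ½ + ½ ≡ 1#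
  ½+½ = trans (solve 1 (λ h → h :+ h := c2 :* h) refl ½) 2*½

  ½≤1 : ½ ≤ 1#
  ½≤1 = by-diff ½ 0≤½ (trans (cong (_- ½) (sym ½+½)) (solve 1 (λ h → (h :+ h) :- h := h) refl ½))

  1≰½ : ¬ (1# ≤ ½)
  1≰½ p = 1≰0 (by-diff (½ - 1# + (½ - 1#)) (+-nonneg (≤⇒0≤- p) (≤⇒0≤- p))
    (trans (solve 0 (c0 :- c1 := c1 :- c2) refl) (trans (cong (_- 2#) (sym ½+½))
      (solve 1 (λ h → (h :+ h) :- c2 := (h :- c1) :+ (h :- c1)) refl ½))))

  2^_ ½^_ : ℕ → Carrier
  2^ n = 2# ^ n
  ½^ n = ½ ^ n

  infix 10 2^_ ½^_

  2^*½^ : ∀ n → 2^ n * ½^ n ≡ 1#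
  2^*½^ n = trans (sym (^-distrib-* 2# ½ n)) (trans (cong (_^ n) 2*½) (1^ n))

  0≤2^ : ∀ n → 0# ≤ 2^ n
  0≤2^ n = ^-nonneg n 0≤2

  1≤2^ : ∀ n → 1# ≤ 2^ n
  1≤2^ n = 1≤^ n 1≤2

  0≤½^ : ∀ n → 0# ≤ ½^ n
  0≤½^ n = ^-nonneg n 0≤½

  ½^≤1 : ∀ n → ½^ n ≤ 1#
  ½^≤1 n = ^≤1 n 0≤½ ½≤1

  2^≰0 : ∀ n → ¬ (2^ n ≤ 0#)
  2^≰0 n = 1≤⇒≰0 (1≤2^ n)

  2^-mono : ∀ {m n} → m ℕ.≤ n → 2^ m ≤ 2^ n
  2^-mono = ^-monoʳ 1≤2

  ½^-anti : ∀ {m n} → m ℕ.≤ n → ½^ n ≤ ½^ m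
  ½^-anti = ^-antiʳ 0≤½ ½≤1

  ιℕ-2^ : ∀ n → ιℕ (2 ℕ.^ n) ≡ 2^ n
  ιℕ-2^ = ιℕ-^ 2

  -- Dy x n m : |x| ≤ 2^(n - m).
  record Dy (x : Carrier) (n m : ℕ) : Set where
    constructor mkDy
    field unDy : ∣ x ∣ * 2^ m ≤ 2^ n
  open Dy public

  dy-shift : ∀ {x n m n′ m′} → Dy x n m → n ℕ.+ m′ ℕ.≤ n′ ℕ.+ m → Dy x n′ m′
  dy-shift {x} {n} {m} {n′} {m′} (mkDy p) q = mkDy (*-cancelˡ-≤ (2^ m) (2^≰0 m)
    (≤-resp (solve 3 (λ x u v → x :* u :* v := u :* (x :* v)) refl ∣ x ∣ (2^ m) (2^ m′))
      (R.*-comm _ _)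
      (*-monoˡ-≤ (0≤2^ m′) p ⟨≤⟩ ≤-resp (^-+ 2# n m′) (^-+ 2# n′ m) (2^-mono q))))

  dy-* : ∀ {x y n m n′ m′} → Dy x n m → Dy y n′ m′ → Dy (x * y) (n ℕ.+ n′) (m ℕ.+ m′)
  dy-* {x} {y} {n} {m} {n′} {m′} (mkDy p) (mkDy q) = mkDy (≤-resp
    (trans (solve 4 (λ x y u v → x :* u :* (y :* v) := x :* y :* (u :* v)) refl ∣ x ∣ ∣ y ∣ (2^ m) (2^ m′))
      (cong₂ _*_ (sym (abs-* x y)) (sym (^-+ 2# m m′))))
    (sym (^-+ 2# n n′))
    (*-mono-≤ (*-nonneg (0≤abs x) (0≤2^ m)) p (*-nonneg (0≤abs y) (0≤2^ m′)) q))

  dy-+ : ∀ {x y n m} → Dy x n m → Dy y n m → Dy (x + y) (suc n) m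
  dy-+ {x} {y} {n} {m} (mkDy p) (mkDy q) = mkDy (*-monoˡ-≤ (0≤2^ m) (abs-+ x y) ⟨≤⟩
    ≤-resp (sym (R.distribʳ _ _ _)) (solve 1 (λ u → u :+ u := c2 :* u) refl (2^ n)) (+-mono-≤ p q))

  dy-neg : ∀ {x n m} → Dy x n m → Dy (- x) n m
  dy-neg {x} {n} {m} (mkDy p) = mkDy (*-monoˡ-≤ (0≤2^ m) (≡⇒≤ (abs-neg x)) ⟨≤⟩ p)

  dy-- : ∀ {x y n m} → Dy x n m → Dy y n m → Dy (x - y) (suc n) m
  dy-- p q = dy-+ p (dy-neg q)

  dy-≤ : ∀ {x y n m} → ∣ y ∣ ≤ ∣ x ∣ → Dy x n m → Dy y n m
  dy-≤ {m = m} q (mkDy p) = mkDy (*-monoˡ-≤ (0≤2^ m) q ⟨≤⟩ p)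

  dy-≡ : ∀ {x y n m} → x ≡ y → Dy x n m → Dy y n m
  dy-≡ refl p = p

  ≤2^⇒dy : ∀ {x} n → ∣ x ∣ ≤ 2^ n → Dy x n 0
  ≤2^⇒dy n p = mkDy (≤-resp (sym (R.*-identityʳ _)) refl p)

  ≤½^⇒dy : ∀ {x} m → ∣ x ∣ ≤ ½^ m → Dy x 0 m
  ≤½^⇒dy {x} m p = mkDy (*-monoˡ-≤ (0≤2^ m) p ⟨≤⟩ ≡⇒≤ (trans (R.*-comm _ _) (2^*½^ m)))

  dy⇒≤½^ : ∀ {x} m → Dy x 0 m → ∣ x ∣ ≤ ½^ m
  dy⇒≤½^ {x} m (mkDy p) = *-cancelˡ-≤ (2^ m) (2^≰0 m) (≤-resp (R.*-comm _ _) (sym (2^*½^ m)) p)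

  Sum : ℕ → (ℕ → Carrier) → Carrier
  Sum zero f    = 0#
  Sum (suc n) f = f 0 + Sum n (λ i → f (suc i))

  Sum-cong : ∀ n {f g} → (∀ i → i ℕ.< n → f i ≡ g i) → Sum n f ≡ Sum n g
  Sum-cong zero h = refl
  Sum-cong (suc n) h = cong₂ _+_ (h 0 (s≤s z≤n)) (Sum-cong n (λ i p → h (suc i) (s≤s p)))

  Sum-+ : ∀ n f g → Sum n (λ i → f i + g i) ≡ Sum n f + Sum n g
  Sum-+ zero f g = sym (R.+-identityˡ _)
  Sum-+ (suc n) f g = trans (cong (_+_ (f 0 + g 0)) (Sum-+ n _ _))
    (solve 4 (λ a b c d → a :+ b :+ (c :+ d) := a :+ c :+ (b :+ d)) refl _ _ _ _)

  Sum-*ˡ : ∀ n c f → Sum n (λ i → c * f i) ≡ c * Sum n f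
  Sum-*ˡ zero c f = sym (R.zeroʳ c)
  Sum-*ˡ (suc n) c f = trans (cong (_+_ (c * f 0)) (Sum-*ˡ n c _)) (sym (R.distribˡ c _ _))

  Sum-*ʳ : ∀ n c f → Sum n (λ i → f i * c) ≡ Sum n f * c
  Sum-*ʳ n c f = trans (Sum-cong n (λ i _ → R.*-comm (f i) c)) (trans (Sum-*ˡ n c f) (R.*-comm c _))

  Sum-0 : ∀ n → Sum n (λ _ → 0#) ≡ 0#
  Sum-0 zero = refl
  Sum-0 (suc n) = trans (R.+-identityˡ _) (Sum-0 n)

  Sum-neg : ∀ n f → Sum n (λ i → - f i) ≡ - Sum n f
  Sum-neg zero f = sym RP.-0#≈0#
  Sum-neg (suc n) f = trans (cong (_+_ _) (Sum-neg n _)) (RP.-‿+-comm _ _)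

  Sum-- : ∀ n f g → Sum n (λ i → f i - g i) ≡ Sum n f - Sum n g
  Sum-- n f g = trans (Sum-+ n f (λ i → - g i)) (cong (_+_ (Sum n f)) (Sum-neg n g))

  Sum-swap : ∀ m n (f : ℕ → ℕ → Carrier) → Sum m (λ i → Sum n (f i)) ≡ Sum n (λ j → Sum m (λ i → f i j))
  Sum-swap zero n f = sym (Sum-0 n)
  Sum-swap (suc m) n f = trans (cong (_+_ _) (Sum-swap m n (λ i → f (suc i)))) (sym (Sum-+ n (f 0) _))

  Sum-mono : ∀ n {f g} → (∀ i → i ℕ.< n → f i ≤ g i) → Sum n f ≤ Sum n g
  Sum-mono zero h = ≤-refl
  Sum-mono (suc n) h = +-mono-≤ (h 0 (s≤s z≤n)) (Sum-mono n (λ i p → h (suc i) (s≤s p)))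

  abs-Sum : ∀ n f → ∣ Sum n f ∣ ≤ Sum n (λ i → ∣ f i ∣)
  abs-Sum zero f = ≡⇒≤ (abs-nonneg ≤-refl)
  abs-Sum (suc n) f = abs-+ _ _ ⟨≤⟩ +-monoʳ-≤ _ (abs-Sum n _)

  Sum-const : ∀ n c → Sum n (λ _ → c) ≡ ιℕ n * c
  Sum-const zero c = sym (R.zeroˡ c)
  Sum-const (suc n) c = trans (cong (_+_ c) (Sum-const n c))
    (trans (solve 2 (λ c n → c :+ n :* c := (c1 :+ n) :* c) refl c (ιℕ n)) (cong (_* c) (sym (ιℕ-suc n))))

  dy-Sum : ∀ N s {f n m} → N ℕ.≤ 2 ℕ.^ s → (∀ i → i ℕ.< N → Dy (f i) n m) → Dy (Sum N f) (s ℕ.+ n) m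
  dy-Sum N s {f} {n} {m} N≤ h = mkDy (*-monoˡ-≤ (0≤2^ m) (abs-Sum N f) ⟨≤⟩ ≡⇒≤ (sym (Sum-*ʳ N (2^ m) _)) ⟨≤⟩
    Sum-mono N (λ i p → unDy (h i p)) ⟨≤⟩ ≡⇒≤ (Sum-const N (2^ n)) ⟨≤⟩
    ≤-resp refl (sym (^-+ 2# s n)) (*-monoˡ-≤ (0≤2^ n) (ιℕ-mono N≤ ⟨≤⟩ ≡⇒≤ (ιℕ-2^ s))))

  dy-ιℕ : ∀ {k} n → k ℕ.≤ 2 ℕ.^ n → Dy (ιℕ k) n 0
  dy-ιℕ {k} n p = ≤2^⇒dy n (≡⇒≤ (abs-nonneg (0≤ιℕ k)) ⟨≤⟩ ιℕ-mono p ⟨≤⟩ ≡⇒≤ (ιℕ-2^ n))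

  abs-ι : ∀ i → ∣ ι i ∣ ≡ ιℕ ℤ.∣ i ∣
  abs-ι (+ n)    = abs-nonneg (0≤ιℕ n)
  abs-ι -[1+ n ] = trans (abs-neg _) (abs-nonneg (0≤ιℕ (suc n)))

  ι-small : ∀ i → ∣ ι i ∣ ≤ ½ → i ≡ + 0
  ι-small i p with ℤ.∣ i ∣ in eq
  ... | zero  = ℤ.∣i∣≡0⇒i≡0 eq
  ... | suc n = ⊥-elim (1≰½ (ιℕ-mono {1} {suc n} (s≤s z≤n) ⟨≤⟩ ≡⇒≤ (trans (cong ιℕ (sym eq)) (sym (abs-ι i))) ⟨≤⟩ p))

  bernoulli : ∀ n {x} → 0# ≤ x → 1# + ιℕ n * x ≤ (1# + x) ^ n
  bernoulli zero {x} p = ≡⇒≤ (solve 1 (λ x → c1 :+ c0 :* x := c1) refl x)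
  bernoulli (suc n) {x} p = by-diff (ιℕ n * (x * x) + (1# + x) * ((1# + x) ^ n - (1# + ιℕ n * x)))
    (+-nonneg (*-nonneg (0≤ιℕ n) (*-nonneg p p)) (*-nonneg (+-nonneg 0≤1 p) (≤⇒0≤- (bernoulli n p))))
    (trans (cong (λ z → (1# + x) * (1# + x) ^ n - (1# + z * x)) (ιℕ-suc n))
      (solve 3 (λ n x u → (c1 :+ x) :* u :- (c1 :+ (c1 :+ n) :* x) :=
         n :* (x :* x) :+ (c1 :+ x) :* (u :- (c1 :+ n :* x))) refl (ιℕ n) x ((1# + x) ^ n)))

  bernoulli⁻ : ∀ n {x} → 0# ≤ x → x ≤ 1# → 1# - ιℕ n * x ≤ (1# - x) ^ n
  bernoulli⁻ zero {x} p _ = ≡⇒≤ (solve 1 (λ x → c1 :- c0 :* x := c1) refl x)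
  bernoulli⁻ (suc n) {x} p p′ = by-diff (ιℕ n * (x * x) + (1# - x) * ((1# - x) ^ n - (1# - ιℕ n * x)))
    (+-nonneg (*-nonneg (0≤ιℕ n) (*-nonneg p p)) (*-nonneg (≤⇒0≤- p′) (≤⇒0≤- (bernoulli⁻ n p p′))))
    (trans (cong (λ z → (1# - x) * (1# - x) ^ n - (1# - z * x)) (ιℕ-suc n))
      (solve 3 (λ n x u → (c1 :- x) :* u :- (c1 :- (c1 :+ n) :* x) :=
         n :* (x :* x) :+ (c1 :- x) :* (u :- (c1 :- n :* x))) refl (ιℕ n) x ((1# - x) ^ n)))

  -- Bernoulli gives (1 + x)^n ≥ 2 for x = 2^(-k) and n = 2^k, while (1 - x)(1 + x) ≤ 1.
  contraction-half : ∀ k → (1# - ½^ k) ^ (2 ℕ.^ k) ≤ ½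
  contraction-half k = *-cancelˡ-≤ 2# (1≤⇒≰0 1≤2) (≤-resp (R.*-comm _ _) (sym 2*½)
    (*-monoʳ-≤ (^-nonneg n 0≤y) 2≤ ⟨≤⟩ ≡⇒≤ (sym (^-distrib-* (1# - x) (1# + x) n)) ⟨≤⟩
     ^≤1 n (*-nonneg 0≤y (+-nonneg 0≤1 (0≤½^ k)))
       (by-diff (x * x) (*-nonneg (0≤½^ k) (0≤½^ k)) (solve 1 (λ x → c1 :- (c1 :- x) :* (c1 :+ x) := x :* x) refl x))))
    where
    n = 2 ℕ.^ k
    x = ½^ k
    0≤y = ≤⇒0≤- (½^≤1 k)
    2≤ : 2# ≤ (1# + x) ^ n
    2≤ = ≡⇒≤ (cong (_+_ 1#) (trans (sym (2^*½^ k)) (cong (_* x) (sym (ιℕ-2^ k))))) ⟨≤⟩ bernoulli n (0≤½^ k)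

  -- Bernoulli bounds the power with half the exponent below by ½; then square.
  1≤4*[1-½^]^ : ∀ p → 1# ≤ 2^ 2 * (1# - ½^ (suc p)) ^ (2 ℕ.^ suc p)
  1≤4*[1-½^]^ p = ≤-resp (trans (sym (^-distrib-* 2# ½ 2)) (trans (cong (_^ 2) 2*½) (1^ 2))) refl
    (*-monoʳ-≤ (0≤2^ 2) (≤-resp refl (trans (sym (^-* y n 2)) (cong (y ^_) (ℕ.*-comm n 2))) (^-mono 2 0≤½ ½≤)))
    where
    n = 2 ℕ.^ p
    x = ½^ (suc p)
    y = 1# - x
    ½≤ : ½ ≤ y ^ n
    ½≤ = ≤-resp (trans (cong (λ z → 1# - z) (trans (cong (_* x) (ιℕ-2^ p))
          (trans (solve 3 (λ u h v → u :* (h :* v) := h :* (u :* v)) refl (2^ p) ½ (½^ p))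
            (trans (cong (_*_ ½) (2^*½^ p)) (R.*-identityʳ ½)))))
          (trans (cong (_- ½) (sym ½+½)) (solve 1 (λ h → (h :+ h) :- h := h) refl ½))) refl
        (bernoulli⁻ n (0≤½^ (suc p)) (½^≤1 (suc p)))

  -- The product with the same power of 1 - x is at most 1, so the preceding lower bound becomes an
  -- upper bound.
  [1+½^]^≤4 : ∀ p → (1# + ½^ (suc p)) ^ (2 ℕ.^ suc p) ≤ 2^ 2
  [1+½^]^≤4 p = ≤-resp (R.*-identityʳ _) refl (*-monoʳ-≤ (^-nonneg n 0≤z) (1≤4*[1-½^]^ p)) ⟨≤⟩
    ≡⇒≤ (trans (solve 3 (λ z f y → z :* (f :* y) := f :* (y :* z)) refl (z ^ n) (2^ 2) (y ^ n))
       (cong (_*_ (2^ 2)) (sym (^-distrib-* y z n)))) ⟨≤⟩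
    ≤-resp refl (R.*-identityʳ _) (*-monoʳ-≤ (0≤2^ 2) (^≤1 n (*-nonneg (≤⇒0≤- (½^≤1 (suc p))) 0≤z)
       (by-diff (x * x) (*-nonneg (0≤½^ (suc p)) (0≤½^ (suc p))) (solve 1 (λ x → c1 :- (c1 :- x) :* (c1 :+ x) := x :* x) refl x))))
    where
    n = 2 ℕ.^ suc p
    x = ½^ (suc p)
    y = 1# - x
    z = 1# + x
    0≤z = +-nonneg 0≤1 (0≤½^ (suc p))

  ½^-double : ∀ n → ½^ (suc n) + ½^ (suc n) ≡ ½^ n
  ½^-double n = trans (sym (R.distribʳ (½^ n) ½ ½)) (trans (cong (_* ½^ n) ½+½) (R.*-identityˡ _))

  ½^-sum : ∀ {x y} n → x ≤ ½^ (suc n) → y ≤ ½^ (suc n) → x + y ≤ ½^ n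
  ½^-sum n p q = +-mono-≤ p q ⟨≤⟩ ≡⇒≤ (½^-double n)

  2^*½^≡ : ∀ n m → 2^ n * ½^ (n ℕ.+ m) ≡ ½^ m
  2^*½^≡ n m = trans (cong (_*_ (2^ n)) (^-+ ½ n m)) (trans (sym (R.*-assoc _ _ _))
    (trans (cong (_* ½^ m) (2^*½^ n)) (R.*-identityˡ _)))

  2^*½^≤ : ∀ n m {X} → n ℕ.+ m ℕ.≤ X → 2^ n * ½^ X ≤ ½^ m
  2^*½^≤ n m p = *-monoʳ-≤ (0≤2^ n) (½^-anti p) ⟨≤⟩ ≡⇒≤ (2^*½^≡ n m)

  n<2^n : ∀ n → n ℕ.< 2 ℕ.^ n
  n<2^n zero    = s≤s z≤n
  n<2^n (suc n) = ℕ.≤-trans (ℕ.+-mono-≤ (ℕ.m^n>0 2 n) (n<2^n n)) (ℕ.≤-reflexive (cong (2 ℕ.^ n ℕ.+_) (sym (ℕ.+-identityʳ _))))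

  ιℕ≤2^ : ∀ n → ιℕ n ≤ 2^ n
  ιℕ≤2^ n = ιℕ-mono (ℕ.<⇒≤ (n<2^n n)) ⟨≤⟩ ≡⇒≤ (ιℕ-2^ n)

  ιℕ*-tiny : ∀ {x X} m n → 0# ≤ x → x ≤ ½^ X → m ℕ.+ n ℕ.≤ X → x * ιℕ m ≤ ½^ n
  ιℕ*-tiny {x} {X} m n 0≤x p q = *-mono-≤ 0≤x p (0≤ιℕ m) (ιℕ≤2^ m) ⟨≤⟩ ≡⇒≤ (R.*-comm _ _) ⟨≤⟩ 2^*½^≤ m n q

  ι-Sumℤ : ∀ n f → ι (Sumℤ n f) ≡ Sum n (λ i → ι (f i))
  ι-Sumℤ zero f = refl
  ι-Sumℤ (suc n) f = trans (ι-+ (f 0) _) (cong (_+_ (ι (f 0))) (ι-Sumℤ n _))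

-- Taylor coefficients and Hermite-Padé interpolation.

module HermitePadé (𝔽 : OrderedField) where
  open IntegerSequences
  open FieldTheory 𝔽
  open Combinatorics

  bin-zero : ∀ {e j} → e ℕ.< j → bin e j ≡ 0
  bin-zero {zero} {suc j} _ = refl
  bin-zero {suc e} {suc j} (s≤s p) = cong₂ ℕ._+_ (bin-zero p) (bin-zero (ℕ.m<n⇒m<1+n p))

  bin-self : ∀ n → bin n n ≡ 1
  bin-self zero    = refl
  bin-self (suc n) = cong₂ ℕ._+_ (bin-self n) (bin-zero (ℕ.n<1+n n))

  bin≤2^ : ∀ e j → bin e j ℕ.≤ 2 ℕ.^ e
  bin≤2^ e zero          = ℕ.m^n>0 2 e
  bin≤2^ zero (suc j)    = z≤n
  bin≤2^ (suc e) (suc j) = ℕ.≤-trans (ℕ.+-mono-≤ (bin≤2^ e j) (bin≤2^ e (suc j))) (ℕ.≤-reflexive (cong (2 ℕ.^ e ℕ.+_) (sym (ℕ.+-identityʳ _))))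

  ιbin : ℕ → ℕ → Carrier
  ιbin e j = ιℕ (bin e j)

  ιbin-suc : ∀ e j → ιbin (suc e) (suc j) ≡ ιbin e j + ιbin e (suc j)
  ιbin-suc e j = ιℕ-+ (bin e j) (bin e (suc j))

  Sum-zero : ∀ n {f} → (∀ i → i ℕ.< n → f i ≡ 0#) → Sum n f ≡ 0#
  Sum-zero n h = trans (Sum-cong n h) (Sum-0 n)

  module _ (w : Carrier) where
    -- w^k times the k-th Taylor coefficient of x^e at 1 + w. The truncated subtraction is harmless,
    -- since the binomial coefficient vanishes for k > e; the factor w^k avoids negative powers of w
    -- in the expansion.
    shifted : ℕ → ℕ → Carrier
    shifted e k = w ^ k * (ιbin e k * (1# + w) ^ (e ℕ.∸ k))

    private
      T : ℕ → ℕ → ℕ → Carrier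
      T n e k = Sum n (λ j → ιbin e j * (ιbin j k * w ^ j))

      T-suc : ∀ n e k → T (suc n) (suc e) k ≡ T (suc n) e k + w * Sum n (λ j → ιbin e j * (ιbin (suc j) k * w ^ j))
      T-suc n e k = begin
        f₀ + Sum n (λ j → ιbin (suc e) (suc j) * (ιbin (suc j) k * w ^ suc j))
          ≡⟨ cong (_+_ f₀) (Sum-cong n (λ j _ → trans (cong (_* (ιbin (suc j) k * w ^ suc j)) (ιbin-suc e j))
               (solve 5 (λ x y b w p → (x :+ y) :* (b :* (w :* p)) := y :* (b :* (w :* p)) :+ w :* (x :* (b :* p))) refl (ιbin e j) (ιbin e (suc j)) (ιbin (suc j) k) w (w ^ j)))) ⟩
        f₀ + Sum n (λ j → A j + w * B j)
          ≡⟨ cong (_+_ f₀) (trans (Sum-+ n A (λ j → w * B j)) (cong (_+_ (Sum n A)) (Sum-*ˡ n w B))) ⟩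
        f₀ + (Sum n A + w * Sum n B)                             ≡⟨ R.+-assoc _ _ _ ⟨
        f₀ + Sum n A + w * Sum n B                               ∎
        where
        open ≡-Reasoning
        f₀ = 1# * (ιbin 0 k * 1#)
        A B : ℕ → Carrier
        A j = ιbin e (suc j) * (ιbin (suc j) k * w ^ suc j)
        B j = ιbin e j * (ιbin (suc j) k * w ^ j)

      shifted-suc : ∀ e k → shifted (suc e) (suc k) ≡ shifted e (suc k) + w * (shifted e k + shifted e (suc k))
      shifted-suc e k with ℕ.≤-<-connex (suc k) e
      ... | inj₁ k<e = begin
        w * w ^ k * (ιbin (suc e) (suc k) * η ^ (e ℕ.∸ k))      ≡⟨ cong₂ (λ x y → w * w ^ k * (x * η ^ y)) (ιbin-suc e k) e∸k ⟩
        w * w ^ k * ((ιbin e k + ιbin e (suc k)) * (η * P))      ≡⟨ solve 5 (λ w u x y P → w :* u :* ((x :+ y) :* ((c1 :+ w) :* P)) :=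
               w :* u :* (y :* P) :+ w :* (u :* (x :* ((c1 :+ w) :* P)) :+ w :* u :* (y :* P))) refl w (w ^ k) (ιbin e k) (ιbin e (suc k)) P ⟩
        shifted e (suc k) + w * (w ^ k * (ιbin e k * η ^ suc (e ℕ.∸ suc k)) + shifted e (suc k))
          ≡⟨ cong (λ z → shifted e (suc k) + w * (w ^ k * (ιbin e k * η ^ z) + shifted e (suc k))) (sym e∸k) ⟩
        shifted e (suc k) + w * (shifted e k + shifted e (suc k)) ∎
        where
        open ≡-Reasoning
        η = 1# + w
        P = η ^ (e ℕ.∸ suc k)
        e∸k : e ℕ.∸ k ≡ suc (e ℕ.∸ suc k)
        e∸k = ℕ.+-∸-assoc 1 k<e
      ... | inj₂ e<k = begin
        w * w ^ k * (ιbin (suc e) (suc k) * E)                   ≡⟨ cong (λ x → w * w ^ k * (x * E)) (ιbin-suc e k) ⟩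
        w * w ^ k * ((ιbin e k + ιbin e (suc k)) * E)            ≡⟨ cong (λ x → w * w ^ k * ((ιbin e k + x) * E)) z ⟩
        w * w ^ k * ((ιbin e k + 0#) * E)                        ≡⟨ solve 5 (λ w u x E F → w :* u :* ((x :+ c0) :* E) := w :* u :* (c0 :* F) :+ w :* (u :* (x :* E) :+ w :* u :* (c0 :* F))) refl w (w ^ k) (ιbin e k) E E′ ⟩
        w * w ^ k * (0# * E′) + w * (shifted e k + w * w ^ k * (0# * E′))
          ≡⟨ cong (λ x → w * w ^ k * (x * E′) + w * (shifted e k + w * w ^ k * (x * E′))) (sym z) ⟩
        shifted e (suc k) + w * (shifted e k + shifted e (suc k)) ∎
        where
        open ≡-Reasoning
        E = (1# + w) ^ (e ℕ.∸ k)
        E′ = (1# + w) ^ (e ℕ.∸ suc k)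
        z : ιbin e (suc k) ≡ 0#
        z = cong ιℕ (bin-zero e<k)

    -- Both sides satisfy the same recurrence in `e`, by Pascal's rule. Any length `n` beyond `e`
    -- serves, so that monomials of different degrees can share one summation range.
    expand : ∀ n e k → e ℕ.< n → shifted e k ≡ T n e k
    expand (suc n) zero zero _ = sym (trans (cong (_+_ (1# * (1# * 1#))) (Sum-zero n (λ j _ → R.zeroˡ _)))
      (solve 0 (c1 :* (c1 :* c1) :+ c0 := c1 :* (c1 :* c1)) refl))
    expand (suc n) zero (suc k) _ = trans (solve 1 (λ u → u :* (c0 :* c1) := c0) refl (w * w ^ k))
      (sym (trans (cong (_+_ (1# * (0# * 1#))) (Sum-zero n (λ j _ → R.zeroˡ _))) (solve 0 (c1 :* (c0 :* c1) :+ c0 := c0) refl)))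
    expand (suc n) (suc e) zero (s≤s p) = sym (trans (T-suc n e 0) (trans (cong₂ (λ x y → x + w * y) (sym (expand (suc n) e 0 (ℕ.m<n⇒m<1+n p))) (sym (expand n e 0 p)))
      (solve 2 (λ w P → c1 :* (c1 :* P) :+ w :* (c1 :* (c1 :* P)) := c1 :* (c1 :* ((c1 :+ w) :* P))) refl w ((1# + w) ^ e))))
    expand (suc n) (suc e) (suc k) (s≤s p) = trans (shifted-suc e k) (sym (trans (T-suc n e (suc k))
      (cong₂ (λ x y → x + w * y) (sym (expand (suc n) e (suc k) (ℕ.m<n⇒m<1+n p)))
        (trans (Sum-cong n (λ j _ → trans (cong (λ z → ιbin e j * (z * w ^ j)) (ιbin-suc j k))
            (solve 4 (λ x y z u → x :* ((y :+ z) :* u) := x :* (y :* u) :+ x :* (z :* u)) refl (ιbin e j) (ιbin j k) (ιbin j (suc k)) (w ^ j))))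
          (trans (Sum-+ n (λ j → ιbin e j * (ιbin j k * w ^ j)) (λ j → ιbin e j * (ιbin j (suc k) * w ^ j)))
            (cong₂ _+_ (sym (expand n e k p)) (sym (expand n e (suc k) p))))))))

  binomial : ∀ x n e → e ℕ.< n → (1# + x) ^ e ≡ Sum n (λ j → ιbin e j * x ^ j)
  binomial x n e p = trans (solve 1 (λ u → u := c1 :* (c1 :* u)) refl ((1# + x) ^ e))
    (trans (expand x n e 0 p) (Sum-cong n (λ j _ → cong (_*_ (ιbin e j)) (R.*-identityˡ _))))

  sg : ℕ → Carrier
  sg zero    = 1#
  sg (suc k) = - sg k

  abs-sg : ∀ k → ∣ sg k ∣ ≡ 1#
  abs-sg zero    = abs-nonneg 0≤1
  abs-sg (suc k) = trans (abs-neg (sg k)) (abs-sg k)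

  -- Padé coefficients: as a function of j, Σₖ (-1)ᵏ pade m r k C(j,k) equals C(m + r - j, m),
  -- which is 1 at j = r and vanishes for r < j ≤ r + m.
  pade : ℕ → ℕ → ℕ → ℕ
  pade m r k = bin (m ℕ.∸ k ℕ.+ r) (m ℕ.∸ k)

  D : ℕ → ℕ → ℕ → Carrier
  D m r j = Sum (suc m) (λ k → sg k * ιℕ (pade m r k) * ιbin j k)

  D-zero : ∀ m r → D m r 0 ≡ ιbin (m ℕ.+ r) m
  D-zero m r = trans (cong (_+_ _) (Sum-zero m (λ k _ → R.zeroʳ _)))
    (solve 1 (λ x → c1 :* x :* c1 :+ c0 := x) refl (ιbin (m ℕ.+ r) m))

  D-suc₀ : ∀ r j → D 0 r j ≡ 1#
  D-suc₀ r j = solve 0 (c1 :* c1 :* c1 :+ c0 := c1) refl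

  -- `pade (suc m) r (suc k)` computes to `pade m r k`, so Pascal's rule in `j` reproduces the sum
  -- for the smaller `m`.
  D-suc : ∀ m r j → D (suc m) r (suc j) ≡ D (suc m) r j - D m r j
  D-suc m r j = begin
    f₀ + Sum (suc m) (λ k → - sg k * ιℕ (pade m r k) * ιbin (suc j) (suc k))
      ≡⟨ cong (_+_ f₀) (Sum-cong (suc m) (λ k _ → trans (cong (_*_ (- sg k * ιℕ (pade m r k))) (ιbin-suc j k))
           (solve 4 (λ s p x y → (:- s) :* p :* (x :+ y) := (:- s) :* p :* y :- s :* p :* x) refl (sg k) (ιℕ (pade m r k)) (ιbin j k) (ιbin j (suc k))))) ⟩
    f₀ + Sum (suc m) (λ k → A k - B k)                          ≡⟨ cong (_+_ f₀) (Sum-- (suc m) A B) ⟩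
    f₀ + (Sum (suc m) A - Sum (suc m) B)                        ≡⟨ R.+-assoc _ _ _ ⟨
    f₀ + Sum (suc m) A - D m r j                                ∎
    where
    open ≡-Reasoning
    f₀ = 1# * ιℕ (pade (suc m) r 0) * 1#
    A B : ℕ → Carrier
    A k = - sg k * ιℕ (pade m r k) * ιbin j (suc k)
    B k = sg k * ιℕ (pade m r k) * ιbin j k

  -- Induction on `j`: by Pascal's rule C(m + r - j, m) obeys the recurrence `D-suc`. The variable
  -- `t` stands for m + r - j.
  D-closed : ∀ j t m r → t ℕ.+ j ≡ m ℕ.+ r → D m r j ≡ ιbin t m
  D-closed zero t m r eq = trans (D-zero m r) (cong (λ z → ιbin z m) (trans (sym eq) (ℕ.+-identityʳ t)))
  D-closed (suc j) t zero r eq = D-suc₀ r (suc j)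
  D-closed (suc j) t (suc m) r eq = trans (D-suc m r j) (trans (cong₂ _-_ (D-closed j (suc t) (suc m) r eq′) (D-closed j t m r (ℕ.suc-injective eq′)))
    (trans (cong (_- ιbin t m) (ιbin-suc t m)) (solve 2 (λ x y → x :+ y :- x := y) refl (ιbin t m) (ιbin t (suc m)))))
    where
    eq′ : suc t ℕ.+ j ≡ suc m ℕ.+ r
    eq′ = trans (sym (ℕ.+-suc t j)) eq

  D-bound : ∀ j m r → ∣ D m r j ∣ ≤ 2^ (j ℕ.+ (m ℕ.+ r))
  D-bound zero m r = ≡⇒≤ (trans (cong ∣_∣ (D-zero m r)) (abs-nonneg (0≤ιℕ (bin (m ℕ.+ r) m)))) ⟨≤⟩ ιℕ-mono (bin≤2^ (m ℕ.+ r) m) ⟨≤⟩ ≡⇒≤ (ιℕ-2^ (m ℕ.+ r))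
  D-bound (suc j) zero r = ≡⇒≤ (trans (cong ∣_∣ (D-suc₀ r (suc j))) (abs-nonneg 0≤1)) ⟨≤⟩ 1≤2^ (suc j ℕ.+ r)
  D-bound (suc j) (suc m) r = ≡⇒≤ (cong ∣_∣ (D-suc m r j)) ⟨≤⟩ abs-- _ _ ⟨≤⟩
    +-mono-≤ (D-bound j (suc m) r) (D-bound j m r ⟨≤⟩ 2^-mono {j ℕ.+ (m ℕ.+ r)} {j ℕ.+ suc (m ℕ.+ r)} (ℕ.+-monoʳ-≤ j (ℕ.n≤1+n _))) ⟨≤⟩
    ≡⇒≤ (solve 1 (λ u → u :+ u := c2 :* u) refl (2^ (j ℕ.+ suc (m ℕ.+ r))))

  δ : ℕ → ℕ → Carrier
  δ zero zero       = 1#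
  δ zero (suc _)    = 0#
  δ (suc _) zero    = 0#
  δ (suc i) (suc j) = δ i j

  δ-same : ∀ i → δ i i ≡ 1#
  δ-same zero    = refl
  δ-same (suc i) = δ-same i

  δ-diff : ∀ {i j} → i ≢ j → δ i j ≡ 0#
  δ-diff {zero} {zero} p = ⊥-elim (p refl)
  δ-diff {zero} {suc j} p = refl
  δ-diff {suc i} {zero} p = refl
  δ-diff {suc i} {suc j} p = δ-diff (λ q → p (cong suc q))

  Sum-δ : ∀ n K f → K ℕ.< n → Sum n (λ j → f j * δ j K) ≡ f K
  Sum-δ (suc n) zero f _ = trans (cong (_+_ (f 0 * 1#)) (Sum-zero n (λ j _ → R.zeroʳ _))) (trans (R.+-identityʳ _) (R.*-identityʳ _))
  Sum-δ (suc n) (suc K) f (s≤s p) = trans (cong₂ _+_ (R.zeroʳ (f 0)) (Sum-δ n K (λ j → f (suc j)) p)) (R.+-identityˡ _)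

  module Extrapolation (N : ℕ) (q : ℕ → ℤ) (e : ℕ → ℕ) (n : ℕ) (e<n : ∀ i → i ℕ.< N → e i ℕ.< n)
                       (y : ℕ) (q≤ : ∀ i → ℤ.∣ q i ∣ ℕ.≤ 2 ℕ.^ y) (w : Carrier) where
    G : ℕ → Carrier
    G j = ι (moment N q e j)

    G-sum : ∀ j → G j ≡ Sum N (λ i → ι (q i) * ιbin (e i) j)
    G-sum j = trans (ι-Sumℤ N _) (Sum-cong N (λ i _ → ι-* (q i) (+ bin (e i) j)))

    -- The Taylor coefficients of the polynomial at 1 + w, whereas `G` consists of those at 1.
    Γ : ℕ → Carrier
    Γ k = Sum N (λ i → ι (q i) * (ιbin (e i) k * (1# + w) ^ (e i ℕ.∸ k)))

    Γ-expand : ∀ k → w ^ k * Γ k ≡ Sum n (λ j → G j * (ιbin j k * w ^ j))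
    Γ-expand k = begin
      w ^ k * Γ k                                                        ≡⟨ Sum-*ˡ N (w ^ k) _ ⟨
      Sum N (λ i → w ^ k * (ι (q i) * (ιbin (e i) k * (1# + w) ^ (e i ℕ.∸ k))))
        ≡⟨ Sum-cong N (λ i p → trans (solve 3 (λ x y z → x :* (y :* z) := y :* (x :* z)) refl (w ^ k) (ι (q i)) _)
             (trans (cong (_*_ (ι (q i))) (expand w n (e i) k (e<n i p))) (sym (Sum-*ˡ n (ι (q i)) _)))) ⟩
      Sum N (λ i → Sum n (λ j → ι (q i) * (ιbin (e i) j * (ιbin j k * w ^ j)))) ≡⟨ Sum-swap N n _ ⟩
      Sum n (λ j → Sum N (λ i → ι (q i) * (ιbin (e i) j * (ιbin j k * w ^ j))))
        ≡⟨ Sum-cong n (λ j _ → trans (Sum-cong N (λ i _ → sym (R.*-assoc (ι (q i)) (ιbin (e i) j) _)))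
             (trans (Sum-*ʳ N (ιbin j k * w ^ j) (λ i → ι (q i) * ιbin (e i) j)) (cong (_* (ιbin j k * w ^ j)) (sym (G-sum j))))) ⟩
      Sum n (λ j → G j * (ιbin j k * w ^ j))                             ∎
      where open ≡-Reasoning

    -- The terms G j c j wʲ with j < K vanish; the others are compared with zᴷ times the
    -- binomial expansion of (1 + x)ⁿ, where z x = s |w|.
    tail-bound : ∀ (c : ℕ → Carrier) s x z K → 0# ≤ s → 0# ≤ x → 0# ≤ z → z ≤ 1# → z * x ≡ s * ∣ w ∣ →
                 (∀ j → ∣ c j ∣ ≤ s ^ j) → (∀ j → j ℕ.< K → G j * (c j * w ^ j) ≡ 0#) →
                 ∣ Sum n (λ j → G j * (c j * w ^ j)) ∣ ≤ z ^ K * (2^ y * (ιℕ N * (1# + x) ^ n))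
    tail-bound c s x z K 0≤s 0≤x 0≤z z≤1 zx c≤ vanish =
      abs-Sum n _ ⟨≤⟩ Sum-mono n (λ j _ → term j) ⟨≤⟩
      ≡⇒≤ (trans (Sum-cong n (λ j _ → swap₁ j)) (trans (Sum-*ˡ n (z ^ K * 2^ y) _) (trans (cong (_*_ (z ^ K * 2^ y))
        (trans (Sum-cong n (λ j _ → sym (Sum-*ʳ N (x ^ j) (λ i → ιbin (e i) j)))) (Sum-swap n N _))) (R.*-assoc _ _ _)))) ⟨≤⟩
      *-monoʳ-≤ (^-nonneg K 0≤z) (*-monoʳ-≤ (0≤2^ y) (Sum-mono N (λ i p → ≡⇒≤ (sym (binomial x n (e i) (e<n i p))) ⟨≤⟩
          ^-monoʳ {1# + x} {e i} {n} (by-diff x 0≤x (solve 1 (λ x → c1 :+ x :- c1 := x) refl x)) (ℕ.<⇒≤ (e<n i p))) ⟨≤⟩ ≡⇒≤ (Sum-const N _)))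
      where
      B : ℕ → Carrier
      B j = Sum N (λ i → ιbin (e i) j)
      0≤B : ∀ j → 0# ≤ B j
      0≤B j = ≡⇒≤ (sym (Sum-0 N)) ⟨≤⟩ Sum-mono N (λ i _ → 0≤ιℕ (bin (e i) j))
      swap₁ : ∀ j → 2^ y * B j * (z ^ K * x ^ j) ≡ z ^ K * 2^ y * (B j * x ^ j)
      swap₁ j = solve 4 (λ a b c d → a :* b :* (c :* d) := c :* a :* (b :* d)) refl (2^ y) (B j) (z ^ K) (x ^ j)
      |G|≤ : ∀ j → ∣ G j ∣ ≤ 2^ y * B j
      |G|≤ j = ≡⇒≤ (cong ∣_∣ (G-sum j)) ⟨≤⟩ abs-Sum N _ ⟨≤⟩
        Sum-mono N (λ i _ → ≡⇒≤ (trans (abs-* _ _) (cong₂ _*_ (abs-ι (q i)) (abs-nonneg (0≤ιℕ (bin (e i) j))))) ⟨≤⟩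
          *-monoˡ-≤ (0≤ιℕ (bin (e i) j)) (ιℕ-mono (q≤ i) ⟨≤⟩ ≡⇒≤ (ιℕ-2^ y))) ⟨≤⟩
        ≡⇒≤ (Sum-*ˡ N (2^ y) _)
      0≤bound : ∀ j → 0# ≤ 2^ y * B j * (z ^ K * x ^ j)
      0≤bound j = *-nonneg (*-nonneg (0≤2^ y) (0≤B j)) (*-nonneg (^-nonneg K 0≤z) (^-nonneg j 0≤x))
      term : ∀ j → ∣ G j * (c j * w ^ j) ∣ ≤ 2^ y * B j * (z ^ K * x ^ j)
      term j = go (ℕ.≤-<-connex K j)
        where
        go : (K ℕ.≤ j) ⊎ (j ℕ.< K) → ∣ G j * (c j * w ^ j) ∣ ≤ 2^ y * B j * (z ^ K * x ^ j)
        go (inj₂ j<K) = ≡⇒≤ (trans (cong ∣_∣ (vanish j j<K)) (abs-nonneg ≤-refl)) ⟨≤⟩ 0≤bound j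
        go (inj₁ K≤j) = ≡⇒≤ (abs-* _ _) ⟨≤⟩ *-mono-≤ (0≤abs _) (|G|≤ j) (0≤abs _)
          (≡⇒≤ (trans (abs-* _ _) (cong (_*_ ∣ c j ∣) (abs-^ w j))) ⟨≤⟩ *-monoˡ-≤ (^-nonneg j (0≤abs w)) (c≤ j) ⟨≤⟩
           ≡⇒≤ (trans (sym (^-distrib-* s ∣ w ∣ j)) (trans (cong (_^ j) (sym zx)) (^-distrib-* z x j))) ⟨≤⟩
           *-monoˡ-≤ (^-nonneg j 0≤x) (^-antiʳ 0≤z z≤1 K≤j))

    -- Hermite–Padé interpolation at 1 + w recovers the leading coefficient G K.
    leading : ∀ m K → (∀ j → j ℕ.< K → G j ≡ 0#) → K ℕ.< n →
              Σ (ℕ → Carrier) λ c → (∀ j → ∣ c j ∣ ≤ (2^ 2) ^ j) × (∀ j → j ℕ.< K ℕ.+ suc m → G j * (c j * w ^ j) ≡ 0#) ×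
              (w ^ K * G K ≡ Sum (suc m) (λ k → sg k * ιℕ (pade m K k) * (w ^ k * Γ k)) - Sum n (λ j → G j * (c j * w ^ j)))
    leading m K vanish K<n = c , c≤ , c-vanish , identity
      where
      -- The weights of the remainder. `G j` vanishes for j < K, and `D m K j` is 1 at j = K and 0
      -- for K < j ≤ K + m, so the interpolation sum consists of the term at K and the terms with j
      -- > K + m.
      c : ℕ → Carrier
      c j with ℕ.≤-<-connex (K ℕ.+ suc m) j
      ... | inj₁ _ = D m K j
      ... | inj₂ _ = 0#
      c≤ : ∀ j → ∣ c j ∣ ≤ (2^ 2) ^ j
      c≤ j with ℕ.≤-<-connex (K ℕ.+ suc m) j
      ... | inj₁ p = D-bound j m K ⟨≤⟩ 2^-mono {j ℕ.+ (m ℕ.+ K)} {2 ℕ.* j} (ℕ.+-monoʳ-≤ j (ℕ.≤-trans (ℕ.≤-trans (ℕ.n≤1+n _) (ℕ.≤-trans (ℕ.≤-reflexive (ℕ.+-comm (suc m) K)) p)) (ℕ.m≤m+n j 0))) ⟨≤⟩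
                       ≡⇒≤ (^-* 2# 2 j)
      ... | inj₂ _ = ≡⇒≤ (abs-nonneg ≤-refl) ⟨≤⟩ ^-nonneg j (0≤2^ 2)
      c-vanish : ∀ j → j ℕ.< K ℕ.+ suc m → G j * (c j * w ^ j) ≡ 0#
      c-vanish j p with ℕ.≤-<-connex (K ℕ.+ suc m) j
      ... | inj₁ q = ⊥-elim (ℕ.<⇒≱ p q)
      ... | inj₂ _ = solve 2 (λ g u → g :* (c0 :* u) := c0) refl (G j) (w ^ j)
      D-at : ∀ j → K ℕ.< j → j ℕ.< K ℕ.+ suc m → D m K j ≡ 0#
      D-at j K<j j< = trans (D-closed j (m ℕ.+ K ℕ.∸ j) m K (ℕ.m∸n+n≡m j≤)) (cong ιℕ (bin-zero t<m))
        where
        j≤ : j ℕ.≤ m ℕ.+ K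
        j≤ = ℕ.≤-pred (ℕ.≤-trans j< (ℕ.≤-reflexive (ℕ.+-comm K (suc m))))
        t<m : m ℕ.+ K ℕ.∸ j ℕ.< m
        t<m = ℕ.+-cancelʳ-< j _ _ (ℕ.≤-<-trans (ℕ.≤-reflexive (ℕ.m∸n+n≡m j≤)) (ℕ.+-monoʳ-< m K<j))
      D-K : D m K K ≡ 1#
      D-K = trans (D-closed K m m K refl) (cong ιℕ (bin-self m))
      split : ∀ j → G j * (D m K j * w ^ j) ≡ G j * w ^ j * δ j K + G j * (c j * w ^ j)
      split j with ℕ.≤-<-connex (K ℕ.+ suc m) j
      ... | inj₁ p = trans (solve 3 (λ g d u → g :* (d :* u) := g :* u :* c0 :+ g :* (d :* u)) refl (G j) (D m K j) (w ^ j))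
            (cong (λ z → G j * w ^ j * z + G j * (D m K j * w ^ j)) (sym (δ-diff {j} {K} (λ { refl → ℕ.<⇒≱ (ℕ.m<m+n j (s≤s z≤n)) p }))))
      ... | inj₂ p with ℕ.<-cmp j K
      ... | tri< j<K _ _ = trans (cong (_* (D m K j * w ^ j)) (vanish j j<K)) (trans (solve 4 (λ g d u x → c0 :* (d :* u) := c0 :* u :* x :+ c0 :* (c0 :* u)) refl (G j) (D m K j) (w ^ j) (δ j K))
            (cong (λ z → z * w ^ j * δ j K + z * (0# * w ^ j)) (sym (vanish j j<K))))
      ... | tri≈ _ refl _ = trans (cong (λ z → G j * (z * w ^ j)) D-K) (trans (solve 2 (λ g u → g :* (c1 :* u) := g :* u :* c1 :+ g :* (c0 :* u)) refl (G j) (w ^ j))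
            (cong (λ z → G j * w ^ j * z + G j * (0# * w ^ j)) (sym (δ-same j))))
      ... | tri> _ j≢K K<j = trans (cong (λ z → G j * (z * w ^ j)) (D-at j K<j p)) (trans (solve 2 (λ g u → g :* (c0 :* u) := g :* u :* c0 :+ g :* (c0 :* u)) refl (G j) (w ^ j))
            (cong (λ z → G j * w ^ j * z + G j * (0# * w ^ j)) (sym (δ-diff {j} {K} j≢K))))
      total : Sum (suc m) (λ k → sg k * ιℕ (pade m K k) * (w ^ k * Γ k)) ≡ Sum n (λ j → G j * (D m K j * w ^ j))
      total = begin
        Sum (suc m) (λ k → A k * (w ^ k * Γ k))                         ≡⟨ Sum-cong (suc m) {λ k → A k * (w ^ k * Γ k)} {λ k → Sum n (λ j → A k * (G j * (ιbin j k * w ^ j)))} (λ k _ → trans (cong (_*_ (A k)) (Γ-expand k)) (sym (Sum-*ˡ n (A k) _))) ⟩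
        Sum (suc m) (λ k → Sum n (λ j → A k * (G j * (ιbin j k * w ^ j)))) ≡⟨ Sum-swap (suc m) n (λ k j → A k * (G j * (ιbin j k * w ^ j))) ⟩
        Sum n (λ j → Sum (suc m) (λ k → A k * (G j * (ιbin j k * w ^ j))))
          ≡⟨ Sum-cong n (λ j _ → trans (Sum-cong (suc m) {λ k → A k * (G j * (ιbin j k * w ^ j))} {λ k → A k * ιbin j k * (G j * w ^ j)} (λ k _ → solve 4 (λ a g b u → a :* (g :* (b :* u)) := a :* b :* (g :* u)) refl (A k) (G j) (ιbin j k) (w ^ j)))
               (trans (Sum-*ʳ (suc m) (G j * w ^ j) (λ k → A k * ιbin j k)) (solve 3 (λ d g u → d :* (g :* u) := g :* (d :* u)) refl (D m K j) (G j) (w ^ j)))) ⟩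
        Sum n (λ j → G j * (D m K j * w ^ j))                           ∎
        where
        open ≡-Reasoning
        A : ℕ → Carrier
        A k = sg k * ιℕ (pade m K k)
      identity : w ^ K * G K ≡ Sum (suc m) (λ k → sg k * ιℕ (pade m K k) * (w ^ k * Γ k)) - Sum n (λ j → G j * (c j * w ^ j))
      identity = sym (trans (cong (_- S) (trans total (trans (Sum-cong n (λ j _ → split j)) (trans (Sum-+ n (λ j → G j * w ^ j * δ j K) (λ j → G j * (c j * w ^ j))) (cong (_+ S) (Sum-δ n K (λ j → G j * w ^ j) K<n))))))
        (solve 3 (λ g u s → g :* u :+ s :- s := u :* g) refl (G K) (w ^ K) S))
        where S = Sum n (λ j → G j * (c j * w ^ j))

-- The dominant root and the Pisot property.

record KBonacci : Set where
  open IntegerSequences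
  field
    k       : ℕ
    3≤k     : 3 ℕ.≤ k
    g       : ℕ → ℤ
    g-rec   : Recℤ k g
    g-bound : ∀ i → ℤ.∣ g i ∣ ℕ.≤ 2 ℕ.^ i
    g-zero  : ∀ i → suc i ℕ.< k → g i ≡ + 0
    g-one   : ∀ i → suc i ≡ k → g i ≡ + 1
    -- Used for multiplicative independence: a large term pins down a rational α, and a nonzero one
    -- prevents `g` from vanishing along a progression.
    g-grows : ∀ N → N ℕ.≤ ℤ.∣ g (N ℕ.+ k) ∣

module Pisot (𝔽 : OrderedField) (k : ℕ) (3≤k : 3 ℕ.≤ k) where
  open IntegerSequences public
  open FieldTheory 𝔽

  -- ω a i = aⁱ - aⁱ⁻¹ - ⋯ - 1, so that ω a k is the characteristic polynomial at a.
  ω : Carrier → ℕ → Carrier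
  ω a zero    = 1#
  ω a (suc i) = a * ω a i - 1#

  -- The dominant root α is only ever used through rational approximations a; the precision X is
  -- chosen after all the other parameters of the argument.
  record Root (X : ℕ) : Set where
    field
      a    : Carrier
      3≤2a : 3# ≤ 2# * a
      a≤   : a + ½^ k ≤ 2#
      -- The sign matters: with `ω-anti` it places every `ω a i` with i ≤ k in [0, 1].
      0≤ωk : 0# ≤ ω a k
      ωk≤  : ω a k ≤ ½^ X

  RecF : (ℕ → Carrier) → Set
  RecF t = ∀ N → drop N t k ≡ Sum k (drop N t)

  ι-drop : ∀ N (t : ℕ → ℤ) i → ι (drop N t i) ≡ drop N (λ j → ι (t j)) i
  ι-drop zero t i    = refl
  ι-drop (suc N) t i = ι-drop N t (suc i)

  ι-Rec : ∀ t → Recℤ k t → RecF (λ i → ι (t i))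
  ι-Rec t rec N = begin
    drop N (λ i → ι (t i)) k               ≡⟨ ι-drop N t k ⟨
    ι (drop N t k)                         ≡⟨ cong ι (rec N) ⟩
    ι (Sumℤ k (drop N t))                  ≡⟨ ι-Sumℤ k _ ⟩
    Sum k (λ i → ι (drop N t i))           ≡⟨ Sum-cong k (λ i _ → ι-drop N t i) ⟩
    Sum k (drop N (λ i → ι (t i)))         ∎
    where open ≡-Reasoning

  module _ (t : ℕ → ℤ) (rec : Recℤ k t) where
    private
      ZeroWindow : ℕ → Set
      ZeroWindow N = ∀ i → i ℕ.< k → t (N ℕ.+ i) ≡ + 0

      up : ∀ N → ZeroWindow N → ZeroWindow (suc N)
      up N z i i<k with suc i ℕ.<? k
      ... | yes p = trans (cong t (sym (ℕ.+-suc N i))) (z (suc i) p)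
      ... | no ¬p = begin
        t (suc N ℕ.+ i)    ≡⟨ cong t (trans (sym (ℕ.+-suc N i)) (cong (N ℕ.+_) (ℕ.≤-antisym i<k (ℕ.≮⇒≥ ¬p)))) ⟩
        t (N ℕ.+ k)        ≡⟨ drop-≡ N t k ⟨
        drop N t k         ≡⟨ rec N ⟩
        Sumℤ k (drop N t)  ≡⟨ Sumℤ-0 k _ (λ j q → trans (drop-≡ N t j) (z j q)) ⟩
        + 0                ∎
        where open ≡-Reasoning

      down-at : ∀ N n → n ≡ k → ZeroWindow (suc N) → t N ≡ + 0
      down-at N zero refl _ = ⊥-elim (case-0 3≤k)
        where
        case-0 : 3 ℕ.≤ 0 → ⊥
        case-0 ()
      down-at N (suc n) refl z = begin
        t N                                          ≡⟨ cong t (ℕ.+-identityʳ N) ⟨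
        t (N ℕ.+ 0)                                  ≡⟨ drop-≡ N t 0 ⟨
        drop N t 0                                   ≡⟨ ℤ.+-identityʳ _ ⟨
        drop N t 0 ℤ.+ + 0                           ≡⟨ cong (λ z → drop N t 0 ℤ.+ z) (Sumℤ-0 n _ (λ j q → trans (drop-≡ (suc N) t j) (z j (ℕ.m<n⇒m<1+n q)))) ⟨
        drop N t 0 ℤ.+ Sumℤ n (drop (suc N) t)       ≡⟨ rec N ⟨
        drop N t (suc n)                             ≡⟨ drop-≡ (suc N) t n ⟩
        t (suc N ℕ.+ n)                              ≡⟨ z n (ℕ.n<1+n n) ⟩
        + 0                                          ∎
        where open ≡-Reasoning

      down : ∀ N → ZeroWindow (suc N) → ZeroWindow N
      down N z zero    _   = trans (cong t (ℕ.+-identityʳ N)) (down-at N k refl z)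
      down N z (suc i) i<k = trans (cong t (ℕ.+-suc N i)) (z i (ℕ.<-trans (ℕ.n<1+n i) i<k))

      to-0 : ∀ N → ZeroWindow N → ZeroWindow 0
      to-0 zero z    = z
      to-0 (suc N) z = to-0 N (down N z)

      from-0 : ∀ N → ZeroWindow 0 → ZeroWindow N
      from-0 zero z    = z
      from-0 (suc N) z = up N (from-0 N z)

    -- The oldest term of the recurrence has coefficient 1, so a window of k zeros propagates
    -- backwards over ℤ as well as forwards.
    zero-window⇒zero : ∀ N → (∀ i → i ℕ.< k → t (N ℕ.+ i) ≡ + 0) → ∀ i → t i ≡ + 0
    zero-window⇒zero N z i = trans (cong t (sym (ℕ.+-identityʳ i)))
      (from-0 i (to-0 N z) 0 (ℕ.≤-trans (s≤s z≤n) 3≤k))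

  module WithRoot {X : ℕ} (root : Root X) where
    open Root root public

    ωₖ : Carrier
    ωₖ = ω a k

    1≤2[a-1] : 1# ≤ 2# * (a - 1#)
    1≤2[a-1] = by-diff (2# * a - 3#) (≤⇒0≤- 3≤2a)
      (solve 1 (λ a → c2 :* (a :- c1) :- c1 := c2 :* a :- c3) refl a)

    ½≤a-1 : ½ ≤ a - 1#
    ½≤a-1 = *-cancelˡ-≤ 2# (1≤⇒≰0 1≤2) (≤-resp (sym 2*½) refl 1≤2[a-1])

    0≤a-1 : 0# ≤ a - 1#
    0≤a-1 = 0≤½ ⟨≤⟩ ½≤a-1

    1≤a : 1# ≤ a
    1≤a = 0≤-⇒≤ 0≤a-1

    0≤a : 0# ≤ a
    0≤a = 0≤1 ⟨≤⟩ 1≤a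

    ½^k≤2-a : ½^ k ≤ 2# - a
    ½^k≤2-a = by-diff (2# - (a + ½^ k)) (≤⇒0≤- a≤)
      (solve 2 (λ a h → c2 :- a :- h := c2 :- (a :+ h)) refl a (½^ k))

    0≤2-a : 0# ≤ 2# - a
    0≤2-a = 0≤½^ k ⟨≤⟩ ½^k≤2-a

    a≤2 : a ≤ 2#
    a≤2 = 0≤-⇒≤ 0≤2-a

    ω-step : ∀ i → ω a i - ω a (suc i) ≡ (2# - a) * a ^ i
    ω-step zero = solve 1 (λ a → c1 :- (a :* c1 :- c1) := (c2 :- a) :* c1) refl a
    ω-step (suc i) = trans (solve 3 (λ a x y → (a :* x :- c1) :- (a :* y :- c1) := a :* (x :- y)) refl a (ω a i) (ω a (suc i)))
      (trans (cong (_*_ a) (ω-step i)) (solve 2 (λ a p → a :* ((c2 :- a) :* p) := (c2 :- a) :* (a :* p)) refl a (a ^ i)))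

    ω-anti : ∀ {i j} → i ℕ.≤ j → ω a j ≤ ω a i
    ω-anti {i} {j} p = go (ℕ.≤⇒≤′ p)
      where
      go : ∀ {j} → i ℕ.≤′ j → ω a j ≤ ω a i
      go (ℕ.≤′-reflexive refl) = ≤-refl
      go (ℕ.≤′-step {j} q) = 0≤-⇒≤ (≤-resp refl (sym (ω-step j)) (*-nonneg 0≤2-a (^-nonneg j 0≤a))) ⟨≤⟩ go q

    0≤ω : ∀ {i} → i ℕ.≤ k → 0# ≤ ω a i
    0≤ω {i} p = 0≤ωk ⟨≤⟩ ω-anti {i} {k} p

    ω≤1 : ∀ i → ω a i ≤ 1#
    ω≤1 i = ω-anti {0} {i} z≤n

    -- At a = α, Y k is the coordinate along αᴺ of a solution of the recurrence.
    Y : ℕ → (ℕ → Carrier) → Carrier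
    Y zero t    = 0#
    Y (suc i) t = ω a i * t 0 + Y i (λ j → t (suc j))

    Y-cong : ∀ n {t u} → (∀ i → t i ≡ u i) → Y n t ≡ Y n u
    Y-cong zero h = refl
    Y-cong (suc n) h = cong₂ (λ x y → ω a n * x + y) (h 0) (Y-cong n (λ i → h (suc i)))

    Y-+ : ∀ n t u → Y n (λ i → t i + u i) ≡ Y n t + Y n u
    Y-+ zero t u = sym (R.+-identityʳ 0#)
    Y-+ (suc n) t u = trans (cong (_+_ _) (Y-+ n _ _))
      (solve 5 (λ w x y p q → w :* (x :+ y) :+ (p :+ q) := w :* x :+ p :+ (w :* y :+ q)) refl (ω a n) (t 0) (u 0) _ _)

    Y-* : ∀ n c t → Y n (λ i → c * t i) ≡ c * Y n t
    Y-* zero c t = sym (R.zeroʳ c)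
    Y-* (suc n) c t = trans (cong (_+_ _) (Y-* n c _))
      (solve 4 (λ w c x p → w :* (c :* x) :+ c :* p := c :* (w :* x :+ p)) refl (ω a n) c (t 0) _)

    Y-suc : ∀ i t → Y (suc i) t ≡ a * Y i t - Sum i t + t i
    Y-suc zero t = solve 2 (λ a x → c1 :* x :+ c0 := a :* c0 :- c0 :+ x) refl a (t 0)
    Y-suc (suc i) t = trans (cong (_+_ (ω a (suc i) * t 0)) (Y-suc i (λ j → t (suc j))))
      (solve 6 (λ a w x y s u → (a :* w :- c1) :* x :+ (a :* y :- s :+ u) := a :* (w :* x :+ y) :- (x :+ s) :+ u) refl
        a (ω a i) (t 0) (Y i (λ j → t (suc j))) (Sum i (λ j → t (suc j))) (t (suc i)))

    -- At an exact root `Y k` is an eigenvector of the shift. The defect `ωₖ * t 0` is all that an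
    -- approximate root costs.
    Y-step : ∀ t → t k ≡ Sum k t → Y k (λ i → t (suc i)) ≡ a * Y k t - ωₖ * t 0
    Y-step t e = begin
      y′                              ≡⟨ solve 2 (λ x y → y := (x :+ y) :- x) refl (ωₖ * t 0) y′ ⟩
      Y (suc k) t - ωₖ * t 0          ≡⟨ cong (_- ωₖ * t 0) (Y-suc k t) ⟩
      a * Y k t - Sum k t + t k - ωₖ * t 0   ≡⟨ cong (λ z → a * Y k t - Sum k t + z - ωₖ * t 0) e ⟩
      a * Y k t - Sum k t + Sum k t - ωₖ * t 0 ≡⟨ cong (_- ωₖ * t 0) (solve 2 (λ x y → x :- y :+ y := x) refl (a * Y k t) (Sum k t)) ⟩
      a * Y k t - ωₖ * t 0            ∎
      where
      open ≡-Reasoning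
      y′ = Y k (λ i → t (suc i))

    private
      Sψ : ℕ → Carrier
      Sψ zero    = 0#
      Sψ (suc n) = (1# - ω a n) + Sψ n

      0≤ψ : ∀ i → 0# ≤ 1# - ω a i
      0≤ψ i = ≤⇒0≤- (ω≤1 i)

      Sψ-closed : ∀ n → (a - 1#) * Sψ n ≡ (1# - ω a n) - ιℕ n * (2# - a)
      Sψ-closed zero = solve 1 (λ a → (a :- c1) :* c0 := (c1 :- c1) :- c0 :* (c2 :- a)) refl a
      Sψ-closed (suc n) = trans (R.distribˡ _ _ _) (trans (cong (_+_ _) (Sψ-closed n))
        (trans (solve 3 (λ a w n → (a :- c1) :* (c1 :- w) :+ ((c1 :- w) :- n :* (c2 :- a)) :=
           (c1 :- (a :* w :- c1)) :- (c1 :+ n) :* (c2 :- a)) refl a (ω a n) (ιℕ n))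
         (cong (λ z → (1# - (a * ω a n - 1#)) - z * (2# - a)) (sym (ιℕ-suc n)))))

      -- With u = 2 - a, the number (a - 1)² exceeds (a - 1) Sψ k by ωₖ + (k - 2) u + u². Hence Sψ k
      -- ≤ a - 1, and a keeps the distance 2^(-k) from 2.
      Sψ≤ : Sψ k ≤ 1# - ½^ k
      Sψ≤ = *-cancelˡ-≤ (a - 1#) (λ p → 1≰½ (1≤2[a-1] ⟨≤⟩ *-monoʳ-≤ 0≤2 p ⟨≤⟩ ≡⇒≤ (R.zeroʳ 2#) ⟨≤⟩ 0≤½)) 
        (≡⇒≤ (Sψ-closed k) ⟨≤⟩
         by-diff (ωₖ + (ιℕ k - 2#) * (2# - a) + (2# - a) * (2# - a))
           (+-nonneg (+-nonneg 0≤ωk (*-nonneg (≤⇒0≤- (ιℕ-mono {2} (ℕ.≤-trans (ℕ.n≤1+n 2) 3≤k))) 0≤2-a)) (*-nonneg 0≤2-a 0≤2-a))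
           (solve 3 (λ a w n → (a :- c1) :* (a :- c1) :- ((c1 :- w) :- n :* (c2 :- a)) :=
              w :+ (n :- c2) :* (c2 :- a) :+ (c2 :- a) :* (c2 :- a)) refl a ωₖ (ιℕ k)) ⟨≤⟩
         *-monoʳ-≤ 0≤a-1 a-1≤)
        where
        a-1≤ : a - 1# ≤ 1# - ½^ k
        a-1≤ = by-diff (2# - (a + ½^ k)) (≤⇒0≤- a≤)
          (solve 2 (λ a h → (c1 :- h) :- (a :- c1) := c2 :- (a :+ h)) refl a (½^ k))

      Sum-Y : ∀ n t {M} → (∀ i → i ℕ.< n → ∣ t i ∣ ≤ M) → ∣ Sum n t - Y n t ∣ ≤ M * Sψ n
      Sum-Y zero t {M} h = ≡⇒≤ (trans (cong ∣_∣ (R.-‿inverseʳ 0#)) (trans (abs-nonneg ≤-refl) (sym (R.zeroʳ M))))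
      Sum-Y (suc n) t {M} h = ≡⇒≤ (cong ∣_∣ (solve 4 (λ x s w y → (x :+ s) :- (w :* x :+ y) := (c1 :- w) :* x :+ (s :- y)) refl
            (t 0) (Sum n (λ i → t (suc i))) (ω a n) (Y n (λ i → t (suc i))))) ⟨≤⟩
        abs-+ _ _ ⟨≤⟩
        +-mono-≤ (≡⇒≤ (trans (abs-* _ _) (cong (_* ∣ t 0 ∣) (abs-nonneg (0≤ψ n)))) ⟨≤⟩ *-monoʳ-≤ (0≤ψ n) (h 0 (s≤s z≤n)))
                 (Sum-Y n (λ i → t (suc i)) (λ i p → h (suc i) (s≤s p))) ⟨≤⟩
        ≡⇒≤ (solve 3 (λ p m s → p :* m :+ m :* s := m :* (p :+ s)) refl (1# - ω a n) M (Sψ n))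

    -- Every coefficient 1 - ω a i of Sum k t - Y k t is nonnegative, and their sum is less than 1.
    contract : ∀ t {M} → 0# ≤ M → (∀ i → i ℕ.< k → ∣ t i ∣ ≤ M) → ∣ Sum k t ∣ ≤ (1# - ½^ k) * M + ∣ Y k t ∣
    contract t {M} 0≤M h = ≡⇒≤ (cong ∣_∣ (solve 2 (λ s y → s := (s :- y) :+ y) refl (Sum k t) (Y k t))) ⟨≤⟩ abs-+ _ _ ⟨≤⟩
      +-monoˡ-≤ _ (Sum-Y k t h ⟨≤⟩ *-monoʳ-≤ 0≤M Sψ≤ ⟨≤⟩ ≡⇒≤ (R.*-comm _ _))

    -- Carrying `ωₖ * B` along lets the doubling of each step absorb the defect of `Y-step`.
    Y-growth : ∀ t → RecF t → ∀ {B} N → (∀ i → i ℕ.< N → ∣ t i ∣ ≤ B) →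
               ∣ Y k (drop N t) ∣ + ωₖ * B ≤ 2^ N * (∣ Y k t ∣ + ωₖ * B)
    Y-growth t rec {B} zero h = ≡⇒≤ (sym (R.*-identityˡ _))
    Y-growth t rec {B} (suc N) h = 
      +-monoˡ-≤ _ (≡⇒≤ (cong ∣_∣ (Y-step (drop N t) (rec N))) ⟨≤⟩ abs-- _ _ ⟨≤⟩
        +-mono-≤ (≡⇒≤ (abs-* a _) ⟨≤⟩ *-monoˡ-≤ (0≤abs _) (≡⇒≤ (abs-nonneg 0≤a) ⟨≤⟩ a≤2))
                 (≡⇒≤ (trans (abs-* ωₖ _) (cong (_* ∣ drop N t 0 ∣) (abs-nonneg 0≤ωk))) ⟨≤⟩
                   *-monoʳ-≤ 0≤ωk (≡⇒≤ (cong ∣_∣ (trans (drop-≡ N t 0) (cong t (ℕ.+-identityʳ N)))) ⟨≤⟩ h N (ℕ.n<1+n N)))) ⟨≤⟩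
      ≡⇒≤ (solve 2 (λ y c → c2 :* y :+ c :+ c := c2 :* (y :+ c)) refl ∣ Y k (drop N t) ∣ (ωₖ * B)) ⟨≤⟩
      *-monoʳ-≤ 0≤2 (Y-growth t rec N (λ i p → h i (ℕ.m<n⇒m<1+n p))) ⟨≤⟩
      ≡⇒≤ (sym (R.*-assoc 2# (2^ N) _))

    -- While the dominant component stays below `s`, which `small` guarantees for T steps, the
    -- averaging estimate `contract` applies with a fixed perturbation `s`.
    module Decay (t : ℕ → Carrier) (rec : RecF t) {M s : Carrier} (T : ℕ)
                 (0≤M : 0# ≤ M) (0≤s : 0# ≤ s)
                 (init : ∀ i → i ℕ.< k → ∣ t i ∣ ≤ M)
                 (small : 2^ T * (∣ Y k t ∣ + ωₖ * (M + 2^ k * s)) ≤ s) where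
      B : Carrier
      B = M + 2^ k * s

      0≤2ᵏs : 0# ≤ 2^ k * s
      0≤2ᵏs = *-nonneg (0≤2^ k) 0≤s

      0≤B : 0# ≤ B
      0≤B = +-nonneg 0≤M 0≤2ᵏs

      0≤c : 0# ≤ ωₖ * B
      0≤c = *-nonneg 0≤ωk 0≤B

      Y-bound : ∀ N → N ℕ.≤ T → (∀ i → i ℕ.< N → ∣ t i ∣ ≤ B) → ∣ Y k (drop N t) ∣ ≤ s
      Y-bound N N≤T h = by-diff (ωₖ * B) 0≤c (solve 2 (λ x y → (x :+ y) :- x := y) refl _ _) ⟨≤⟩ Y-growth t rec N h ⟨≤⟩
        *-monoˡ-≤ (+-nonneg (0≤abs _) 0≤c) (2^-mono N≤T) ⟨≤⟩ small

      -- `2^ k * s` is the fixed point of x ↦ (1 - ½^k) x + s, so only the excess `m` over it is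
      -- contracted.
      affine : ∀ m → (1# - ½^ k) * (m + 2^ k * s) + s ≡ (1# - ½^ k) * m + 2^ k * s
      affine m = trans (solve 4 (λ h m p s → (c1 :- h) :* (m :+ p :* s) :+ s := (c1 :- h) :* m :+ p :* s :+ (s :- p :* h :* s)) refl (½^ k) m (2^ k) s)
        (trans (cong (λ z → (1# - ½^ k) * m + 2^ k * s + (s - z * s)) (2^*½^ k))
          (solve 2 (λ x s → x :+ (s :- c1 :* s) := x) refl _ s))

      next : ∀ N {m} → 0# ≤ m → ∣ Y k (drop N t) ∣ ≤ s → (∀ i → i ℕ.< k → ∣ t (N ℕ.+ i) ∣ ≤ m + 2^ k * s) →
             ∣ t (N ℕ.+ k) ∣ ≤ (1# - ½^ k) * m + 2^ k * s
      next N {m} 0≤m y≤ h = ≡⇒≤ (cong ∣_∣ (trans (sym (drop-≡ N t k)) (rec N))) ⟨≤⟩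
        contract (drop N t) (+-nonneg 0≤m 0≤2ᵏs) (λ i p → ≡⇒≤ (cong ∣_∣ (drop-≡ N t i)) ⟨≤⟩ h i p) ⟨≤⟩
        +-monoʳ-≤ _ y≤ ⟨≤⟩ ≡⇒≤ (affine m)

      stay : ∀ N → N ℕ.≤ suc T → ∀ i → i ℕ.< N ℕ.+ k → ∣ t i ∣ ≤ B
      stay zero _ i i<k = init i i<k ⟨≤⟩ by-diff (2^ k * s) 0≤2ᵏs (solve 2 (λ x y → (x :+ y) :- x := y) refl M _)
      stay (suc N) (s≤s N≤T) i (s≤s i≤) with ℕ.m≤n⇒m<n∨m≡n i≤
      ... | inj₁ i< = stay N (ℕ.m≤n⇒m≤1+n N≤T) i i<
      ... | inj₂ refl = next N 0≤M
              (Y-bound N N≤T (λ j p → ih j (ℕ.<-≤-trans p (ℕ.m≤m+n N k))))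
              (λ j p → ih (N ℕ.+ j) (ℕ.+-monoʳ-< N p)) ⟨≤⟩
              +-monoˡ-≤ _ (by-diff (½^ k * M) (*-nonneg (0≤½^ k) 0≤M) (solve 2 (λ m h → m :- (c1 :- h) :* m := h :* m) refl M (½^ k)))
        where ih = stay N (ℕ.m≤n⇒m≤1+n N≤T)

      Y≤s : ∀ N → N ℕ.≤ T → ∣ Y k (drop N t) ∣ ≤ s
      Y≤s N N≤T = Y-bound N N≤T (λ i p → stay N (ℕ.m≤n⇒m≤1+n N≤T) i (ℕ.<-≤-trans p (ℕ.m≤m+n N k)))

      decay : ∀ n i → n ℕ.* k ℕ.≤ i → i ℕ.< suc T ℕ.+ k → ∣ t i ∣ ≤ (1# - ½^ k) ^ n * M + 2^ k * s
      decay zero i _ i< = stay (suc T) ℕ.≤-refl i i< ⟨≤⟩ ≡⇒≤ (cong (_+ 2^ k * s) (sym (R.*-identityˡ M)))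
      decay (suc n) i n≤i i< = ≡⇒≤ (cong (λ z → ∣ t z ∣) (sym N+k)) ⟨≤⟩
        next N (*-nonneg (^-nonneg n (≤⇒0≤- (½^≤1 k))) 0≤M) (Y≤s N N≤T)
          (λ j j<k → decay n (N ℕ.+ j) (ℕ.≤-trans nk≤N (ℕ.m≤m+n N j)) (s≤s (ℕ.+-mono-≤ N≤T (ℕ.<⇒≤ j<k)))) ⟨≤⟩
        ≡⇒≤ (cong (_+ 2^ k * s) (sym (R.*-assoc (1# - ½^ k) _ M)))
        where
        N = i ℕ.∸ k
        k≤i : k ℕ.≤ i
        k≤i = ℕ.≤-trans (ℕ.m≤m+n k _) n≤i
        N+k : N ℕ.+ k ≡ i
        N+k = ℕ.m∸n+n≡m k≤i
        nk≤N : n ℕ.* k ℕ.≤ N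
        nk≤N = ℕ.+-cancelʳ-≤ k _ _ (ℕ.≤-trans (ℕ.≤-reflexive (ℕ.+-comm (n ℕ.* k) k)) (ℕ.≤-trans n≤i (ℕ.≤-reflexive (sym N+k))))
        N≤T : N ℕ.≤ T
        N≤T = ℕ.+-cancelʳ-≤ k _ _ (ℕ.≤-trans (ℕ.≤-reflexive N+k) (ℕ.≤-pred i<))

  -- By `contraction-half`, 2^k blocks of k steps halve the excess; Z + 2 halvings bring it from 2^Z
  -- down to ¼.
  steps : ℕ → ℕ
  steps Z = (2 ℕ.^ k ℕ.* (Z ℕ.+ 2)) ℕ.* k

  -- An integral solution of the recurrence is determined to vanish by the smallness of its component
  -- along the dominant root, because the other components decay (a is a Pisot number in the limit).
  liouville : ∀ {X} (root : Root X) (t : ℕ → ℤ) → Recℤ k t → ∀ Z →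
              (∀ i → i ℕ.< k → ℤ.∣ t i ∣ ℕ.≤ 2 ℕ.^ Z) →
              ∣ WithRoot.Y root k (λ i → ι (t i)) ∣ ≤ ½^ (steps Z ℕ.+ k ℕ.+ 3) →
              steps Z ℕ.+ k ℕ.+ 4 ℕ.+ Z ℕ.≤ X →
              ∀ i → t i ≡ + 0
  liouville {X} root t rec Z init y≤ X≥ = zero-window⇒zero t rec T
      (λ i i<k → ι-small _ (decay n (T ℕ.+ i) (ℕ.m≤m+n T i) (s≤s (ℕ.+-monoʳ-≤ T (ℕ.<⇒≤ i<k))) ⟨≤⟩ final))
    where
    open WithRoot root
    n = 2 ℕ.^ k ℕ.* (Z ℕ.+ 2)
    T = steps Z
    -- This makes the fixed point `2^ k * s` equal to ¼; the decayed initial size contributes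
    -- another ¼, which leaves integers of size at most ½.
    s = ½^ (k ℕ.+ 2)
    u = λ i → ι (t i)
    M = 2^ Z
    quarter : 2^ k * s ≡ ½^ 2
    quarter = trans (cong (_*_ (2^ k)) (^-+ ½ k 2)) (trans (sym (R.*-assoc _ _ _)) (trans (cong (_* ½^ 2) (2^*½^ k)) (R.*-identityˡ _)))
    twice : ∀ n → ½^ (suc n) + ½^ (suc n) ≡ ½^ n
    twice n = trans (sym (R.distribʳ (½^ n) ½ ½)) (trans (cong (_* ½^ n) ½+½) (R.*-identityˡ _))
    B≤ : M + 2^ k * s ≤ 2^ (suc Z)
    B≤ = +-monoʳ-≤ M (≡⇒≤ quarter ⟨≤⟩ ½^≤1 2 ⟨≤⟩ 1≤2^ Z) ⟨≤⟩ ≡⇒≤ (solve 1 (λ u → u :+ u := c2 :* u) refl M)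
    0≤B : 0# ≤ M + 2^ k * s
    0≤B = +-nonneg (0≤2^ Z) (*-nonneg (0≤2^ k) (0≤½^ (k ℕ.+ 2)))
    D = T ℕ.+ k ℕ.+ 3
    exp≡ : T ℕ.+ k ℕ.+ 4 ℕ.+ Z ≡ suc Z ℕ.+ D
    exp≡ = trans (ℕ.+-comm _ Z) (trans (cong (λ z → Z ℕ.+ z) (ℕ.+-suc (T ℕ.+ k) 3)) (ℕ.+-suc Z _))
    ωB≤ : ωₖ * (M + 2^ k * s) ≤ ½^ D
    ωB≤ = *-mono-≤ 0≤ωk (ωk≤ ⟨≤⟩ ½^-anti X≥) 0≤B B≤ ⟨≤⟩
      ≡⇒≤ (trans (cong (λ z → ½^ z * 2^ (suc Z)) exp≡) (trans (cong (_* 2^ (suc Z)) (^-+ ½ (suc Z) D))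
        (trans (solve 3 (λ h d p → h :* d :* p := p :* h :* d) refl (½^ (suc Z)) (½^ D) (2^ (suc Z)))
          (trans (cong (_* ½^ D) (2^*½^ (suc Z))) (R.*-identityˡ _)))))
    D≡ : D ≡ suc (T ℕ.+ (k ℕ.+ 2))
    D≡ = trans (ℕ.+-suc (T ℕ.+ k) 2) (cong suc (ℕ.+-assoc T k 2))
    small : 2^ T * (∣ Y k u ∣ + ωₖ * (M + 2^ k * s)) ≤ s
    small = *-monoʳ-≤ (0≤2^ T) (+-mono-≤ y≤ ωB≤ ⟨≤⟩ ≡⇒≤ (trans (cong (λ z → ½^ z + ½^ z) D≡) (twice (T ℕ.+ (k ℕ.+ 2))))) ⟨≤⟩
      ≡⇒≤ (trans (cong (_*_ (2^ T)) (^-+ ½ T (k ℕ.+ 2))) (trans (sym (R.*-assoc _ _ _))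
        (trans (cong (_* s) (2^*½^ T)) (R.*-identityˡ s))))
    open Decay u (ι-Rec t rec) {M} {s} T (0≤2^ Z) (^-nonneg (k ℕ.+ 2) 0≤½)
      (λ i i<k → ≡⇒≤ (abs-ι (t i)) ⟨≤⟩ ιℕ-mono (init i i<k) ⟨≤⟩ ≡⇒≤ (ιℕ-2^ Z)) small using (decay)
    final : (1# - ½^ k) ^ n * M + 2^ k * s ≤ ½
    final = +-mono-≤ (*-monoˡ-≤ (0≤2^ Z) (≡⇒≤ (^-* (1# - ½^ k) (2 ℕ.^ k) (Z ℕ.+ 2)) ⟨≤⟩
                        ^-mono (Z ℕ.+ 2) (^-nonneg (2 ℕ.^ k) (≤⇒0≤- (½^≤1 k))) (contraction-half k)) ⟨≤⟩
                      ≡⇒≤ (trans (cong (_* 2^ Z) (^-+ ½ Z 2)) (trans (solve 3 (λ h d p → h :* d :* p := p :* h :* d) refl (½^ Z) (½^ 2) (2^ Z))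
                         (trans (cong (_* ½^ 2) (2^*½^ Z)) (R.*-identityˡ _)))))
                     (≡⇒≤ quarter) ⟨≤⟩ ≡⇒≤ (trans (twice 1) (R.*-identityʳ ½))

-- Rational approximations to α and φ by bisection.

module Approximation (𝔽 : OrderedField) (k : ℕ) (3≤k : 3 ℕ.≤ k) where
  open FieldTheory 𝔽
  open Pisot 𝔽 k 3≤k

  module Bisection (f : Carrier → Carrier) (lo₀ hi₀ : Carrier) (lo₀≤hi₀ : lo₀ ≤ hi₀) (width : hi₀ - lo₀ ≤ 1#)
                   (f-lo : f lo₀ ≤ 0#) (f-hi : 0# ≤ f hi₀) (L : ℕ)
                   (lipschitz : ∀ x y → lo₀ ≤ x → x ≤ y → y ≤ hi₀ → f y - f x ≤ 2^ L * (y - x)) where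
    record Bracket (n : ℕ) : Set where
      field
        lo hi : Carrier
        lo₀≤lo : lo₀ ≤ lo
        lo≤hi  : lo ≤ hi
        hi≤hi₀ : hi ≤ hi₀
        f-lo≤0 : f lo ≤ 0#
        0≤f-hi : 0# ≤ f hi
        hi-lo≤ : hi - lo ≤ ½^ n

    bracket : ∀ n → Bracket n
    bracket zero = record { lo₀≤lo = ≤-refl ; lo≤hi = lo₀≤hi₀ ; hi≤hi₀ = ≤-refl ; f-lo≤0 = f-lo ; 0≤f-hi = f-hi ; hi-lo≤ = width }
    bracket (suc n) = choose (≤-total (f mid) 0#)
      where
      open Bracket (bracket n)
      d = hi - lo
      0≤d = ≤⇒0≤- lo≤hi
      mid = lo + ½ * d
      0≤½d = *-nonneg 0≤½ 0≤d
      hi≡ : hi ≡ lo + ½ * d + ½ * d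
      hi≡ = trans (solve 2 (λ h l → h := l :+ c1 :* (h :- l)) refl hi lo)
        (trans (cong (λ z → lo + z * d) (sym ½+½)) (solve 3 (λ l h d → l :+ (h :+ h) :* d := l :+ h :* d :+ h :* d) refl lo ½ d))
      lo≤mid : lo ≤ mid
      lo≤mid = by-diff (½ * d) 0≤½d (solve 2 (λ l x → (l :+ x) :- l := x) refl lo _)
      mid≤hi : mid ≤ hi
      mid≤hi = ≤-resp refl (sym hi≡) (by-diff (½ * d) 0≤½d (solve 2 (λ l x → (l :+ x :+ x) :- (l :+ x) := x) refl lo _))
      choose : (f mid ≤ 0#) ⊎ (0# ≤ f mid) → Bracket (suc n)
      choose (inj₁ p) = record { lo₀≤lo = lo₀≤lo ⟨≤⟩ lo≤mid ; lo≤hi = mid≤hi ; hi≤hi₀ = hi≤hi₀ ; f-lo≤0 = p ; 0≤f-hi = 0≤f-hi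
        ; hi-lo≤ = ≡⇒≤ (trans (cong (_- mid) hi≡) (solve 2 (λ l x → (l :+ x :+ x) :- (l :+ x) := x) refl lo _)) ⟨≤⟩ *-monoʳ-≤ 0≤½ hi-lo≤ }
      choose (inj₂ p) = record { lo₀≤lo = lo₀≤lo ; lo≤hi = lo≤mid ; hi≤hi₀ = mid≤hi ⟨≤⟩ hi≤hi₀ ; f-lo≤0 = f-lo≤0 ; 0≤f-hi = p
        ; hi-lo≤ = ≡⇒≤ (solve 2 (λ l x → (l :+ x) :- l := x) refl lo _) ⟨≤⟩ *-monoʳ-≤ 0≤½ hi-lo≤ }

    -- The upper end of the bracket is returned because `Root` asks for a nonnegative value. As f is
    -- at most 0 at the lower end, the Lipschitz bound controls that value.
    root : ∀ X → Σ Carrier λ x → lo₀ ≤ x × x ≤ hi₀ × 0# ≤ f x × f x ≤ ½^ X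
    root X = hi , (lo₀≤lo ⟨≤⟩ lo≤hi) , hi≤hi₀ , 0≤f-hi , 
      (by-diff (0# - f lo) (≤⇒0≤- f-lo≤0) (solve 2 (λ h l → (h :- l) :- h := c0 :- l) refl (f hi) (f lo)) ⟨≤⟩
       lipschitz lo hi lo₀≤lo lo≤hi hi≤hi₀ ⟨≤⟩ *-monoʳ-≤ (0≤2^ L) hi-lo≤ ⟨≤⟩
       ≡⇒≤ (trans (cong (_*_ (2^ L)) (^-+ ½ L X)) (trans (sym (R.*-assoc _ _ _)) (trans (cong (_* ½^ X) (2^*½^ L)) (R.*-identityˡ _)))))
      where open Bracket (bracket (L ℕ.+ X))

  private
    lo₀ : Carrier
    lo₀ = 1# + ½

    hi₀ : Carrier
    hi₀ = 2# - ½^ k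

    0≤lo₀ : 0# ≤ lo₀
    0≤lo₀ = +-nonneg 0≤1 0≤½

    ½²≤½ : ½ * ½ ≤ ½
    ½²≤½ = *-monoʳ-≤ 0≤½ ½≤1 ⟨≤⟩ ≡⇒≤ (R.*-identityʳ ½)

    2-½ : 2# - ½ ≡ lo₀
    2-½ = trans (cong (λ z → 1# + z - ½) (sym ½+½)) (solve 1 (λ h → c1 :+ (h :+ h) :- h := c1 :+ h) refl ½)

    ω₂-lo : ω lo₀ 2 ≤ 0#
    ω₂-lo = by-diff (½ - ½ * ½) (≤⇒0≤- ½²≤½)
      (trans (solve 1 (λ h → c0 :- ((c1 :+ h) :* ((c1 :+ h) :* c1 :- c1) :- c1) := (c1 :- h) :- h :* h) refl ½)
        (cong (_- ½ * ½) (trans (cong (_- ½) (sym ½+½)) (solve 1 (λ h → (h :+ h) :- h := h) refl ½))))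

    ω-lo : ∀ n → ω lo₀ (2 ℕ.+ n) ≤ 0#
    ω-lo zero    = ω₂-lo
    ω-lo (suc n) = +-monoˡ-≤ (- 1#) (*-monoʳ-≤ 0≤lo₀ (ω-lo n) ⟨≤⟩ ≡⇒≤ (R.zeroʳ lo₀)) ⟨≤⟩
      by-diff 1# 0≤1 (solve 0 (c0 :- (c0 :- c1) := c1) refl)

    d = ½^ k

    0≤hi₀ : 0# ≤ hi₀
    0≤hi₀ = ≤⇒0≤- (½^≤1 k ⟨≤⟩ 1≤2)

    -- At 2 every `ω` equals 1. At 2 - d the deviation from 1 is multiplied by 2 - d and increased
    -- by d in each step. For i = k the bound is 1 - d, whence ω ≥ d there.
    ω-hi : ∀ i → 1# - ω hi₀ i ≤ (2^ i - 1#) * d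
    ω-hi zero    = ≡⇒≤ (solve 1 (λ d → c1 :- c1 := (c1 :- c1) :* d) refl d)
    ω-hi (suc i) = ≡⇒≤ (solve 2 (λ d w → c1 :- ((c2 :- d) :* w :- c1) := (c2 :- d) :* (c1 :- w) :+ d) refl d (ω hi₀ i)) ⟨≤⟩
      +-monoˡ-≤ d (*-monoʳ-≤ 0≤hi₀ (ω-hi i) ⟨≤⟩
        *-monoˡ-≤ (*-nonneg (≤⇒0≤- (1≤2^ i)) (0≤½^ k)) (by-diff d (0≤½^ k) (solve 1 (λ d → c2 :- (c2 :- d) := d) refl d))) ⟨≤⟩
      ≡⇒≤ (solve 2 (λ d p → c2 :* ((p :- c1) :* d) :+ d := (c2 :* p :- c1) :* d) refl d (2^ i))

    ωₖ-hi : 0# ≤ ω hi₀ k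
    ωₖ-hi = 0≤½^ k ⟨≤⟩ by-diff (((2^ k) - 1#) * d - (1# - ω hi₀ k)) (≤⇒0≤- (ω-hi k))
      (trans (solve 2 (λ w d → w :- d := (c1 :- d) :- (c1 :- w)) refl (ω hi₀ k) d)
        (cong (_- (1# - ω hi₀ k)) (trans (cong (_- d) (sym (2^*½^ k))) (solve 2 (λ p d → p :* d :- d := (p :- c1) :* d) refl (2^ k) d))))

    |ω|≤ : ∀ {x} i → 0# ≤ x → x ≤ 2# → ∣ ω x i ∣ ≤ 2^ (2 ℕ.* i)
    |ω|≤ zero _ _ = ≡⇒≤ (abs-nonneg 0≤1)
    |ω|≤ {x} (suc i) p q = abs-- (x * ω x i) 1# ⟨≤⟩
      +-mono-≤ (≡⇒≤ (trans (abs-* x _) (cong (_* ∣ ω x i ∣) (abs-nonneg p))) ⟨≤⟩ *-mono-≤ p q (0≤abs _) (|ω|≤ i p q))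
               (≡⇒≤ (abs-nonneg 0≤1) ⟨≤⟩ 1≤2^ (2 ℕ.* i) ⟨≤⟩ (by-diff (2^ (2 ℕ.* i)) (0≤2^ (2 ℕ.* i)) (solve 1 (λ u → c2 :* u :- u := u) refl _))) ⟨≤⟩
      ≡⇒≤ (trans (solve 1 (λ u → c2 :* u :+ c2 :* u := c2 :* (c2 :* u)) refl (2^ (2 ℕ.* i))) (cong 2^_ (sym (ℕ.*-suc 2 i))))

    ω-lipschitz : ∀ i {x y} → 0# ≤ x → x ≤ y → y ≤ 2# → ω y i - ω x i ≤ 2^ (2 ℕ.* i) * (y - x)
    ω-lipschitz i {x} {y} p q r = ≤abs _ ⟨≤⟩ go i
      where
      0≤y-x = ≤⇒0≤- q
      go : ∀ i → ∣ ω y i - ω x i ∣ ≤ 2^ (2 ℕ.* i) * (y - x)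
      go zero = ≡⇒≤ (trans (cong ∣_∣ (R.-‿inverseʳ 1#)) (abs-nonneg ≤-refl)) ⟨≤⟩ *-nonneg 0≤1 0≤y-x
      go (suc i) = ≡⇒≤ (cong ∣_∣ (solve 4 (λ x y u v → (y :* v :- c1) :- (x :* u :- c1) := y :* (v :- u) :+ u :* (y :- x)) refl x y (ω x i) (ω y i))) ⟨≤⟩
        abs-+ _ _ ⟨≤⟩ +-mono-≤
          (≡⇒≤ (trans (abs-* y _) (cong (_* ∣ ω y i - ω x i ∣) (abs-nonneg (p ⟨≤⟩ q)))) ⟨≤⟩ *-mono-≤ (p ⟨≤⟩ q) r (0≤abs _) (go i))
          (≡⇒≤ (trans (abs-* _ _) (cong (_*_ ∣ ω x i ∣) (abs-nonneg 0≤y-x))) ⟨≤⟩ *-monoˡ-≤ 0≤y-x (|ω|≤ i p (q ⟨≤⟩ r)) ⟨≤⟩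
            by-diff (2^ (2 ℕ.* i) * (y - x)) (*-nonneg (0≤2^ (2 ℕ.* i)) 0≤y-x) (solve 1 (λ z → c2 :* z :- z := z) refl _)) ⟨≤⟩
        ≡⇒≤ (trans (solve 2 (λ u z → c2 :* (u :* z) :+ c2 :* (u :* z) := c2 :* (c2 :* u) :* z) refl (2^ (2 ℕ.* i)) (y - x))
          (cong (λ n → 2^ n * (y - x)) (sym (ℕ.*-suc 2 i))))

    3≤2lo₀ : 3# ≤ 2# * lo₀
    3≤2lo₀ = ≡⇒≤ (sym (trans (R.distribˡ 2# 1# ½) (trans (cong (_+_ (2# * 1#)) 2*½) (solve 0 (c2 :* c1 :+ c1 := c3) refl))))

  root-of : ∀ X → Root X
  root-of X = build (Bisection.root (λ x → ω x k) lo₀ hi₀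
      (≤-resp 2-½ refl (+-monoʳ-≤ 2# (neg-mono (½^-anti {1} {k} (ℕ.≤-trans (s≤s z≤n) 3≤k) ⟨≤⟩ ≡⇒≤ (R.*-identityʳ ½)))))
      (by-diff (½ + d) (+-nonneg 0≤½ (0≤½^ k)) (solve 2 (λ h d → c1 :- ((c2 :- d) :- (c1 :+ h)) := h :+ d) refl ½ d))
      (ω-lo′ k (ℕ.≤-trans (ℕ.n≤1+n 2) 3≤k)) ωₖ-hi (2 ℕ.* k)
      (λ x y p q r → ω-lipschitz k (0≤lo₀ ⟨≤⟩ p) q (r ⟨≤⟩ hi₀≤2)) X)
    where
    ω-lo′ : ∀ n → 2 ℕ.≤ n → ω lo₀ n ≤ 0#
    ω-lo′ (suc (suc n)) _ = ω-lo n
    ω-lo′ (suc zero) (s≤s ())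
    hi₀≤2 : hi₀ ≤ 2#
    hi₀≤2 = by-diff d (0≤½^ k) (solve 1 (λ d → c2 :- (c2 :- d) := d) refl d)
    build : Σ Carrier (λ x → lo₀ ≤ x × x ≤ hi₀ × 0# ≤ ω x k × ω x k ≤ ½^ X) → Root X
    build (a , lo≤ , ≤hi , 0≤f , f≤) = record
      { a = a ; 3≤2a = 3≤2lo₀ ⟨≤⟩ *-monoʳ-≤ 0≤2 lo≤
      ; a≤ = +-monoˡ-≤ d ≤hi ⟨≤⟩ ≡⇒≤ (solve 1 (λ d → c2 :- d :+ d := c2) refl d)
      ; 0≤ωk = 0≤f ; ωk≤ = f≤ }

  record Golden (X : ℕ) : Set where
    field
      b    : Carrier
      3≤2b : 3# ≤ 2# * b
      b≤2  : b ≤ 2#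
      b²≤  : ∣ b * b - b - 1# ∣ ≤ ½^ X

  golden-of : ∀ X → Golden X
  golden-of X = build (Bisection.root (λ x → x * x - x - 1#) lo₀ 2#
      (by-diff ½ 0≤½ (trans (cong (_- lo₀) (cong (_+_ 1#) (sym ½+½))) (solve 1 (λ h → (c1 :+ (h :+ h)) :- (c1 :+ h) := h) refl ½)))
      (by-diff ½ 0≤½ (solve 1 (λ h → c1 :- (c2 :- (c1 :+ h)) := h) refl ½))
      (≤-resp (solve 1 (λ x → x :* (x :* c1 :- c1) :- c1 := x :* x :- x :- c1) refl lo₀) refl ω₂-lo)
      (≤-resp refl (solve 0 (c1 := c2 :* c2 :- c2 :- c1) refl) 0≤1)
      2
      (λ x y p q r → ≡⇒≤ (solve 2 (λ x y → (y :* y :- y :- c1) :- (x :* x :- x :- c1) := (y :+ x :- c1) :* (y :- x)) refl x y) ⟨≤⟩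
         *-monoˡ-≤ (≤⇒0≤- q) (by-diff ((2# - y) + (2# - x) + 1#)
            (+-nonneg (+-nonneg (≤⇒0≤- r) (≤⇒0≤- (q ⟨≤⟩ r))) 0≤1)
            (solve 2 (λ x y → c2 :* (c2 :* c1) :- (y :+ x :- c1) := (c2 :- y) :+ (c2 :- x) :+ c1) refl x y)))
      X)
    where
    build : Σ Carrier (λ x → lo₀ ≤ x × x ≤ 2# × 0# ≤ x * x - x - 1# × x * x - x - 1# ≤ ½^ X) → Golden X
    build (b , lo≤ , ≤hi , 0≤f , f≤) = record
      { b = b ; 3≤2b = 3≤2lo₀ ⟨≤⟩ *-monoʳ-≤ 0≤2 lo≤ ; b≤2 = ≤hi ; b²≤ = ≡⇒≤ (abs-nonneg 0≤f) ⟨≤⟩ f≤ }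

-- The Liouville inequality in ℤ[α].

module Liouville (𝔽 : OrderedField) (𝓖 : KBonacci) where
  open KBonacci 𝓖
  open FieldTheory 𝔽
  open Pisot 𝔽 k 3≤k
  open Approximation 𝔽 k 3≤k

  infixl 6 _⊕_
  infixl 7 _⊗_
  -- Syntax instead of numbers, since one element must act exactly on integer sequences and also be
  -- evaluated at every approximate root.
  data E : Set where
    con′    : ℤ → E
    X′      : E
    _⊕_ _⊗_ : E → E → E

  -- The action of ℤ[x] on sequences, x acting by the shift.
  act : E → (ℕ → ℤ) → ℕ → ℤ
  act (con′ c) t i = c ℤ.* t i
  act X′ t i       = t (suc i)
  act (e ⊕ f) t i  = act e t i ℤ.+ act f t i
  act (e ⊗ f) t    = act e (act f t)

  -- A weight with x counted as 2: it bounds the action on sequences of growth 2^i as well as the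
  -- value at a ≤ 2.
  nrm : E → ℕ
  nrm (con′ c) = ℤ.∣ c ∣
  nrm X′       = 2
  nrm (e ⊕ f)  = nrm e ℕ.+ nrm f
  nrm (e ⊗ f)  = nrm e ℕ.* nrm f

  -- Counts, in multiples of `ωₖ`, how far the exact action on sequences departs from multiplication
  -- by the value; the product clause has the Leibniz pattern.
  err : E → ℕ
  err (con′ c) = 0
  err X′       = 1
  err (e ⊕ f)  = err e ℕ.+ err f
  err (e ⊗ f)  = err e ℕ.* nrm f ℕ.+ nrm e ℕ.* err f

  private
    drop-map : ∀ N (h : ℤ → ℤ) t i → drop N (λ j → h (t j)) i ≡ h (drop N t i)
    drop-map zero h t i    = refl
    drop-map (suc N) h t i = drop-map N h t (suc i)

    drop-+ : ∀ N (t u : ℕ → ℤ) i → drop N (λ j → t j ℤ.+ u j) i ≡ drop N t i ℤ.+ drop N u i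
    drop-+ zero t u i    = refl
    drop-+ (suc N) t u i = drop-+ N t u (suc i)

    drop-shift : ∀ N (t : ℕ → ℤ) i → drop N (λ j → t (suc j)) i ≡ drop N t (suc i)
    drop-shift zero t i    = refl
    drop-shift (suc N) t i = drop-shift N t (suc i)

  act-rec : ∀ e {t} → Recℤ k t → Recℤ k (act e t)
  act-rec (con′ c) {t} rec N = trans (drop-map N (λ z → c ℤ.* z) t k) (trans (cong (λ z → c ℤ.* z) (rec N))
    (trans (sym (Sumℤ-* k c (drop N t))) (Sumℤ-cong k (λ i → sym (drop-map N (λ z → c ℤ.* z) t i)))))
  act-rec X′ {t} rec N = trans (drop-shift N t k) (trans (rec (suc N)) (Sumℤ-cong k (λ i → sym (drop-shift N t i))))
  act-rec (e ⊕ f) {t} rec N = trans (drop-+ N (act e t) (act f t) k) (trans (cong₂ ℤ._+_ (act-rec e rec N) (act-rec f rec N))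
    (trans (sym (Sumℤ-+ k (drop N (act e t)) (drop N (act f t)))) (Sumℤ-cong k (λ i → sym (drop-+ N (act e t) (act f t) i)))))
  act-rec (e ⊗ f) rec = act-rec e (act-rec f rec)

  act-bound : ∀ e {t M} → (∀ i → ℤ.∣ t i ∣ ℕ.≤ M ℕ.* 2 ℕ.^ i) → ∀ i → ℤ.∣ act e t i ∣ ℕ.≤ nrm e ℕ.* M ℕ.* 2 ℕ.^ i
  act-bound (con′ c) {t} {M} h i = ℕ.≤-trans (ℕ.≤-reflexive (ℤ.abs-* c (t i)))
    (ℕ.≤-trans (ℕ.*-monoʳ-≤ ℤ.∣ c ∣ (h i)) (ℕ.≤-reflexive (sym (ℕ.*-assoc ℤ.∣ c ∣ M _))))
  act-bound X′ {t} {M} h i = ℕ.≤-trans (h (suc i)) (ℕ.≤-reflexive (lemma M (2 ℕ.^ i)))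
    where
    lemma : ∀ m p → m ℕ.* (2 ℕ.* p) ≡ 2 ℕ.* m ℕ.* p
    lemma = solve-∀
  act-bound (e ⊕ f) {t} {M} h i = ℕ.≤-trans (ℤ.∣i+j∣≤∣i∣+∣j∣ (act e t i) (act f t i))
    (ℕ.≤-trans (ℕ.+-mono-≤ (act-bound e h i) (act-bound f h i)) (ℕ.≤-reflexive (lemma (nrm e) (nrm f) M (2 ℕ.^ i))))
    where
    lemma : ∀ x y m p → x ℕ.* m ℕ.* p ℕ.+ y ℕ.* m ℕ.* p ≡ (x ℕ.+ y) ℕ.* m ℕ.* p
    lemma = solve-∀
  act-bound (e ⊗ f) {t} {M} h i = ℕ.≤-trans (act-bound e (act-bound f h) i) (ℕ.≤-reflexive (cong (ℕ._* 2 ℕ.^ i) (sym (ℕ.*-assoc (nrm e) (nrm f) M))))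

  g-bound′ : ∀ i → ℤ.∣ g i ∣ ℕ.≤ 1 ℕ.* 2 ℕ.^ i
  g-bound′ i = ℕ.≤-trans (g-bound i) (ℕ.≤-reflexive (sym (ℕ.*-identityˡ _)))

  le : ∀ {m n} d → m ℕ.+ d ≡ n → m ℕ.≤ n
  le {m} d refl = ℕ.m≤m+n m d

  module Evaluation {X : ℕ} (root : Root X) where
    open WithRoot root public

    eval : E → Carrier
    eval (con′ c) = ι c
    eval X′       = a
    eval (e ⊕ f)  = eval e + eval f
    eval (e ⊗ f)  = eval e * eval f

    abs-a : ∣ a ∣ ≡ a
    abs-a = abs-nonneg 0≤a

    eval≤ : ∀ e → ∣ eval e ∣ ≤ ιℕ (nrm e)
    eval≤ (con′ c) = ≡⇒≤ (abs-ι c)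
    eval≤ X′       = ≡⇒≤ abs-a ⟨≤⟩ a≤2
    eval≤ (e ⊕ f)  = abs-+ _ _ ⟨≤⟩ +-mono-≤ (eval≤ e) (eval≤ f) ⟨≤⟩ ≡⇒≤ (sym (ιℕ-+ (nrm e) (nrm f)))
    eval≤ (e ⊗ f)  = ≡⇒≤ (abs-* _ _) ⟨≤⟩ *-mono-≤ (0≤abs _) (eval≤ e) (0≤abs _) (eval≤ f) ⟨≤⟩ ≡⇒≤ (sym (ιℕ-* (nrm e) (nrm f)))

    Yℤ : (ℕ → ℤ) → Carrier
    Yℤ t = Y k (λ i → ι (t i))

    act-Y : ∀ e {t M} → Recℤ k t → (∀ i → ℤ.∣ t i ∣ ℕ.≤ M ℕ.* 2 ℕ.^ i) →
            ∣ Yℤ (act e t) - eval e * Yℤ t ∣ ≤ ωₖ * ιℕ (err e ℕ.* M)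
    act-Y (con′ c) {t} {M} rec h = ≡⇒≤ (trans (cong ∣_∣ (trans (cong (_- ι c * Yℤ t)
        (trans (Y-cong k (λ i → ι-* c (t i))) (Y-* k (ι c) (λ i → ι (t i))))) (R.-‿inverseʳ _)))
        (trans (abs-nonneg ≤-refl) (sym (R.zeroʳ ωₖ))))
    act-Y X′ {t} {M} rec h = ≡⇒≤ (trans (cong ∣_∣ (trans (cong (_- a * Yℤ t) (Y-step (λ i → ι (t i)) (ι-Rec t rec 0)))
        (solve 3 (λ x w t → x :- w :* t :- x := :- (w :* t)) refl (a * Yℤ t) ωₖ (ι (t 0)))))
        (trans (abs-neg _) (trans (abs-* _ _) (cong₂ _*_ (abs-nonneg 0≤ωk) (abs-ι (t 0)))))) ⟨≤⟩
      *-monoʳ-≤ 0≤ωk (ιℕ-mono (ℕ.≤-trans (h 0) (ℕ.≤-reflexive (lemma M))))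
      where
      lemma : ∀ m → m ℕ.* 1 ≡ 1 ℕ.* m
      lemma = solve-∀
    act-Y (e ⊕ f) {t} {M} rec h = ≡⇒≤ (cong ∣_∣ (trans (cong (_- (eval e + eval f) * Yℤ t)
          (trans (Y-cong k (λ i → ι-+ (act e t i) (act f t i))) (Y-+ k _ _)))
        (solve 5 (λ p q e f y → p :+ q :- (e :+ f) :* y := p :- e :* y :+ (q :- f :* y)) refl (Yℤ (act e t)) (Yℤ (act f t)) (eval e) (eval f) (Yℤ t)))) ⟨≤⟩
      abs-+ _ _ ⟨≤⟩ +-mono-≤ (act-Y e rec h) (act-Y f rec h) ⟨≤⟩
      ≡⇒≤ (trans (sym (R.distribˡ ωₖ _ _)) (cong (_*_ ωₖ) (trans (sym (ιℕ-+ (err e ℕ.* M) (err f ℕ.* M))) (cong ιℕ (sym (ℕ.*-distribʳ-+ M (err e) (err f)))))))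
    act-Y (e ⊗ f) {t} {M} rec h = ≡⇒≤ (cong ∣_∣ (solve 5 (λ p q e f y → p :- e :* f :* y := p :- e :* q :+ e :* (q :- f :* y)) refl
          (Yℤ (act e (act f t))) (Yℤ (act f t)) (eval e) (eval f) (Yℤ t))) ⟨≤⟩
      abs-+ _ _ ⟨≤⟩ +-mono-≤ (act-Y e (act-rec f rec) (act-bound f h))
        (≡⇒≤ (abs-* _ _) ⟨≤⟩ *-mono-≤ (0≤abs _) (eval≤ e) (0≤abs _) (act-Y f rec h)) ⟨≤⟩
      ≡⇒≤ (trans (solve 4 (λ w x n y → w :* x :+ n :* (w :* y) := w :* (x :+ n :* y)) refl ωₖ (ιℕ (err e ℕ.* (nrm f ℕ.* M))) (ιℕ (nrm e)) (ιℕ (err f ℕ.* M)))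
        (cong (_*_ ωₖ) (trans (cong (_+_ _) (sym (ιℕ-* (nrm e) (err f ℕ.* M)))) (trans (sym (ιℕ-+ (err e ℕ.* (nrm f ℕ.* M)) (nrm e ℕ.* (err f ℕ.* M)))) (cong ιℕ (lemma (err e) (nrm f) M (nrm e) (err f)))))))
      where
      lemma : ∀ x y m z w → x ℕ.* (y ℕ.* m) ℕ.+ z ℕ.* (w ℕ.* m) ≡ (x ℕ.* y ℕ.+ z ℕ.* w) ℕ.* m
      lemma = solve-∀

    Yℤ-g : Yℤ g ≡ 1#
    Yℤ-g = go k refl
      where
      lemma : ∀ n t → (∀ i → i ℕ.< n → t i ≡ 0#) → t n ≡ 1# → Y (suc n) t ≡ 1#
      lemma zero t z o = trans (cong (λ x → 1# * x + 0#) o) (solve 0 (c1 :* c1 :+ c0 := c1) refl)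
      lemma (suc n) t z o = trans (cong₂ (λ x y → ω a (suc n) * x + y) (z 0 (s≤s z≤n)) (lemma n (λ i → t (suc i)) (λ i p → z (suc i) (s≤s p)) o))
        (solve 1 (λ w → w :* c0 :+ c1 := c1) refl (ω a (suc n)))
      go : ∀ n → n ≡ k → Y n (λ i → ι (g i)) ≡ 1#
      go zero eq = ⊥-elim (absurd (subst (3 ℕ.≤_) (sym eq) 3≤k))
        where
        absurd : 3 ℕ.≤ 0 → ⊥
        absurd ()
      go (suc n) eq = lemma n _ (λ i p → cong ι (g-zero i (subst (suc i ℕ.<_) eq (s≤s p)))) (cong ι (g-one n eq))

    -- Since `Yℤ g` is 1, the dominant component of `act e g` recovers the value of `e`. A small
    -- number in ℤ[α] thus becomes an integer sequence to which `liouville` applies.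
    eval-Y : ∀ e → ∣ Yℤ (act e g) - eval e ∣ ≤ ωₖ * ιℕ (err e)
    eval-Y e = ≡⇒≤ (cong (λ z → ∣ Yℤ (act e g) - z ∣) (trans (sym (R.*-identityʳ (eval e))) (cong (_*_ (eval e)) (sym Yℤ-g)))) ⟨≤⟩
      act-Y e g-rec g-bound′ ⟨≤⟩ ≡⇒≤ (cong (λ z → ωₖ * ιℕ z) (ℕ.*-identityʳ (err e)))

    zero⇒eval≤ : ∀ e → (∀ i → act e g i ≡ + 0) → ∣ eval e ∣ ≤ ωₖ * ιℕ (err e)
    zero⇒eval≤ e z = ≡⇒≤ (trans (sym (abs-neg (eval e))) (cong ∣_∣ (trans (sym (R.+-identityˡ _))
        (cong (_- eval e) (trans (sym (Y-zero k)) (Y-cong k (λ i → cong ι (sym (z i))))))))) ⟨≤⟩ eval-Y e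
      where
      Y-zero : ∀ n → Y n (λ _ → 0#) ≡ 0#
      Y-zero zero = refl
      Y-zero (suc n) = trans (cong (_+_ _) (Y-zero n)) (trans (R.+-identityʳ _) (R.zeroʳ _))

  -- The first k terms of `act e g` are at most 2^(Z + k), hence the argument of `steps`; the one
  -- bit more than in `liouville` leaves room for the error of `eval-Y`.
  Dℓ : ℕ → ℕ
  Dℓ Z = steps (Z ℕ.+ k) ℕ.+ k ℕ.+ 4

  liouville₁ : ∀ {X} (root : Root X) e Z → nrm e ℕ.≤ 2 ℕ.^ Z →
               ∣ Evaluation.eval root e ∣ ≤ ½^ (Dℓ Z) → Dℓ Z ℕ.+ (Z ℕ.+ k) ℕ.+ err e ℕ.≤ X → ∀ i → act e g i ≡ + 0
  liouville₁ {X} root e Z n≤ e≤ X≥ = liouville root (act e g) (act-rec e g-rec) (Z ℕ.+ k) init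
      (≡⇒≤ (cong ∣_∣ (solve 2 (λ y e → y := (y :- e) :+ e) refl (Yℤ (act e g)) (eval e))) ⟨≤⟩ abs-+ _ _ ⟨≤⟩
        ½^-sum D (eval-Y e ⟨≤⟩ ιℕ*-tiny (err e) (suc D) 0≤ωk ωk≤
              (ℕ.≤-trans (le (Z ℕ.+ k) (lemma (steps (Z ℕ.+ k)) k (err e) (Z ℕ.+ k))) X≥))
            (e≤ ⟨≤⟩ ≡⇒≤ (cong ½^_ (ℕ.+-suc (steps (Z ℕ.+ k) ℕ.+ k) 3))))
      (ℕ.≤-trans (ℕ.m≤m+n _ (err e)) X≥)
    where
    open Evaluation root
    D = steps (Z ℕ.+ k) ℕ.+ k ℕ.+ 3
    lemma : ∀ s k e z → e ℕ.+ suc (s ℕ.+ k ℕ.+ 3) ℕ.+ z ≡ s ℕ.+ k ℕ.+ 4 ℕ.+ z ℕ.+ e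
    lemma = solve-∀
    init : ∀ i → i ℕ.< k → ℤ.∣ act e g i ∣ ℕ.≤ 2 ℕ.^ (Z ℕ.+ k)
    init i i<k = ℕ.≤-trans (act-bound e g-bound′ i) (ℕ.≤-trans (ℕ.*-mono-≤ (ℕ.≤-trans (ℕ.≤-reflexive (ℕ.*-identityʳ (nrm e))) n≤) (ℕ.^-monoʳ-≤ 2 (ℕ.<⇒≤ i<k)))
      (ℕ.≤-reflexive (sym (ℕ.^-distribˡ-+-* 2 Z k))))

-- The Liouville inequality in ℤ[α, φ].

module GoldenExtension (𝔽 : OrderedField) (𝓖 : KBonacci) where
  open KBonacci 𝓖
  open FieldTheory 𝔽
  open Pisot 𝔽 k 3≤k
  open Approximation 𝔽 k 3≤k
  open Liouville 𝔽 𝓖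

  -- The norm of P + Qφ from ℤ[x][φ] to ℤ[x].
  norm : E → E → E
  norm P Q = P ⊗ P ⊕ P ⊗ Q ⊕ con′ -[1+ 0 ] ⊗ (Q ⊗ Q)

  -- Z bits for the size of the conjugate, `Dℓ (Z + Z)` for the norm, whose weight is at most
  -- 2^(2Z), and three bits for the halvings when both coordinates are recovered.
  Aℓ : ℕ → ℕ
  Aℓ Z = Z ℕ.+ (Dℓ (Z ℕ.+ Z) ℕ.+ 3)

  module Quadratic {X : ℕ} (root : Root X) (golden : Golden X) where
    open Evaluation root public
    open Golden golden public

    1≤b : 1# ≤ b
    1≤b = *-cancelˡ-≤ 2# (1≤⇒≰0 1≤2) (by-diff ((2# * b - 3#) + 1#) (+-nonneg (≤⇒0≤- 3≤2b) 0≤1)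
      (solve 1 (λ b → c2 :* b :- c2 :* c1 := (c2 :* b :- c3) :+ c1) refl b))

    0≤b : 0# ≤ b
    0≤b = 0≤1 ⟨≤⟩ 1≤b

    abs-b : ∣ b ∣ ≤ 2#
    abs-b = ≡⇒≤ (abs-nonneg 0≤b) ⟨≤⟩ b≤2

    |1-b|≤1 : ∣ 1# - b ∣ ≤ 1#
    |1-b|≤1 = abs-≤ (by-diff b 0≤b (solve 1 (λ b → c1 :- (c1 :- b) := b) refl b))
      (by-diff (2# - b) (≤⇒0≤- b≤2) (solve 1 (λ b → c1 :- :- (c1 :- b) := c2 :- b) refl b))

    β : Carrier
    β = b * b - b - 1#

    -- The second is the conjugate under φ ↦ 1 - φ. The product is the norm up to a multiple of the
    -- defect `β`.
    PE PE̅ : E → E → Carrier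
    PE P Q  = eval P + eval Q * b
    PE̅ P Q = eval P + eval Q * (1# - b)

    eval-norm : ∀ P Q → eval (norm P Q) ≡ PE P Q * PE̅ P Q + eval Q * eval Q * β
    eval-norm P Q = solve 3 (λ p q b → p :* p :+ p :* q :+ (:- c1) :* (q :* q) :=
       (p :+ q :* b) :* (p :+ q :* (c1 :- b)) :+ q :* q :* (b :* b :- b :- c1)) refl (eval P) (eval Q) b

    module _ (P Q : E) (Z : ℕ) (nrm≤ : nrm P ℕ.+ 2 ℕ.* nrm Q ℕ.≤ 2 ℕ.^ Z) where
      private
        D = Dℓ (Z ℕ.+ Z)
        nQ≤ : nrm Q ℕ.≤ nrm P ℕ.+ 2 ℕ.* nrm Q
        nQ≤ = le (nrm P ℕ.+ nrm Q) (lemma (nrm P) (nrm Q))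
          where
          lemma : ∀ p q → q ℕ.+ (p ℕ.+ q) ≡ p ℕ.+ 2 ℕ.* q
          lemma = solve-∀
        square : ℕ
        square = (nrm P ℕ.+ 2 ℕ.* nrm Q) ℕ.* (nrm P ℕ.+ 2 ℕ.* nrm Q)
        square≤ : square ℕ.≤ 2 ℕ.^ (Z ℕ.+ Z)
        square≤ = ℕ.≤-trans (ℕ.*-mono-≤ nrm≤ nrm≤) (ℕ.≤-reflexive (sym (ℕ.^-distribˡ-+-* 2 Z Z)))
        2^Z≤ : 2 ℕ.^ Z ℕ.≤ 2 ℕ.^ (Z ℕ.+ Z)
        2^Z≤ = ℕ.^-monoʳ-≤ 2 (ℕ.m≤m+n Z Z)
        nrm-norm≤ : nrm (norm P Q) ℕ.≤ 2 ℕ.^ (Z ℕ.+ Z)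
        nrm-norm≤ = ℕ.≤-trans (le _ (lemma (nrm P) (nrm Q))) square≤
          where
          lemma : ∀ p q → p ℕ.* p ℕ.+ p ℕ.* q ℕ.+ 1 ℕ.* (q ℕ.* q) ℕ.+ (3 ℕ.* (p ℕ.* q) ℕ.+ 3 ℕ.* (q ℕ.* q)) ≡ (p ℕ.+ 2 ℕ.* q) ℕ.* (p ℕ.+ 2 ℕ.* q)
          lemma = solve-∀
        |v̅|≤ : ∣ PE̅ P Q ∣ ≤ 2^ Z
        |v̅|≤ = abs-+ _ _ ⟨≤⟩ +-mono-≤ (eval≤ P) (≡⇒≤ (abs-* _ _) ⟨≤⟩ *-mono-≤ (0≤abs _) (eval≤ Q) (0≤abs _) |1-b|≤1 ⟨≤⟩ ≡⇒≤ (R.*-identityʳ _)) ⟨≤⟩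
          ≡⇒≤ (sym (ιℕ-+ (nrm P) (nrm Q))) ⟨≤⟩ ιℕ-mono (ℕ.≤-trans (ℕ.+-monoʳ-≤ (nrm P) (ℕ.m≤m+n _ _)) nrm≤) ⟨≤⟩ ≡⇒≤ (ιℕ-2^ Z)
        |Q²β|≤ : ∀ W → Z ℕ.+ Z ℕ.+ W ℕ.≤ X → ∣ eval Q * eval Q * β ∣ ≤ ½^ W
        |Q²β|≤ W X≥ = ≡⇒≤ (trans (abs-* _ _) (cong (_* ∣ β ∣) (abs-* _ _))) ⟨≤⟩
          *-mono-≤ (*-nonneg (0≤abs _) (0≤abs _)) (*-mono-≤ (0≤abs _) (eval≤ Q) (0≤abs _) (eval≤ Q)) (0≤abs _) b²≤ ⟨≤⟩
          *-monoˡ-≤ (0≤½^ X) (≡⇒≤ (sym (ιℕ-* (nrm Q) (nrm Q))) ⟨≤⟩ ιℕ-mono (ℕ.≤-trans (ℕ.*-mono-≤ nQ≤ nQ≤) square≤) ⟨≤⟩ ≡⇒≤ (ιℕ-2^ (Z ℕ.+ Z))) ⟨≤⟩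
          2^*½^≤ (Z ℕ.+ Z) W X≥

      -- The conjugate costs at most Z bits, so smallness passes from the element to its norm, where
      -- `liouville₁` applies.
      norm-zero : ∣ PE P Q ∣ ≤ ½^ (Aℓ Z) → D ℕ.+ (Z ℕ.+ Z ℕ.+ k) ℕ.+ (err (norm P Q) ℕ.+ 1) ℕ.≤ X → ∀ i → act (norm P Q) g i ≡ + 0
      norm-zero v≤ X≥ = liouville₁ root (norm P Q) (Z ℕ.+ Z) nrm-norm≤
        (≡⇒≤ (cong ∣_∣ (eval-norm P Q)) ⟨≤⟩ abs-+ _ _ ⟨≤⟩
         ½^-sum D (≡⇒≤ (trans (abs-* _ _) (R.*-comm _ _)) ⟨≤⟩ *-mono-≤ (0≤abs _) |v̅|≤ (0≤abs _) v≤ ⟨≤⟩ ≡⇒≤ (2^*½^≡ Z (D ℕ.+ 3)) ⟨≤⟩ ½^-anti {suc D} {D ℕ.+ 3} (le 2 (lemma₁ D)))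
                  (|Q²β|≤ (suc D) (ℕ.≤-trans (le (k ℕ.+ err (norm P Q)) (lemma₂ Z D k (err (norm P Q)))) X≥)))
        (ℕ.≤-trans (le 1 (ℕ.+-assoc (D ℕ.+ (Z ℕ.+ Z ℕ.+ k)) (err (norm P Q)) 1)) X≥)
        where
        lemma₁ : ∀ d → suc d ℕ.+ 2 ≡ d ℕ.+ 3
        lemma₁ = solve-∀
        lemma₂ : ∀ z d k e → z ℕ.+ z ℕ.+ suc d ℕ.+ (k ℕ.+ e) ≡ d ℕ.+ (z ℕ.+ z ℕ.+ k) ℕ.+ (e ℕ.+ 1)
        lemma₂ = solve-∀

      need : ℕ → ℕ
      need W = (Dℓ (Z ℕ.+ Z) ℕ.+ (Z ℕ.+ Z ℕ.+ k)) ℕ.+ (err (norm P Q) ℕ.+ err P ℕ.+ err Q ℕ.+ 3) ℕ.+ (W ℕ.+ Aℓ Z)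

      -- A small element of ℤ[α,φ] is negligible: its norm to ℤ[α] vanishes, so either the element or its
      -- conjugate vanishes in the limit, and in the latter case both coordinates are small, hence zero.
      negligible : ∀ W → need W ℕ.≤ X → ∣ PE P Q ∣ ≤ ½^ (Aℓ Z) → ∣ PE P Q ∣ ≤ ½^ W
      negligible W X≥ v≤ with ≤-total ∣ PE̅ P Q ∣ (½^ (Aℓ Z))
      ... | inj₂ v̅≥ = *-cancelˡ-≤ (½^ (Aℓ Z)) (λ p → 1≰0 (≡⇒≤ (sym (2^*½^ (Aℓ Z))) ⟨≤⟩ *-monoʳ-≤ (0≤2^ (Aℓ Z)) p ⟨≤⟩ ≡⇒≤ (R.zeroʳ _)))
          (*-monoˡ-≤ (0≤abs _) v̅≥ ⟨≤⟩ ≡⇒≤ (trans (R.*-comm _ _) (sym (abs-* _ _))) ⟨≤⟩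
           ≡⇒≤ (cong ∣_∣ (solve 2 (λ x y → x := (x :+ y) :- y) refl (PE P Q * PE̅ P Q) (eval Q * eval Q * β))) ⟨≤⟩ abs-- _ _ ⟨≤⟩
           ½^-sum (Aℓ Z ℕ.+ W)
             (≡⇒≤ (cong ∣_∣ (sym (eval-norm P Q))) ⟨≤⟩ zero⇒eval≤ (norm P Q) (norm-zero v≤ (ℕ.≤-trans (le (err P ℕ.+ err Q ℕ.+ 2 ℕ.+ (W ℕ.+ Aℓ Z)) (l₁ (D ℕ.+ (Z ℕ.+ Z ℕ.+ k)) (err (norm P Q)) (err P) (err Q) (W ℕ.+ Aℓ Z))) X≥)) ⟨≤⟩
               ιℕ*-tiny (err (norm P Q)) _ 0≤ωk ωk≤ (ℕ.≤-trans (le (D ℕ.+ (Z ℕ.+ Z ℕ.+ k) ℕ.+ (err P ℕ.+ err Q ℕ.+ 2)) (l₂ (D ℕ.+ (Z ℕ.+ Z ℕ.+ k)) (err (norm P Q)) (err P) (err Q) W (Aℓ Z))) X≥))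
             (|Q²β|≤ (suc (Aℓ Z ℕ.+ W)) (ℕ.≤-trans (le (D ℕ.+ k ℕ.+ (err (norm P Q) ℕ.+ err P ℕ.+ err Q ℕ.+ 2)) (l₃ Z D k (err (norm P Q) ℕ.+ err P ℕ.+ err Q) W (Aℓ Z))) X≥)) ⟨≤⟩
           ≡⇒≤ (^-+ ½ (Aℓ Z) W))
        where
        l₁ : ∀ x n p q w → x ℕ.+ (n ℕ.+ 1) ℕ.+ (p ℕ.+ q ℕ.+ 2 ℕ.+ w) ≡ x ℕ.+ (n ℕ.+ p ℕ.+ q ℕ.+ 3) ℕ.+ w
        l₁ = solve-∀
        l₂ : ∀ x n p q w a → n ℕ.+ suc (a ℕ.+ w) ℕ.+ (x ℕ.+ (p ℕ.+ q ℕ.+ 2)) ≡ x ℕ.+ (n ℕ.+ p ℕ.+ q ℕ.+ 3) ℕ.+ (w ℕ.+ a)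
        l₂ = solve-∀
        l₃ : ∀ z d k n w a → z ℕ.+ z ℕ.+ suc (a ℕ.+ w) ℕ.+ (d ℕ.+ k ℕ.+ (n ℕ.+ 2)) ≡ d ℕ.+ (z ℕ.+ z ℕ.+ k) ℕ.+ (n ℕ.+ 3) ℕ.+ (w ℕ.+ a)
        l₃ = solve-∀
      ... | inj₁ v̅≤ = abs-+ _ _ ⟨≤⟩ ½^-sum W
          (zero⇒eval≤ P (liouville₁ root P (Z ℕ.+ Z) (ℕ.≤-trans (ℕ.≤-trans (ℕ.m≤m+n _ _) nrm≤) 2^Z≤) |P|≤ (slack₁ (err P) (err (norm P Q) ℕ.+ err Q ℕ.+ 3 ℕ.+ (W ℕ.+ Aℓ Z)) (l₁ D′ (err P) (err (norm P Q)) (err Q) (W ℕ.+ Aℓ Z)))) ⟨≤⟩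
            ιℕ*-tiny (err P) _ 0≤ωk ωk≤ (ℕ.≤-trans (le (D′ ℕ.+ (err (norm P Q) ℕ.+ err Q ℕ.+ 2) ℕ.+ Aℓ Z) (l₂ D′ (err P) (err (norm P Q)) (err Q) W (Aℓ Z))) X≥))
          (≡⇒≤ (abs-* _ _) ⟨≤⟩ *-mono-≤ (0≤abs _) (zero⇒eval≤ Q (liouville₁ root Q (Z ℕ.+ Z) (ℕ.≤-trans (ℕ.≤-trans nQ≤ nrm≤) 2^Z≤) |Q|≤ (slack₁ (err Q) (err (norm P Q) ℕ.+ err P ℕ.+ 3 ℕ.+ (W ℕ.+ Aℓ Z)) (l₃ D′ (err P) (err (norm P Q)) (err Q) (W ℕ.+ Aℓ Z)))) ⟨≤⟩
            ιℕ*-tiny (err Q) (suc (suc W)) 0≤ωk ωk≤ (ℕ.≤-trans (le (D′ ℕ.+ (err (norm P Q) ℕ.+ err P ℕ.+ 1) ℕ.+ Aℓ Z) (l₄ D′ (err P) (err (norm P Q)) (err Q) W (Aℓ Z))) X≥)) (0≤abs _) abs-b ⟨≤⟩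
            ≡⇒≤ (trans (solve 2 (λ h u → h :* u :* c2 := c2 :* h :* u) refl ½ (½^ (suc W))) (trans (cong (_* ½^ (suc W)) 2*½) (R.*-identityˡ _))))
        where
        D′ = D ℕ.+ (Z ℕ.+ Z ℕ.+ k)
        slack₁ : ∀ e s → D′ ℕ.+ e ℕ.+ s ≡ need W → D′ ℕ.+ e ℕ.≤ X
        slack₁ e s eq = ℕ.≤-trans (le s eq) X≥
        l₁ : ∀ d p n q w → d ℕ.+ p ℕ.+ (n ℕ.+ q ℕ.+ 3 ℕ.+ w) ≡ d ℕ.+ (n ℕ.+ p ℕ.+ q ℕ.+ 3) ℕ.+ w
        l₁ = solve-∀
        l₂ : ∀ d p n q w a → p ℕ.+ suc w ℕ.+ (d ℕ.+ (n ℕ.+ q ℕ.+ 2) ℕ.+ a) ≡ d ℕ.+ (n ℕ.+ p ℕ.+ q ℕ.+ 3) ℕ.+ (w ℕ.+ a)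
        l₂ = solve-∀
        l₃ : ∀ d p n q w → d ℕ.+ q ℕ.+ (n ℕ.+ p ℕ.+ 3 ℕ.+ w) ≡ d ℕ.+ (n ℕ.+ p ℕ.+ q ℕ.+ 3) ℕ.+ w
        l₃ = solve-∀
        l₄ : ∀ d p n q w a → q ℕ.+ suc (suc w) ℕ.+ (d ℕ.+ (n ℕ.+ p ℕ.+ 1) ℕ.+ a) ≡ d ℕ.+ (n ℕ.+ p ℕ.+ q ℕ.+ 3) ℕ.+ (w ℕ.+ a)
        l₄ = solve-∀
        D+3≤ : D ℕ.+ 3 ℕ.≤ Aℓ Z
        D+3≤ = ℕ.m≤n+m _ Z
        small : ∀ {x} j → j ℕ.≤ 3 → x ≤ ½^ (Aℓ Z) → x ≤ ½^ (D ℕ.+ j)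
        small j j≤ p = p ⟨≤⟩ ½^-anti (ℕ.≤-trans (ℕ.+-monoʳ-≤ D j≤) D+3≤)
        -- Q (2b - 1) is the difference of the element and its conjugate, and 2b - 1 ≥ 1.
        |Q|≤₂ : ∣ eval Q ∣ ≤ ½^ (D ℕ.+ 2)
        |Q|≤₂ = ≡⇒≤ (sym (R.*-identityʳ _)) ⟨≤⟩ *-monoʳ-≤ (0≤abs _) (by-diff ((2# * b - 3#) + 1#) (+-nonneg (≤⇒0≤- 3≤2b) 0≤1) (solve 1 (λ b → (c2 :* b :- c1) :- c1 := (c2 :* b :- c3) :+ c1) refl b) ⟨≤⟩ ≤abs _) ⟨≤⟩
          ≡⇒≤ (trans (sym (abs-* (eval Q) (2# * b - 1#))) (cong ∣_∣ (solve 3 (λ p q b → q :* (c2 :* b :- c1) := (p :+ q :* b) :- (p :+ q :* (c1 :- b))) refl (eval P) (eval Q) b))) ⟨≤⟩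
          abs-- _ _ ⟨≤⟩ ½^-sum (D ℕ.+ 2) (≤-resp refl (cong ½^_ (ℕ.+-suc D 2)) (small 3 ℕ.≤-refl v≤)) (≤-resp refl (cong ½^_ (ℕ.+-suc D 2)) (small 3 ℕ.≤-refl v̅≤))
        |Q|≤ : ∣ eval Q ∣ ≤ ½^ D
        |Q|≤ = |Q|≤₂ ⟨≤⟩ ½^-anti (ℕ.m≤m+n D 2)
        |P|≤ : ∣ eval P ∣ ≤ ½^ D
        |P|≤ = ≡⇒≤ (cong ∣_∣ (solve 3 (λ p q b → p := (p :+ q :* b) :- q :* b) refl (eval P) (eval Q) b)) ⟨≤⟩ abs-- _ _ ⟨≤⟩
          ½^-sum D (≤-resp refl (cong ½^_ (ℕ.+-comm D 1)) (small 1 (s≤s z≤n) v≤))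
            (≡⇒≤ (abs-* _ _) ⟨≤⟩ *-mono-≤ (0≤abs _) |Q|≤₂ (0≤abs _) abs-b ⟨≤⟩
             ≡⇒≤ (trans (cong (λ z → ½^ z * 2#) (ℕ.+-comm D 2)) (trans (solve 2 (λ h u → h :* u :* c2 := c2 :* h :* u) refl ½ (½^ (suc D))) (trans (cong (_* ½^ (suc D)) 2*½) (R.*-identityˡ _)))))

  infixl 6 _⊕₂_
  infixl 7 _⊗₂_
  infixr 9 _^₂_
  data E₂ : Set where
    con₂      : ℤ → E₂
    x₂ φ₂     : E₂
    _⊕₂_ _⊗₂_ : E₂ → E₂ → E₂

  _^₂_ : E₂ → ℕ → E₂
  e ^₂ zero  = con₂ (+ 1)
  e ^₂ suc n = e ⊗₂ e ^₂ n

  coord₁ coord₂ : E₂ → E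
  coord₁ (con₂ c) = con′ c
  coord₁ x₂       = X′
  coord₁ φ₂       = con′ (+ 0)
  coord₁ (e ⊕₂ f) = coord₁ e ⊕ coord₁ f
  coord₁ (e ⊗₂ f) = coord₁ e ⊗ coord₁ f ⊕ coord₂ e ⊗ coord₂ f
  coord₂ (con₂ c) = con′ (+ 0)
  coord₂ x₂       = con′ (+ 0)
  coord₂ φ₂       = con′ (+ 1)
  coord₂ (e ⊕₂ f) = coord₂ e ⊕ coord₂ f
  coord₂ (e ⊗₂ f) = coord₁ e ⊗ coord₂ f ⊕ coord₂ e ⊗ coord₁ f ⊕ coord₂ e ⊗ coord₂ f

  nrm₂ : E₂ → ℕ
  nrm₂ (con₂ c) = ℤ.∣ c ∣
  nrm₂ x₂       = 2
  nrm₂ φ₂       = 2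
  nrm₂ (e ⊕₂ f) = nrm₂ e ℕ.+ nrm₂ f
  nrm₂ (e ⊗₂ f) = nrm₂ e ℕ.* nrm₂ f

  -- The analogue of `err` for φ: it counts the multiples of `β` incurred whenever φ² is replaced
  -- with φ + 1.
  err₂ : E₂ → ℕ
  err₂ (con₂ c) = 0
  err₂ x₂       = 0
  err₂ φ₂       = 0
  err₂ (e ⊕₂ f) = err₂ e ℕ.+ err₂ f
  err₂ (e ⊗₂ f) = err₂ e ℕ.* nrm₂ f ℕ.+ nrm₂ e ℕ.* err₂ f ℕ.+ nrm₂ e ℕ.* nrm₂ f

  -- The weight 2 for φ makes this multiplicative estimate true: reducing φ² to φ + 1 turns the
  -- weight 4 into 1 + 2.
  nrm-coord : ∀ e → nrm (coord₁ e) ℕ.+ 2 ℕ.* nrm (coord₂ e) ℕ.≤ nrm₂ e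
  nrm-coord (con₂ c) = ℕ.≤-reflexive (ℕ.+-identityʳ _)
  nrm-coord x₂ = ℕ.≤-refl
  nrm-coord φ₂ = ℕ.≤-refl
  nrm-coord (e ⊕₂ f) = ℕ.≤-trans (ℕ.≤-reflexive (lemma (nrm (coord₁ e)) (nrm (coord₁ f)) (nrm (coord₂ e)) (nrm (coord₂ f)))) (ℕ.+-mono-≤ (nrm-coord e) (nrm-coord f))
    where
    lemma : ∀ p p′ q q′ → p ℕ.+ p′ ℕ.+ 2 ℕ.* (q ℕ.+ q′) ≡ p ℕ.+ 2 ℕ.* q ℕ.+ (p′ ℕ.+ 2 ℕ.* q′)
    lemma = solve-∀
  nrm-coord (e ⊗₂ f) = ℕ.≤-trans (le (nrm (coord₂ e) ℕ.* nrm (coord₂ f)) (lemma (nrm (coord₁ e)) (nrm (coord₁ f)) (nrm (coord₂ e)) (nrm (coord₂ f)))) (ℕ.*-mono-≤ (nrm-coord e) (nrm-coord f))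
    where
    lemma : ∀ p p′ q q′ → p ℕ.* p′ ℕ.+ q ℕ.* q′ ℕ.+ 2 ℕ.* (p ℕ.* q′ ℕ.+ q ℕ.* p′ ℕ.+ q ℕ.* q′) ℕ.+ q ℕ.* q′ ≡ (p ℕ.+ 2 ℕ.* q) ℕ.* (p′ ℕ.+ 2 ℕ.* q′)
    lemma = solve-∀

  -- Adds up the precision demanded by `negligible` and by the passage to coordinates. Its size is
  -- irrelevant, because the precision is fixed last.
  need₂ : E₂ → ℕ → ℕ → ℕ
  need₂ e Z W = (Dℓ (Z ℕ.+ Z) ℕ.+ (Z ℕ.+ Z ℕ.+ k)) ℕ.+ (err (norm (coord₁ e) (coord₂ e)) ℕ.+ err (coord₁ e) ℕ.+ err (coord₂ e) ℕ.+ 3) ℕ.+ (suc W ℕ.+ Aℓ Z) ℕ.+ err₂ e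

  module Evaluation₂ {X : ℕ} (root : Root X) (golden : Golden X) where
    open Quadratic root golden public

    eval₂ : E₂ → Carrier
    eval₂ (con₂ c) = ι c
    eval₂ x₂       = a
    eval₂ φ₂       = b
    eval₂ (e ⊕₂ f) = eval₂ e + eval₂ f
    eval₂ (e ⊗₂ f) = eval₂ e * eval₂ f

    eval₂-^ : ∀ e n → eval₂ (e ^₂ n) ≡ eval₂ e ^ n
    eval₂-^ e zero    = refl
    eval₂-^ e (suc n) = cong (_*_ (eval₂ e)) (eval₂-^ e n)

    eval₂≤ : ∀ e → ∣ eval₂ e ∣ ≤ ιℕ (nrm₂ e)
    eval₂≤ (con₂ c) = ≡⇒≤ (abs-ι c)
    eval₂≤ x₂       = ≡⇒≤ abs-a ⟨≤⟩ a≤2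
    eval₂≤ φ₂       = abs-b
    eval₂≤ (e ⊕₂ f) = abs-+ _ _ ⟨≤⟩ +-mono-≤ (eval₂≤ e) (eval₂≤ f) ⟨≤⟩ ≡⇒≤ (sym (ιℕ-+ (nrm₂ e) (nrm₂ f)))
    eval₂≤ (e ⊗₂ f) = ≡⇒≤ (abs-* _ _) ⟨≤⟩ *-mono-≤ (0≤abs _) (eval₂≤ e) (0≤abs _) (eval₂≤ f) ⟨≤⟩ ≡⇒≤ (sym (ιℕ-* (nrm₂ e) (nrm₂ f)))

    PE₂ : E₂ → Carrier
    PE₂ e = PE (coord₁ e) (coord₂ e)

    PE₂≤ : ∀ e → ∣ PE₂ e ∣ ≤ ιℕ (nrm₂ e)
    PE₂≤ e = abs-+ _ _ ⟨≤⟩ +-mono-≤ (eval≤ (coord₁ e)) (≡⇒≤ (trans (abs-* _ _) (R.*-comm _ _)) ⟨≤⟩ *-mono-≤ (0≤abs _) abs-b (0≤abs _) (eval≤ (coord₂ e)) ⟨≤⟩ ≡⇒≤ (sym (ιℕ-* 2 (nrm (coord₂ e))))) ⟨≤⟩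
      ≡⇒≤ (sym (ιℕ-+ (nrm (coord₁ e)) (2 ℕ.* nrm (coord₂ e)))) ⟨≤⟩ ιℕ-mono (nrm-coord e)

    private
      coord₂≤ : ∀ e → ∣ eval (coord₂ e) ∣ ≤ ιℕ (nrm₂ e)
      coord₂≤ e = eval≤ (coord₂ e) ⟨≤⟩ ιℕ-mono (ℕ.≤-trans (ℕ.≤-trans (ℕ.m≤m+n (nrm (coord₂ e)) (1 ℕ.* nrm (coord₂ e))) (ℕ.m≤n+m _ (nrm (coord₁ e)))) (nrm-coord e))

    eval₂-PE : ∀ e → ∣ eval₂ e - PE₂ e ∣ ≤ ∣ β ∣ * ιℕ (err₂ e)
    eval₂-PE (con₂ c) = ≡⇒≤ (trans (cong ∣_∣ (solve 2 (λ c b → c :- (c :+ c0 :* b) := c0) refl (ι c) b)) (trans (abs-nonneg ≤-refl) (sym (R.zeroʳ _))))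
    eval₂-PE x₂ = ≡⇒≤ (trans (cong ∣_∣ (solve 2 (λ c b → c :- (c :+ c0 :* b) := c0) refl a b)) (trans (abs-nonneg ≤-refl) (sym (R.zeroʳ _))))
    eval₂-PE φ₂ = ≡⇒≤ (trans (cong ∣_∣ (solve 1 (λ b → b :- (c0 :+ c1 :* b) := c0) refl b)) (trans (abs-nonneg ≤-refl) (sym (R.zeroʳ _))))
    eval₂-PE (e ⊕₂ f) = ≡⇒≤ (cong ∣_∣ (solve 7 (λ u v p q r s b → u :+ v :- (p :+ q :+ (r :+ s) :* b) := u :- (p :+ r :* b) :+ (v :- (q :+ s :* b))) refl
        (eval₂ e) (eval₂ f) (eval (coord₁ e)) (eval (coord₁ f)) (eval (coord₂ e)) (eval (coord₂ f)) b)) ⟨≤⟩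
      abs-+ _ _ ⟨≤⟩ +-mono-≤ (eval₂-PE e) (eval₂-PE f) ⟨≤⟩ ≡⇒≤ (trans (sym (R.distribˡ _ _ _)) (cong (_*_ ∣ β ∣) (sym (ιℕ-+ (err₂ e) (err₂ f)))))
    eval₂-PE (e ⊗₂ f) = ≡⇒≤ (cong ∣_∣ (solve 7 (λ u v p q r s b → u :* v :- (p :* q :+ r :* s :+ (p :* s :+ r :* q :+ r :* s) :* b) :=
          (u :- (p :+ r :* b)) :* v :+ (p :+ r :* b) :* (v :- (q :+ s :* b)) :+ (b :* b :- b :- c1) :* (r :* s)) refl
        (eval₂ e) (eval₂ f) (eval (coord₁ e)) (eval (coord₁ f)) (eval (coord₂ e)) (eval (coord₂ f)) b)) ⟨≤⟩
      abs-+ _ _ ⟨≤⟩ +-mono-≤ (abs-+ _ _ ⟨≤⟩ +-mono-≤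
          (≡⇒≤ (abs-* _ _) ⟨≤⟩ *-mono-≤ (0≤abs _) (eval₂-PE e) (0≤abs _) (eval₂≤ f))
          (≡⇒≤ (abs-* _ _) ⟨≤⟩ *-mono-≤ (0≤abs _) (PE₂≤ e) (0≤abs _) (eval₂-PE f)))
        (≡⇒≤ (abs-* _ _) ⟨≤⟩ *-monoʳ-≤ (0≤abs _) (≡⇒≤ (abs-* _ _) ⟨≤⟩ *-mono-≤ (0≤abs _) (coord₂≤ e) (0≤abs _) (coord₂≤ f))) ⟨≤⟩
      ≡⇒≤ (trans (solve 5 (λ β x n m y → β :* x :* n :+ m :* (β :* y) :+ β :* (m :* n) := β :* (x :* n :+ m :* y :+ m :* n)) refl
            ∣ β ∣ (ιℕ (err₂ e)) (ιℕ (nrm₂ f)) (ιℕ (nrm₂ e)) (ιℕ (err₂ f)))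
          (cong (_*_ ∣ β ∣) (sym (trans (ιℕ-+ (err₂ e ℕ.* nrm₂ f ℕ.+ nrm₂ e ℕ.* err₂ f) (nrm₂ e ℕ.* nrm₂ f)) (cong₂ _+_ (trans (ιℕ-+ (err₂ e ℕ.* nrm₂ f) (nrm₂ e ℕ.* err₂ f)) (cong₂ _+_ (ιℕ-* (err₂ e) (nrm₂ f)) (ιℕ-* (nrm₂ e) (err₂ f)))) (ιℕ-* (nrm₂ e) (nrm₂ f)))))))

    PE₂-close : ∀ e W → err₂ e ℕ.+ W ℕ.≤ X → ∣ eval₂ e - PE₂ e ∣ ≤ ½^ W
    PE₂-close e W X≥ = eval₂-PE e ⟨≤⟩ ιℕ*-tiny (err₂ e) W (0≤abs _) b²≤ X≥

    small⇒PE₂-small : ∀ e W → err₂ e ℕ.+ suc W ℕ.≤ X → ∣ eval₂ e ∣ ≤ ½^ (suc W) → ∣ PE₂ e ∣ ≤ ½^ W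
    small⇒PE₂-small e W X≥ p = ≡⇒≤ (cong ∣_∣ (solve 2 (λ x y → y := x :- (x :- y)) refl (eval₂ e) (PE₂ e))) ⟨≤⟩ abs-- _ _ ⟨≤⟩
      ½^-sum W p (PE₂-close e (suc W) X≥)

    small⇒negligible : ∀ e Z W → nrm₂ e ℕ.≤ 2 ℕ.^ Z → need₂ e Z W ℕ.≤ X → ∣ eval₂ e ∣ ≤ ½^ (suc (Aℓ Z)) → ∣ eval₂ e ∣ ≤ ½^ W
    small⇒negligible e Z W n≤ X≥ p = ≡⇒≤ (cong ∣_∣ (solve 2 (λ x y → x := (x :- y) :+ y) refl (eval₂ e) (PE₂ e))) ⟨≤⟩ abs-+ _ _ ⟨≤⟩
      ½^-sum W (PE₂-close e (suc W) (ℕ.≤-trans (le (u ℕ.+ (v ℕ.+ 3) ℕ.+ Aℓ Z) (l₁ u v W (Aℓ Z) (err₂ e))) X≥))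
        (negligible (coord₁ e) (coord₂ e) Z (ℕ.≤-trans (nrm-coord e) n≤) (suc W) (ℕ.≤-trans (ℕ.m≤m+n _ (err₂ e)) X≥)
          (small⇒PE₂-small e (Aℓ Z) (ℕ.≤-trans (le (u ℕ.+ (v ℕ.+ 3) ℕ.+ W) (l₂ u v W (Aℓ Z) (err₂ e))) X≥) p))
      where
      u = Dℓ (Z ℕ.+ Z) ℕ.+ (Z ℕ.+ Z ℕ.+ k)
      v = err (norm (coord₁ e) (coord₂ e)) ℕ.+ err (coord₁ e) ℕ.+ err (coord₂ e)
      l₁ : ∀ u v w a e → e ℕ.+ suc w ℕ.+ (u ℕ.+ (v ℕ.+ 3) ℕ.+ a) ≡ u ℕ.+ (v ℕ.+ 3) ℕ.+ (suc w ℕ.+ a) ℕ.+ e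
      l₁ = solve-∀
      l₂ : ∀ u v w a e → e ℕ.+ suc a ℕ.+ (u ℕ.+ (v ℕ.+ 3) ℕ.+ w) ≡ u ℕ.+ (v ℕ.+ 3) ℕ.+ (suc w ℕ.+ a) ℕ.+ e
      l₂ = solve-∀

-- Multiplicative independence of α and φ.

module MultiplicativeIndependence (𝔽 : OrderedField) (𝓖 : KBonacci) where
  open KBonacci 𝓖
  open FieldTheory 𝔽
  open Pisot 𝔽 k 3≤k
  open Approximation 𝔽 k 3≤k
  open Liouville 𝔽 𝓖
  open GoldenExtension 𝔽 𝓖

  2^[_]*2^[_] : ∀ m n → 2^ m * 2^ n ≡ 2^ (m ℕ.+ n)
  2^[ m ]*2^[ n ] = sym (^-+ 2# m n)

  ≤2^-ιℕ : ∀ {m} n → m ℕ.≤ 2 ℕ.^ n → ιℕ m ≤ 2^ n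
  ≤2^-ιℕ n p = ιℕ-mono p ⟨≤⟩ ≡⇒≤ (ιℕ-2^ n)

  2^+2^ : ∀ n → 2^ n + 2^ n ≡ 2^ (suc n)
  2^+2^ n = solve 1 (λ u → u :+ u := c2 :* u) refl (2^ n)

  G : ℕ → Carrier
  G i = ι (g i)

  |G|≤ : ∀ i → ∣ G i ∣ ≤ 2^ i
  |G|≤ i = ≡⇒≤ (abs-ι (g i)) ⟨≤⟩ ≤2^-ιℕ i (g-bound i)

  -- Fibonacci pairs: φᵐ = u m + v m φ.
  u v : ℕ → ℕ
  u zero    = 1
  u (suc m) = v m
  v zero    = 0
  v (suc m) = u m ℕ.+ v m

  u+v≤ : ∀ m → u m ℕ.+ v m ℕ.≤ 2 ℕ.^ m
  u+v≤ zero    = ℕ.≤-refl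
  u+v≤ (suc m) = ℕ.≤-trans (le (u m) (lemma (u m) (v m))) (ℕ.*-monoʳ-≤ 2 (u+v≤ m))
    where
    lemma : ∀ x y → y ℕ.+ (x ℕ.+ y) ℕ.+ x ≡ 2 ℕ.* (x ℕ.+ y)
    lemma = solve-∀

  v≤ : ∀ m → v m ℕ.≤ 2 ℕ.^ m
  v≤ m = ℕ.≤-trans (ℕ.m≤n+m (v m) (u m)) (u+v≤ m)

  module Gap {X : ℕ} (root : Root X) where
    open Evaluation root public

    private
      e : ℕ → Carrier
      e i = G (suc i) - a * G i

      drop-e : ∀ N i → drop N e i ≡ G (suc N ℕ.+ i) - a * G (N ℕ.+ i)
      drop-e N i = drop-≡ N e i

      e-rec : RecF e
      e-rec N = begin
        drop N e k                                            ≡⟨ drop-e N k ⟩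
        G (suc N ℕ.+ k) - a * G (N ℕ.+ k)                     ≡⟨ cong₂ (λ x y → x - a * y) (rec (suc N)) (rec N) ⟩
        Sum k (λ i → G (suc N ℕ.+ i)) - a * Sum k (λ i → G (N ℕ.+ i)) ≡⟨ cong (λ z → Sum k (λ i → G (suc N ℕ.+ i)) - z) (Sum-*ˡ k a _) ⟨
        Sum k (λ i → G (suc N ℕ.+ i)) - Sum k (λ i → a * G (N ℕ.+ i)) ≡⟨ Sum-- k (λ i → G (suc N ℕ.+ i)) (λ i → a * G (N ℕ.+ i)) ⟨
        Sum k (λ i → G (suc N ℕ.+ i) - a * G (N ℕ.+ i))       ≡⟨ Sum-cong k (λ i _ → drop-e N i) ⟨
        Sum k (drop N e)                                      ∎
        where
        open ≡-Reasoning
        rec : ∀ N → G (N ℕ.+ k) ≡ Sum k (λ i → G (N ℕ.+ i))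
        rec N = trans (sym (drop-≡ N G k)) (trans (ι-Rec g g-rec N) (Sum-cong k (λ i _ → drop-≡ N G i)))

      Y-e : Y k e ≡ 0#
      Y-e = begin
        Y k e                                                ≡⟨ Y-cong k (λ i → cong (_+_ (G (suc i))) (solve 2 (λ a x → :- (a :* x) := (:- a) :* x) refl a (G i))) ⟩
        Y k (λ i → G (suc i) + (- a) * G i)                  ≡⟨ Y-+ k (λ i → G (suc i)) (λ i → (- a) * G i) ⟩
        Y k (λ i → G (suc i)) + Y k (λ i → (- a) * G i)      ≡⟨ cong₂ _+_ (Y-step G (ι-Rec g g-rec 0)) (Y-* k (- a) G) ⟩
        a * Y k G - ωₖ * G 0 + (- a) * Y k G                 ≡⟨ cong (λ z → a * Y k G - ωₖ * ι z + (- a) * Y k G) (g-zero 0 (ℕ.≤-trans (s≤s (s≤s z≤n)) 3≤k)) ⟩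
        a * Y k G - ωₖ * 0# + (- a) * Y k G                  ≡⟨ solve 3 (λ a y w → a :* y :- w :* c0 :+ (:- a) :* y := c0) refl a (Y k G) ωₖ ⟩
        0#                                                   ∎
        where open ≡-Reasoning

    -- The sequence `e` solves the recurrence and its component `Y k e` is exactly 0, so only the
    -- contracting part and the defect of the root remain, and `Decay.stay` bounds it.
    gap : ∀ T → T ℕ.+ (k ℕ.+ 3) ℕ.≤ X → ∀ N → N ℕ.≤ T → ∣ G (suc N) - a * G N ∣ ≤ 2^ (k ℕ.+ 3)
    gap T X≥ N N≤T = Decay.stay e e-rec T (0≤2^ (k ℕ.+ 2)) 0≤1 init small (suc T) ℕ.≤-refl N (ℕ.≤-trans (s≤s N≤T) (ℕ.m≤m+n _ k)) ⟨≤⟩ B≤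
      where
      init : ∀ i → i ℕ.< k → ∣ e i ∣ ≤ 2^ (k ℕ.+ 2)
      init i i<k = abs-- _ _ ⟨≤⟩ +-mono-≤ (|G|≤ (suc i)) (≡⇒≤ (abs-* _ _) ⟨≤⟩ *-mono-≤ (0≤abs _) (≡⇒≤ abs-a ⟨≤⟩ a≤2) (0≤abs _) (|G|≤ i)) ⟨≤⟩
        ≡⇒≤ (2^+2^ (suc i)) ⟨≤⟩ 2^-mono (ℕ.≤-trans (s≤s i<k) (ℕ.≤-trans (ℕ.n≤1+n (suc k)) (ℕ.≤-reflexive (ℕ.+-comm 2 k))))
      B≤ : 2^ (k ℕ.+ 2) + 2^ k * 1# ≤ 2^ (k ℕ.+ 3)
      B≤ = +-monoʳ-≤ _ (≡⇒≤ (R.*-identityʳ _) ⟨≤⟩ 2^-mono (ℕ.m≤m+n k 2)) ⟨≤⟩ ≡⇒≤ (trans (2^+2^ (k ℕ.+ 2)) (cong 2^_ (sym (ℕ.+-suc k 2))))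
      small : 2^ T * (∣ Y k e ∣ + ωₖ * (2^ (k ℕ.+ 2) + 2^ k * 1#)) ≤ 1#
      small = *-monoʳ-≤ (0≤2^ T) (≡⇒≤ (trans (cong (_+ ωₖ * (2^ (k ℕ.+ 2) + 2^ k * 1#)) (trans (cong ∣_∣ Y-e) (abs-nonneg ≤-refl))) (R.+-identityˡ _)) ⟨≤⟩
          *-mono-≤ 0≤ωk ωk≤ (+-nonneg (0≤2^ (k ℕ.+ 2)) (*-nonneg (0≤2^ k) 0≤1)) B≤) ⟨≤⟩
        ≡⇒≤ (trans (solve 3 (λ x y z → x :* (y :* z) := x :* z :* y) refl (2^ T) (½^ X) (2^ (k ℕ.+ 3))) (cong (_* ½^ X) (2^[ T ]*2^[ k ℕ.+ 3 ]))) ⟨≤⟩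
        2^*½^≤ (T ℕ.+ (k ℕ.+ 3)) 0 (ℕ.≤-trans (ℕ.≤-reflexive (ℕ.+-identityʳ _)) X≥)

  module Fibonacci {X : ℕ} (golden : Golden X) where
    open Golden golden
    private
      β = b * b - b - 1#
      1≤b : 1# ≤ b
      1≤b = *-cancelˡ-≤ 2# (1≤⇒≰0 1≤2) (by-diff ((2# * b - 3#) + 1#) (+-nonneg (≤⇒0≤- 3≤2b) 0≤1)
        (solve 1 (λ b → c2 :* b :- c2 :* c1 := (c2 :* b :- c3) :+ c1) refl b))
      abs-b : ∣ b ∣ ≤ 2#
      abs-b = ≡⇒≤ (abs-nonneg (0≤1 ⟨≤⟩ 1≤b)) ⟨≤⟩ b≤2
      |1-b|≤1 : ∣ 1# - b ∣ ≤ 1#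
      |1-b|≤1 = abs-≤ (by-diff b (0≤1 ⟨≤⟩ 1≤b) (solve 1 (λ b → c1 :- (c1 :- b) := b) refl b))
        (by-diff (2# - b) (≤⇒0≤- b≤2) (solve 1 (λ b → c1 :- :- (c1 :- b) := c2 :- b) refl b))
      |βv|≤ : ∀ m → ∣ β * ιℕ (v m) ∣ ≤ ∣ β ∣ * 2^ m
      |βv|≤ m = ≡⇒≤ (abs-* _ _) ⟨≤⟩ *-monoʳ-≤ (0≤abs β) (≡⇒≤ (abs-nonneg (0≤ιℕ (v m))) ⟨≤⟩ ≤2^-ιℕ m (v≤ m))

    b^-uv : ∀ m → ∣ b ^ m - (ιℕ (v m) * b + ιℕ (u m)) ∣ ≤ ∣ β ∣ * 2^ (2 ℕ.* m)
    b^-uv zero = ≡⇒≤ (trans (cong ∣_∣ (solve 1 (λ b → c1 :- (c0 :* b :+ c1) := c0) refl b)) (abs-nonneg ≤-refl)) ⟨≤⟩ *-nonneg (0≤abs β) (0≤2^ 0)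
    b^-uv (suc m) = ≡⇒≤ (cong ∣_∣ (trans (cong (λ z → b * b ^ m - (z * b + V)) (ιℕ-+ (u m) (v m)))
        (solve 4 (λ b p u v → b :* p :- ((u :+ v) :* b :+ v) := b :* (p :- (v :* b :+ u)) :+ (b :* b :- b :- c1) :* v) refl b (b ^ m) U V))) ⟨≤⟩
      abs-+ _ _ ⟨≤⟩ +-mono-≤ (≡⇒≤ (abs-* _ _) ⟨≤⟩ *-mono-≤ (0≤abs _) abs-b (0≤abs _) (b^-uv m))
        (|βv|≤ m ⟨≤⟩ *-monoʳ-≤ (0≤abs β) (2^-mono {m} {suc (2 ℕ.* m)} (ℕ.≤-trans (ℕ.m≤m+n m _) (ℕ.n≤1+n _)))) ⟨≤⟩
      ≡⇒≤ (trans (solve 2 (λ β p → c2 :* (β :* p) :+ β :* (c2 :* p) := β :* (c2 :* (c2 :* p))) refl ∣ β ∣ (2^ (2 ℕ.* m)))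
        (cong (λ z → ∣ β ∣ * 2^ z) (sym (ℕ.*-suc 2 m))))
      where U = ιℕ (u m) ; V = ιℕ (v m)

    -- The difference is (1 - φ)^m up to the defect of `b`, and |1 - b| ≤ 1.
    v-ratio : ∀ m → ∣ ιℕ (v (suc m)) - b * ιℕ (v m) ∣ ≤ 1# + ∣ β ∣ * 2^ m
    v-ratio zero = ≡⇒≤ (trans (cong ∣_∣ (solve 1 (λ b → c1 :- b :* c0 := c1) refl b)) (abs-nonneg 0≤1)) ⟨≤⟩
      by-diff (∣ β ∣ * 2^ 0) (*-nonneg (0≤abs β) (0≤2^ 0)) (solve 1 (λ x → (c1 :+ x) :- c1 := x) refl _)
    v-ratio (suc m) = ≡⇒≤ (cong ∣_∣ (trans (cong (_- b * ιℕ (v (suc m))) (trans (cong ιℕ (ℕ.+-comm (v m) (v (suc m)))) (ιℕ-+ (v (suc m)) (v m))))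
        (solve 3 (λ b y x → y :+ x :- b :* y := (c1 :- b) :* (y :- b :* x) :- (b :* b :- b :- c1) :* x) refl b (ιℕ (v (suc m))) (ιℕ (v m))))) ⟨≤⟩
      abs-- _ _ ⟨≤⟩ +-mono-≤ (≡⇒≤ (abs-* _ _) ⟨≤⟩ *-mono-≤ (0≤abs _) |1-b|≤1 (0≤abs _) (v-ratio m)) (|βv|≤ m) ⟨≤⟩
      ≡⇒≤ (solve 2 (λ β p → c1 :* (c1 :+ β :* p) :+ β :* p := c1 :+ β :* (c2 :* p)) refl ∣ β ∣ (2^ m))

    -- Binet's formula, with `2# * b - 1#` in the role of √5.
    √5v : ∀ m → 2 ℕ.* m ℕ.≤ X → ∣ (2# * b - 1#) * ιℕ (v m) - b ^ m ∣ ≤ 2^ 2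
    √5v m X≥ = ≡⇒≤ (cong ∣_∣ (trans (solve 4 (λ b p u v → (c2 :* b :- c1) :* v :- p := :- ((u :+ v) :- b :* v) :- (p :- (v :* b :+ u))) refl b (b ^ m) (ιℕ (u m)) (ιℕ (v m)))
        (cong (λ z → - (z - b * ιℕ (v m)) - (b ^ m - (ιℕ (v m) * b + ιℕ (u m)))) (sym (ιℕ-+ (u m) (v m)))))) ⟨≤⟩
      abs-- _ _ ⟨≤⟩ +-mono-≤ (≡⇒≤ (abs-neg _) ⟨≤⟩ v-ratio m ⟨≤⟩ +-monoʳ-≤ 1# (*-monoʳ-≤ (0≤abs β) (2^-mono (ℕ.m≤m+n m _)) ⟨≤⟩ β≤)) (b^-uv m ⟨≤⟩ β≤) ⟨≤⟩
      by-diff 1# 0≤1 (solve 0 (c2 :* (c2 :* c1) :- ((c1 :+ c1) :+ c1) := c1) refl)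
      where
      β≤ : ∣ β ∣ * 2^ (2 ℕ.* m) ≤ 1#
      β≤ = *-monoˡ-≤ (0≤2^ (2 ℕ.* m)) b²≤ ⟨≤⟩ ≡⇒≤ (R.*-comm _ _) ⟨≤⟩ 2^*½^≤ (2 ℕ.* m) 0 (ℕ.≤-trans (ℕ.≤-reflexive (ℕ.+-identityʳ _)) X≥)

  -- If αⁿ = φᵐ, then αⁿ is quadratic over ℤ, so i ↦ g (i n) and i ↦ g (i n + 1) satisfy the same
  -- two-term recurrence; both vanish at i = 0, hence they are proportional and α is rational.
  module Independence (n m : ℕ) where
    Xpow : ℕ → E
    Xpow zero    = con′ (+ 1)
    Xpow (suc n) = X′ ⊗ Xpow n

    P Q : E
    P = Xpow n ⊕ con′ (ℤ.- + u m)
    Q = con′ (ℤ.- + v m)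

    Z : ℕ
    Z = nrm P ℕ.+ 2 ℕ.* nrm Q

    -- The exponent of an explicit lower bound for |αⁿ - φᵐ|. Mere inequality would not suffice,
    -- since this number later bounds p.
    Amax : ℕ
    Amax = suc (Aℓ Z)

    private
      -- The trace of φᵐ and the negative of its norm.
      S T : ℤ
      S = + 2 ℤ.* + u m ℤ.+ + v m
      T = + v m ℤ.* + v m ℤ.- + u m ℤ.* + u m ℤ.- + u m ℤ.* + v m

      act-Xpow : ∀ n t i → act (Xpow n) t i ≡ t (n ℕ.+ i)
      act-Xpow zero t i    = ℤ.*-identityˡ _
      act-Xpow (suc n) t i = trans (act-Xpow n t (suc i)) (cong t (ℕ.+-suc n i))

      act-P : ∀ t i → act P t i ≡ t (n ℕ.+ i) ℤ.+ (ℤ.- + u m) ℤ.* t i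
      act-P t i = cong (λ z → z ℤ.+ (ℤ.- + u m) ℤ.* t i) (act-Xpow n t i)

      linear : (∀ i → act (norm P Q) g i ≡ + 0) → ∀ i → g (n ℕ.+ (n ℕ.+ i)) ≡ S ℤ.* g (n ℕ.+ i) ℤ.+ T ℤ.* g i
      linear z i = trans (solveℤ 5 (λ y₂ y₁ y₀ p q → y₂ Z.:= p Z.:* y₁ Z.:+ q Z.:* y₀ Z.:+ (y₂ Z.:- p Z.:* y₁ Z.:- q Z.:* y₀)) refl
          (g (n ℕ.+ (n ℕ.+ i))) (g (n ℕ.+ i)) (g i) S T)
        (trans (cong (λ z → S ℤ.* g (n ℕ.+ i) ℤ.+ T ℤ.* g i ℤ.+ z) (trans eq (z i))) (ℤ.+-identityʳ _))
        where
        module Z = +-*-Solver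
        open +-*-Solver using () renaming (solve to solveℤ)
        eq : g (n ℕ.+ (n ℕ.+ i)) ℤ.- S ℤ.* g (n ℕ.+ i) ℤ.- T ℤ.* g i ≡ act (norm P Q) g i
        eq = sym (trans (cong₂ (λ x y → x ℤ.+ y ℤ.+ -[1+ 0 ] ℤ.* ((ℤ.- + v m) ℤ.* ((ℤ.- + v m) ℤ.* g i)))
               (trans (act-P (act P g) i) (cong₂ (λ x y → x ℤ.+ (ℤ.- + u m) ℤ.* y) (act-P g (n ℕ.+ i)) (act-P g i)))
               (act-P (act Q g) i))
             (solveℤ 5 (λ y₂ y₁ y₀ p q → (y₂ Z.:+ (Z.:- p) Z.:* y₁ Z.:+ (Z.:- p) Z.:* (y₁ Z.:+ (Z.:- p) Z.:* y₀)) Z.:+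
                  ((Z.:- q) Z.:* y₁ Z.:+ (Z.:- p) Z.:* ((Z.:- q) Z.:* y₀)) Z.:+ Z.con -[1+ 0 ] Z.:* ((Z.:- q) Z.:* ((Z.:- q) Z.:* y₀))
                  Z.:= y₂ Z.:- (Z.con (+ 2) Z.:* p Z.:+ q) Z.:* y₁ Z.:- (q Z.:* q Z.:- p Z.:* p Z.:- p Z.:* q) Z.:* y₀) refl
                (g (n ℕ.+ (n ℕ.+ i))) (g (n ℕ.+ i)) (g i) (+ u m) (+ v m)))

      two-term : ∀ (c : ℕ → ℤ) → (∀ i → c (suc (suc i)) ≡ S ℤ.* c (suc i) ℤ.+ T ℤ.* c i) → c 0 ≡ + 0 → c 1 ≡ + 0 →
                 ∀ i → (c i ≡ + 0) × (c (suc i) ≡ + 0)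
      two-term c rec z₀ z₁ zero = z₀ , z₁
      two-term c rec z₀ z₁ (suc i) with two-term c rec z₀ z₁ i
      ... | p , q = q , trans (rec i) (trans (cong₂ (λ x y → S ℤ.* x ℤ.+ T ℤ.* y) q p) (cong₂ ℤ._+_ (ℤ.*-zeroʳ S) (ℤ.*-zeroʳ T)))

      U V : ℤ
      U = g n
      V = g (n ℕ.+ 1)

      -- The linear form that vanishes at α once `cross` suggests α = V / U.
      line : E
      line = con′ U ⊗ X′ ⊕ con′ (ℤ.- V)

      -- At N the term of `g` is at least 2^W, so the bounded quantity from `gap` forces `line`
      -- below the Liouville threshold `Dℓ (n + 2)`. N is a multiple of n so that `cross` applies.
      W N : ℕ
      W = suc n ℕ.+ (k ℕ.+ 3) ℕ.+ Dℓ (n ℕ.+ 2)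
      N = (2 ℕ.^ W ℕ.+ k) ℕ.* n

      g0 : g 0 ≡ + 0
      g0 = g-zero 0 (ℕ.≤-trans (s≤s (s≤s z≤n)) 3≤k)
      -- Here k ≥ 3 is decisive: for k = 2 this term is 1, the root is φ itself, and independence
      -- fails.
      g1 : g 1 ≡ + 0
      g1 = g-zero 1 3≤k

      module _ (lin : ∀ i → g (n ℕ.+ (n ℕ.+ i)) ≡ S ℤ.* g (n ℕ.+ i) ℤ.+ T ℤ.* g i) where
        solveℤ = +-*-Solver.solve
        module Z = +-*-Solver

        cross : ∀ i → U ℤ.* g (i ℕ.* n ℕ.+ 1) ≡ V ℤ.* g (i ℕ.* n)
        cross i = ℤ.i-j≡0⇒i≡j _ _ (proj₁ (two-term c rec c₀ c₁ i))
          where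
          c : ℕ → ℤ
          c i = U ℤ.* g (i ℕ.* n ℕ.+ 1) ℤ.- V ℤ.* g (i ℕ.* n)
          c₀ : c 0 ≡ + 0
          c₀ = trans (cong₂ (λ x y → U ℤ.* x ℤ.- V ℤ.* y) g1 g0) (solveℤ 2 (λ x y → x Z.:* Z.con (+ 0) Z.:- y Z.:* Z.con (+ 0) Z.:= Z.con (+ 0)) refl U V)
          c₁ : c 1 ≡ + 0
          c₁ = trans (cong (λ z → U ℤ.* g (z ℕ.+ 1) ℤ.- V ℤ.* g z) (ℕ.+-identityʳ n)) (solveℤ 2 (λ x y → x Z.:* y Z.:- y Z.:* x Z.:= Z.con (+ 0)) refl U V)
          rec : ∀ i → c (suc (suc i)) ≡ S ℤ.* c (suc i) ℤ.+ T ℤ.* c i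
          rec i = trans (cong₂ (λ x y → U ℤ.* x ℤ.- V ℤ.* y)
              (trans (cong g (trans (ℕ.+-assoc n _ 1) (cong (n ℕ.+_) (ℕ.+-assoc n _ 1)))) (trans (lin (i ℕ.* n ℕ.+ 1)) (cong (λ z → S ℤ.* g z ℤ.+ T ℤ.* g (i ℕ.* n ℕ.+ 1)) (sym (ℕ.+-assoc n _ 1)))))
              (lin (i ℕ.* n)))
            (solveℤ 8 (λ U V S T x y z w → U Z.:* (S Z.:* x Z.:+ T Z.:* y) Z.:- V Z.:* (S Z.:* z Z.:+ T Z.:* w) Z.:= S Z.:* (U Z.:* x Z.:- V Z.:* z) Z.:+ T Z.:* (U Z.:* y Z.:- V Z.:* w)) refl
              U V S T (g (n ℕ.+ i ℕ.* n ℕ.+ 1)) (g (i ℕ.* n ℕ.+ 1)) (g (n ℕ.+ i ℕ.* n)) (g (i ℕ.* n)))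

        all-zero : U ≡ + 0 → ∀ i → g (i ℕ.* n) ≡ + 0
        all-zero z i = proj₁ (two-term (λ i → g (i ℕ.* n)) (λ i → lin (i ℕ.* n)) g0 (trans (cong g (ℕ.+-identityʳ n)) z) i)

      1≤2^ℕ : ∀ m → 1 ℕ.≤ 2 ℕ.^ m
      1≤2^ℕ m = ℕ.m^n>0 2 m

    Xmin : ℕ
    Xmin = (Dℓ (Z ℕ.+ Z) ℕ.+ (Z ℕ.+ Z ℕ.+ k) ℕ.+ (err (norm P Q) ℕ.+ 1)) ℕ.+ (2 ℕ.* m ℕ.+ suc (Aℓ Z))
           ℕ.+ (N ℕ.+ (k ℕ.+ 3)) ℕ.+ (Dℓ (n ℕ.+ 2) ℕ.+ (n ℕ.+ 2 ℕ.+ k) ℕ.+ err line)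

    module _ {X : ℕ} (root : Root X) (golden : Golden X) (1≤n : 1 ℕ.≤ n) (X≥ : Xmin ℕ.≤ X) where
      open Gap root
      open Quadratic root golden using (b; b²≤; β; PE; norm-zero)
      open Fibonacci golden

      private
        eval-Xpow : ∀ n → eval (Xpow n) ≡ a ^ n
        eval-Xpow zero    = refl
        eval-Xpow (suc n) = cong (_*_ a) (eval-Xpow n)

        x₁ = Dℓ (Z ℕ.+ Z) ℕ.+ (Z ℕ.+ Z ℕ.+ k) ℕ.+ (err (norm P Q) ℕ.+ 1)
        x₂′ = 2 ℕ.* m ℕ.+ suc (Aℓ Z)
        x₃ = N ℕ.+ (k ℕ.+ 3)
        x₄ = Dℓ (n ℕ.+ 2) ℕ.+ (n ℕ.+ 2 ℕ.+ k) ℕ.+ err line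
        X≥₁ : x₁ ℕ.≤ X
        X≥₁ = ℕ.≤-trans (le (x₂′ ℕ.+ x₃ ℕ.+ x₄) (lemma x₁ x₂′ x₃ x₄)) X≥
          where
          lemma : ∀ a b c d → a ℕ.+ (b ℕ.+ c ℕ.+ d) ≡ a ℕ.+ b ℕ.+ c ℕ.+ d
          lemma = solve-∀
        X≥₂ : x₂′ ℕ.≤ X
        X≥₂ = ℕ.≤-trans (le (x₁ ℕ.+ x₃ ℕ.+ x₄) (lemma x₁ x₂′ x₃ x₄)) X≥
          where
          lemma : ∀ a b c d → b ℕ.+ (a ℕ.+ c ℕ.+ d) ≡ a ℕ.+ b ℕ.+ c ℕ.+ d
          lemma = solve-∀
        X≥₃ : x₃ ℕ.≤ X
        X≥₃ = ℕ.≤-trans (le (x₁ ℕ.+ x₂′ ℕ.+ x₄) (lemma x₁ x₂′ x₃ x₄)) X≥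
          where
          lemma : ∀ a b c d → c ℕ.+ (a ℕ.+ b ℕ.+ d) ≡ a ℕ.+ b ℕ.+ c ℕ.+ d
          lemma = solve-∀
        X≥₄ : x₄ ℕ.≤ X
        X≥₄ = ℕ.≤-trans (ℕ.m≤n+m x₄ (x₁ ℕ.+ x₂′ ℕ.+ x₃)) X≥

        PE≡ : PE P Q ≡ (a ^ n - b ^ m) + (b ^ m - (ιℕ (v m) * b + ιℕ (u m)))
        PE≡ = trans (cong₂ _+_ (cong₂ _+_ (eval-Xpow n) (ι-neg (+ u m))) (cong (_* b) (ι-neg (+ v m))))
          (solve 5 (λ x y b u v → x :+ :- u :+ (:- v) :* b := (x :- y) :+ (y :- (v :* b :+ u))) refl (a ^ n) (b ^ m) b (ιℕ (u m)) (ιℕ (v m)))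

        N≥ : 2 ℕ.^ W ℕ.+ k ℕ.≤ N
        N≥ = ℕ.≤-trans (ℕ.≤-reflexive (sym (ℕ.*-identityʳ _))) (ℕ.*-monoʳ-≤ (2 ℕ.^ W ℕ.+ k) 1≤n)

        gN≥ : 2 ℕ.^ W ℕ.≤ ℤ.∣ g N ∣
        gN≥ = ℕ.≤-trans (ℕ.≤-trans (ℕ.m+n≤o⇒m≤o∸n (2 ℕ.^ W) N≥) (g-grows (N ℕ.∸ k))) (ℕ.≤-reflexive (cong (λ z → ℤ.∣ g z ∣) (ℕ.m∸n+n≡m (ℕ.≤-trans (ℕ.m≤n+m k _) N≥))))

        |U|≤ : ∣ ι U ∣ ≤ 2^ n
        |U|≤ = |G|≤ n

        line-small : (∀ i → U ℤ.* g (i ℕ.* n ℕ.+ 1) ≡ V ℤ.* g (i ℕ.* n)) → ∣ eval line ∣ ≤ ½^ (Dℓ (n ℕ.+ 2))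
        line-small cross = *-cancelˡ-≤ (2^ W) (2^≰0 W)
          (≡⇒≤ (R.*-comm _ _) ⟨≤⟩ *-monoʳ-≤ (0≤abs _) (≡⇒≤ (sym (ιℕ-2^ W)) ⟨≤⟩ ιℕ-mono gN≥ ⟨≤⟩ ≡⇒≤ (sym (abs-ι (g N)))) ⟨≤⟩
           ≡⇒≤ (trans (sym (abs-* _ _)) (trans (cong ∣_∣ eq) (abs-* _ _))) ⟨≤⟩
           *-mono-≤ (0≤abs _) |U|≤ (0≤abs _) (≡⇒≤ (abs-sym _ _) ⟨≤⟩ gap N X≥₃ N ℕ.≤-refl) ⟨≤⟩
           ≡⇒≤ (2^[ n ]*2^[ k ℕ.+ 3 ]) ⟨≤⟩ 2^-mono {n ℕ.+ (k ℕ.+ 3)} {suc n ℕ.+ (k ℕ.+ 3)} (ℕ.n≤1+n _) ⟨≤⟩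
           ≡⇒≤ (trans (sym (R.*-identityʳ _)) (trans (cong (_*_ (2^ (suc n ℕ.+ (k ℕ.+ 3)))) (sym (2^*½^ D′))) (trans (sym (R.*-assoc _ _ _)) (cong (_* ½^ D′) (2^[ suc n ℕ.+ (k ℕ.+ 3) ]*2^[ D′ ]))))))
          where
          D′ = Dℓ (n ℕ.+ 2)
          eq : eval line * G N ≡ ι U * (a * G N - G (suc N))
          eq = trans (cong (λ z → (ι U * a + z) * G N) (ι-neg V))
            (trans (solve 4 (λ u a v x → (u :* a :+ :- v) :* x := u :* (a :* x) :- v :* x) refl (ι U) a (ι V) (G N))
              (trans (cong (λ z → ι U * (a * G N) - z) (trans (sym (ι-* V (g N))) (trans (cong ι (sym (cross (2 ℕ.^ W ℕ.+ k)))) (trans (ι-* U (g (N ℕ.+ 1))) (cong (λ z → ι U * G z) (ℕ.+-comm N 1))))))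
                (solve 3 (λ u x y → u :* x :- u :* y := u :* (x :- y)) refl (ι U) (a * G N) (G (suc N)))))

        nrm-line : nrm line ℕ.≤ 2 ℕ.^ (n ℕ.+ 2)
        nrm-line = ℕ.≤-trans (ℕ.+-mono-≤ (ℕ.*-monoˡ-≤ 2 (g-bound n)) (ℕ.≤-trans (ℕ.≤-reflexive (ℤ.∣-i∣≡∣i∣ V)) (g-bound (n ℕ.+ 1))))
          (ℕ.≤-reflexive (trans (cong (2 ℕ.^ n ℕ.* 2 ℕ.+_) (ℕ.^-distribˡ-+-* 2 n 1)) (trans (lemma (2 ℕ.^ n)) (sym (ℕ.^-distribˡ-+-* 2 n 2)))))
          where
          lemma : ∀ p → p ℕ.* 2 ℕ.+ p ℕ.* 2 ≡ p ℕ.* 4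
          lemma = solve-∀

        -- Read the relation at index k - 2, where `g` passes from 0 to 1: only U is left.
        U≡0 : (∀ i → act line g i ≡ + 0) → U ≡ + 0
        U≡0 z = go k 3≤k refl
          where
          go : ∀ k′ → 3 ℕ.≤ k′ → k′ ≡ k → U ≡ + 0
          go (suc (suc i)) _ eq = trans (sym (ℤ.*-identityʳ U)) (trans (sym (trans (cong (λ z → U ℤ.* + 1 ℤ.+ z) (ℤ.*-zeroʳ (ℤ.- V))) (ℤ.+-identityʳ _)))
            (trans (cong₂ (λ x y → U ℤ.* x ℤ.+ (ℤ.- V) ℤ.* y) (sym (g-one (suc i) eq)) (sym (g-zero i (subst (suc i ℕ.<_) eq ℕ.≤-refl)))) (z i)))
          go (suc zero) (s≤s ()) _

      independent : ¬ (∣ a ^ n - b ^ m ∣ ≤ ½^ Amax)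
      independent small = absurd gN≥ (cong ℤ.∣_∣ (all-zero lin (U≡0 (liouville₁ root line (n ℕ.+ 2) nrm-line (line-small (cross lin)) X≥₄)) (2 ℕ.^ W ℕ.+ k)))
        where
        v-small : ∣ PE P Q ∣ ≤ ½^ (Aℓ Z)
        v-small = ≡⇒≤ (cong ∣_∣ PE≡) ⟨≤⟩ abs-+ _ _ ⟨≤⟩ ½^-sum (Aℓ Z) small
          (b^-uv m ⟨≤⟩ *-monoˡ-≤ (0≤2^ (2 ℕ.* m)) b²≤ ⟨≤⟩ ≡⇒≤ (R.*-comm _ _) ⟨≤⟩ 2^*½^≤ (2 ℕ.* m) (suc (Aℓ Z)) X≥₂)
        lin = linear (norm-zero P Q Z (ℕ.<⇒≤ (n<2^n Z)) v-small X≥₁)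
        absurd : ∀ {x} → 2 ℕ.^ W ℕ.≤ x → x ≡ 0 → ⊥
        absurd p refl = ℕ.<⇒≱ (1≤2^ℕ W) p

-- The linear form attached to a solution.

module LinearForm (𝔽 : OrderedField) (𝓖 : KBonacci) where
  open KBonacci 𝓖
  open FieldTheory 𝔽
  open Pisot 𝔽 k 3≤k
  open Approximation 𝔽 k 3≤k
  open Liouville 𝔽 𝓖
  open GoldenExtension 𝔽 𝓖

  open MultiplicativeIndependence 𝔽 𝓖

  ωE : ℕ → E₂
  ωE zero    = con₂ (+ 1)
  ωE (suc i) = x₂ ⊗₂ ωE i ⊕₂ con₂ -[1+ 0 ]

  YE : ℕ → ℕ → E₂
  YE zero s    = con₂ (+ 0)
  YE (suc n) s = ωE n ⊗₂ x₂ ^₂ s ⊕₂ YE n (suc s)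

  σE : ℕ → ℕ → E₂
  σE zero s    = con₂ (+ 0)
  σE (suc n) s = x₂ ^₂ s ⊕₂ σE n (suc s)

  -- γ₁ aʲ ≈ γ₂ bᵐ whenever G j + ⋯ + G (j + d) = F m.
  Γ₁ : ℕ → E₂
  Γ₁ d = (con₂ (+ 2) ⊗₂ φ₂ ⊕₂ con₂ -[1+ 0 ]) ⊗₂ σE (suc d) 0

  Γ₂ : E₂
  Γ₂ = YE k 0

  Xλ : ℕ → ℕ → ℕ → ℕ
  Xλ d j m = j ℕ.+ d ℕ.+ k ℕ.+ (k ℕ.+ 3) ℕ.+ 2 ℕ.* (j ℕ.+ d) ℕ.+ 2 ℕ.* m

  module Linear {X : ℕ} (root : Root X) (golden : Golden X) (d : ℕ) where
    open Gap root
    open Evaluation₂ root golden using (eval₂; eval₂-^; b; β; 0≤b; 1≤b; b≤2; 3≤2b)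
    open Fibonacci golden

    -- The derivative of the characteristic polynomial at `a`: the numbers `ω a i` are the Horner
    -- coefficients of its quotient by x - a. Accordingly g j is close to a^j / γ₂.
    γ₂ : Carrier
    γ₂ = Y k (λ i → a ^ i)

    σ : Carrier
    σ = Sum (suc d) (λ i → a ^ i)

    -- The factor √5 comes from Binet's formula, and σ = 1 + a + ⋯ + a^d from the window.
    γ₁ : Carrier
    γ₁ = (2# * b - 1#) * σ

    eval-ωE : ∀ i → eval₂ (ωE i) ≡ ω a i
    eval-ωE zero    = refl
    eval-ωE (suc i) = cong (λ z → a * z - 1#) (eval-ωE i)

    eval-YE : ∀ n s → eval₂ (YE n s) ≡ Y n (λ i → a ^ (s ℕ.+ i))
    eval-YE zero s    = refl
    eval-YE (suc n) s = cong₂ _+_ (cong₂ _*_ (eval-ωE n) (trans (eval₂-^ x₂ s) (cong (a ^_) (sym (ℕ.+-identityʳ s)))))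
      (trans (eval-YE n (suc s)) (Y-cong n (λ i → cong (a ^_) (sym (ℕ.+-suc s i)))))

    eval-σE : ∀ n s → eval₂ (σE n s) ≡ Sum n (λ i → a ^ (s ℕ.+ i))
    eval-σE zero s    = refl
    eval-σE (suc n) s = cong₂ _+_ (trans (eval₂-^ x₂ s) (cong (a ^_) (sym (ℕ.+-identityʳ s))))
      (trans (eval-σE n (suc s)) (Sum-cong n (λ i _ → cong (a ^_) (sym (ℕ.+-suc s i)))))

    eval-Γ₁ : eval₂ (Γ₁ d) ≡ γ₁
    eval-Γ₁ = cong (_*_ (2# * b - 1#)) (eval-σE (suc d) 0)

    eval-Γ₂ : eval₂ Γ₂ ≡ γ₂
    eval-Γ₂ = eval-YE k 0

    1≤Y : ∀ n t → suc n ℕ.≤ k → (∀ i → 1# ≤ t i) → 1# ≤ Y (suc n) t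
    1≤Y zero t _ h = h 0 ⟨≤⟩ ≡⇒≤ (solve 1 (λ x → x := c1 :* x :+ c0) refl (t 0))
    1≤Y (suc n) t p h = ≡⇒≤ (sym (R.+-identityˡ 1#)) ⟨≤⟩ +-mono-≤ (*-nonneg (0≤ω (ℕ.≤-trans (ℕ.n≤1+n _) p)) (0≤1 ⟨≤⟩ h 0))
      (1≤Y n (λ i → t (suc i)) (ℕ.≤-trans (ℕ.n≤1+n _) p) (λ i → h (suc i)))

    1≤γ₂ : 1# ≤ γ₂
    1≤γ₂ = go k 3≤k refl
      where
      go : ∀ n → 3 ℕ.≤ n → n ≡ k → 1# ≤ Y n (λ i → a ^ i)
      go (suc n) _ refl = 1≤Y n _ ℕ.≤-refl (λ i → 1≤^ i 1≤a)

    1≤2b-1 : 1# ≤ 2# * b - 1#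
    1≤2b-1 = by-diff (2# * b - 3# + 1#) (+-nonneg (≤⇒0≤- 3≤2b) 0≤1) (solve 1 (λ b → c2 :* b :- c1 :- c1 := c2 :* b :- c3 :+ c1) refl b)

    0≤Sum : ∀ n {f : ℕ → Carrier} → (∀ i → 0# ≤ f i) → 0# ≤ Sum n f
    0≤Sum zero h    = ≤-refl
    0≤Sum (suc n) h = +-nonneg (h 0) (0≤Sum n (λ i → h (suc i)))

    1≤γ₁ : 1# ≤ γ₁
    1≤γ₁ = ≡⇒≤ (sym (R.*-identityˡ 1#)) ⟨≤⟩ *-mono-≤ 0≤1 1≤2b-1 0≤1
      (≡⇒≤ (sym (R.+-identityʳ 1#)) ⟨≤⟩ +-monoʳ-≤ 1# (0≤Sum d (λ i → ^-nonneg (suc i) 0≤a)))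

    private
      C = 2^ (k ℕ.+ 3)

      |Y|≤ : ∀ n t {M} → n ℕ.≤ k → (∀ i → i ℕ.< n → ∣ t i ∣ ≤ M) → ∣ Y n t ∣ ≤ ιℕ n * M
      |Y|≤ zero t {M} _ h = ≡⇒≤ (trans (abs-nonneg ≤-refl) (sym (R.zeroˡ M)))
      |Y|≤ (suc n) t {M} p h = abs-+ _ _ ⟨≤⟩ +-mono-≤ (≡⇒≤ (abs-* _ _) ⟨≤⟩ *-mono-≤ (0≤abs _)
            (≡⇒≤ (abs-nonneg (0≤ω (ℕ.≤-trans (ℕ.n≤1+n n) p))) ⟨≤⟩ ω≤1 n) (0≤abs _) (h 0 (s≤s z≤n)))
          (|Y|≤ n (λ i → t (suc i)) (ℕ.≤-trans (ℕ.n≤1+n n) p) (λ i q → h (suc i) (s≤s q))) ⟨≤⟩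
        ≡⇒≤ (trans (solve 2 (λ m n → c1 :* m :+ n :* m := (c1 :+ n) :* m) refl M (ιℕ n)) (cong (_* M) (sym (ιℕ-suc n))))

    module _ (T : ℕ) (X≥ : T ℕ.+ (k ℕ.+ 3) ℕ.≤ X) where
      power-close : ∀ j i → j ℕ.+ i ℕ.≤ T → ∣ a ^ i * G j - G (j ℕ.+ i) ∣ ≤ (2^ i - 1#) * C
      power-close j zero _ = ≡⇒≤ (trans (cong ∣_∣ (trans (cong (λ z → 1# * G j - G z) (ℕ.+-identityʳ j)) (solve 1 (λ x → c1 :* x :- x := c0) refl (G j))))
        (trans (abs-nonneg ≤-refl) (solve 1 (λ c → c0 := (c1 :- c1) :* c) refl C)))
      power-close j (suc i) p = ≡⇒≤ (cong ∣_∣ (trans (cong (λ z → a * a ^ i * G j - G z) (ℕ.+-suc j i))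
          (solve 5 (λ a p x y z → a :* p :* x :- z := a :* (p :* x :- y) :+ (a :* y :- z)) refl a (a ^ i) (G j) (G (j ℕ.+ i)) (G (suc (j ℕ.+ i)))))) ⟨≤⟩
        abs-+ _ _ ⟨≤⟩ +-mono-≤ (≡⇒≤ (abs-* _ _) ⟨≤⟩ *-mono-≤ (0≤abs _) (≡⇒≤ abs-a ⟨≤⟩ a≤2) (0≤abs _) (power-close j i p′))
          (≡⇒≤ (abs-sym _ _) ⟨≤⟩ gap T X≥ (j ℕ.+ i) p′) ⟨≤⟩
        ≡⇒≤ (solve 2 (λ p c → c2 :* ((p :- c1) :* c) :+ c := (c2 :* p :- c1) :* c) refl (2^ i) C)
        where
        p′ : j ℕ.+ i ℕ.≤ T
        p′ = ℕ.≤-trans (ℕ.+-monoʳ-≤ j (ℕ.n≤1+n i)) p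

      Y-G : ∀ j → ∣ Y k (drop j G) - a ^ j ∣ ≤ ωₖ * 2^ (2 ℕ.* j)
      Y-G zero = ≡⇒≤ (trans (cong ∣_∣ (trans (cong (_- 1#) Yℤ-g) (R.-‿inverseʳ 1#))) (abs-nonneg ≤-refl)) ⟨≤⟩ *-nonneg 0≤ωk (0≤2^ 0)
      Y-G (suc j) = ≡⇒≤ (cong ∣_∣ (trans (cong (_- a ^ suc j) (Y-step (drop j G) (ι-Rec g g-rec j)))
          (solve 5 (λ a y w x p → a :* y :- w :* x :- a :* p := a :* (y :- p) :- w :* x) refl a (Y k (drop j G)) ωₖ (drop j G 0) (a ^ j)))) ⟨≤⟩
        abs-- _ _ ⟨≤⟩ +-mono-≤ (≡⇒≤ (abs-* _ _) ⟨≤⟩ *-mono-≤ (0≤abs _) (≡⇒≤ abs-a ⟨≤⟩ a≤2) (0≤abs _) (Y-G j))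
          (≡⇒≤ (abs-* _ _) ⟨≤⟩ *-mono-≤ (0≤abs _) (≡⇒≤ (abs-nonneg 0≤ωk)) (0≤abs _)
            (≡⇒≤ (cong ∣_∣ (trans (drop-≡ j G 0) (cong G (ℕ.+-identityʳ j)))) ⟨≤⟩ |G|≤ j ⟨≤⟩ 2^-mono {j} {suc (2 ℕ.* j)} (ℕ.≤-trans (ℕ.m≤m+n j _) (ℕ.n≤1+n _)))) ⟨≤⟩
        ≡⇒≤ (trans (solve 2 (λ w p → c2 :* (w :* p) :+ w :* (c2 :* p) := w :* (c2 :* (c2 :* p))) refl ωₖ (2^ (2 ℕ.* j)))
          (cong (λ z → ωₖ * 2^ z) (sym (ℕ.*-suc 2 j))))

      -- `Y k (drop j G)` is close to both terms: to γ₂ G j because consecutive terms differ from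
      -- the ratio `a` by a bounded amount, and to a^j because the shift multiplies `Y k` by `a`.
      γ₂-G : ∀ j → j ℕ.+ k ℕ.≤ T → 2 ℕ.* j ℕ.≤ X → ∣ γ₂ * G j - a ^ j ∣ ≤ 2^ (3 ℕ.* k ℕ.+ 4)
      γ₂-G j p X≥′ = ≡⇒≤ (cong ∣_∣ (trans (solve 3 (λ x y z → x :- z := (x :- y) :+ (y :- z)) refl (γ₂ * G j) (Y k (drop j G)) (a ^ j)) (cong (_+ (Y k (drop j G) - a ^ j)) Yeq))) ⟨≤⟩
        abs-+ _ _ ⟨≤⟩ +-mono-≤ (|Y|≤ k _ ℕ.≤-refl (λ i i<k → power-close j i (ℕ.≤-trans (ℕ.+-monoʳ-≤ j (ℕ.<⇒≤ i<k)) p) ⟨≤⟩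
            *-monoˡ-≤ (0≤2^ (k ℕ.+ 3)) (by-diff 1# 0≤1 (solve 1 (λ p → p :- (p :- c1) := c1) refl (2^ i)) ⟨≤⟩ 2^-mono (ℕ.<⇒≤ i<k))) ⟨≤⟩
            *-monoˡ-≤ (*-nonneg (0≤2^ k) (0≤2^ (k ℕ.+ 3))) (ιℕ≤2^ k) ⟨≤⟩
            ≡⇒≤ (trans (cong (_*_ (2^ k)) (2^[ k ]*2^[ k ℕ.+ 3 ])) (trans (2^[ k ]*2^[ k ℕ.+ (k ℕ.+ 3) ]) (cong 2^_ (lemma k)))))
          (Y-G j ⟨≤⟩ ≡⇒≤ (R.*-comm _ _) ⟨≤⟩ *-monoʳ-≤ (0≤2^ (2 ℕ.* j)) ωk≤ ⟨≤⟩ 2^*½^≤ (2 ℕ.* j) 0 (ℕ.≤-trans (ℕ.≤-reflexive (ℕ.+-identityʳ _)) X≥′) ⟨≤⟩ 1≤2^ (3 ℕ.* k ℕ.+ 3)) ⟨≤⟩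
        ≡⇒≤ (trans (2^+2^ (3 ℕ.* k ℕ.+ 3)) (cong 2^_ (sym (ℕ.+-suc (3 ℕ.* k) 3))))
        where
        lemma : ∀ k → k ℕ.+ (k ℕ.+ (k ℕ.+ 3)) ≡ 3 ℕ.* k ℕ.+ 3
        lemma = solve-∀
        Yeq : γ₂ * G j - Y k (drop j G) ≡ Y k (λ i → a ^ i * G j - G (j ℕ.+ i))
        Yeq = sym (trans (Y-cong k (λ i → cong₂ _+_ (R.*-comm (a ^ i) (G j)) (solve 1 (λ x → :- x := (:- c1) :* x) refl (G (j ℕ.+ i)))))
          (trans (Y-+ k (λ i → G j * a ^ i) (λ i → (- 1#) * G (j ℕ.+ i)))
            (trans (cong₂ _+_ (Y-* k (G j) (λ i → a ^ i)) (trans (Y-* k (- 1#) (λ i → G (j ℕ.+ i))) (cong (_*_ (- 1#)) (Y-cong k (λ i → sym (drop-≡ j G i))))))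
              (solve 3 (λ x y z → x :* y :+ (:- c1) :* z := y :* x :- z) refl (G j) γ₂ (Y k (drop j G))))))

    -- The window equation is multiplied by √5 γ₂; both sides are then replaced with pure powers at
    -- a cost that does not depend on j and m.
    linear-form : ∀ j m → Xλ d j m ℕ.≤ X → Sum (suc d) (λ i → G (j ℕ.+ i)) ≡ ιℕ (v m) →
                  ∣ γ₁ * a ^ j - γ₂ * b ^ m ∣ ≤ 2^ (d ℕ.+ 3 ℕ.* k ℕ.+ 7)
    linear-form j m X≥ win = ≡⇒≤ (cong ∣_∣ (trans (solve 6 (λ s σ p γ V q → s :* σ :* p :- γ :* q := (:- s) :* (γ :* V :- σ :* p) :+ γ :* (s :* V :- q)) refl
          (2# * b - 1#) σ (a ^ j) γ₂ (ιℕ (v m)) (b ^ m)) (cong (λ z → (- (2# * b - 1#)) * (γ₂ * z - σ * a ^ j) + γ₂ * ((2# * b - 1#) * ιℕ (v m) - b ^ m)) (sym win)))) ⟨≤⟩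
      abs-+ _ _ ⟨≤⟩ +-mono-≤
        (≡⇒≤ (abs-* _ _) ⟨≤⟩ *-mono-≤ (0≤abs _) (≡⇒≤ (trans (abs-neg _) (abs-nonneg (0≤1 ⟨≤⟩ 1≤2b-1))) ⟨≤⟩ 2b-1≤4) (0≤abs _) win-close ⟨≤⟩ ≡⇒≤ (trans (2^[ 2 ]*2^[ d ℕ.+ (3 ℕ.* k ℕ.+ 4) ]) (cong 2^_ (lemma₁ d k))))
        (≡⇒≤ (abs-* _ _) ⟨≤⟩ *-mono-≤ (0≤abs _) |γ₂|≤ (0≤abs _) (√5v m X≥₃) ⟨≤⟩ ≡⇒≤ (2^[ k ℕ.+ k ]*2^[ 2 ]) ⟨≤⟩ 2^-mono {k ℕ.+ k ℕ.+ 2} (le (d ℕ.+ k ℕ.+ 4) (lemma₂ d k))) ⟨≤⟩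
      ≡⇒≤ (trans (2^+2^ (d ℕ.+ 3 ℕ.* k ℕ.+ 6)) (cong 2^_ (sym (ℕ.+-suc (d ℕ.+ 3 ℕ.* k) 6))))
      where
      T = j ℕ.+ d ℕ.+ k
      lemma₁ : ∀ d k → 2 ℕ.+ (d ℕ.+ (3 ℕ.* k ℕ.+ 4)) ≡ d ℕ.+ 3 ℕ.* k ℕ.+ 6
      lemma₁ = solve-∀
      lemma₂ : ∀ d k → k ℕ.+ k ℕ.+ 2 ℕ.+ (d ℕ.+ k ℕ.+ 4) ≡ d ℕ.+ 3 ℕ.* k ℕ.+ 6
      lemma₂ = solve-∀
      lemma₃ : ∀ a b c → b ℕ.+ (a ℕ.+ c) ≡ a ℕ.+ b ℕ.+ c
      lemma₃ = solve-∀
      X≥₁ : T ℕ.+ (k ℕ.+ 3) ℕ.≤ X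
      X≥₁ = ℕ.≤-trans (ℕ.≤-trans (ℕ.m≤m+n _ (2 ℕ.* (j ℕ.+ d))) (ℕ.m≤m+n _ (2 ℕ.* m))) X≥
      X≥₂ : 2 ℕ.* (j ℕ.+ d) ℕ.≤ X
      X≥₂ = ℕ.≤-trans (le (T ℕ.+ (k ℕ.+ 3) ℕ.+ 2 ℕ.* m) (lemma₃ (T ℕ.+ (k ℕ.+ 3)) (2 ℕ.* (j ℕ.+ d)) (2 ℕ.* m))) X≥
      X≥₃ : 2 ℕ.* m ℕ.≤ X
      X≥₃ = ℕ.≤-trans (ℕ.m≤n+m (2 ℕ.* m) (T ℕ.+ (k ℕ.+ 3) ℕ.+ 2 ℕ.* (j ℕ.+ d))) X≥
      2b-1≤4 : 2# * b - 1# ≤ 2^ 2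
      2b-1≤4 = by-diff (2# * (2# - b) + 1#) (+-nonneg (*-nonneg 0≤2 (≤⇒0≤- b≤2)) 0≤1) (solve 1 (λ b → c2 :* (c2 :* c1) :- (c2 :* b :- c1) := c2 :* (c2 :- b) :+ c1) refl b)
      |γ₂|≤ : ∣ γ₂ ∣ ≤ 2^ (k ℕ.+ k)
      |γ₂|≤ = |Y|≤ k _ ℕ.≤-refl (λ i i<k → ≡⇒≤ (abs-nonneg (^-nonneg i 0≤a)) ⟨≤⟩ ^-mono i 0≤a a≤2 ⟨≤⟩ 2^-mono (ℕ.<⇒≤ i<k)) ⟨≤⟩
        *-monoˡ-≤ (0≤2^ k) (ιℕ≤2^ k) ⟨≤⟩ ≡⇒≤ (2^[ k ]*2^[ k ])
      win-close : ∣ γ₂ * Sum (suc d) (λ i → G (j ℕ.+ i)) - σ * a ^ j ∣ ≤ 2^ (d ℕ.+ (3 ℕ.* k ℕ.+ 4))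
      win-close = ≡⇒≤ (cong ∣_∣ (trans (cong₂ _-_ (sym (Sum-*ˡ (suc d) γ₂ (λ i → G (j ℕ.+ i)))) (sym (Sum-*ʳ (suc d) (a ^ j) (λ i → a ^ i)))) (sym (Sum-- (suc d) (λ i → γ₂ * G (j ℕ.+ i)) (λ i → a ^ i * a ^ j))))) ⟨≤⟩
        abs-Sum (suc d) (λ i → γ₂ * G (j ℕ.+ i) - a ^ i * a ^ j) ⟨≤⟩
        Sum-mono (suc d) {λ i → ∣ γ₂ * G (j ℕ.+ i) - a ^ i * a ^ j ∣} {λ _ → 2^ (3 ℕ.* k ℕ.+ 4)} (λ i i≤d → ≡⇒≤ (cong (λ z → ∣ γ₂ * G (j ℕ.+ i) - z ∣) (trans (R.*-comm _ _) (sym (^-+ a j i)))) ⟨≤⟩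
          γ₂-G T X≥₁ (j ℕ.+ i) (ℕ.+-monoˡ-≤ k (ℕ.+-monoʳ-≤ j (ℕ.≤-pred i≤d))) (ℕ.≤-trans (ℕ.*-monoʳ-≤ 2 (ℕ.+-monoʳ-≤ j (ℕ.≤-pred i≤d))) X≥₂)) ⟨≤⟩
        ≡⇒≤ (Sum-const (suc d) _) ⟨≤⟩ *-monoˡ-≤ (0≤2^ (3 ℕ.* k ℕ.+ 4)) (≤2^-ιℕ d (n<2^n d)) ⟨≤⟩ ≡⇒≤ (2^[ d ]*2^[ 3 ℕ.* k ℕ.+ 4 ])

-- Quotients of powers of α and φ close to 1.

module SmallUnits (𝔽 : OrderedField) (𝓖 : KBonacci) where
  open KBonacci 𝓖
  open FieldTheory 𝔽
  open Pisot 𝔽 k 3≤k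
  open Approximation 𝔽 k 3≤k
  open Liouville 𝔽 𝓖
  open GoldenExtension 𝔽 𝓖

  open MultiplicativeIndependence 𝔽 𝓖

  open LinearForm 𝔽 𝓖
  open import Data.Fin using (Fin; toℕ; fromℕ<)
  open import Data.Fin.Properties using (pigeonhole; toℕ<n; toℕ-fromℕ<)

  module SmallUnit {X : ℕ} (root : Root X) (golden : Golden X) where
    open Evaluation₂ root golden

    2≤b² : 2# ≤ b * b
    2≤b² = *-cancelˡ-≤ 2# (1≤⇒≰0 1≤2) (*-cancelˡ-≤ 2# (1≤⇒≰0 1≤2)
      (by-diff ((2# * b - 3#) * (2# * b - 3#) + 3# * 2# * (2# * b - 3#) + 1#)
        (+-nonneg (+-nonneg (*-nonneg 0≤t 0≤t) (*-nonneg (*-nonneg (0≤ιℕ 3) 0≤2) 0≤t)) 0≤1)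
        (solve 1 (λ b → c2 :* (c2 :* (b :* b)) :- c2 :* (c2 :* c2) :=
           (c2 :* b :- c3) :* (c2 :* b :- c3) :+ c3 :* c2 :* (c2 :* b :- c3) :+ c1) refl b)))
      where 0≤t = ≤⇒0≤- 3≤2b

    2^≤b^ : ∀ n → 2^ n ≤ b ^ n * b ^ n
    2^≤b^ n = ^-mono n 0≤2 2≤b² ⟨≤⟩ ≡⇒≤ (^-distrib-* b b n)

    private
      -- A substitute for the integer part of log a^i / log b. It rises by at most two at each step,
      -- as a ≤ 2 ≤ b².
      Level : ℕ → Set
      Level i = Σ ℕ λ j → b ^ j ≤ a ^ i × a ^ i ≤ b ^ suc j

      next-level : ∀ i j → b ^ j ≤ a ^ i → a ^ i ≤ b ^ suc j →
                   (a ^ suc i ≤ b ^ suc j) ⊎ (b ^ suc j ≤ a ^ suc i) →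
                   (a ^ suc i ≤ b ^ suc (suc j)) ⊎ (b ^ suc (suc j) ≤ a ^ suc i) → Level (suc i)
      next-level i j lo hi (inj₁ p) _        = j , (lo ⟨≤⟩ ≡⇒≤ (sym (R.*-identityˡ _)) ⟨≤⟩ *-monoˡ-≤ (^-nonneg i 0≤a) 1≤a) , p
      next-level i j lo hi (inj₂ p) (inj₁ q) = suc j , p , q
      next-level i j lo hi (inj₂ p) (inj₂ q) = suc (suc j) , q ,
        (*-mono-≤ 0≤a a≤2 (^-nonneg i 0≤a) hi ⟨≤⟩ *-monoˡ-≤ (^-nonneg (suc j) 0≤b) 2≤b² ⟨≤⟩ ≡⇒≤ (R.*-assoc b b _))

      level : ∀ i → Level i
      level zero    = 0 , ≤-refl , (1≤b ⟨≤⟩ ≡⇒≤ (sym (R.*-identityʳ b)))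
      level (suc i) = up (level i)
        where
        up : Level i → Level (suc i)
        up (j , lo , hi) = next-level i j lo hi (≤-total (a ^ suc i) (b ^ suc j)) (≤-total (a ^ suc i) (b ^ suc (suc j)))

      box : ∀ N {x δ} → 0# ≤ x → x ≤ ιℕ (suc N) * δ → Σ ℕ λ t → t ℕ.≤ N × ιℕ t * δ ≤ x × x ≤ ιℕ (suc t) * δ
      box zero {x} {δ} 0≤x x≤ = 0 , z≤n , (≡⇒≤ (R.zeroˡ δ) ⟨≤⟩ 0≤x) , x≤
      box (suc N) {x} {δ} 0≤x x≤ = pick (≤-total x (ιℕ (suc N) * δ))
        where
        Box = λ N → Σ ℕ λ t → t ℕ.≤ N × ιℕ t * δ ≤ x × x ≤ ιℕ (suc t) * δ
        widen : Box N → Box (suc N)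
        widen (t , t≤ , lo , hi) = t , ℕ.m≤n⇒m≤1+n t≤ , lo , hi
        pick : (x ≤ ιℕ (suc N) * δ) ⊎ (ιℕ (suc N) * δ ≤ x) → Box (suc N)
        pick (inj₁ p) = widen (box N 0≤x p)
        pick (inj₂ p) = suc N , ℕ.≤-refl , p , x≤

      b⁻¹ : Carrier
      b⁻¹ = proj₁ (inverse b (1≤⇒≰0 1≤b))

      b*b⁻¹ : b * b⁻¹ ≡ 1#
      b*b⁻¹ = proj₂ (proj₂ (inverse b (1≤⇒≰0 1≤b)))

      0≤b⁻¹ : 0# ≤ b⁻¹
      0≤b⁻¹ = proj₁ (proj₂ (inverse b (1≤⇒≰0 1≤b)))

      b^*b⁻¹^ : ∀ j → b ^ j * b⁻¹ ^ j ≡ 1#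
      b^*b⁻¹^ j = trans (sym (^-distrib-* b b⁻¹ j)) (trans (cong (_^ j) b*b⁻¹) (1^ j))

    module _ (l : ℕ) where
      private
        δ = ½^ l
        M = 2 ℕ.^ l
        j : ℕ → ℕ
        j i = proj₁ (level i)
        v′ : ℕ → Carrier
        v′ i = a ^ i * b⁻¹ ^ j i

        1≤v : ∀ i → 1# ≤ v′ i
        1≤v i = ≡⇒≤ (sym (b^*b⁻¹^ (j i))) ⟨≤⟩ *-monoˡ-≤ (^-nonneg (j i) 0≤b⁻¹) (proj₁ (proj₂ (level i)))

        v≤2 : ∀ i → v′ i ≤ 2#
        v≤2 i = *-monoˡ-≤ (^-nonneg (j i) 0≤b⁻¹) (proj₂ (proj₂ (level i))) ⟨≤⟩
          ≡⇒≤ (trans (R.*-assoc b _ _) (trans (cong (_*_ b) (b^*b⁻¹^ (j i))) (R.*-identityʳ b))) ⟨≤⟩ b≤2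

        M≡ : suc (ℕ.pred M) ≡ M
        M≡ = ℕ.suc-pred M {{ℕ.>-nonZero (ℕ.m^n>0 2 l)}}

        boxᵢ : ∀ i → Σ ℕ λ t → t ℕ.≤ ℕ.pred M × ιℕ t * δ ≤ v′ i - 1# × v′ i - 1# ≤ ιℕ (suc t) * δ
        boxᵢ i = box (ℕ.pred M) (≤⇒0≤- (1≤v i))
          (by-diff (2# - v′ i) (≤⇒0≤- (v≤2 i)) (trans (cong (_- (v′ i - 1#)) (trans (cong (λ z → ιℕ z * δ) M≡) (trans (cong (_* δ) (ιℕ-2^ l)) (2^*½^ l)))) (solve 1 (λ v → c1 :- (v :- c1) := c2 :- v) refl (v′ i))))

        box< : ∀ i → proj₁ (boxᵢ i) ℕ.< M
        box< i = ℕ.≤-trans (s≤s (proj₁ (proj₂ (boxᵢ i)))) (ℕ.≤-reflexive M≡)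

        f : Fin (suc M) → Fin M
        f i = fromℕ< (box< (toℕ i))

        close : ∀ {x y : Carrier} t → ιℕ t * δ ≤ x → y ≤ ιℕ (suc t) * δ → y - x ≤ δ
        close {x} {y} t p q = +-mono-≤ q (neg-mono p) ⟨≤⟩ ≡⇒≤ (trans (cong (λ z → z * δ - ιℕ t * δ) (ιℕ-suc t)) (solve 2 (λ t d → (c1 :+ t) :* d :- t :* d := d) refl (ιℕ t) δ))

      -- Dirichlet's argument: the 2^l + 1 numbers a^i / b^(j i) lie in [1, 2], which is cut into
      -- 2^l boxes, and the quotient of two numbers in one box is close to 1.
      small-unit : Σ ℕ λ n → Σ ℕ λ m → 1 ℕ.≤ n × n ℕ.≤ M × ∣ a ^ n - b ^ m ∣ ≤ ½^ l * b ^ m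
      small-unit = collide (pigeonhole (ℕ.n<1+n M) f)
        where
        build : ∀ i i′ → i ℕ.< i′ → i′ ℕ.≤ M → proj₁ (boxᵢ i) ≡ proj₁ (boxᵢ i′) →
                Σ ℕ λ n → Σ ℕ λ m → 1 ℕ.≤ n × n ℕ.≤ M × ∣ a ^ n - b ^ m ∣ ≤ ½^ l * b ^ m
        build i i′ i<i′ i′≤M eq = n , m , ℕ.m<n⇒0<n∸m i<i′ , ℕ.≤-trans (ℕ.m∸n≤m i′ i) i′≤M ,
            *-cancelˡ-≤ (a ^ i) (1≤⇒≰0 (1≤^ i 1≤a))
              (≡⇒≤ (trans (cong (_* ∣ a ^ n - b ^ m ∣) (sym (abs-nonneg (^-nonneg i 0≤a)))) (trans (sym (abs-* _ _)) (trans (cong ∣_∣ key) (trans (abs-* _ _) (cong (_* ∣ v′ i′ - v′ i ∣) (abs-nonneg (^-nonneg (j i′) 0≤b))))))) ⟨≤⟩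
               *-mono-≤ (^-nonneg (j i′) 0≤b) (≡⇒≤ b^j′ ⟨≤⟩ *-monoˡ-≤ (^-nonneg m 0≤b) (proj₁ (proj₂ (level i)))) (0≤abs _) v-close ⟨≤⟩
               ≡⇒≤ (solve 3 (λ x y d → x :* y :* d := x :* (d :* y)) refl (a ^ i) (b ^ m) δ))
          where
          n = i′ ℕ.∸ i
          m = j i′ ℕ.∸ j i
          a^i′ : a ^ i′ ≡ a ^ i * a ^ n
          a^i′ = trans (cong (a ^_) (sym (ℕ.m+[n∸m]≡n (ℕ.<⇒≤ i<i′)))) (^-+ a i n)
          -- Otherwise the levels would give a^i′ ≤ a^i with i < i′, although a exceeds 1.
          j≤ : j i ℕ.≤ j i′
          j≤ = ℕ.≮⇒≥ (λ j′<j → absurd j′<j)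
            where
            back : j i′ ℕ.< j i → a ^ i′ ≤ a ^ i
            back j′<j = proj₂ (proj₂ (level i′)) ⟨≤⟩ ^-monoʳ {b} {suc (j i′)} {j i} 1≤b j′<j ⟨≤⟩ proj₁ (proj₂ (level i))
            a≤1 : j i′ ℕ.< j i → a ≤ 1#
            a≤1 j′<j = *-cancelˡ-≤ (a ^ i) (1≤⇒≰0 (1≤^ i 1≤a)) (≡⇒≤ (R.*-comm _ _) ⟨≤⟩ ^-monoʳ {a} {suc i} {i′} 1≤a i<i′ ⟨≤⟩ back j′<j ⟨≤⟩ ≡⇒≤ (sym (R.*-identityʳ _)))
            a-1≤0 : j i′ ℕ.< j i → a - 1# ≤ 0#
            a-1≤0 j′<j = +-monoˡ-≤ (- 1#) (a≤1 j′<j) ⟨≤⟩ ≡⇒≤ (R.-‿inverseʳ 1#)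
            absurd : j i′ ℕ.< j i → ⊥
            absurd j′<j = 1≰0 (1≤2[a-1] ⟨≤⟩ *-monoʳ-≤ 0≤2 (a-1≤0 j′<j) ⟨≤⟩ ≡⇒≤ (R.zeroʳ 2#))
          b^j′ : b ^ j i′ ≡ b ^ j i * b ^ m
          b^j′ = trans (cong (b ^_) (sym (ℕ.m+[n∸m]≡n j≤))) (^-+ b (j i) m)
          recover : ∀ i → a ^ i ≡ b ^ j i * v′ i
          recover i = sym (trans (solve 3 (λ x y z → x :* (y :* z) := y :* (x :* z)) refl (b ^ j i) (a ^ i) (b⁻¹ ^ j i)) (trans (cong (_*_ (a ^ i)) (b^*b⁻¹^ (j i))) (R.*-identityʳ _)))
          key : a ^ i * (a ^ n - b ^ m) ≡ b ^ j i′ * (v′ i′ - v′ i)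
          key = trans (solve 3 (λ x y z → x :* (y :- z) := x :* y :- x :* z) refl (a ^ i) (a ^ n) (b ^ m))
            (trans (cong₂ _-_ (trans (sym a^i′) (recover i′)) (trans (cong (_* b ^ m) (recover i)) (trans (solve 3 (λ x y z → x :* y :* z := x :* z :* y) refl (b ^ j i) (v′ i) (b ^ m)) (cong (_* v′ i) (sym b^j′)))))
              (solve 3 (λ x y z → x :* y :- x :* z := x :* (y :- z)) refl (b ^ j i′) (v′ i′) (v′ i)))
          bx = boxᵢ i
          bx′ = boxᵢ i′
          lo′ : ιℕ (proj₁ bx) * δ ≤ v′ i′ - 1#
          lo′ = subst (λ t → ιℕ t * δ ≤ v′ i′ - 1#) (sym eq) (proj₁ (proj₂ (proj₂ bx′)))
          hi′ : v′ i′ - 1# ≤ ιℕ (suc (proj₁ bx)) * δ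
          hi′ = subst (λ t → v′ i′ - 1# ≤ ιℕ (suc t) * δ) (sym eq) (proj₂ (proj₂ (proj₂ bx′)))
          v-close : ∣ v′ i′ - v′ i ∣ ≤ δ
          v-close = abs-≤
            (≡⇒≤ (solve 2 (λ x y → x :- y := (x :- c1) :- (y :- c1)) refl (v′ i′) (v′ i)) ⟨≤⟩ close (proj₁ bx) (proj₁ (proj₂ (proj₂ bx))) hi′)
            (≡⇒≤ (solve 2 (λ x y → :- (x :- y) := (y :- c1) :- (x :- c1)) refl (v′ i′) (v′ i)) ⟨≤⟩ close (proj₁ bx) lo′ (proj₂ (proj₂ (proj₂ bx))))

        collide : (Σ (Fin (suc M)) λ p → Σ (Fin (suc M)) λ q → p Fin.< q × f p ≡ f q) →
                  Σ ℕ λ n → Σ ℕ λ m → 1 ℕ.≤ n × n ℕ.≤ M × ∣ a ^ n - b ^ m ∣ ≤ ½^ l * b ^ m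
        collide (p , q , p<q , eq) = build (toℕ p) (toℕ q) p<q (ℕ.≤-pred (toℕ<n q))
          (trans (sym (toℕ-fromℕ< (box< (toℕ p)))) (trans (cong toℕ eq) (toℕ-fromℕ< (box< (toℕ q)))))

    2^-reflects : ∀ {m n} → 2^ m ≤ 2^ n → m ℕ.≤ n
    2^-reflects {m} {n} p = ℕ.≮⇒≥ (λ n<m → 2^≰0 n (by-diff (2^ n - 2# * 2^ n) (≤⇒0≤- (2^-mono {suc n} {m} n<m ⟨≤⟩ p))
          (solve 1 (λ u → c0 :- u := u :- c2 :* u) refl (2^ n))))

-- The auxiliary polynomial and its parameters.

module AuxiliaryPolynomial (𝔽 : OrderedField) (𝓖 : KBonacci) (d : ℕ) where
  open KBonacci 𝓖
  open FieldTheory 𝔽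
  open Pisot 𝔽 k 3≤k
  open Approximation 𝔽 k 3≤k
  open Liouville 𝔽 𝓖
  open GoldenExtension 𝔽 𝓖

  open MultiplicativeIndependence 𝔽 𝓖

  open LinearForm 𝔽 𝓖
  open SmallUnits 𝔽 𝓖
  open Combinatorics
  open HermitePadé 𝔽
  open import Data.Nat.DivMod using (_/_; _%_; m≡m%n+[m/n]*n; m%n<n; m<n*o⇒m/o<n; [m+kn]%n≡m%n; m<n⇒m%n≡m)

  -- c₁ and c₂ are slope and intercept of the Liouville exponent (`Aℓ-linear`), 2^g₀ bounds γ₁ and
  -- γ₂, and 2^c₀ is the bound in `linear-form`.
  κ₀ c₁ c₂ g₀ c₀ : ℕ
  κ₀ = 2 ℕ.^ k ℕ.* k
  c₁ = 1 ℕ.+ 2 ℕ.* κ₀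
  c₂ = κ₀ ℕ.* (k ℕ.+ 2) ℕ.+ k ℕ.+ 8
  g₀ = nrm₂ (Γ₁ d) ℕ.+ nrm₂ Γ₂
  c₀ = d ℕ.+ 3 ℕ.* k ℕ.+ 7

  abstract
    -- The number of bits by which w is small, per unit of p; the value is the total found in
    -- `main-dy`. It is kept opaque, since powers with this exponent must never be computed.
    cc : ℕ
    cc = 84 ℕ.+ 78 ℕ.* c₁

    cc≡ : cc ≡ 84 ℕ.+ 78 ℕ.* c₁
    cc≡ = refl

    1≤cc : 1 ℕ.≤ cc
    1≤cc = s≤s z≤n

    cc-* : ∀ p n → (84 ℕ.+ 78 ℕ.* c₁) ℕ.* p ℕ.* n ≡ cc ℕ.* p ℕ.* n
    cc-* p n = refl

    4cc-* : ∀ p → (54 ℕ.+ 4 ℕ.* (84 ℕ.+ 78 ℕ.* c₁)) ℕ.* p ≡ (54 ℕ.+ 4 ℕ.* cc) ℕ.* p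
    4cc-* p = refl

  -- Linearity is essential: for Z of order pU the Liouville cost stays of order pU, to be beaten by
  -- 2^(p-1) U.
  Aℓ-linear : ∀ Z → suc (Aℓ Z) ≡ c₁ ℕ.* Z ℕ.+ c₂
  Aℓ-linear = lemma (2 ℕ.^ k) k
    where
    lemma : ∀ t k Z → suc (Z ℕ.+ (t ℕ.* (Z ℕ.+ Z ℕ.+ k ℕ.+ 2) ℕ.* k ℕ.+ k ℕ.+ 4 ℕ.+ 3)) ≡
            (1 ℕ.+ 2 ℕ.* (t ℕ.* k)) ℕ.* Z ℕ.+ (t ℕ.* k ℕ.* (k ℕ.+ 2) ℕ.+ k ℕ.+ 8)
    lemma = solve-∀

  Sum-term : ∀ n f k → (∀ j → 0# ≤ f j) → k ℕ.< n → f k ≤ Sum n f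
  Sum-term (suc n) f zero h _ = ≡⇒≤ (sym (R.+-identityʳ _)) ⟨≤⟩ +-monoʳ-≤ (f 0) (≡⇒≤ (sym (Sum-0 n)) ⟨≤⟩ Sum-mono n (λ i _ → h (suc i)))
  Sum-term (suc n) f (suc k) h (s≤s p) = Sum-term n (λ j → f (suc j)) k (λ j → h (suc j)) p ⟨≤⟩
    ≡⇒≤ (sym (R.+-identityˡ _)) ⟨≤⟩ +-monoˡ-≤ _ (h 0)

  ιℕ-reflects : ∀ {m n} → ιℕ m ≤ ιℕ n → m ℕ.≤ n
  ιℕ-reflects {m} {n} p = ℕ.≮⇒≥ (λ n<m → 1≰0 (by-diff (ιℕ n - ιℕ (suc n)) (≤⇒0≤- (ιℕ-mono n<m ⟨≤⟩ p))
    (trans (solve 2 (λ x u → c0 :- c1 := x :- (c1 :+ x)) refl (ιℕ n) 0#) (cong (λ z → ιℕ n - z) (sym (ιℕ-suc n))))))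

  power-diff : ∀ {A B M Δ : Carrier} s → 1# ≤ M → ∣ A ∣ ≤ M → ∣ B ∣ ≤ M → ∣ A - B ∣ ≤ Δ → ∣ A ^ s - B ^ s ∣ ≤ ιℕ s * (M ^ s * Δ)
  power-diff {Δ = Δ} zero _ _ _ _ = ≡⇒≤ (trans (cong ∣_∣ (R.-‿inverseʳ 1#)) (trans (abs-nonneg ≤-refl) (sym (R.zeroˡ _))))
  power-diff {A} {B} {M} {Δ} (suc s) 1≤M A≤ B≤ Δ≤ = ≡⇒≤ (cong ∣_∣ (solve 4 (λ a b x y → a :* x :- b :* y := a :* (x :- y) :+ (a :- b) :* y) refl A B (A ^ s) (B ^ s))) ⟨≤⟩
    abs-+ _ _ ⟨≤⟩ +-mono-≤
      (≡⇒≤ (abs-* _ _) ⟨≤⟩ *-mono-≤ (0≤abs A) A≤ (0≤abs _) (power-diff s 1≤M A≤ B≤ Δ≤))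
      (≡⇒≤ (trans (abs-* _ _) (cong (_*_ ∣ A - B ∣) (abs-^ B s))) ⟨≤⟩ *-mono-≤ (0≤abs _) Δ≤ (^-nonneg s (0≤abs B)) (^-mono s (0≤abs B) B≤) ⟨≤⟩
        ≡⇒≤ (sym (R.*-identityˡ _)) ⟨≤⟩ *-monoˡ-≤ (*-nonneg 0≤Δ (^-nonneg s 0≤M)) 1≤M) ⟨≤⟩
    ≡⇒≤ (trans (solve 4 (λ m n u d → m :* (n :* (u :* d)) :+ m :* (d :* u) := (c1 :+ n) :* (m :* u :* d)) refl M (ιℕ s) (M ^ s) Δ)
      (cong (_* (M * M ^ s * Δ)) (sym (ιℕ-suc s))))
    where
    0≤M = 0≤1 ⟨≤⟩ 1≤M
    0≤Δ = 0≤abs (A - B) ⟨≤⟩ Δ≤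

  nrm₂-^ : ∀ e n → nrm₂ (e ^₂ n) ≡ nrm₂ e ℕ.^ n
  nrm₂-^ e zero    = refl
  nrm₂-^ e (suc n) = cong (nrm₂ e ℕ.*_) (nrm₂-^ e n)

  ΣE : ℕ → (ℕ → E₂) → E₂
  ΣE zero f    = con₂ (+ 0)
  ΣE (suc n) f = f 0 ⊕₂ ΣE n (λ i → f (suc i))

  nrm₂-ΣE : ∀ n f {B} → (∀ i → i ℕ.< n → nrm₂ (f i) ℕ.≤ B) → nrm₂ (ΣE n f) ℕ.≤ n ℕ.* B
  nrm₂-ΣE zero f h    = z≤n
  nrm₂-ΣE (suc n) f h = ℕ.+-mono-≤ (h 0 (s≤s z≤n)) (nrm₂-ΣE n _ (λ i p → h (suc i) (s≤s p)))

  ^-pow2 : ∀ m n → (2 ℕ.^ m) ℕ.^ n ≡ 2 ℕ.^ (m ℕ.* n)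
  ^-pow2 = ℕ.^-*-assoc 2

  module Construction (n₁ p′ R s₀ m₁ m : ℕ) {{R≢0 : ℕ.NonZero R}} (1≤n₁ : 1 ℕ.≤ n₁) (2≤U : 2 ℕ.≤ R ℕ.* n₁) where
    -- R and S = 2 n₁ are balanced so that x^(n₁ r) and the powers of θ both have O(U) bits. There
    -- are N = 2U unknowns for U conditions, n̂ exceeds all exponents, and y and b̂ count the bits
    -- of the coefficients and of the binomial coefficients.
    p P ℓ U S N n̂ y b̂ : ℕ
    p = suc p′
    P = 2 ℕ.^ p
    ℓ = P ℕ.* R
    U = R ℕ.* n₁
    S = 2 ℕ.* n₁
    N = R ℕ.* S
    n̂ = 2 ℕ.^ suc p ℕ.* U
    y = (p ℕ.+ 5) ℕ.* U
    b̂ = (p ℕ.+ 3) ℕ.* U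

    -- The index i < N = R S stands for the monomial of exponent r + s ℓ with r < R and s < S.
    r s e : ℕ → ℕ
    r i = i % R
    s i = i / R
    e i = r i ℕ.+ s i ℕ.* ℓ

    1≤U : 1 ℕ.≤ U
    1≤U = ℕ.≤-trans (s≤s z≤n) 2≤U

    N≡ : N ≡ 2 ℕ.* U
    N≡ = lemma R n₁
      where
      lemma : ∀ R n → R ℕ.* (2 ℕ.* n) ≡ 2 ℕ.* (R ℕ.* n)
      lemma = solve-∀

    N<2^ : N ℕ.< 2 ℕ.^ suc U
    N<2^ = ℕ.≤-<-trans (ℕ.≤-reflexive N≡) (ℕ.*-monoʳ-< 2 (n<2^n U))

    R≤ℓ : R ℕ.≤ ℓ
    R≤ℓ = ℕ.≤-trans (ℕ.≤-reflexive (sym (ℕ.*-identityˡ R))) (ℕ.*-monoˡ-≤ R (ℕ.m^n>0 2 p))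

    r<R : ∀ i → r i ℕ.< R
    r<R i = m%n<n i R

    s<S : ∀ i → i ℕ.< N → s i ℕ.< S
    s<S i p = m<n*o⇒m/o<n (ℕ.<-≤-trans p (ℕ.≤-reflexive (ℕ.*-comm R S)))

    e<n̂ : ∀ i → i ℕ.< N → e i ℕ.< n̂
    e<n̂ i i<N = ℕ.<-≤-trans (ℕ.+-monoˡ-< (s i ℕ.* ℓ) (ℕ.<-≤-trans (r<R i) R≤ℓ))
      (ℕ.≤-trans (ℕ.*-monoˡ-≤ ℓ (s<S i i<N)) (ℕ.≤-reflexive (lemma n₁ P R)))
      where
      lemma : ∀ n P R → 2 ℕ.* n ℕ.* (P ℕ.* R) ≡ 2 ℕ.* P ℕ.* (R ℕ.* n)
      lemma = solve-∀

    instance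
      ℓ≢0 : ℕ.NonZero ℓ
      ℓ≢0 = ℕ.>-nonZero (ℕ.<-≤-trans (ℕ.>-nonZero⁻¹ R) R≤ℓ)

    e-injective : ∀ i i′ → i ℕ.< N → i′ ℕ.< N → e i ≡ e i′ → i ≡ i′
    e-injective i i′ _ _ eq = trans (m≡m%n+[m/n]*n i R) (trans (cong₂ (λ a b → a ℕ.+ b ℕ.* R) r≡ s≡) (sym (m≡m%n+[m/n]*n i′ R)))
      where
      r-of : ∀ i → e i % ℓ ≡ r i
      r-of i = trans ([m+kn]%n≡m%n (r i) (s i) ℓ) (m<n⇒m%n≡m (ℕ.<-≤-trans (r<R i) R≤ℓ))
      r≡ : r i ≡ r i′
      r≡ = trans (sym (r-of i)) (trans (cong (_% ℓ) eq) (r-of i′))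
      s≡ : s i ≡ s i′
      s≡ = ℕ.*-cancelʳ-≡ (s i) (s i′) ℓ (ℕ.+-cancelˡ-≡ (r i) _ _ (trans eq (cong (ℕ._+ s i′ ℕ.* ℓ) (sym r≡))))

    -- Equal to U / n̂, so that (1 + x)^n̂ stays below 4^U.
    x : Carrier
    x = ½^ (suc p)

    0≤x : 0# ≤ x
    0≤x = 0≤½^ (suc p)

    1≤1+x : 1# ≤ 1# + x
    1≤1+x = by-diff x 0≤x (solve 1 (λ x → c1 :+ x :- c1 := x) refl x)

    [1+x]^n̂≤ : (1# + x) ^ n̂ ≤ 2^ (2 ℕ.* U)
    [1+x]^n̂≤ = ≡⇒≤ (^-* (1# + x) (2 ℕ.^ suc p) U) ⟨≤⟩
      ^-mono U (^-nonneg (2 ℕ.^ suc p) (0≤1 ⟨≤⟩ 1≤1+x)) ([1+½^]^≤4 p) ⟨≤⟩ ≡⇒≤ (sym (^-* 2# 2 U))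

    U<n̂ : U ℕ.< n̂
    U<n̂ = ℕ.<-≤-trans (ℕ.m<m+n U 1≤U) (ℕ.≤-trans (ℕ.≤-reflexive (cong (U ℕ.+_) (sym (ℕ.+-identityʳ U)))) (ℕ.*-monoˡ-≤ U (ℕ.≤-trans (ℕ.≤-reflexive (sym (ℕ.*-identityʳ 2))) (ℕ.*-monoʳ-≤ 2 (ℕ.m^n>0 2 p)))))

    -- One term of the binomial expansion is at most the whole: C(e,j) x^j ≤ (1 + x)^e ≤ 4^U.
    -- Dividing by x^j costs (p + 1) U bits, much less than the trivial bound 2^e.
    ιbin≤ : ∀ i → i ℕ.< N → ∀ j → j ℕ.≤ U → ιbin (e i) j ≤ 2^ b̂
    ιbin≤ i i<N j j≤U = ≡⇒≤ (trans (sym (R.*-identityʳ _)) (trans (cong (_*_ (ιbin (e i) j)) (sym xj)) (sym (R.*-assoc _ _ _)))) ⟨≤⟩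
      *-mono-≤ (*-nonneg (0≤ιℕ (bin (e i) j)) (^-nonneg j 0≤x))
        (Sum-term n̂ (λ j → ιbin (e i) j * x ^ j) j (λ j → *-nonneg (0≤ιℕ (bin (e i) j)) (^-nonneg j 0≤x)) (ℕ.≤-<-trans j≤U U<n̂) ⟨≤⟩
         ≡⇒≤ (sym (binomial x n̂ (e i) (e<n̂ i i<N))) ⟨≤⟩ ^-monoʳ {1# + x} 1≤1+x (ℕ.<⇒≤ (e<n̂ i i<N)) ⟨≤⟩ [1+x]^n̂≤)
        (^-nonneg j (0≤2^ (suc p))) (^-monoʳ {2^ (suc p)} (1≤2^ (suc p)) j≤U ⟨≤⟩ ≡⇒≤ (sym (^-* 2# (suc p) U))) ⟨≤⟩
      ≡⇒≤ (trans (2^[ 2 ℕ.* U ]*2^[ suc p ℕ.* U ]) (cong 2^_ (lemma p U)))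
      where
      xj : x ^ j * (2^ (suc p)) ^ j ≡ 1#
      xj = trans (sym (^-distrib-* x (2^ (suc p)) j)) (trans (cong (_^ j) (trans (R.*-comm _ _) (2^*½^ (suc p)))) (1^ j))
      lemma : ∀ p U → 2 ℕ.* U ℕ.+ suc p ℕ.* U ≡ (p ℕ.+ 3) ℕ.* U
      lemma = solve-∀

    bin≤ : ∀ i → i ℕ.< N → ∀ j → j ℕ.≤ U → bin (e i) j ℕ.≤ 2 ℕ.^ b̂
    bin≤ i i<N j j≤U = ιℕ-reflects (ιbin≤ i i<N j j≤U ⟨≤⟩ ≡⇒≤ (sym (ιℕ-2^ b̂)))

    private
      Eₛ : ℕ
      Eₛ = suc U ℕ.+ (y ℕ.+ b̂)

      siegel-bound : ∀ (x : ℕ → ℕ) → (∀ i → x i ℕ.< 2 ℕ.^ y) → ∀ j → j ℕ.< U → SumN N (λ i → x i ℕ.* bin (e i) j) ℕ.< 2 ℕ.^ Eₛ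
      siegel-bound x x< j j<U = ℕ.≤-<-trans (SumN-mono N (λ i i<N → ℕ.*-mono-≤ (ℕ.<⇒≤ (x< i)) (bin≤ i i<N j (ℕ.<⇒≤ j<U))))
        (ℕ.≤-<-trans (ℕ.≤-reflexive (trans (SumN-const N _) (cong (N ℕ.*_) (sym (ℕ.^-distribˡ-+-* 2 y b̂)))))
          (ℕ.<-≤-trans (ℕ.*-monoˡ-< (2 ℕ.^ (y ℕ.+ b̂)) {{ℕ.>-nonZero (ℕ.m^n>0 2 (y ℕ.+ b̂))}} N<2^) (ℕ.≤-reflexive (sym (ℕ.^-distribˡ-+-* 2 (suc U) (y ℕ.+ b̂))))))

      siegel-room : (2 ℕ.^ Eₛ) ℕ.^ U ℕ.< (2 ℕ.^ y) ℕ.^ N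
      siegel-room = ℕ.≤-<-trans (ℕ.≤-reflexive (^-pow2 Eₛ U)) (ℕ.<-≤-trans (ℕ.^-monoʳ-< 2 (s≤s (s≤s z≤n)) lt) (ℕ.≤-reflexive (sym (^-pow2 y N))))
        where
        -- This decides the choice of y: Eₛ is (2p + 9) U + 1 and 2y is (2p + 10) U, so U ≥ 2
        -- suffices.
        Eₛ< : Eₛ ℕ.< 2 ℕ.* y
        Eₛ< = ℕ.≤-trans (ℕ.≤-reflexive (lemma₁ p U)) (ℕ.≤-trans (ℕ.+-monoˡ-≤ ((2 ℕ.* p ℕ.+ 9) ℕ.* U) 2≤U) (ℕ.≤-reflexive (lemma₂ p U)))
          where
          lemma₁ : ∀ p U → suc (suc U ℕ.+ ((p ℕ.+ 5) ℕ.* U ℕ.+ (p ℕ.+ 3) ℕ.* U)) ≡ 2 ℕ.+ (2 ℕ.* p ℕ.+ 9) ℕ.* U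
          lemma₁ = solve-∀
          lemma₂ : ∀ p U → U ℕ.+ (2 ℕ.* p ℕ.+ 9) ℕ.* U ≡ 2 ℕ.* ((p ℕ.+ 5) ℕ.* U)
          lemma₂ = solve-∀
        lt : Eₛ ℕ.* U ℕ.< y ℕ.* N
        lt = ℕ.<-≤-trans (ℕ.*-monoˡ-< U {{ℕ.>-nonZero 1≤U}} Eₛ<) (ℕ.≤-reflexive (trans (lemma y U) (cong (y ℕ.*_) (sym N≡))))
          where
          lemma : ∀ y U → 2 ℕ.* y ℕ.* U ≡ y ℕ.* (2 ℕ.* U)
          lemma = solve-∀

    open Siegel N U (2 ℕ.^ y) (2 ℕ.^ Eₛ) (λ i j → bin (e i) j) (ℕ.m^n>0 2 y) siegel-bound siegel-room using (Relation; relation)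
    open Relation relation public using (q; q-bound)

    Order : Set
    Order = Σ ℕ λ K → U ℕ.≤ K × K ℕ.< N × ¬ (moment N q e K ≡ + 0) × (∀ j → j ℕ.< K → moment N q e j ≡ + 0)

    order : Order
    order = pick (first-nonzero (moment N q e) N)
      where
      pick : (∀ j → j ℕ.< N → moment N q e j ≡ + 0) ⊎
             (Σ ℕ λ K → K ℕ.< N × ¬ (moment N q e K ≡ + 0) × (∀ j → j ℕ.< K → moment N q e j ≡ + 0)) → Order
      pick (inj₁ z) = ⊥-elim (Relation.nonzero relation (moments-zero N q e e-injective z))
      pick (inj₂ (K , K<N , nz , z)) = K , ℕ.≮⇒≥ (λ K<U → nz (Relation.vanish relation K K<U)) , K<N , nz , z

    K : ℕ
    K = proj₁ order

    -- The positive and negative parts of m - ℓ m₁. Since γ₁ α^(n₁ ℓ + s₀) ≈ γ₂ φ^m, the power ηˡ is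
    -- close to γ₂ φ^(m - ℓ m₁) / (γ₁ α^s₀), whose numerator and denominator are the next two
    -- expressions.
    t₊ t₋ : ℕ
    t₊ = m ℕ.∸ ℓ ℕ.* m₁
    t₋ = ℓ ℕ.* m₁ ℕ.∸ m

    Θ₁ Θ₂ : E₂
    Θ₁ = Γ₂ ⊗₂ φ₂ ^₂ t₊
    Θ₂ = Γ₁ d ⊗₂ x₂ ^₂ s₀ ⊗₂ φ₂ ^₂ t₋

    -- V j is the j-th Taylor coefficient at η of Σ qᵢ x^(e i), with xˡ replaced by θ₁ / θ₂ and
    -- denominators cleared.
    termE : ℕ → ℕ → E₂
    termE j i = con₂ (q i ℤ.* + bin (e i) j) ⊗₂ ((x₂ ^₂ n₁) ^₂ r i) ⊗₂ ((φ₂ ^₂ m₁) ^₂ (R ℕ.∸ r i)) ⊗₂ (Θ₁ ^₂ s i) ⊗₂ (Θ₂ ^₂ (S ℕ.∸ s i))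

    V : ℕ → E₂
    V j = ΣE N (termE j)

    -- Z counts the bits of the height of `V`. W is n₁ ℓ / 2, and as a² ≥ 2 the power a^(n₁ ℓ) is at
    -- least 2^W; this is the accuracy of θ.
    Z W : ℕ
    Z = (2 ℕ.* p ℕ.+ 24) ℕ.* U
    W = 2 ℕ.^ p′ ℕ.* U

    precision : ℕ
    precision = SumN U (λ j → need₂ (V j) Z W)

    SumN-term : ∀ n f k → k ℕ.< n → f k ℕ.≤ SumN n f
    SumN-term (suc n) f zero _ = ℕ.m≤m+n _ _
    SumN-term (suc n) f (suc k) (s≤s p) = ℕ.≤-trans (SumN-term n (λ i → f (suc i)) k p) (ℕ.m≤n+m _ _)

-- Sizes of η, θ and the exponents.

module SizeEstimates (𝔽 : OrderedField) (𝓖 : KBonacci) (d : ℕ) where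
  open KBonacci 𝓖
  open FieldTheory 𝔽
  open Pisot 𝔽 k 3≤k
  open Approximation 𝔽 k 3≤k
  open Liouville 𝔽 𝓖
  open GoldenExtension 𝔽 𝓖

  open MultiplicativeIndependence 𝔽 𝓖

  open LinearForm 𝔽 𝓖
  open SmallUnits 𝔽 𝓖
  open Combinatorics
  open HermitePadé 𝔽
  open import Data.Nat.DivMod using (_/_; _%_; m≡m%n+[m/n]*n; m%n<n; m<n*o⇒m/o<n; [m+kn]%n≡m%n; m<n⇒m%n≡m)

  open AuxiliaryPolynomial 𝔽 𝓖 d

  ≤-dy : ∀ {z n} → 0# ≤ z → z ≤ 2^ n → Dy z n 0
  ≤-dy {z} {n} p q = ≤2^⇒dy n (≡⇒≤ (abs-nonneg p) ⟨≤⟩ q)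

  balance : ∀ m t → m ℕ.+ (t ℕ.∸ m) ≡ t ℕ.+ (m ℕ.∸ t)
  balance m t with ℕ.≤-total m t
  ... | inj₁ p = trans (ℕ.m+[n∸m]≡n p) (trans (sym (ℕ.+-identityʳ t)) (cong (t ℕ.+_) (sym (ℕ.m≤n⇒m∸n≡0 p))))
  ... | inj₂ p = trans (cong (m ℕ.+_) (ℕ.m≤n⇒m∸n≡0 p)) (trans (ℕ.+-identityʳ m) (sym (ℕ.m+[n∸m]≡n p)))

  halve : ∀ K → 2 ℕ.≤ K → Σ ℕ λ m → suc m ℕ.+ suc m ℕ.≤ K × K ℕ.≤ suc (suc m ℕ.+ suc m)
  halve (suc zero) (s≤s ())
  halve (suc (suc zero)) _ = 0 , ℕ.≤-refl , ℕ.n≤1+n 2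
  halve (suc (suc (suc zero))) _ = 0 , ℕ.n≤1+n 2 , ℕ.≤-refl
  halve (suc (suc (suc (suc K)))) _ = up (halve (suc (suc K)) (s≤s (s≤s z≤n)))
    where
    up : (Σ ℕ λ m → suc m ℕ.+ suc m ℕ.≤ suc (suc K) × suc (suc K) ℕ.≤ suc (suc m ℕ.+ suc m)) →
         Σ ℕ λ m → suc m ℕ.+ suc m ℕ.≤ suc (suc (suc (suc K))) × suc (suc (suc (suc K))) ℕ.≤ suc (suc m ℕ.+ suc m)
    up (m , p , q) = suc m , ℕ.≤-trans (ℕ.≤-reflexive (lemma m)) (s≤s (s≤s p)) , ℕ.≤-trans (s≤s (s≤s q)) (ℕ.≤-reflexive (cong suc (sym (lemma m))))
      where
      lemma : ∀ m → suc (suc m) ℕ.+ suc (suc m) ≡ suc (suc (suc m ℕ.+ suc m))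
      lemma = solve-∀

  -- The three summands make R dominate, respectively, the fixed part of `τ`, the constants of the
  -- linear form, and the intercept of the Liouville exponent.
  R₀ : ℕ → ℕ → ℕ
  R₀ n₁ P = 2 ℕ.* (3 ℕ.* g₀ ℕ.+ 2 ℕ.+ 3 ℕ.* (n₁ ℕ.* P)) ℕ.+ (g₀ ℕ.+ 1 ℕ.+ c₀) ℕ.+ (c₂ ℕ.+ 2)

  module Estimates (n₁ p′ R s₀ m₁ m : ℕ) {{R≢0 : ℕ.NonZero R}} (1≤n₁ : 1 ℕ.≤ n₁) (2≤U : 2 ℕ.≤ R ℕ.* n₁)
                   (hR : R₀ n₁ (2 ℕ.^ suc p′) ℕ.≤ R) (hs : s₀ ℕ.≤ n₁ ℕ.* 2 ℕ.^ suc p′) where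
    open Construction n₁ p′ R s₀ m₁ m 1≤n₁ 2≤U

    -- `T` will bound `t₊` and `t₋`, its factor 2 stemming from b² ≥ 2, and 2^τ the heights of `Θ₁`
    -- and `Θ₂`.
    j T τ : ℕ
    j = n₁ ℕ.* ℓ ℕ.+ s₀
    T = 2 ℕ.* (g₀ ℕ.+ 1 ℕ.+ s₀ ℕ.+ 2 ℕ.* R)
    τ = g₀ ℕ.+ s₀ ℕ.+ T

    R≤U : R ℕ.≤ U
    R≤U = ℕ.≤-trans (ℕ.≤-reflexive (sym (ℕ.*-identityʳ R))) (ℕ.*-monoʳ-≤ R 1≤n₁)

    S≤2U : S ℕ.≤ 2 ℕ.* U
    S≤2U = ℕ.*-monoʳ-≤ 2 (ℕ.≤-trans (ℕ.≤-reflexive (sym (ℕ.*-identityˡ n₁))) (ℕ.*-monoˡ-≤ n₁ (ℕ.>-nonZero⁻¹ R)))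

    hR₁ : 2 ℕ.* (3 ℕ.* g₀ ℕ.+ 2 ℕ.+ 3 ℕ.* (n₁ ℕ.* P)) ℕ.≤ R
    hR₁ = ℕ.≤-trans (ℕ.≤-trans (ℕ.m≤m+n _ (g₀ ℕ.+ 1 ℕ.+ c₀)) (ℕ.m≤m+n _ (c₂ ℕ.+ 2))) hR

    hR₂ : g₀ ℕ.+ 1 ℕ.+ c₀ ℕ.≤ R
    hR₂ = ℕ.≤-trans (ℕ.≤-trans (ℕ.m≤n+m _ (2 ℕ.* (3 ℕ.* g₀ ℕ.+ 2 ℕ.+ 3 ℕ.* (n₁ ℕ.* P)))) (ℕ.m≤m+n _ (c₂ ℕ.+ 2))) hR

    hR₃ : c₂ ℕ.+ 2 ℕ.≤ R
    hR₃ = ℕ.≤-trans (ℕ.m≤n+m _ (2 ℕ.* (3 ℕ.* g₀ ℕ.+ 2 ℕ.+ 3 ℕ.* (n₁ ℕ.* P)) ℕ.+ (g₀ ℕ.+ 1 ℕ.+ c₀))) hR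

    τS≤ : τ ℕ.* S ℕ.≤ 9 ℕ.* U
    τS≤ = ℕ.≤-trans (ℕ.≤-reflexive (lemma₁ g₀ s₀ R n₁)) (ℕ.≤-trans (ℕ.+-monoˡ-≤ (8 ℕ.* (R ℕ.* n₁)) (ℕ.*-monoˡ-≤ n₁
        (ℕ.≤-trans (ℕ.*-monoʳ-≤ 2 (ℕ.+-monoʳ-≤ (3 ℕ.* g₀ ℕ.+ 2) (ℕ.*-monoʳ-≤ 3 hs))) hR₁))) (ℕ.≤-reflexive (lemma₂ (R ℕ.* n₁))))
      where
      lemma₁ : ∀ g s R n → (g ℕ.+ s ℕ.+ 2 ℕ.* (g ℕ.+ 1 ℕ.+ s ℕ.+ 2 ℕ.* R)) ℕ.* (2 ℕ.* n) ≡
                           2 ℕ.* (3 ℕ.* g ℕ.+ 2 ℕ.+ 3 ℕ.* s) ℕ.* n ℕ.+ 8 ℕ.* (R ℕ.* n)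
      lemma₁ = solve-∀
      lemma₂ : ∀ u → u ℕ.+ 8 ℕ.* u ≡ 9 ℕ.* u
      lemma₂ = solve-∀

    module WithApproximation {X : ℕ} (root : Root X) (golden : Golden X) where
      open Evaluation₂ root golden
      open Linear root golden d using (γ₁; γ₂; 1≤γ₁; 1≤γ₂; eval-Γ₁; eval-Γ₂)
      open SmallUnit root golden using (2^≤b^; 2^-reflects)

      module Bounds (w-upper : ∣ a ^ n₁ - b ^ m₁ ∣ ≤ ½^ (cc ℕ.* p) * b ^ m₁)
               (w-lower : ½^ (2 ℕ.* (cc ℕ.* p)) * b ^ m₁ ≤ ∣ a ^ n₁ - b ^ m₁ ∣)
               (Λ : ∣ γ₁ * a ^ j - γ₂ * b ^ m ∣ ≤ 2^ c₀) where
        β̂ β̂⁻¹ η w μ : Carrier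
        β̂ = b ^ m₁
        b⁻¹ : Carrier
        b⁻¹ = proj₁ (inverse b (1≤⇒≰0 1≤b))
        β̂⁻¹ = b⁻¹ ^ m₁
        η = a ^ n₁ * β̂⁻¹
        w = η - 1#
        μ = ∣ w ∣

        0≤μ : 0# ≤ μ
        0≤μ = 0≤abs w

        1≤β̂ : 1# ≤ β̂
        1≤β̂ = 1≤^ m₁ 1≤b

        0≤β̂ : 0# ≤ β̂
        0≤β̂ = 0≤1 ⟨≤⟩ 1≤β̂

        ηβ̂ : η * β̂ ≡ a ^ n₁
        ηβ̂ = trans (R.*-assoc _ _ _) (trans (cong (_*_ (a ^ n₁)) (trans (sym (^-distrib-* b⁻¹ b m₁)) (trans (cong (_^ m₁) (trans (R.*-comm _ _) (proj₂ (proj₂ (inverse b (1≤⇒≰0 1≤b)))))) (1^ m₁)))) (R.*-identityʳ _))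

        1+w≡η : 1# + w ≡ η
        1+w≡η = solve 1 (λ h → c1 :+ (h :- c1) := h) refl η

        μβ̂ : β̂ * μ ≡ ∣ a ^ n₁ - β̂ ∣
        μβ̂ = trans (cong (_* μ) (sym (abs-nonneg 0≤β̂))) (trans (sym (abs-* β̂ w)) (cong ∣_∣ (trans (solve 2 (λ b h → b :* (h :- c1) := h :* b :- b) refl β̂ η) (cong (_- β̂) ηβ̂))))

        μ≤ : μ ≤ ½^ (cc ℕ.* p)
        μ≤ = *-cancelˡ-≤ β̂ (1≤⇒≰0 1≤β̂) (≡⇒≤ μβ̂ ⟨≤⟩ w-upper ⟨≤⟩ ≡⇒≤ (R.*-comm _ _))

        ≤μ : ½^ (2 ℕ.* (cc ℕ.* p)) ≤ μ
        ≤μ = *-cancelˡ-≤ β̂ (1≤⇒≰0 1≤β̂) (≡⇒≤ (R.*-comm _ _) ⟨≤⟩ w-lower ⟨≤⟩ ≡⇒≤ (sym μβ̂))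

        p≤ccp : p ℕ.≤ cc ℕ.* p
        p≤ccp = ℕ.≤-trans (ℕ.≤-reflexive (sym (ℕ.*-identityˡ p))) (ℕ.*-monoˡ-≤ p 1≤cc)

        μ≤½^p : μ ≤ ½^ p
        μ≤½^p = μ≤ ⟨≤⟩ ½^-anti p≤ccp

        μ≤1 : μ ≤ 1#
        μ≤1 = μ≤½^p ⟨≤⟩ ½^≤1 p

        η≤ : η ≤ 1# + ½^ p
        η≤ = ≡⇒≤ (sym 1+w≡η) ⟨≤⟩ +-monoʳ-≤ 1# (≤abs w ⟨≤⟩ μ≤½^p)

        ≤η : 1# - ½^ p ≤ η
        ≤η = +-monoʳ-≤ 1# (neg-mono (-≤abs w ⟨≤⟩ μ≤½^p)) ⟨≤⟩ ≡⇒≤ (trans (cong (_+_ 1#) (RP.-‿involutive w)) 1+w≡η)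

        ½≤η : ½ ≤ η
        ½≤η = ≡⇒≤ (trans (solve 1 (λ h → h := (h :+ h) :- h) refl ½) (cong (_- ½) ½+½)) ⟨≤⟩
          +-monoʳ-≤ 1# (neg-mono (½^-anti {1} {p} (s≤s z≤n) ⟨≤⟩ ≡⇒≤ (R.*-identityʳ ½))) ⟨≤⟩ ≤η

        0≤η : 0# ≤ η
        0≤η = 0≤½ ⟨≤⟩ ½≤η

        η≤2 : η ≤ 2#
        η≤2 = η≤ ⟨≤⟩ +-monoʳ-≤ 1# (½^≤1 p)

        -- As ℓ = 2^p R and |w| ≤ 2^(-p), each of the R blocks of 2^p factors contributes at most 4.
        η^ℓ≤ : η ^ ℓ ≤ 2^ (2 ℕ.* R)
        η^ℓ≤ = ≡⇒≤ (^-* η P R) ⟨≤⟩ ^-mono R (^-nonneg P 0≤η) (^-mono P 0≤η η≤ ⟨≤⟩ [1+½^]^≤4 p′) ⟨≤⟩ ≡⇒≤ (sym (^-* 2# 2 R))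

        ≤η^ℓ : 1# ≤ 2^ (2 ℕ.* R) * η ^ ℓ
        ≤η^ℓ = 1≤^ R (1≤4*[1-½^]^ p′ ⟨≤⟩ *-monoʳ-≤ (0≤2^ 2) (^-mono P (≤⇒0≤- (½^≤1 p)) ≤η)) ⟨≤⟩
          ≡⇒≤ (trans (^-distrib-* (2^ 2) (η ^ P) R) (cong₂ _*_ (sym (^-* 2# 2 R)) (sym (^-* η P R))))

        0≤η^ℓ : 0# ≤ η ^ ℓ
        0≤η^ℓ = ^-nonneg ℓ 0≤η

        2≤a² : 2# ≤ a * a
        2≤a² = *-cancelˡ-≤ 2# (1≤⇒≰0 1≤2) (*-cancelˡ-≤ 2# (1≤⇒≰0 1≤2)
          (by-diff ((2# * a - 3#) * (2# * a - 3#) + 3# * 2# * (2# * a - 3#) + 1#)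
            (+-nonneg (+-nonneg (*-nonneg 0≤t 0≤t) (*-nonneg (*-nonneg (0≤ιℕ 3) 0≤2) 0≤t)) 0≤1)
            (solve 1 (λ b → c2 :* (c2 :* (b :* b)) :- c2 :* (c2 :* c2) :=
               (c2 :* b :- c3) :* (c2 :* b :- c3) :+ c3 :* c2 :* (c2 :* b :- c3) :+ c1) refl a)))
          where 0≤t = ≤⇒0≤- 3≤2a

        2^≤a^ : ∀ n → 2^ n ≤ a ^ (2 ℕ.* n)
        2^≤a^ n = ^-mono n 0≤2 (2≤a² ⟨≤⟩ ≡⇒≤ (solve 1 (λ a → a :* a := a :* (a :* c1)) refl a)) ⟨≤⟩ ≡⇒≤ (sym (^-* a 2 n))

        b^≤ : ∀ n → b ^ n ≤ 2^ n
        b^≤ n = ^-mono n 0≤b b≤2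

        a^≤ : ∀ n → a ^ n ≤ 2^ n
        a^≤ n = ^-mono n 0≤a a≤2

        m₁≤ : m₁ ℕ.≤ 4 ℕ.* n₁
        m₁≤ = ℕ.≤-trans (2^-reflects (2^≤b^ m₁ ⟨≤⟩ *-mono-≤ 0≤β̂ β̂≤ 0≤β̂ β̂≤ ⟨≤⟩ ≡⇒≤ (2^[ suc n₁ ]*2^[ suc n₁ ])))
            (ℕ.≤-trans (ℕ.≤-reflexive (lemma₁ n₁)) (ℕ.≤-trans (ℕ.+-monoˡ-≤ (2 ℕ.* n₁) (ℕ.*-monoʳ-≤ 2 1≤n₁)) (ℕ.≤-reflexive (lemma₂ n₁))))
          where
          β̂≤ : β̂ ≤ 2^ (suc n₁)
          β̂≤ = ≡⇒≤ (trans (sym (R.*-identityˡ β̂)) (trans (cong (_* β̂) (sym 2*½)) (R.*-assoc _ _ _))) ⟨≤⟩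
            *-monoʳ-≤ 0≤2 (*-monoˡ-≤ 0≤β̂ ½≤η ⟨≤⟩ ≡⇒≤ ηβ̂ ⟨≤⟩ a^≤ n₁)
          lemma₁ : ∀ n → suc n ℕ.+ suc n ≡ 2 ℕ.* 1 ℕ.+ 2 ℕ.* n
          lemma₁ = solve-∀
          lemma₂ : ∀ n → 2 ℕ.* n ℕ.+ 2 ℕ.* n ≡ 4 ℕ.* n
          lemma₂ = solve-∀

        m₁R≤ : m₁ ℕ.* R ℕ.≤ 4 ℕ.* U
        m₁R≤ = ℕ.≤-trans (ℕ.*-monoˡ-≤ R m₁≤) (ℕ.≤-reflexive (lemma n₁ R))
          where
          lemma : ∀ n R → 4 ℕ.* n ℕ.* R ≡ 4 ℕ.* (R ℕ.* n)
          lemma = solve-∀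

        nΓ₁≤ : nrm₂ (Γ₁ d) ℕ.≤ 2 ℕ.^ g₀
        nΓ₁≤ = ℕ.≤-trans (ℕ.m≤m+n _ (nrm₂ Γ₂)) (ℕ.<⇒≤ (n<2^n g₀))

        nΓ₂≤ : nrm₂ Γ₂ ℕ.≤ 2 ℕ.^ g₀
        nΓ₂≤ = ℕ.≤-trans (ℕ.m≤n+m _ (nrm₂ (Γ₁ d))) (ℕ.<⇒≤ (n<2^n g₀))

        γ₁≤ : γ₁ ≤ 2^ g₀
        γ₁≤ = ≤abs γ₁ ⟨≤⟩ ≡⇒≤ (cong ∣_∣ (sym eval-Γ₁)) ⟨≤⟩ eval₂≤ (Γ₁ d) ⟨≤⟩ ≤2^-ιℕ g₀ nΓ₁≤

        γ₂≤ : γ₂ ≤ 2^ g₀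
        γ₂≤ = ≤abs γ₂ ⟨≤⟩ ≡⇒≤ (cong ∣_∣ (sym eval-Γ₂)) ⟨≤⟩ eval₂≤ Γ₂ ⟨≤⟩ ≤2^-ιℕ g₀ nΓ₂≤

        0≤a^j : 0# ≤ a ^ j
        0≤a^j = ^-nonneg j 0≤a

        0≤b^m : 0# ≤ b ^ m
        0≤b^m = ^-nonneg m 0≤b

        2^W≤ : 2^ W ≤ a ^ (n₁ ℕ.* ℓ)
        2^W≤ = 2^≤a^ W ⟨≤⟩ ≡⇒≤ (cong (a ^_) (lemma (2 ℕ.^ p′) R n₁))
          where
          lemma : ∀ P R n → 2 ℕ.* (P ℕ.* (R ℕ.* n)) ≡ n ℕ.* (2 ℕ.* P ℕ.* R)
          lemma = solve-∀

        -- The main term is at least twice the error of the linear form, so γ₁ a^j and γ₂ b^m agree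
        -- up to a factor 2; `a^j≤` and `b^m≤` follow.
        main-term : 2^ (suc c₀) ≤ γ₁ * a ^ j
        main-term = 2^-mono {suc c₀} {W} (ℕ.≤-trans (ℕ.≤-trans (ℕ.≤-reflexive (ℕ.+-comm 1 c₀)) (ℕ.≤-trans (ℕ.≤-trans (ℕ.m≤n+m (c₀ ℕ.+ 1) g₀) (ℕ.≤-reflexive (lemma g₀ c₀))) (ℕ.≤-trans hR₂ R≤U)))
              (ℕ.≤-trans (ℕ.≤-reflexive (sym (ℕ.*-identityˡ U))) (ℕ.*-monoˡ-≤ U (ℕ.m^n>0 2 p′)))) ⟨≤⟩ 2^W≤ ⟨≤⟩
          ^-monoʳ 1≤a (ℕ.m≤m+n (n₁ ℕ.* ℓ) s₀) ⟨≤⟩ ≡⇒≤ (sym (R.*-identityˡ _)) ⟨≤⟩ *-monoˡ-≤ 0≤a^j 1≤γ₁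
          where
          lemma : ∀ g c → g ℕ.+ (c ℕ.+ 1) ≡ g ℕ.+ 1 ℕ.+ c
          lemma = solve-∀

        a^j≤ : a ^ j ≤ 2^ (suc g₀) * b ^ m
        a^j≤ = ≡⇒≤ (sym (R.*-identityˡ _)) ⟨≤⟩ *-monoˡ-≤ 0≤a^j 1≤γ₁ ⟨≤⟩
          by-diff ((γ₁ * a ^ j - 2# * 2^ c₀) + 2# * (2^ c₀ - (γ₁ * a ^ j - γ₂ * b ^ m)))
            (+-nonneg (≤⇒0≤- main-term) (*-nonneg 0≤2 (≤⇒0≤- (≤abs _ ⟨≤⟩ Λ))))
            (solve 3 (λ x y c → c2 :* y :- x := (x :- c2 :* c) :+ c2 :* (c :- (x :- y))) refl (γ₁ * a ^ j) (γ₂ * b ^ m) (2^ c₀)) ⟨≤⟩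
          ≡⇒≤ (sym (R.*-assoc _ _ _)) ⟨≤⟩ *-monoˡ-≤ 0≤b^m (*-monoʳ-≤ 0≤2 γ₂≤)

        b^m≤ : b ^ m ≤ 2^ (suc g₀) * a ^ j
        b^m≤ = ≡⇒≤ (sym (R.*-identityˡ _)) ⟨≤⟩ *-monoˡ-≤ 0≤b^m 1≤γ₂ ⟨≤⟩
          by-diff ((γ₁ * a ^ j - 2# * 2^ c₀) + (2^ c₀ - (- (γ₁ * a ^ j - γ₂ * b ^ m))) + 2^ c₀)
            (+-nonneg (+-nonneg (≤⇒0≤- main-term) (≤⇒0≤- (-≤abs _ ⟨≤⟩ Λ))) (0≤2^ c₀))
            (solve 3 (λ x y c → c2 :* x :- y := (x :- c2 :* c) :+ (c :- (:- (x :- y))) :+ c) refl (γ₁ * a ^ j) (γ₂ * b ^ m) (2^ c₀)) ⟨≤⟩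
          ≡⇒≤ (sym (R.*-assoc _ _ _)) ⟨≤⟩ *-monoˡ-≤ 0≤a^j (*-monoʳ-≤ 0≤2 γ₁≤)

        B : Carrier
        B = β̂ ^ ℓ

        1≤B : 1# ≤ B
        1≤B = 1≤^ ℓ 1≤β̂

        0≤B : 0# ≤ B
        0≤B = 0≤1 ⟨≤⟩ 1≤B

        a^n₁ℓ : a ^ (n₁ ℕ.* ℓ) ≡ η ^ ℓ * B
        a^n₁ℓ = trans (^-* a n₁ ℓ) (trans (cong (_^ ℓ) (sym ηβ̂)) (^-distrib-* η β̂ ℓ))

        a^j≡ : a ^ j ≡ η ^ ℓ * B * a ^ s₀
        a^j≡ = trans (^-+ a (n₁ ℕ.* ℓ) s₀) (cong (_* a ^ s₀) a^n₁ℓ)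

        b^ℓm₁ : b ^ (ℓ ℕ.* m₁) ≡ B
        b^ℓm₁ = trans (cong (b ^_) (ℕ.*-comm ℓ m₁)) (^-* b m₁ ℓ)

        bb : b ^ m * b ^ t₋ ≡ B * b ^ t₊
        bb = trans (sym (^-+ b m t₋)) (trans (cong (b ^_) (balance m (ℓ ℕ.* m₁))) (trans (^-+ b (ℓ ℕ.* m₁) t₊) (cong (_* b ^ t₊) b^ℓm₁)))

        -- If the exponent is positive, `bb` makes b^t₊ the quotient of b^m by B, and b^m is at most
        -- a constant times a^j = ηˡ B a^s₀.
        b^t₊≤ : b ^ t₊ ≤ 2^ (g₀ ℕ.+ 1 ℕ.+ s₀ ℕ.+ 2 ℕ.* R)
        b^t₊≤ = pick (ℕ.≤-total m (ℓ ℕ.* m₁))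
          where
          pick : (m ℕ.≤ ℓ ℕ.* m₁) ⊎ (ℓ ℕ.* m₁ ℕ.≤ m) → b ^ t₊ ≤ 2^ (g₀ ℕ.+ 1 ℕ.+ s₀ ℕ.+ 2 ℕ.* R)
          pick (inj₁ q) = ≡⇒≤ (cong (b ^_) (ℕ.m≤n⇒m∸n≡0 q)) ⟨≤⟩ 1≤2^ (g₀ ℕ.+ 1 ℕ.+ s₀ ℕ.+ 2 ℕ.* R)
          pick (inj₂ q) = *-cancelˡ-≤ B (1≤⇒≰0 1≤B) (≡⇒≤ (trans (sym bb) (trans (cong (λ z → b ^ m * b ^ z) (ℕ.m≤n⇒m∸n≡0 q)) (R.*-identityʳ _))) ⟨≤⟩ b^m≤ ⟨≤⟩
            *-monoʳ-≤ (0≤2^ (suc g₀)) (≡⇒≤ a^j≡ ⟨≤⟩ *-mono-≤ (*-nonneg 0≤η^ℓ 0≤B) (*-monoˡ-≤ 0≤B η^ℓ≤) (^-nonneg s₀ 0≤a) (a^≤ s₀)) ⟨≤⟩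
            ≡⇒≤ (trans (solve 4 (λ g r b s → g :* (r :* b :* s) := b :* (g :* s :* r)) refl (2^ (suc g₀)) (2^ (2 ℕ.* R)) B (2^ s₀))
              (cong (_*_ B) (trans (cong (_* 2^ (2 ℕ.* R)) (2^[ suc g₀ ]*2^[ s₀ ])) (trans (2^[ suc g₀ ℕ.+ s₀ ]*2^[ 2 ℕ.* R ]) (cong (λ z → 2^ (z ℕ.+ s₀ ℕ.+ 2 ℕ.* R)) (ℕ.+-comm 1 g₀)))))))

        b^t₋≤ : b ^ t₋ ≤ 2^ (g₀ ℕ.+ 1 ℕ.+ 2 ℕ.* R)
        b^t₋≤ = pick (ℕ.≤-total m (ℓ ℕ.* m₁))
          where
          0≤b^t₋ = ^-nonneg t₋ 0≤b
          pick : (m ℕ.≤ ℓ ℕ.* m₁) ⊎ (ℓ ℕ.* m₁ ℕ.≤ m) → b ^ t₋ ≤ 2^ (g₀ ℕ.+ 1 ℕ.+ 2 ℕ.* R)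
          pick (inj₂ q) = ≡⇒≤ (cong (b ^_) (ℕ.m≤n⇒m∸n≡0 q)) ⟨≤⟩ 1≤2^ (g₀ ℕ.+ 1 ℕ.+ 2 ℕ.* R)
          pick (inj₁ q) = ≡⇒≤ (sym (R.*-identityˡ _)) ⟨≤⟩ *-monoˡ-≤ 0≤b^t₋ ≤η^ℓ ⟨≤⟩ ≡⇒≤ (R.*-assoc _ _ _) ⟨≤⟩
            *-monoʳ-≤ (0≤2^ (2 ℕ.* R)) (*-cancelˡ-≤ B (1≤⇒≰0 1≤B)
              (≡⇒≤ (solve 3 (λ b h t → b :* (h :* t) := h :* b :* t) refl B (η ^ ℓ) (b ^ t₋)) ⟨≤⟩
               *-monoˡ-≤ 0≤b^t₋ (≡⇒≤ (sym a^n₁ℓ) ⟨≤⟩ ^-monoʳ 1≤a (ℕ.m≤m+n (n₁ ℕ.* ℓ) s₀) ⟨≤⟩ a^j≤) ⟨≤⟩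
               ≡⇒≤ (trans (R.*-assoc _ _ _) (trans (cong (_*_ (2^ (suc g₀))) (trans bb (trans (cong (λ z → B * b ^ z) (ℕ.m≤n⇒m∸n≡0 q)) (R.*-identityʳ B)))) (R.*-comm _ _))))) ⟨≤⟩
            ≡⇒≤ (trans (2^[ 2 ℕ.* R ]*2^[ suc g₀ ]) (cong 2^_ (lemma g₀ R)))
            where
            lemma : ∀ g R → 2 ℕ.* R ℕ.+ suc g ≡ g ℕ.+ 1 ℕ.+ 2 ℕ.* R
            lemma = solve-∀

        exponent-bound : ∀ {t} → b ^ t ≤ 2^ (g₀ ℕ.+ 1 ℕ.+ s₀ ℕ.+ 2 ℕ.* R) → t ℕ.≤ T
        exponent-bound {t} q = 2^-reflects (2^≤b^ t ⟨≤⟩ *-mono-≤ (^-nonneg t 0≤b) q (^-nonneg t 0≤b) q ⟨≤⟩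
          ≡⇒≤ (trans (2^[ g₀ ℕ.+ 1 ℕ.+ s₀ ℕ.+ 2 ℕ.* R ]*2^[ g₀ ℕ.+ 1 ℕ.+ s₀ ℕ.+ 2 ℕ.* R ]) (cong 2^_ (lemma (g₀ ℕ.+ 1 ℕ.+ s₀ ℕ.+ 2 ℕ.* R)))))
          where
          lemma : ∀ x → x ℕ.+ x ≡ 2 ℕ.* x
          lemma = solve-∀

        t₊≤T : t₊ ℕ.≤ T
        t₊≤T = exponent-bound b^t₊≤

        t₋≤T : t₋ ℕ.≤ T
        t₋≤T = exponent-bound (b^t₋≤ ⟨≤⟩ 2^-mono {g₀ ℕ.+ 1 ℕ.+ 2 ℕ.* R} (le s₀ (lemma g₀ s₀ R)))
          where
          lemma : ∀ g s R → g ℕ.+ 1 ℕ.+ 2 ℕ.* R ℕ.+ s ≡ g ℕ.+ 1 ℕ.+ s ℕ.+ 2 ℕ.* R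
          lemma = solve-∀

        θ₁ θ₂ : Carrier
        θ₁ = eval₂ Θ₁
        θ₂ = eval₂ Θ₂

        nΘ₁≤ : nrm₂ Θ₁ ℕ.≤ 2 ℕ.^ τ
        nΘ₁≤ = ℕ.≤-trans (ℕ.*-mono-≤ nΓ₂≤ (ℕ.≤-trans (ℕ.≤-reflexive (nrm₂-^ φ₂ t₊)) (ℕ.^-monoʳ-≤ 2 t₊≤T)))
          (ℕ.≤-trans (ℕ.≤-reflexive (sym (ℕ.^-distribˡ-+-* 2 g₀ T))) (ℕ.^-monoʳ-≤ 2 (ℕ.+-monoˡ-≤ T (ℕ.m≤m+n g₀ s₀))))

        nΘ₂≤ : nrm₂ Θ₂ ℕ.≤ 2 ℕ.^ τ
        nΘ₂≤ = ℕ.≤-trans (ℕ.*-mono-≤ (ℕ.*-mono-≤ nΓ₁≤ (ℕ.≤-reflexive (nrm₂-^ x₂ s₀))) (ℕ.≤-trans (ℕ.≤-reflexive (nrm₂-^ φ₂ t₋)) (ℕ.^-monoʳ-≤ 2 t₋≤T)))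
          (ℕ.≤-reflexive (trans (cong (ℕ._* 2 ℕ.^ T) (sym (ℕ.^-distribˡ-+-* 2 g₀ s₀))) (sym (ℕ.^-distribˡ-+-* 2 (g₀ ℕ.+ s₀) T))))

        |θ₁|≤ : ∣ θ₁ ∣ ≤ 2^ τ
        |θ₁|≤ = eval₂≤ Θ₁ ⟨≤⟩ ≤2^-ιℕ τ nΘ₁≤

        |θ₂|≤ : ∣ θ₂ ∣ ≤ 2^ τ
        |θ₂|≤ = eval₂≤ Θ₂ ⟨≤⟩ ≤2^-ιℕ τ nΘ₂≤

        θ₁≡ : θ₁ ≡ γ₂ * b ^ t₊
        θ₁≡ = cong₂ _*_ eval-Γ₂ (eval₂-^ φ₂ t₊)

        θ₂≡ : θ₂ ≡ γ₁ * a ^ s₀ * b ^ t₋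
        θ₂≡ = cong₂ _*_ (cong₂ _*_ eval-Γ₁ (eval₂-^ x₂ s₀)) (eval₂-^ φ₂ t₋)

        1≤θ₂ : 1# ≤ θ₂
        1≤θ₂ = one ⟨≤⟩ ≡⇒≤ (sym θ₂≡)
          where
          1≤* : ∀ {x y} → 1# ≤ x → 1# ≤ y → 1# ≤ x * y
          1≤* {x} {y} p q = ≡⇒≤ (sym (R.*-identityˡ 1#)) ⟨≤⟩ *-mono-≤ 0≤1 p 0≤1 q
          one : 1# ≤ γ₁ * a ^ s₀ * b ^ t₋
          one = 1≤* (1≤* 1≤γ₁ (1≤^ s₀ 1≤a)) (1≤^ t₋ 1≤b)

        0≤θ₂ : 0# ≤ θ₂
        0≤θ₂ = 0≤1 ⟨≤⟩ 1≤θ₂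

        -- θ₁ / θ₂ approximates ηˡ because γ₁ aʲ approximates γ₂ bᵐ.
        dΔ : ℕ
        dΔ = g₀ ℕ.+ 1 ℕ.+ 4 ℕ.* R ℕ.+ c₀

        Δ-bound : ∣ θ₁ - θ₂ * η ^ ℓ ∣ * 2^ W ≤ 2^ dΔ
        Δ-bound = *-monoʳ-≤ (0≤abs _) (2^W≤ ⟨≤⟩ ≡⇒≤ a^n₁ℓ ⟨≤⟩ *-monoˡ-≤ 0≤B η^ℓ≤) ⟨≤⟩
          ≡⇒≤ (trans (solve 3 (λ x r b → x :* (r :* b) := r :* (x :* b)) refl ∣ θ₁ - θ₂ * η ^ ℓ ∣ (2^ (2 ℕ.* R)) B)
            (cong (_*_ (2^ (2 ℕ.* R))) (trans (cong (_*_ ∣ θ₁ - θ₂ * η ^ ℓ ∣) (sym (abs-nonneg 0≤B))) (trans (sym (abs-* _ _)) (trans (cong ∣_∣ key) (abs-* _ _)))))) ⟨≤⟩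
          *-monoʳ-≤ (0≤2^ (2 ℕ.* R)) (*-mono-≤ (0≤abs _) (≡⇒≤ (abs-nonneg (^-nonneg t₋ 0≤b)) ⟨≤⟩ b^t₋≤) (0≤abs _) (≡⇒≤ (abs-sym _ _) ⟨≤⟩ Λ)) ⟨≤⟩
          ≡⇒≤ (trans (cong (_*_ (2^ (2 ℕ.* R))) (2^[ g₀ ℕ.+ 1 ℕ.+ 2 ℕ.* R ]*2^[ c₀ ])) (trans (2^[ 2 ℕ.* R ]*2^[ g₀ ℕ.+ 1 ℕ.+ 2 ℕ.* R ℕ.+ c₀ ]) (cong 2^_ (lemma g₀ R c₀))))
          where
          lemma : ∀ g R c → 2 ℕ.* R ℕ.+ (g ℕ.+ 1 ℕ.+ 2 ℕ.* R ℕ.+ c) ≡ g ℕ.+ 1 ℕ.+ 4 ℕ.* R ℕ.+ c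
          lemma = solve-∀
          key : (θ₁ - θ₂ * η ^ ℓ) * B ≡ b ^ t₋ * (γ₂ * b ^ m - γ₁ * a ^ j)
          key = trans (cong₂ (λ x y → (x - y * η ^ ℓ) * B) θ₁≡ θ₂≡)
            (trans (solve 7 (λ c t g s v h B → (c :* t :- g :* s :* v :* h) :* B := c :* (B :* t) :- g :* (h :* B :* s) :* v) refl γ₂ (b ^ t₊) γ₁ (a ^ s₀) (b ^ t₋) (η ^ ℓ) B)
              (trans (cong₂ (λ x y → γ₂ * x - γ₁ * y * b ^ t₋) (sym bb) (sym a^j≡))
                (solve 5 (λ c m v g x → c :* (m :* v) :- g :* x :* v := v :* (c :* m :- g :* x)) refl γ₂ (b ^ m) (b ^ t₋) γ₁ (a ^ j))))

-- Vanishing at η and the contradiction.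

module Vanishing (𝔽 : OrderedField) (𝓖 : KBonacci) (d : ℕ) where
  open KBonacci 𝓖
  open FieldTheory 𝔽
  open Pisot 𝔽 k 3≤k
  open Approximation 𝔽 k 3≤k
  open Liouville 𝔽 𝓖
  open GoldenExtension 𝔽 𝓖

  open MultiplicativeIndependence 𝔽 𝓖

  open LinearForm 𝔽 𝓖
  open SmallUnits 𝔽 𝓖
  open Combinatorics
  open HermitePadé 𝔽
  open import Data.Nat.DivMod using (_/_; _%_; m≡m%n+[m/n]*n; m%n<n; m<n*o⇒m/o<n; [m+kn]%n≡m%n; m<n⇒m%n≡m)

  open AuxiliaryPolynomial 𝔽 𝓖 d

  open SizeEstimates 𝔽 𝓖 d

  ∸-< : ∀ {l K} κ → l ℕ.< κ → κ ℕ.+ κ ℕ.≤ K → κ ℕ.≤ K ℕ.∸ l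
  ∸-< {l} {K} κ l<κ 2κ≤K = ℕ.m+n≤o⇒m≤o∸n κ (ℕ.≤-trans (ℕ.+-monoʳ-≤ κ (ℕ.<⇒≤ l<κ)) 2κ≤K)

  module Contradiction (n₁ p′ R s₀ m₁ m : ℕ) {{R≢0 : ℕ.NonZero R}} (1≤n₁ : 1 ℕ.≤ n₁) (2≤U : 2 ℕ.≤ R ℕ.* n₁)
                   (hR : R₀ n₁ (2 ℕ.^ suc p′) ℕ.≤ R) (hs : s₀ ℕ.≤ n₁ ℕ.* 2 ℕ.^ suc p′)
                   (hp : (54 ℕ.+ 4 ℕ.* cc) ℕ.* suc p′ ℕ.≤ 2 ℕ.^ p′) where
    open Construction n₁ p′ R s₀ m₁ m 1≤n₁ 2≤U
    open Estimates n₁ p′ R s₀ m₁ m 1≤n₁ 2≤U hR hs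

    U≤K : U ℕ.≤ K
    U≤K = proj₁ (proj₂ order)

    K<N : K ℕ.< N
    K<N = proj₁ (proj₂ (proj₂ order))

    K-nonzero : ¬ (moment N q e K ≡ + 0)
    K-nonzero = proj₁ (proj₂ (proj₂ (proj₂ order)))

    below-K : ∀ j → j ℕ.< K → moment N q e j ≡ + 0
    below-K = proj₂ (proj₂ (proj₂ (proj₂ order)))

    private
      halved = halve K (ℕ.≤-trans 2≤U U≤K)

    -- κ is about K / 2: Taylor coefficients of order l < κ at η still carry at least κ factors of
    -- w, and interpolation with κ coefficients at η leaves κ spare factors of w in the remainder.
    μ′ κ : ℕ
    μ′ = proj₁ halved
    κ = suc μ′

    2κ≤K : κ ℕ.+ κ ℕ.≤ K
    2κ≤K = proj₁ (proj₂ halved)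

    K≤3κ : K ℕ.≤ 3 ℕ.* κ
    K≤3κ = ℕ.≤-trans (proj₂ (proj₂ halved)) (le μ′ (lemma μ′))
      where
      lemma : ∀ m → suc (suc m ℕ.+ suc m) ℕ.+ m ≡ 3 ℕ.* suc m
      lemma = solve-∀

    U≤3κ : U ℕ.≤ 3 ℕ.* κ
    U≤3κ = ℕ.≤-trans U≤K K≤3κ

    K<2U : K ℕ.< 2 ℕ.* U
    K<2U = ℕ.<-≤-trans K<N (ℕ.≤-reflexive N≡)

    κ≤U : κ ℕ.≤ U
    κ≤U = ℕ.*-cancelˡ-≤ 2 (ℕ.≤-trans (ℕ.≤-reflexive (cong (κ ℕ.+_) (ℕ.+-identityʳ κ))) (ℕ.≤-trans 2κ≤K (ℕ.<⇒≤ K<2U)))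

    K<n̂ : K ℕ.< n̂
    K<n̂ = ℕ.<-≤-trans K<2U (ℕ.*-monoˡ-≤ U (ℕ.≤-trans (ℕ.≤-reflexive (sym (ℕ.*-identityʳ 2))) (ℕ.*-monoʳ-≤ 2 (ℕ.m^n>0 2 p))))

    1≤p : 1 ℕ.≤ p
    1≤p = s≤s z≤n

    module _ {X : ℕ} (root : Root X) (golden : Golden X) (X≥ : precision ℕ.≤ X) where
      open Evaluation₂ root golden
      open Linear root golden d using (γ₁; γ₂)
      open WithApproximation root golden

      module _ (w-upper : ∣ a ^ n₁ - b ^ m₁ ∣ ≤ ½^ (cc ℕ.* p) * b ^ m₁)
               (w-lower : ½^ (2 ℕ.* (cc ℕ.* p)) * b ^ m₁ ≤ ∣ a ^ n₁ - b ^ m₁ ∣)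
               (Λ : ∣ γ₁ * a ^ j - γ₂ * b ^ m ∣ ≤ 2^ c₀) where
        open Bounds w-upper w-lower Λ
        open Extrapolation N q e n̂ e<n̂ y (λ i → ℕ.<⇒≤ (q-bound i)) w using (Γ; Γ-expand; tail-bound; leading) renaming (G to g⁺)

        -- The denominator of the Taylor coefficients at η after ηˡ has been replaced with θ₁ / θ₂.
        Bf : Carrier
        Bf = β̂ ^ R * θ₂ ^ S

        eval₂-ΣE : ∀ n f → eval₂ (ΣE n f) ≡ Sum n (λ i → eval₂ (f i))
        eval₂-ΣE zero f    = refl
        eval₂-ΣE (suc n) f = cong (_+_ (eval₂ (f 0))) (eval₂-ΣE n (λ i → f (suc i)))

        module _ (l : ℕ) where
          private
            error : ℕ → Carrier
            error i = ι (q i) * ιbin (e i) l * (η ^ r i * β̂ ^ R * θ₂ ^ (S ℕ.∸ s i)) * (θ₁ ^ s i - (θ₂ * η ^ ℓ) ^ s i)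

            Γ-term : ℕ → Carrier
            Γ-term i = ι (q i) * (ιbin (e i) l * (1# + w) ^ (e i ℕ.∸ l))

            eval-termE : ∀ i → eval₂ (termE l i) ≡
              ι (q i) * ιbin (e i) l * (a ^ n₁) ^ r i * β̂ ^ (R ℕ.∸ r i) * θ₁ ^ s i * θ₂ ^ (S ℕ.∸ s i)
            eval-termE i = cong₂ _*_ (cong₂ _*_ (cong₂ _*_ (cong₂ _*_ (ι-* (q i) (+ bin (e i) l))
                  (trans (eval₂-^ (x₂ ^₂ n₁) (r i)) (cong (_^ r i) (eval₂-^ x₂ n₁))))
                (trans (eval₂-^ (φ₂ ^₂ m₁) (R ℕ.∸ r i)) (cong (_^ (R ℕ.∸ r i)) (eval₂-^ φ₂ m₁))))
              (eval₂-^ Θ₁ (s i))) (eval₂-^ Θ₂ (S ℕ.∸ s i))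

            base : ∀ i → (a ^ n₁) ^ r i * β̂ ^ (R ℕ.∸ r i) ≡ η ^ r i * β̂ ^ R
            base i = trans (cong (_* β̂ ^ (R ℕ.∸ r i)) (trans (cong (_^ r i) (sym ηβ̂)) (^-distrib-* η β̂ (r i)))) (trans (R.*-assoc _ _ _)
              (cong (_*_ (η ^ r i)) (trans (sym (^-+ β̂ (r i) (R ℕ.∸ r i))) (cong (β̂ ^_) (ℕ.m+[n∸m]≡n (ℕ.<⇒≤ (r<R i)))))))

            bin-η : ∀ i → ιbin (e i) l * (η ^ l * (1# + w) ^ (e i ℕ.∸ l)) ≡ ιbin (e i) l * (η ^ r i * (η ^ ℓ) ^ s i)
            bin-η i = pick (ℕ.≤-<-connex l (e i))
              where
              pick : (l ℕ.≤ e i) ⊎ (e i ℕ.< l) → ιbin (e i) l * (η ^ l * (1# + w) ^ (e i ℕ.∸ l)) ≡ ιbin (e i) l * (η ^ r i * (η ^ ℓ) ^ s i)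
              pick (inj₁ l≤e) = cong (_*_ (ιbin (e i) l)) (trans (cong (λ z → η ^ l * z ^ (e i ℕ.∸ l)) 1+w≡η)
                (trans (sym (^-+ η l (e i ℕ.∸ l))) (trans (cong (η ^_) (ℕ.m+[n∸m]≡n l≤e)) (trans (^-+ η (r i) (s i ℕ.* ℓ))
                  (cong (_*_ (η ^ r i)) (trans (cong (η ^_) (ℕ.*-comm (s i) ℓ)) (^-* η ℓ (s i))))))))
              pick (inj₂ e<l) = trans (cong (_* (η ^ l * (1# + w) ^ (e i ℕ.∸ l))) (cong ιℕ (bin-zero e<l)))
                (trans (R.zeroˡ _) (sym (trans (cong (_* (η ^ r i * (η ^ ℓ) ^ s i)) (cong ιℕ (bin-zero e<l))) (R.zeroˡ _))))

            θ₂-split : ∀ i → i ℕ.< N → θ₂ ^ S ≡ θ₂ ^ s i * θ₂ ^ (S ℕ.∸ s i)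
            θ₂-split i i<N = trans (cong (θ₂ ^_) (sym (ℕ.m+[n∸m]≡n (ℕ.<⇒≤ (s<S i i<N))))) (^-+ θ₂ (s i) (S ℕ.∸ s i))

            term-diff : ∀ i → i ℕ.< N → eval₂ (termE l i) - Bf * (η ^ l * Γ-term i) ≡ error i
            term-diff i i<N = trans (cong₂ _-_
                (trans (eval-termE i) (trans (solve 6 (λ Q b x y u v → Q :* b :* x :* y :* u :* v := Q :* b :* (x :* y) :* u :* v) refl
                    (ι (q i)) (ιbin (e i) l) ((a ^ n₁) ^ r i) (β̂ ^ (R ℕ.∸ r i)) (θ₁ ^ s i) (θ₂ ^ (S ℕ.∸ s i)))
                  (cong (λ z → ι (q i) * ιbin (e i) l * z * θ₁ ^ s i * θ₂ ^ (S ℕ.∸ s i)) (base i))))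
                (trans (solve 6 (λ β t h Q b w → β :* t :* (h :* (Q :* (b :* w))) := β :* t :* Q :* (b :* (h :* w))) refl
                    (β̂ ^ R) (θ₂ ^ S) (η ^ l) (ι (q i)) (ιbin (e i) l) ((1# + w) ^ (e i ℕ.∸ l)))
                  (cong₂ (λ x y → β̂ ^ R * x * ι (q i) * y) (θ₂-split i i<N) (bin-η i))))
              (trans (solve 8 (λ Q b hr β t₁ t₂ θs h → Q :* b :* (hr :* β) :* t₁ :* t₂ :- β :* (θs :* t₂) :* Q :* (b :* (hr :* h)) :=
                  Q :* b :* (hr :* β :* t₂) :* (t₁ :- θs :* h)) refl
                  (ι (q i)) (ιbin (e i) l) (η ^ r i) (β̂ ^ R) (θ₁ ^ s i) (θ₂ ^ (S ℕ.∸ s i)) (θ₂ ^ s i) ((η ^ ℓ) ^ s i))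
                (cong (λ z → ι (q i) * ιbin (e i) l * (η ^ r i * β̂ ^ R * θ₂ ^ (S ℕ.∸ s i)) * (θ₁ ^ s i - z)) (sym (^-distrib-* θ₂ (η ^ ℓ) (s i)))))

            total-diff : eval₂ (V l) - Bf * (η ^ l * Γ l) ≡ Sum N error
            total-diff = trans (cong₂ _-_ (eval₂-ΣE N (termE l))
                (trans (cong (_*_ Bf) (sym (Sum-*ˡ N (η ^ l) Γ-term))) (sym (Sum-*ˡ N Bf (λ i → η ^ l * Γ-term i)))))
              (trans (sym (Sum-- N (λ i → eval₂ (termE l i)) (λ i → Bf * (η ^ l * Γ-term i)))) (Sum-cong N term-diff))

            dPow dErr : ℕ
            dPow = S ℕ.+ ((τ ℕ.+ 2 ℕ.* R) ℕ.* S ℕ.+ dΔ)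
            dErr = y ℕ.+ b̂ ℕ.+ (R ℕ.+ m₁ ℕ.* R ℕ.+ τ ℕ.* S) ℕ.+ dPow

            M : Carrier
            M = 2^ (τ ℕ.+ 2 ℕ.* R)

            pow-dy : ∀ i → i ℕ.< N → Dy (θ₁ ^ s i - (θ₂ * η ^ ℓ) ^ s i) dPow W
            pow-dy i i<N = mkDy (*-monoˡ-≤ (0≤2^ W) (power-diff (s i) (1≤2^ (τ ℕ.+ 2 ℕ.* R))
                  (|θ₁|≤ ⟨≤⟩ 2^-mono (ℕ.m≤m+n τ _))
                  (≡⇒≤ (abs-* _ _) ⟨≤⟩ *-mono-≤ (0≤abs _) |θ₂|≤ (0≤abs _) (≡⇒≤ (abs-nonneg 0≤η^ℓ) ⟨≤⟩ η^ℓ≤) ⟨≤⟩ ≡⇒≤ (2^[ τ ]*2^[ 2 ℕ.* R ])) ≤-refl) ⟨≤⟩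
              ≡⇒≤ (trans (R.*-assoc _ _ _) (cong (_*_ (ιℕ (s i))) (R.*-assoc _ _ _))) ⟨≤⟩
              *-mono-≤ (0≤ιℕ (s i)) (ιℕ≤2^ (s i) ⟨≤⟩ 2^-mono s≤S) (*-nonneg (^-nonneg (s i) (0≤2^ (τ ℕ.+ 2 ℕ.* R))) (*-nonneg (0≤abs _) (0≤2^ W)))
                (*-mono-≤ (^-nonneg (s i) (0≤2^ (τ ℕ.+ 2 ℕ.* R))) (^-monoʳ {M} (1≤2^ (τ ℕ.+ 2 ℕ.* R)) s≤S ⟨≤⟩ ≡⇒≤ (sym (^-* 2# (τ ℕ.+ 2 ℕ.* R) S)))
                  (*-nonneg (0≤abs _) (0≤2^ W)) Δ-bound ⟨≤⟩ ≡⇒≤ (2^[ (τ ℕ.+ 2 ℕ.* R) ℕ.* S ]*2^[ dΔ ])) ⟨≤⟩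
              ≡⇒≤ (2^[ S ]*2^[ (τ ℕ.+ 2 ℕ.* R) ℕ.* S ℕ.+ dΔ ]))
              where
              s≤S : s i ℕ.≤ S
              s≤S = ℕ.<⇒≤ (s<S i i<N)

            q-dy : ∀ i → Dy (ι (q i)) y 0
            q-dy i = ≤2^⇒dy y (≡⇒≤ (abs-ι (q i)) ⟨≤⟩ ≤2^-ιℕ y (ℕ.<⇒≤ (q-bound i)))

          module _ (l≤U : l ℕ.≤ U) where
            private
              bin-dy : ∀ i → i ℕ.< N → Dy (ιbin (e i) l) b̂ 0
              bin-dy i i<N = ≤-dy (0≤ιℕ (bin (e i) l)) (ιbin≤ i i<N l l≤U)

              error-dy : ∀ i → i ℕ.< N → Dy (error i) dErr W
              error-dy i i<N = dy-* (dy-* (dy-* (q-dy i) (bin-dy i i<N))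
                  (dy-* (dy-* (≤-dy {n = R} (^-nonneg (r i) 0≤η) (^-mono (r i) 0≤η η≤2 ⟨≤⟩ 2^-mono (ℕ.<⇒≤ (r<R i))))
                              (≤-dy {n = m₁ ℕ.* R} (^-nonneg R 0≤β̂) (^-mono R 0≤β̂ (b^≤ m₁) ⟨≤⟩ ≡⇒≤ (sym (^-* 2# m₁ R)))))
                        (≤-dy {n = τ ℕ.* S} (^-nonneg (S ℕ.∸ s i) 0≤θ₂) (^-mono (S ℕ.∸ s i) 0≤θ₂ (≤abs θ₂ ⟨≤⟩ |θ₂|≤) ⟨≤⟩ ^-monoʳ {2^ τ} (1≤2^ τ) (ℕ.m∸n≤m S (s i)) ⟨≤⟩ ≡⇒≤ (sym (^-* 2# τ S))))))
                (pow-dy i i<N)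

              dErr≤ : suc U ℕ.+ dErr ℕ.≤ (2 ℕ.* p ℕ.+ 44) ℕ.* U
              dErr≤ = ℕ.≤-trans (ℕ.≤-reflexive (lemma₁ U p R (m₁ ℕ.* R) τ S (g₀ ℕ.+ 1) c₀ n₁))
                (ℕ.≤-trans (ℕ.+-monoʳ-≤ ((2 ℕ.* p ℕ.+ 9) ℕ.* U) (ℕ.+-mono-≤ (ℕ.+-mono-≤ (ℕ.+-mono-≤ (ℕ.+-mono-≤ (ℕ.+-mono-≤ 1≤U (ℕ.*-monoʳ-≤ 5 R≤U)) m₁R≤) (ℕ.*-monoʳ-≤ 2 τS≤)) (ℕ.+-mono-≤ S≤2U (ℕ.≤-trans hR₂ R≤U))) (ℕ.≤-refl {4 ℕ.* (R ℕ.* n₁)})))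
                  (ℕ.≤-reflexive (lemma₂ p (R ℕ.* n₁))))
                where
                lemma₁ : ∀ U p R mR τ S g c n → suc U ℕ.+ ((p ℕ.+ 5) ℕ.* U ℕ.+ (p ℕ.+ 3) ℕ.* U ℕ.+ (R ℕ.+ mR ℕ.+ τ ℕ.* (2 ℕ.* n)) ℕ.+ (2 ℕ.* n ℕ.+ ((τ ℕ.+ 2 ℕ.* R) ℕ.* (2 ℕ.* n) ℕ.+ (g ℕ.+ 4 ℕ.* R ℕ.+ c)))) ≡
                         (2 ℕ.* p ℕ.+ 9) ℕ.* U ℕ.+ (1 ℕ.+ 5 ℕ.* R ℕ.+ mR ℕ.+ 2 ℕ.* (τ ℕ.* (2 ℕ.* n)) ℕ.+ (2 ℕ.* n ℕ.+ (g ℕ.+ c)) ℕ.+ 4 ℕ.* (R ℕ.* n))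
                lemma₁ = solve-∀
                lemma₂ : ∀ p u → (2 ℕ.* p ℕ.+ 9) ℕ.* u ℕ.+ (u ℕ.+ 5 ℕ.* u ℕ.+ 4 ℕ.* u ℕ.+ 2 ℕ.* (9 ℕ.* u) ℕ.+ (2 ℕ.* u ℕ.+ u) ℕ.+ 4 ℕ.* u) ≡ (2 ℕ.* p ℕ.+ 44) ℕ.* u
                lemma₂ = solve-∀

            -- The algebraic number V l and the analytic quantity Γ l agree up to the error in θ₁ / θ₂ ≈ ηˡ.
            difference : Dy (eval₂ (V l) - Bf * (η ^ l * Γ l)) ((2 ℕ.* p ℕ.+ 44) ℕ.* U) W
            difference = dy-≡ (sym total-diff) (dy-shift (dy-Sum N (suc U) (ℕ.<⇒≤ N<2^) error-dy) (ℕ.+-monoˡ-≤ W dErr≤))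

            nrm-V : nrm₂ (V l) ℕ.≤ 2 ℕ.^ Z
            nrm-V = ℕ.≤-trans (nrm₂-ΣE N (termE l) term≤) (ℕ.≤-trans (ℕ.*-monoˡ-≤ (2 ℕ.^ D′) (ℕ.<⇒≤ N<2^))
              (ℕ.≤-trans (ℕ.≤-reflexive (sym (ℕ.^-distribˡ-+-* 2 (suc U) D′))) (ℕ.^-monoʳ-≤ 2 D′≤)))
              where
              D′ = y ℕ.+ b̂ ℕ.+ n₁ ℕ.* R ℕ.+ m₁ ℕ.* R ℕ.+ τ ℕ.* S
              D′≤ : suc U ℕ.+ D′ ℕ.≤ Z
              D′≤ = ℕ.≤-trans (ℕ.≤-reflexive (lemma₁ p R n₁ (m₁ ℕ.* R) (τ ℕ.* S))) (ℕ.≤-trans (ℕ.+-monoʳ-≤ ((2 ℕ.* p ℕ.+ 10) ℕ.* U) (ℕ.+-mono-≤ (ℕ.+-mono-≤ 1≤U m₁R≤) τS≤)) (ℕ.≤-reflexive (lemma₂ p U)))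
                where
                lemma₁ : ∀ p R n mR τS → suc (R ℕ.* n) ℕ.+ ((p ℕ.+ 5) ℕ.* (R ℕ.* n) ℕ.+ (p ℕ.+ 3) ℕ.* (R ℕ.* n) ℕ.+ n ℕ.* R ℕ.+ mR ℕ.+ τS) ≡
                         (2 ℕ.* p ℕ.+ 10) ℕ.* (R ℕ.* n) ℕ.+ (1 ℕ.+ mR ℕ.+ τS)
                lemma₁ = solve-∀
                lemma₂ : ∀ p u → (2 ℕ.* p ℕ.+ 10) ℕ.* u ℕ.+ (u ℕ.+ 4 ℕ.* u ℕ.+ 9 ℕ.* u) ≡ (2 ℕ.* p ℕ.+ 24) ℕ.* u
                lemma₂ = solve-∀
              pow≤ : ∀ {x t} n n′ → x ℕ.≤ 2 ℕ.^ t → n ℕ.≤ n′ → x ℕ.^ n ℕ.≤ 2 ℕ.^ (t ℕ.* n′)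
              pow≤ {t = t} n n′ x≤ n≤ = ℕ.≤-trans (ℕ.^-monoˡ-≤ n x≤) (ℕ.≤-trans (ℕ.≤-reflexive (^-pow2 t n)) (ℕ.^-monoʳ-≤ 2 (ℕ.*-monoʳ-≤ t n≤)))
              2^+ : ∀ a b → 2 ℕ.^ a ℕ.* 2 ℕ.^ b ≡ 2 ℕ.^ (a ℕ.+ b)
              2^+ a b = sym (ℕ.^-distribˡ-+-* 2 a b)
              term≤ : ∀ i → i ℕ.< N → nrm₂ (termE l i) ℕ.≤ 2 ℕ.^ D′
              term≤ i i<N = ℕ.≤-trans (ℕ.≤-reflexive (ℕ.*-assoc A₄ (nrm₂ (Θ₁ ^₂ s i)) (nrm₂ (Θ₂ ^₂ (S ℕ.∸ s i)))))
                (ℕ.≤-trans (ℕ.*-mono-≤ (ℕ.*-mono-≤ (ℕ.*-mono-≤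
                    (ℕ.≤-trans (ℕ.≤-reflexive (ℤ.abs-* (q i) (+ bin (e i) l))) (ℕ.≤-trans (ℕ.*-mono-≤ (ℕ.<⇒≤ (q-bound i)) (bin≤ i i<N l l≤U)) (ℕ.≤-reflexive (2^+ y b̂))))
                    (ℕ.≤-trans (ℕ.≤-reflexive (nrm₂-^ (x₂ ^₂ n₁) (r i))) (pow≤ {t = n₁} (r i) R (ℕ.≤-reflexive (nrm₂-^ x₂ n₁)) (ℕ.<⇒≤ (r<R i)))))
                    (ℕ.≤-trans (ℕ.≤-reflexive (nrm₂-^ (φ₂ ^₂ m₁) (R ℕ.∸ r i))) (pow≤ {t = m₁} (R ℕ.∸ r i) R (ℕ.≤-reflexive (nrm₂-^ φ₂ m₁)) (ℕ.m∸n≤m R (r i)))))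
                    Θ≤)
                  (ℕ.≤-reflexive (trans (cong (ℕ._* 2 ℕ.^ (τ ℕ.* S)) (trans (cong (ℕ._* 2 ℕ.^ (m₁ ℕ.* R)) (2^+ (y ℕ.+ b̂) (n₁ ℕ.* R))) (2^+ (y ℕ.+ b̂ ℕ.+ n₁ ℕ.* R) (m₁ ℕ.* R)))) (2^+ (y ℕ.+ b̂ ℕ.+ n₁ ℕ.* R ℕ.+ m₁ ℕ.* R) (τ ℕ.* S)))))
                where
                A₄ = nrm₂ (con₂ (q i ℤ.* + bin (e i) l) ⊗₂ ((x₂ ^₂ n₁) ^₂ r i) ⊗₂ ((φ₂ ^₂ m₁) ^₂ (R ℕ.∸ r i)))
                Θ≤ : nrm₂ (Θ₁ ^₂ s i) ℕ.* nrm₂ (Θ₂ ^₂ (S ℕ.∸ s i)) ℕ.≤ 2 ℕ.^ (τ ℕ.* S)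
                Θ≤ = ℕ.≤-trans (ℕ.*-mono-≤ (ℕ.≤-trans (ℕ.≤-reflexive (nrm₂-^ Θ₁ (s i))) (pow≤ {t = τ} (s i) (s i) nΘ₁≤ ℕ.≤-refl))
                                           (ℕ.≤-trans (ℕ.≤-reflexive (nrm₂-^ Θ₂ (S ℕ.∸ s i))) (pow≤ {t = τ} (S ℕ.∸ s i) (S ℕ.∸ s i) nΘ₂≤ ℕ.≤-refl)))
                  (ℕ.≤-reflexive (trans (2^+ (τ ℕ.* s i) (τ ℕ.* (S ℕ.∸ s i))) (cong (2 ℕ.^_) (trans (sym (ℕ.*-distribˡ-+ τ (s i) (S ℕ.∸ s i))) (cong (τ ℕ.*_) (ℕ.m+[n∸m]≡n (ℕ.<⇒≤ (s<S i i<N))))))))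

        -- The part of `tail-bound` that is independent of w.
        Hq : Carrier
        Hq = 2^ y * (ιℕ N * (1# + x) ^ n̂)

        0≤Hq : 0# ≤ Hq
        0≤Hq = *-nonneg (0≤2^ y) (*-nonneg (0≤ιℕ N) (^-nonneg n̂ (0≤1 ⟨≤⟩ 1≤1+x)))

        Hq≤ : Hq ≤ 2^ ((p ℕ.+ 9) ℕ.* U)
        Hq≤ = *-monoʳ-≤ (0≤2^ y) (*-mono-≤ (0≤ιℕ N) (≤2^-ιℕ (suc U) (ℕ.<⇒≤ N<2^)) (^-nonneg n̂ (0≤1 ⟨≤⟩ 1≤1+x)) [1+x]^n̂≤) ⟨≤⟩
          ≡⇒≤ (trans (cong (_*_ (2^ y)) (2^[ suc U ]*2^[ 2 ℕ.* U ])) (2^[ y ]*2^[ suc U ℕ.+ 2 ℕ.* U ])) ⟨≤⟩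
          2^-mono {y ℕ.+ (suc U ℕ.+ 2 ℕ.* U)} {(p ℕ.+ 9) ℕ.* U} (ℕ.≤-trans (ℕ.≤-reflexive (lemma₁ p U)) (ℕ.≤-trans (ℕ.+-monoʳ-≤ ((p ℕ.+ 8) ℕ.* U) 1≤U) (ℕ.≤-reflexive (lemma₂ p U))))
          where
          lemma₁ : ∀ p U → (p ℕ.+ 5) ℕ.* U ℕ.+ (suc U ℕ.+ 2 ℕ.* U) ≡ (p ℕ.+ 8) ℕ.* U ℕ.+ 1
          lemma₁ = solve-∀
          lemma₂ : ∀ p U → (p ℕ.+ 8) ℕ.* U ℕ.+ U ≡ (p ℕ.+ 9) ℕ.* U
          lemma₂ = solve-∀

        μ^≰0 : ∀ n → ¬ (μ ^ n ≤ 0#)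
        μ^≰0 n q = 1≰0 (≡⇒≤ (sym (2^*½^ (E₁ ℕ.* n))) ⟨≤⟩ *-monoʳ-≤ (0≤2^ (E₁ ℕ.* n)) (≡⇒≤ (^-* ½ E₁ n) ⟨≤⟩ ^-mono n (0≤½^ E₁) ≤μ ⟨≤⟩ q) ⟨≤⟩ ≡⇒≤ (R.zeroʳ _))
          where E₁ = 2 ℕ.* (cc ℕ.* p)

        μ^κ≤ : μ ^ κ ≤ ½^ (cc ℕ.* p ℕ.* κ)
        μ^κ≤ = ^-mono κ 0≤μ μ≤ ⟨≤⟩ ≡⇒≤ (sym (^-* ½ (cc ℕ.* p) κ))

        -- The `z` of `tail-bound` for weights of size at most 2^(t j): t = 1 serves the binomial
        -- coefficients, t = 2 the interpolation remainder.
        zf : ℕ → Carrier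
        zf t = 2^ (suc p) * (2^ t * μ)

        zf-x : ∀ t → zf t * x ≡ 2^ t * μ
        zf-x t = trans (solve 3 (λ a b c → a :* b :* c := a :* c :* b) refl (2^ (suc p)) (2^ t * μ) x) (trans (cong (_* (2^ t * μ)) (2^*½^ (suc p))) (R.*-identityˡ _))

        zf≡ : ∀ t → zf t ≡ 2^ (suc p ℕ.+ t) * μ
        zf≡ t = trans (sym (R.*-assoc _ _ _)) (cong (_* μ) (2^[ suc p ]*2^[ t ]))

        0≤zf : ∀ t → 0# ≤ zf t
        0≤zf t = *-nonneg (0≤2^ (suc p)) (*-nonneg (0≤2^ t) 0≤μ)

        zf≤1 : ∀ t → t ℕ.≤ 2 → zf t ≤ 1#
        zf≤1 t t≤2 = ≡⇒≤ (zf≡ t) ⟨≤⟩ *-monoʳ-≤ (0≤2^ (suc p ℕ.+ t)) μ≤ ⟨≤⟩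
          2^*½^≤ (suc p ℕ.+ t) 0 (ℕ.≤-trans (ℕ.≤-reflexive (ℕ.+-identityʳ _)) (ℕ.≤-trans (ℕ.+-monoʳ-≤ (suc p) t≤2)
            (ℕ.≤-trans (ℕ.+-monoʳ-≤ (suc p) (ℕ.*-monoʳ-≤ 2 1≤p)) (ℕ.≤-trans (ℕ.+-monoˡ-≤ (2 ℕ.* p) (ℕ.+-monoˡ-≤ p 1≤p)) (ℕ.≤-trans (ℕ.≤-reflexive (lemma p)) (ℕ.*-monoˡ-≤ p 4≤cc))))))
          where
          lemma : ∀ p → p ℕ.+ p ℕ.+ 2 ℕ.* p ≡ 4 ℕ.* p
          lemma = solve-∀
          4≤cc : 4 ℕ.≤ cc
          4≤cc = ℕ.≤-trans (ℕ.≤-trans (ℕ.m≤m+n 4 80) (ℕ.m≤m+n 84 (78 ℕ.* c₁))) (ℕ.≤-reflexive (sym cc≡))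

        zf^ : ∀ t n → zf t ^ n ≡ 2^ ((suc p ℕ.+ t) ℕ.* n) * μ ^ n
        zf^ t n = trans (cong (_^ n) (zf≡ t)) (trans (^-distrib-* _ μ n) (cong (_* μ ^ n) (sym (^-* 2# (suc p ℕ.+ t) n))))

        vanish : ∀ i → i ℕ.< K → g⁺ i ≡ 0#
        vanish i p = cong ι (below-K i p)

        module _ (l : ℕ) (l<κ : l ℕ.< κ) where
          private
            l≤U : l ℕ.≤ U
            l≤U = ℕ.≤-trans (ℕ.<⇒≤ l<κ) κ≤U

            κ≤K-l : κ ℕ.≤ K ℕ.∸ l
            κ≤K-l = ∸-< κ l<κ 2κ≤K

            l≤K : l ℕ.≤ K
            l≤K = ℕ.≤-trans l≤U U≤K

            Bound : Carrier
            Bound = 2^ ((suc p ℕ.+ 1) ℕ.* K) * μ ^ (K ℕ.∸ l) * Hq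

            -- In the expansion of w^l Γ l around 1 only powers of w from K onwards occur; dividing
            -- by w^l leaves K - l ≥ κ of them.
            |Γ|≤ : ∣ Γ l ∣ ≤ Bound
            |Γ|≤ = *-cancelˡ-≤ (μ ^ l) (μ^≰0 l)
              (≡⇒≤ (trans (cong (_* ∣ Γ l ∣) (sym (abs-^ w l))) (trans (sym (abs-* _ _)) (cong ∣_∣ (Γ-expand l)))) ⟨≤⟩
               tail-bound (λ j → ιbin j l) 2# x (zf 1) K 0≤2 0≤x (0≤zf 1) (zf≤1 1 (s≤s z≤n)) (trans (zf-x 1) (cong (_* μ) (R.*-identityʳ 2#)))
                 (λ j → ≡⇒≤ (abs-nonneg (0≤ιℕ (bin j l))) ⟨≤⟩ ≤2^-ιℕ j (bin≤2^ j l))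
                 (λ j j<K → trans (cong (_* (ιbin j l * w ^ j)) (vanish j j<K)) (R.zeroˡ _)) ⟨≤⟩
               ≡⇒≤ (trans (cong (_* Hq) (trans (zf^ 1 K) (cong (_*_ (2^ ((suc p ℕ.+ 1) ℕ.* K))) (trans (cong (μ ^_) (sym (ℕ.m+[n∸m]≡n l≤K))) (^-+ μ l (K ℕ.∸ l))))))
                 (solve 4 (λ a b c h → a :* (b :* c) :* h := b :* (a :* c :* h)) refl (2^ ((suc p ℕ.+ 1) ℕ.* K)) (μ ^ l) (μ ^ (K ℕ.∸ l)) Hq)))

            Γ-first : Dy (Γ l) ((suc p ℕ.+ 1) ℕ.* K ℕ.+ 0 ℕ.+ (p ℕ.+ 9) ℕ.* U) (0 ℕ.+ cc ℕ.* p ℕ.* κ ℕ.+ 0)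
            Γ-first = dy-≤ (|Γ|≤ ⟨≤⟩ ≤abs Bound) (dy-* (dy-* (≤-dy {n = (suc p ℕ.+ 1) ℕ.* K} (0≤2^ ((suc p ℕ.+ 1) ℕ.* K)) ≤-refl)
                (≤½^⇒dy (cc ℕ.* p ℕ.* κ) (≡⇒≤ (abs-nonneg (^-nonneg (K ℕ.∸ l) 0≤μ)) ⟨≤⟩ ^-antiʳ {μ} 0≤μ μ≤1 κ≤K-l ⟨≤⟩ μ^κ≤)))
              (≤-dy {n = (p ℕ.+ 9) ℕ.* U} 0≤Hq Hq≤))

            A : ℕ
            A = c₁ ℕ.* Z ℕ.+ c₂

            sA≤ : suc A ℕ.≤ (c₁ ℕ.* (2 ℕ.* p ℕ.+ 24) ℕ.+ 1) ℕ.* U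
            sA≤ = ℕ.≤-trans (ℕ.≤-reflexive (lemma₁ c₁ p U c₂)) (ℕ.≤-trans (ℕ.+-monoʳ-≤ (c₁ ℕ.* (2 ℕ.* p ℕ.+ 24) ℕ.* U) (ℕ.≤-trans (ℕ.+-monoʳ-≤ c₂ (ℕ.n≤1+n 1)) (ℕ.≤-trans hR₃ R≤U))) (ℕ.≤-reflexive (lemma₂ (c₁ ℕ.* (2 ℕ.* p ℕ.+ 24)) U)))
              where
              lemma₁ : ∀ c p U d → suc (c ℕ.* ((2 ℕ.* p ℕ.+ 24) ℕ.* U) ℕ.+ d) ≡ c ℕ.* (2 ℕ.* p ℕ.+ 24) ℕ.* U ℕ.+ (d ℕ.+ 1)
              lemma₁ = solve-∀
              lemma₂ : ∀ c U → c ℕ.* U ℕ.+ U ≡ (c ℕ.+ 1) ℕ.* U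
              lemma₂ = solve-∀

            -- The budget behind `cc`: denominator, polynomial and Liouville threshold need at most
            -- (84 + 78 c₁) p κ bits once U and K are bounded by 3κ, and |w|^κ supplies cc p κ.
            main-dy : Dy (Bf * (η ^ l * Γ l)) 0 (suc A)
            main-dy = dy-shift (dy-* (dy-* (≤-dy {n = m₁ ℕ.* R} (^-nonneg R 0≤β̂) (^-mono R 0≤β̂ (b^≤ m₁) ⟨≤⟩ ≡⇒≤ (sym (^-* 2# m₁ R))))
                                          (≤-dy {n = τ ℕ.* S} (^-nonneg S 0≤θ₂) (^-mono S 0≤θ₂ (≤abs θ₂ ⟨≤⟩ |θ₂|≤) ⟨≤⟩ ≡⇒≤ (sym (^-* 2# τ S)))))
                                    (dy-* (≤-dy {n = U} (^-nonneg l 0≤η) (^-mono l 0≤η η≤2 ⟨≤⟩ 2^-mono l≤U)) Γ-first)) 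
              (ℕ.≤-trans (ℕ.+-monoʳ-≤ (m₁ ℕ.* R ℕ.+ τ ℕ.* S ℕ.+ (U ℕ.+ ((suc p ℕ.+ 1) ℕ.* K ℕ.+ 0 ℕ.+ (p ℕ.+ 9) ℕ.* U))) sA≤)
               (ℕ.≤-trans (ℕ.+-monoˡ-≤ ((c₁ ℕ.* (2 ℕ.* p ℕ.+ 24) ℕ.+ 1) ℕ.* U) (ℕ.+-monoˡ-≤ (U ℕ.+ ((suc p ℕ.+ 1) ℕ.* K ℕ.+ 0 ℕ.+ (p ℕ.+ 9) ℕ.* U)) (ℕ.+-mono-≤ m₁R≤ τS≤)))
                (ℕ.≤-trans (ℕ.≤-reflexive (lemma₁ c₁ p U K))
                 (ℕ.≤-trans (ℕ.+-mono-≤ (ℕ.*-monoʳ-≤ (p ℕ.+ 2) K≤3κ) (ℕ.*-monoʳ-≤ (p ℕ.+ 24 ℕ.+ c₁ ℕ.* (2 ℕ.* p ℕ.+ 24)) U≤3κ))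
                  (ℕ.≤-trans (ℕ.≤-reflexive (lemma₂ c₁ p κ))
                   (ℕ.≤-trans (ℕ.+-monoʳ-≤ (6 ℕ.* p ℕ.* κ ℕ.+ 6 ℕ.* c₁ ℕ.* p ℕ.* κ) (ℕ.+-mono-≤ (ℕ.*-monoʳ-≤ 78 pκ) (ℕ.*-monoʳ-≤ (72 ℕ.* c₁) pκ)))
                    (ℕ.≤-reflexive (trans (lemma₃ c₁ p κ) (trans (cc-* p κ) (lemma₄ (cc ℕ.* p ℕ.* κ))))))))))) 
              where
              pκ : κ ℕ.≤ p ℕ.* κ
              pκ = ℕ.≤-trans (ℕ.≤-reflexive (sym (ℕ.*-identityˡ κ))) (ℕ.*-monoˡ-≤ κ 1≤p)
              lemma₁ : ∀ c p U K → 4 ℕ.* U ℕ.+ 9 ℕ.* U ℕ.+ (U ℕ.+ ((suc p ℕ.+ 1) ℕ.* K ℕ.+ 0 ℕ.+ (p ℕ.+ 9) ℕ.* U)) ℕ.+ (c ℕ.* (2 ℕ.* p ℕ.+ 24) ℕ.+ 1) ℕ.* U ≡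
                       (p ℕ.+ 2) ℕ.* K ℕ.+ (p ℕ.+ 24 ℕ.+ c ℕ.* (2 ℕ.* p ℕ.+ 24)) ℕ.* U
              lemma₁ = solve-∀
              lemma₂ : ∀ c p κ → (p ℕ.+ 2) ℕ.* (3 ℕ.* κ) ℕ.+ (p ℕ.+ 24 ℕ.+ c ℕ.* (2 ℕ.* p ℕ.+ 24)) ℕ.* (3 ℕ.* κ) ≡
                       6 ℕ.* p ℕ.* κ ℕ.+ 6 ℕ.* c ℕ.* p ℕ.* κ ℕ.+ (78 ℕ.* κ ℕ.+ 72 ℕ.* c ℕ.* κ)
              lemma₂ = solve-∀
              lemma₃ : ∀ c p κ → 6 ℕ.* p ℕ.* κ ℕ.+ 6 ℕ.* c ℕ.* p ℕ.* κ ℕ.+ (78 ℕ.* (p ℕ.* κ) ℕ.+ 72 ℕ.* c ℕ.* (p ℕ.* κ)) ≡ (84 ℕ.+ 78 ℕ.* c) ℕ.* p ℕ.* κ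
              lemma₃ = solve-∀
              lemma₄ : ∀ x → x ≡ 0 ℕ.+ (0 ℕ.+ 0 ℕ.+ (0 ℕ.+ (0 ℕ.+ x ℕ.+ 0)))
              lemma₄ = solve-∀

            room : ∀ t → t ℕ.≤ (54 ℕ.+ 4 ℕ.* cc) ℕ.* p → t ℕ.* U ℕ.≤ W
            room t t≤ = ℕ.*-monoˡ-≤ U (ℕ.≤-trans t≤ hp)

            diff-dy : Dy (eval₂ (V l) - Bf * (η ^ l * Γ l)) 0 (suc A)
            diff-dy = dy-shift (difference l l≤U) (ℕ.≤-trans (ℕ.+-monoʳ-≤ ((2 ℕ.* p ℕ.+ 44) ℕ.* U) sA≤)
              (ℕ.≤-trans (ℕ.≤-reflexive (sym (ℕ.*-distribʳ-+ U (2 ℕ.* p ℕ.+ 44) (c₁ ℕ.* (2 ℕ.* p ℕ.+ 24) ℕ.+ 1)))) (room _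
                (ℕ.≤-trans (ℕ.≤-reflexive (lemma₁ c₁ p)) (ℕ.≤-trans (ℕ.+-monoʳ-≤ (2 ℕ.* p ℕ.+ 2 ℕ.* c₁ ℕ.* p) (ℕ.+-mono-≤ (ℕ.*-monoʳ-≤ 45 1≤p) (ℕ.*-monoʳ-≤ (24 ℕ.* c₁) 1≤p)))
                  (ℕ.≤-trans (le ((343 ℕ.+ 286 ℕ.* c₁) ℕ.* p) (lemma₂ c₁ p)) (ℕ.≤-reflexive (4cc-* p))))))))
              where
              lemma₁ : ∀ c p → 2 ℕ.* p ℕ.+ 44 ℕ.+ (c ℕ.* (2 ℕ.* p ℕ.+ 24) ℕ.+ 1) ≡ 2 ℕ.* p ℕ.+ 2 ℕ.* c ℕ.* p ℕ.+ (45 ℕ.* 1 ℕ.+ 24 ℕ.* c ℕ.* 1)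
              lemma₁ = solve-∀
              lemma₂ : ∀ c p → 2 ℕ.* p ℕ.+ 2 ℕ.* c ℕ.* p ℕ.+ (45 ℕ.* p ℕ.+ 24 ℕ.* c ℕ.* p) ℕ.+ (343 ℕ.+ 286 ℕ.* c) ℕ.* p ≡ (54 ℕ.+ 4 ℕ.* (84 ℕ.+ 78 ℕ.* c)) ℕ.* p
              lemma₂ = solve-∀

            V-small : ∣ eval₂ (V l) ∣ ≤ ½^ (suc (Aℓ Z))
            V-small = dy⇒≤½^ (suc (Aℓ Z)) (dy-shift (dy-≡ (solve 2 (λ v m → (v :- m) :+ m := v) refl (eval₂ (V l)) (Bf * (η ^ l * Γ l))) (dy-+ diff-dy main-dy))
              (ℕ.≤-reflexive (cong suc (Aℓ-linear Z))))

            -- Below the Liouville threshold `V l` vanishes in the limit, so it is as small as the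
            -- precision X permits, in particular below 2^(-W).
            V-tiny : Dy (eval₂ (V l)) 0 W
            V-tiny = ≤½^⇒dy W (small⇒negligible (V l) Z W (nrm-V l l≤U)
              (ℕ.≤-trans (SumN-term U (λ j → need₂ (V j) Z W) l (ℕ.<-≤-trans l<κ κ≤U)) X≥) V-small)

          -- With `V l` out of the way, Γ l is bounded by the error of θ alone, that is 2^(-W) up to
          -- O(pU) bits, since Bf η^l is at least 2^(-U).
          Γ-second : Dy (Γ l) ((2 ℕ.* p ℕ.+ 46) ℕ.* U) W
          Γ-second = dy-shift (dy-≤ grow (dy-* (≤-dy {n = U} (0≤2^ U) ≤-refl) (dy-≡ (solve 2 (λ v m → v :- (v :- m) := m) refl (eval₂ (V l)) (Bf * (η ^ l * Γ l)))
                (dy-- (dy-shift V-tiny (ℕ.m≤n+m W ((2 ℕ.* p ℕ.+ 44) ℕ.* U))) (difference l l≤U)))))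
              (ℕ.+-monoˡ-≤ W (ℕ.≤-trans (ℕ.≤-reflexive (lemma₁ p U)) (ℕ.≤-trans (ℕ.+-monoʳ-≤ ((2 ℕ.* p ℕ.+ 45) ℕ.* U) 1≤U) (ℕ.≤-reflexive (lemma₂ p U)))))
            where
            lemma₁ : ∀ p U → U ℕ.+ suc ((2 ℕ.* p ℕ.+ 44) ℕ.* U) ≡ (2 ℕ.* p ℕ.+ 45) ℕ.* U ℕ.+ 1
            lemma₁ = solve-∀
            lemma₂ : ∀ p U → (2 ℕ.* p ℕ.+ 45) ℕ.* U ℕ.+ U ≡ (2 ℕ.* p ℕ.+ 46) ℕ.* U
            lemma₂ = solve-∀
            1≤Bf : 1# ≤ Bf
            1≤Bf = ≡⇒≤ (sym (R.*-identityˡ 1#)) ⟨≤⟩ *-mono-≤ 0≤1 (1≤^ R 1≤β̂) 0≤1 (1≤^ S 1≤θ₂)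
            1≤2η : 1# ≤ 2# * η
            1≤2η = ≡⇒≤ (sym 2*½) ⟨≤⟩ *-monoʳ-≤ 0≤2 ½≤η
            factor : 1# ≤ 2^ U * (Bf * η ^ l)
            factor = ≡⇒≤ (sym (R.*-identityˡ 1#)) ⟨≤⟩ *-mono-≤ 0≤1 1≤Bf 0≤1 (1≤^ l 1≤2η ⟨≤⟩ ≡⇒≤ (^-distrib-* 2# η l) ⟨≤⟩ *-monoˡ-≤ (^-nonneg l 0≤η) (2^-mono l≤U)) ⟨≤⟩
              ≡⇒≤ (solve 3 (λ b t h → b :* (t :* h) := t :* (b :* h)) refl Bf (2^ U) (η ^ l))
            grow : ∣ Γ l ∣ ≤ ∣ 2^ U * (Bf * (η ^ l * Γ l)) ∣
            grow = ≡⇒≤ (sym (R.*-identityˡ _)) ⟨≤⟩ *-monoˡ-≤ (0≤abs (Γ l)) (factor ⟨≤⟩ ≤abs _) ⟨≤⟩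
              ≡⇒≤ (trans (sym (abs-* _ _)) (cong ∣_∣ (solve 4 (λ t b h g → t :* (b :* h) :* g := t :* (b :* (h :* g))) refl (2^ U) Bf (η ^ l) (Γ l))))

        contradiction : ⊥
        contradiction = finish (leading μ′ K vanish K<n̂)
          where
          finish : (Σ (ℕ → Carrier) λ c → (∀ j → ∣ c j ∣ ≤ (2^ 2) ^ j) × (∀ j → j ℕ.< K ℕ.+ suc μ′ → g⁺ j * (c j * w ^ j) ≡ 0#) ×
              (w ^ K * g⁺ K ≡ Sum (suc μ′) (λ k → sg k * ιℕ (pade μ′ K k) * (w ^ k * Γ k)) - Sum n̂ (λ j → g⁺ j * (c j * w ^ j)))) → ⊥
          finish (c , c≤ , cv , identity) = K-nonzero (ι-small (moment N q e K) gK≤½)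
            where
            S₁ S₂ : Carrier
            S₁ = Sum κ (λ k → sg k * ιℕ (pade μ′ K k) * (w ^ k * Γ k))
            S₂ = Sum n̂ (λ j → g⁺ j * (c j * w ^ j))

            -- Here the lower bound for |w| enters: |w|^K costs at most 4 cc p U bits, which W can
            -- afford.
            E₂′ : ℕ
            E₂′ = 2 ℕ.* (cc ℕ.* p) ℕ.* (2 ℕ.* U)

            E₂′≤ : ½^ E₂′ ≤ μ ^ K
            E₂′≤ = ½^-anti (ℕ.*-monoʳ-≤ (2 ℕ.* (cc ℕ.* p)) (ℕ.<⇒≤ K<2U)) ⟨≤⟩ ≡⇒≤ (^-* ½ (2 ℕ.* (cc ℕ.* p)) K) ⟨≤⟩ ^-mono K (0≤½^ (2 ℕ.* (cc ℕ.* p))) ≤μ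

            μ′+K≤ : μ′ ℕ.+ K ℕ.≤ 3 ℕ.* U
            μ′+K≤ = ℕ.+-mono-≤ (ℕ.≤-trans (ℕ.n≤1+n μ′) κ≤U) (ℕ.<⇒≤ K<2U)

            term-dy : ∀ l → l ℕ.< κ → Dy (sg l * ιℕ (pade μ′ K l) * (w ^ l * Γ l)) (0 ℕ.+ 3 ℕ.* U ℕ.+ (0 ℕ.+ (2 ℕ.* p ℕ.+ 46) ℕ.* U)) (0 ℕ.+ 0 ℕ.+ (0 ℕ.+ W))
            term-dy l l<κ = dy-* (dy-* (≤2^⇒dy 0 (≡⇒≤ (abs-sg l)))
                (dy-ιℕ (3 ℕ.* U) (ℕ.≤-trans (bin≤2^ (μ′ ℕ.∸ l ℕ.+ K) (μ′ ℕ.∸ l)) (ℕ.^-monoʳ-≤ 2 (ℕ.≤-trans (ℕ.+-monoˡ-≤ K (ℕ.m∸n≤m μ′ l)) μ′+K≤)))))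
              (dy-* (≤2^⇒dy 0 (≡⇒≤ (abs-^ w l) ⟨≤⟩ ^≤1 l 0≤μ μ≤1)) (Γ-second l l<κ))

            -- This estimate fixes the constant 54 + 4 cc in `hp`: 4 cc p U bits for |w|^K and the
            -- rest for the Padé coefficients and Γ, all paid from W.
            S₁≤ : ∣ S₁ ∣ ≤ ½^ 2 * μ ^ K
            S₁≤ = dy⇒≤½^ (2 ℕ.+ E₂′) (dy-shift (dy-Sum κ U (ℕ.≤-trans κ≤U (ℕ.<⇒≤ (n<2^n U))) term-dy)
                (ℕ.≤-trans (ℕ.≤-reflexive (lemma₁ p U cc)) (ℕ.≤-trans (ℕ.+-mono-≤ (ℕ.≤-refl {(2 ℕ.* p ℕ.+ 50 ℕ.+ 4 ℕ.* cc ℕ.* p) ℕ.* U}) (ℕ.*-monoʳ-≤ 2 1≤U))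
                  (ℕ.≤-trans (ℕ.≤-reflexive (lemma₂ p U cc)) (ℕ.≤-trans (ℕ.*-monoˡ-≤ U (ℕ.+-monoʳ-≤ (2 ℕ.* p ℕ.+ 4 ℕ.* cc ℕ.* p) (ℕ.*-monoʳ-≤ 52 1≤p)))
                    (ℕ.≤-trans (ℕ.≤-reflexive (lemma₃ p U cc)) (ℕ.*-monoˡ-≤ U hp))))))) ⟨≤⟩
              ≡⇒≤ (^-+ ½ 2 E₂′) ⟨≤⟩ *-monoʳ-≤ (0≤½^ 2) E₂′≤
              where
              lemma₁ : ∀ p U c → U ℕ.+ (0 ℕ.+ 3 ℕ.* U ℕ.+ (0 ℕ.+ (2 ℕ.* p ℕ.+ 46) ℕ.* U)) ℕ.+ (2 ℕ.+ 2 ℕ.* (c ℕ.* p) ℕ.* (2 ℕ.* U)) ≡ (2 ℕ.* p ℕ.+ 50 ℕ.+ 4 ℕ.* c ℕ.* p) ℕ.* U ℕ.+ 2 ℕ.* 1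
              lemma₁ = solve-∀
              lemma₂ : ∀ p U c → (2 ℕ.* p ℕ.+ 50 ℕ.+ 4 ℕ.* c ℕ.* p) ℕ.* U ℕ.+ 2 ℕ.* U ≡ (2 ℕ.* p ℕ.+ 4 ℕ.* c ℕ.* p ℕ.+ 52 ℕ.* 1) ℕ.* U
              lemma₂ = solve-∀
              lemma₃ : ∀ p U c → (2 ℕ.* p ℕ.+ 4 ℕ.* c ℕ.* p ℕ.+ 52 ℕ.* p) ℕ.* U ≡ (54 ℕ.+ 4 ℕ.* c) ℕ.* p ℕ.* U
              lemma₃ = solve-∀

            -- The remainder starts at order K + κ. Relative to |w|^K it keeps κ factors of |w|,
            -- whose cc p κ bits outweigh the size of the polynomial.
            coef : Carrier
            coef = 2^ ((suc p ℕ.+ 2) ℕ.* (K ℕ.+ κ)) * μ ^ κ * Hq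

            coef≤ : coef ≤ ½^ 2
            coef≤ = ≤abs coef ⟨≤⟩ dy⇒≤½^ 2 (dy-shift (dy-* (dy-* (≤-dy {n = (suc p ℕ.+ 2) ℕ.* (K ℕ.+ κ)} (0≤2^ ((suc p ℕ.+ 2) ℕ.* (K ℕ.+ κ))) ≤-refl)
                  (≤½^⇒dy (cc ℕ.* p ℕ.* κ) (≡⇒≤ (abs-nonneg (^-nonneg κ 0≤μ)) ⟨≤⟩ μ^κ≤))) (≤-dy {n = (p ℕ.+ 9) ℕ.* U} 0≤Hq Hq≤))
                (ℕ.≤-trans (ℕ.+-mono-≤ (ℕ.+-mono-≤ (ℕ.+-monoˡ-≤ 0 (ℕ.*-monoʳ-≤ (suc p ℕ.+ 2) (ℕ.+-monoˡ-≤ κ K≤3κ))) (ℕ.*-monoʳ-≤ (p ℕ.+ 9) U≤3κ)) (ℕ.*-monoʳ-≤ 2 (s≤s (z≤n {μ′}))))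
                  (ℕ.≤-trans (ℕ.≤-reflexive (lemma₁ p κ)) (ℕ.≤-trans (ℕ.*-monoˡ-≤ κ (ℕ.+-monoʳ-≤ (7 ℕ.* p) (ℕ.*-monoʳ-≤ 41 1≤p)))
                    (ℕ.≤-trans (le ((36 ℕ.+ 78 ℕ.* c₁) ℕ.* p ℕ.* κ) (lemma₂ p κ c₁)) (ℕ.≤-reflexive (trans (cc-* p κ) (lemma₃ (cc ℕ.* p ℕ.* κ)))))))))
              where
              lemma₁ : ∀ p κ → (suc p ℕ.+ 2) ℕ.* (3 ℕ.* κ ℕ.+ κ) ℕ.+ 0 ℕ.+ (p ℕ.+ 9) ℕ.* (3 ℕ.* κ) ℕ.+ 2 ℕ.* κ ≡ (7 ℕ.* p ℕ.+ 41 ℕ.* 1) ℕ.* κ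
              lemma₁ = solve-∀
              lemma₂ : ∀ p κ c → (7 ℕ.* p ℕ.+ 41 ℕ.* p) ℕ.* κ ℕ.+ (36 ℕ.+ 78 ℕ.* c) ℕ.* p ℕ.* κ ≡ (84 ℕ.+ 78 ℕ.* c) ℕ.* p ℕ.* κ
              lemma₂ = solve-∀
              lemma₃ : ∀ x → x ≡ 0 ℕ.+ (0 ℕ.+ x ℕ.+ 0)
              lemma₃ = solve-∀

            S₂≤ : ∣ S₂ ∣ ≤ ½^ 2 * μ ^ K
            S₂≤ = tail-bound c (2^ 2) x (zf 2) (K ℕ.+ κ) (0≤2^ 2) 0≤x (0≤zf 2) (zf≤1 2 ℕ.≤-refl) (zf-x 2) c≤ cv ⟨≤⟩
              ≡⇒≤ (trans (cong (_* Hq) (trans (zf^ 2 (K ℕ.+ κ)) (cong (_*_ (2^ ((suc p ℕ.+ 2) ℕ.* (K ℕ.+ κ)))) (^-+ μ K κ))))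
                (solve 4 (λ a b c h → a :* (b :* c) :* h := a :* c :* h :* b) refl (2^ ((suc p ℕ.+ 2) ℕ.* (K ℕ.+ κ))) (μ ^ K) (μ ^ κ) Hq)) ⟨≤⟩
              *-monoˡ-≤ (^-nonneg K 0≤μ) coef≤

            gK≤½ : ∣ g⁺ K ∣ ≤ ½
            gK≤½ = *-cancelˡ-≤ (μ ^ K) (μ^≰0 K)
              (≡⇒≤ (trans (cong (_* ∣ g⁺ K ∣) (sym (abs-^ w K))) (trans (sym (abs-* _ _)) (cong ∣_∣ identity))) ⟨≤⟩ abs-- S₁ S₂ ⟨≤⟩ +-mono-≤ S₁≤ S₂≤ ⟨≤⟩
               ≡⇒≤ (trans (sym (R.distribʳ (μ ^ K) (½^ 2) (½^ 2))) (trans (cong (_* μ ^ K) (trans (½^-double 1) (R.*-identityʳ ½))) (R.*-comm _ _))))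

-- Choice of parameters and the bound for j.

module Bounding (𝔽 : OrderedField) (𝓖 : KBonacci) (d : ℕ) where
  open KBonacci 𝓖
  open FieldTheory 𝔽
  open Pisot 𝔽 k 3≤k
  open Approximation 𝔽 k 3≤k
  open Liouville 𝔽 𝓖
  open GoldenExtension 𝔽 𝓖

  open MultiplicativeIndependence 𝔽 𝓖

  open LinearForm 𝔽 𝓖
  open SmallUnits 𝔽 𝓖
  open Combinatorics
  open HermitePadé 𝔽
  open import Data.Nat.DivMod using (_/_; _%_; m≡m%n+[m/n]*n; m%n<n; m<n*o⇒m/o<n; [m+kn]%n≡m%n; m<n⇒m%n≡m)

  open AuxiliaryPolynomial 𝔽 𝓖 d

  open SizeEstimates 𝔽 𝓖 d

  open Vanishing 𝔽 𝓖 d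

  -- From the exponent 2C + 2 onwards: there (2C + 3) C is at most 2^(C + 2) 2^C, and afterwards the
  -- right side doubles while the left at most doubles.
  room-for : ∀ C t → C ℕ.* suc (t ℕ.+ (C ℕ.+ (C ℕ.+ 2))) ℕ.≤ 2 ℕ.^ (t ℕ.+ (C ℕ.+ (C ℕ.+ 2)))
  room-for C zero = ℕ.≤-trans (ℕ.*-mono-≤ (ℕ.<⇒≤ (n<2^n C)) step) (ℕ.≤-reflexive (sym (ℕ.^-distribˡ-+-* 2 C (C ℕ.+ 2))))
    where
    lemma : ∀ c → suc (c ℕ.+ (c ℕ.+ 2)) ℕ.+ (2 ℕ.* c ℕ.+ 1) ≡ suc c ℕ.* 4
    lemma = solve-∀
    step : suc (C ℕ.+ (C ℕ.+ 2)) ℕ.≤ 2 ℕ.^ (C ℕ.+ 2)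
    step = ℕ.≤-trans (le (2 ℕ.* C ℕ.+ 1) (lemma C)) (ℕ.≤-trans (ℕ.*-monoˡ-≤ 4 (n<2^n C)) (ℕ.≤-reflexive (sym (ℕ.^-distribˡ-+-* 2 C 2))))
  room-for C (suc t) = ℕ.≤-trans (le (C ℕ.* p) (lemma C p)) (ℕ.*-monoʳ-≤ 2 (room-for C t))
    where
    p = t ℕ.+ (C ℕ.+ (C ℕ.+ 2))
    lemma : ∀ c p → c ℕ.* suc (suc p) ℕ.+ c ℕ.* p ≡ 2 ℕ.* (c ℕ.* suc p)
    lemma = solve-∀

  private
    lastTrue : ∀ {P : ℕ → Set} (P? : ∀ i → P i ⊎ ¬ P i) s → P 0 → ¬ P s → Σ ℕ λ i → i ℕ.< s × P i × ¬ P (suc i)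
    lastTrue P? zero p ¬p = ⊥-elim (¬p p)
    lastTrue {P} P? (suc s) p ¬p = pick (P? s)
      where
      widen : (Σ ℕ λ i → i ℕ.< s × P i × ¬ P (suc i)) → Σ ℕ λ i → i ℕ.< suc s × P i × ¬ P (suc i)
      widen (i , i<s , q , r) = i , ℕ.m<n⇒m<1+n i<s , q , r
      pick : P s ⊎ ¬ P s → Σ ℕ λ i → i ℕ.< suc s × P i × ¬ P (suc i)
      pick (inj₁ q)  = s , ℕ.≤-refl , q , ¬p
      pick (inj₂ ¬q) = widen (lastTrue P? s p ¬q)

    -- Merges finitely many sufficient precisions into one.
    collect : ∀ n {P : ℕ → ℕ → Set} → (∀ {i X X′} → X ℕ.≤ X′ → P i X → P i X′) →
              (∀ i → i ℕ.< n → Σ ℕ (P i)) → Σ ℕ λ X → ∀ i → i ℕ.< n → P i X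
    collect zero mono h = 0 , λ _ ()
    collect (suc n) {P} mono h = combine (h n ℕ.≤-refl) (collect n mono (λ i p → h i (ℕ.m<n⇒m<1+n p)))
      where
      combine : Σ ℕ (P n) → (Σ ℕ λ X → ∀ i → i ℕ.< n → P i X) → Σ ℕ λ X → ∀ i → i ℕ.< suc n → P i X
      combine (X₁ , p₁) (X₂ , p₂) = X₁ ℕ.+ X₂ , all
        where
        all : ∀ i → i ℕ.< suc n → P i (X₁ ℕ.+ X₂)
        all i (s≤s i≤n) = pick (ℕ.m≤n⇒m<n∨m≡n i≤n)
          where
          pick : (i ℕ.< n) ⊎ (i ≡ n) → P i (X₁ ℕ.+ X₂)
          pick (inj₁ q)    = mono (ℕ.m≤n+m X₂ X₁) (p₂ i q)
          pick (inj₂ refl) = mono (ℕ.m≤m+n X₁ X₂) p₁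

  -- The constants enter as variables with the relations that are needed, because their values are
  -- enormous. They involve only d and k, neither a solution nor a precision.
  module Bounded (p₀ Q M Pmax Pw Rmax Xm threshold : ℕ)
                 (room : ∀ t → (54 ℕ.+ 4 ℕ.* cc) ℕ.* suc (t ℕ.+ p₀) ℕ.≤ 2 ℕ.^ (t ℕ.+ p₀))
                 (Q≡ : Q ≡ 2 ℕ.^ (cc ℕ.* suc p₀)) (2Q+3≤M : 2 ℕ.* Q ℕ.+ 3 ℕ.≤ M)
                 (Amax≤ : ∀ n m → n ℕ.≤ Q → m ℕ.< M → Independence.Amax n m ℕ.+ m ℕ.+ p₀ ℕ.≤ Pmax)
                 (Xmin≤Xm : ∀ n m → n ℕ.≤ Q → m ℕ.< M → Independence.Xmin n m ℕ.≤ Xm)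
                 (Pw≡ : Pw ≡ 2 ℕ.^ suc Pmax) (R₀≤ : R₀ Q Pw ℕ.+ 2 ℕ.≤ Rmax)
                 (threshold≥ : Rmax ℕ.* (Q ℕ.* Pw) ℕ.≤ threshold) where
    private
      l : ℕ
      l = cc ℕ.* suc p₀

      2Q+3≤M′ : suc (2 ℕ.* Q ℕ.+ 2) ℕ.≤ M
      2Q+3≤M′ = ℕ.≤-trans (ℕ.≤-reflexive (sym (ℕ.+-suc (2 ℕ.* Q) 2))) 2Q+3≤M

      1≤l : 1 ℕ.≤ l
      1≤l = ℕ.≤-trans 1≤cc (ℕ.≤-trans (ℕ.≤-reflexive (sym (ℕ.*-identityʳ cc))) (ℕ.*-monoʳ-≤ cc (s≤s z≤n)))

    module _ (j m : ℕ) (big : threshold ℕ.≤ j) (window : Sumℤ (suc d) (λ i → g (j ℕ.+ i)) ≡ + v m) where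
      private
        -- Quantifies over all finer precisions and all approximations, so that it can be
        -- established before the approximation that reveals n₁, m₁ and p is chosen.
        Refuted : ℕ → ℕ → ℕ → ℕ → Set
        Refuted n₁ m₁ p′ X = ∀ {X′} → X ℕ.≤ X′ → Xλ d j m ℕ.≤ X′ → (root : Root X′) (golden : Golden X′) → let open Evaluation₂ root golden in
          ∣ a ^ n₁ - b ^ m₁ ∣ ≤ ½^ (cc ℕ.* suc p′) * b ^ m₁ → ½^ (2 ℕ.* (cc ℕ.* suc p′)) * b ^ m₁ ≤ ∣ a ^ n₁ - b ^ m₁ ∣ → ⊥

        refute : ∀ n₁ m₁ p′ → 1 ℕ.≤ n₁ → n₁ ℕ.≤ Q → p′ ℕ.≤ Pmax → (54 ℕ.+ 4 ℕ.* cc) ℕ.* suc p′ ℕ.≤ 2 ℕ.^ p′ → Σ ℕ (Refuted n₁ m₁ p′)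
        refute n₁ m₁ p′ 1≤n₁ n₁≤Q p′≤ room = Construction.precision n₁ p′ R s₀ m₁ m {{R≢0}} 1≤n₁ 2≤U , refuted
          where
          P D′ : ℕ
          P = 2 ℕ.^ suc p′
          D′ = n₁ ℕ.* P
          instance
            D≢0 : ℕ.NonZero D′
            D≢0 = ℕ.>-nonZero (ℕ.*-mono-≤ 1≤n₁ (ℕ.m^n>0 2 (suc p′)))
          R s₀ : ℕ
          -- Thus j = n₁ 2^p R + s₀. As n₁ and p are bounded beforehand, a large j makes R as large
          -- as `R₀` demands.
          R = j / D′
          s₀ = j % D′
          s₀≤ : s₀ ℕ.≤ D′
          s₀≤ = ℕ.<⇒≤ (m%n<n j D′)
          P≤ : P ℕ.≤ Pw
          P≤ = ℕ.≤-trans (ℕ.^-monoʳ-≤ 2 (s≤s p′≤)) (ℕ.≤-reflexive (sym Pw≡))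
          Rmax≤R : Rmax ℕ.≤ R
          Rmax≤R = ℕ.≮⇒≥ (λ R<Rmax → ℕ.<-irrefl refl (ℕ.<-≤-trans (ℕ.<-≤-trans
            (ℕ.≤-<-trans (ℕ.≤-reflexive (m≡m%n+[m/n]*n j D′)) (ℕ.+-monoˡ-< (R ℕ.* D′) (m%n<n j D′)))
            (ℕ.≤-trans (ℕ.*-monoˡ-≤ D′ R<Rmax) (ℕ.≤-trans (ℕ.*-monoʳ-≤ Rmax (ℕ.*-mono-≤ n₁≤Q P≤)) threshold≥))) big))
          2≤R : 2 ℕ.≤ R
          2≤R = ℕ.≤-trans (ℕ.m≤n+m 2 (R₀ Q Pw)) (ℕ.≤-trans R₀≤ Rmax≤R)
          R≢0 : ℕ.NonZero R
          R≢0 = ℕ.>-nonZero (ℕ.≤-trans (s≤s z≤n) 2≤R)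
          2≤U : 2 ℕ.≤ R ℕ.* n₁
          2≤U = ℕ.*-mono-≤ 2≤R 1≤n₁
          hR : R₀ n₁ P ℕ.≤ R
          hR = ℕ.≤-trans (ℕ.≤-trans (ℕ.+-monoˡ-≤ (c₂ ℕ.+ 2) (ℕ.+-monoˡ-≤ (g₀ ℕ.+ 1 ℕ.+ c₀) (ℕ.*-monoʳ-≤ 2 (ℕ.+-monoʳ-≤ (3 ℕ.* g₀ ℕ.+ 2) (ℕ.*-monoʳ-≤ 3 (ℕ.*-mono-≤ n₁≤Q P≤))))))
            (ℕ.m≤m+n (R₀ Q Pw) 2)) (ℕ.≤-trans R₀≤ Rmax≤R)
          j≡ : j ≡ n₁ ℕ.* (P ℕ.* R) ℕ.+ s₀
          j≡ = trans (m≡m%n+[m/n]*n j D′) (lemma s₀ R n₁ P)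
            where
            lemma : ∀ s R n P → s ℕ.+ R ℕ.* (n ℕ.* P) ≡ n ℕ.* (P ℕ.* R) ℕ.+ s
            lemma = solve-∀
          refuted : Refuted n₁ m₁ p′ (Construction.precision n₁ p′ R s₀ m₁ m {{R≢0}} 1≤n₁ 2≤U)
          refuted X≥ Xλ≤ root golden upper lower =
            Contradiction.contradiction n₁ p′ R s₀ m₁ m {{R≢0}} 1≤n₁ 2≤U hR s₀≤ room root golden X≥ upper lower
              (≤-resp (cong form j≡) refl (linear-form j m Xλ≤ (trans (sym (ι-Sumℤ (suc d) (λ i → g (j ℕ.+ i)))) (cong ι window))))
            where
            open Evaluation₂ root golden using (a; b)
            open Linear root golden d using (γ₁; γ₂; linear-form)
            form : ℕ → Carrier
            form i = ∣ γ₁ * a ^ i - γ₂ * b ^ m ∣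

        Refuted₃ : ℕ → ℕ → ℕ → Set
        Refuted₃ n′ m₁ X = ∀ t → t ℕ.+ p₀ ℕ.≤ Pmax → Refuted (suc n′) m₁ (t ℕ.+ p₀) X

        refuted-mono : ∀ n₁ m₁ p′ {X X′} → X ℕ.≤ X′ → Refuted n₁ m₁ p′ X → Refuted n₁ m₁ p′ X′
        refuted-mono n₁ m₁ p′ X≤ r X′≤ = r (ℕ.≤-trans X≤ X′≤)

        uniform₃ : ∀ n′ m₁ → n′ ℕ.< Q → Σ ℕ (Refuted₃ n′ m₁)
        uniform₃ n′ m₁ n′<Q = finish (collect (suc Pmax) {λ t X → t ℕ.+ p₀ ℕ.≤ Pmax → Refuted (suc n′) m₁ (t ℕ.+ p₀) X} (λ {t} X≤ r t≤ → refuted-mono (suc n′) m₁ (t ℕ.+ p₀) X≤ (r t≤))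
            (λ t _ → pick t (t ℕ.+ p₀ ℕ.≤? Pmax)))
          where
          pick : ∀ t → Dec (t ℕ.+ p₀ ℕ.≤ Pmax) → Σ ℕ (λ X → t ℕ.+ p₀ ℕ.≤ Pmax → Refuted (suc n′) m₁ (t ℕ.+ p₀) X)
          pick t (yes t≤) = proj₁ r , λ _ → proj₂ r
            where r = refute (suc n′) m₁ (t ℕ.+ p₀) (s≤s z≤n) n′<Q t≤ (room t)
          pick t (no ¬t≤) = 0 , λ t≤ → ⊥-elim (¬t≤ t≤)
          finish : (Σ ℕ λ X → ∀ t → t ℕ.< suc Pmax → t ℕ.+ p₀ ℕ.≤ Pmax → Refuted (suc n′) m₁ (t ℕ.+ p₀) X) → Σ ℕ (Refuted₃ n′ m₁)
          finish (X , r) = X , λ t t≤ → r t (s≤s (ℕ.≤-trans (ℕ.m≤m+n t p₀) t≤)) t≤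

        -- Breaks the circle between the precision and the parameters found with it: all admissible
        -- triples n₁, m₁, p are refuted from one precision on.
        uniform : Σ ℕ λ X → ∀ n′ → n′ ℕ.< Q → ∀ m₁ → m₁ ℕ.< M → Refuted₃ n′ m₁ X
        uniform = collect Q (λ {n′} X≤ r m₁ m₁<M t t≤ → refuted-mono (suc n′) m₁ (t ℕ.+ p₀) X≤ (r m₁ m₁<M t t≤))
          (λ n′ n′<Q → collect M (λ {m₁} X≤ r t t≤ → refuted-mono (suc n′) m₁ (t ℕ.+ p₀) X≤ (r t t≤)) (λ m₁ _ → uniform₃ n′ m₁ n′<Q))

        X : ℕ
        X = proj₁ uniform ℕ.+ Xm ℕ.+ Xλ d j m

        root : Root X
        root = root-of X

        golden : Golden X
        golden = golden-of X

        open Evaluation₂ root golden using (a; b; 0≤b; b≤2; 1≤b; 0≤a; a≤2)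
        open SmallUnit root golden using (small-unit; 2^≤b^; 2^-reflects)

        m₁-bound : ∀ n₁ m₁ → ∣ a ^ n₁ - b ^ m₁ ∣ ≤ ½^ l * b ^ m₁ → m₁ ℕ.≤ 2 ℕ.* n₁ ℕ.+ 2
        m₁-bound n₁ m₁ close = ℕ.≤-trans (2^-reflects (2^≤b^ m₁ ⟨≤⟩ *-mono-≤ 0≤β̂ β̂≤ 0≤β̂ β̂≤ ⟨≤⟩ ≡⇒≤ (2^[ suc n₁ ]*2^[ suc n₁ ]))) (ℕ.≤-reflexive (lemma n₁))
          where
          β̂ = b ^ m₁
          0≤β̂ : 0# ≤ β̂
          0≤β̂ = ^-nonneg m₁ 0≤b
          lemma : ∀ n → suc n ℕ.+ suc n ≡ 2 ℕ.* n ℕ.+ 2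
          lemma = solve-∀
          ½β̂ : ½ * β̂ ≤ a ^ n₁
          ½β̂ = by-diff (½ * β̂ - - (a ^ n₁ - β̂)) (≤⇒0≤- (-≤abs _ ⟨≤⟩ close ⟨≤⟩ *-monoˡ-≤ 0≤β̂ (½^-anti {1} {l} 1≤l ⟨≤⟩ ≡⇒≤ (R.*-identityʳ ½))))
            (trans (solve 3 (λ x h b → x :- h :* b := (h :* b :- :- (x :- b)) :- (h :+ h :- c1) :* b) refl (a ^ n₁) ½ β̂)
              (trans (cong (λ z → ½ * β̂ - - (a ^ n₁ - β̂) - (z - 1#) * β̂) ½+½) (solve 2 (λ x b → x :- (c1 :- c1) :* b := x) refl (½ * β̂ - - (a ^ n₁ - β̂)) β̂)))
          β̂≤ : β̂ ≤ 2^ (suc n₁)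
          β̂≤ = ≡⇒≤ (trans (sym (R.*-identityˡ β̂)) (trans (cong (_* β̂) (sym 2*½)) (R.*-assoc _ _ _))) ⟨≤⟩
            *-monoʳ-≤ 0≤2 (½β̂ ⟨≤⟩ ^-mono n₁ 0≤a a≤2)

        absurd : (Σ ℕ λ n → Σ ℕ λ m → 1 ℕ.≤ n × n ℕ.≤ Q × ∣ a ^ n - b ^ m ∣ ≤ ½^ l * b ^ m) → ⊥
        -- Closeness at p together with its failure at p + 1 gives both bounds on |w|, because cc (p
        -- + 1) ≤ 2 cc p.
        absurd (suc n′ , m₁ , 1≤n₁ , n₁≤Q , close) = finish (lastTrue decide s close not-forever)
          where
          n₁ = suc n′
          Close : ℕ → Set
          Close t = ∣ a ^ n₁ - b ^ m₁ ∣ ≤ ½^ (cc ℕ.* suc (t ℕ.+ p₀)) * b ^ m₁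
          decide : ∀ t → Close t ⊎ ¬ Close t
          decide t = pick (∣ a ^ n₁ - b ^ m₁ ∣ ≤? (½^ (cc ℕ.* suc (t ℕ.+ p₀)) * b ^ m₁))
            where
            pick : Dec (Close t) → Close t ⊎ ¬ Close t
            pick (yes p) = inj₁ p
            pick (no ¬p) = inj₂ ¬p
          m₁<M : m₁ ℕ.< M
          m₁<M = ℕ.≤-trans (s≤s (ℕ.≤-trans (m₁-bound n₁ m₁ close) (ℕ.+-monoˡ-≤ 2 (ℕ.*-monoʳ-≤ 2 n₁≤Q)))) 2Q+3≤M′
          A s : ℕ
          A = Independence.Amax n₁ m₁
          -- Independence excludes closeness here: A bits contradict `Amax`, and m₁ bits pay for the
          -- factor b^m₁ ≤ 2^m₁.
          s = A ℕ.+ m₁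
          s+p₀≤ : s ℕ.+ p₀ ℕ.≤ Pmax
          s+p₀≤ = Amax≤ n₁ m₁ n₁≤Q m₁<M
          Xmin≤ : Independence.Xmin n₁ m₁ ℕ.≤ X
          Xmin≤ = ℕ.≤-trans (Xmin≤Xm n₁ m₁ n₁≤Q m₁<M)
            (ℕ.≤-trans (ℕ.m≤n+m _ (proj₁ uniform)) (ℕ.m≤m+n _ (Xλ d j m)))
          not-forever : ¬ Close s
          not-forever c = Independence.independent n₁ m₁ root golden 1≤n₁ Xmin≤ (c ⟨≤⟩
            *-mono-≤ (0≤½^ (cc ℕ.* suc (s ℕ.+ p₀))) (½^-anti s≤) (^-nonneg m₁ 0≤b) (^-mono m₁ 0≤b b≤2) ⟨≤⟩ ≡⇒≤ (R.*-comm _ _) ⟨≤⟩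
            2^*½^≤ m₁ A (ℕ.≤-reflexive (ℕ.+-comm m₁ A)))
            where
            s≤ : s ℕ.≤ cc ℕ.* suc (s ℕ.+ p₀)
            s≤ = ℕ.≤-trans (ℕ.≤-trans (ℕ.m≤m+n s p₀) (ℕ.n≤1+n _)) (ℕ.≤-trans (ℕ.≤-reflexive (sym (ℕ.*-identityˡ _))) (ℕ.*-monoˡ-≤ (suc (s ℕ.+ p₀)) 1≤cc))
          finish : (Σ ℕ λ t → t ℕ.< s × Close t × ¬ Close (suc t)) → ⊥
          finish (t , t<s , c , ¬c) = proj₂ uniform n′ n₁≤Q m₁ m₁<M t (ℕ.≤-trans (ℕ.+-monoˡ-≤ p₀ (ℕ.<⇒≤ t<s)) s+p₀≤)
              (ℕ.≤-trans (ℕ.m≤m+n (proj₁ uniform) Xm) (ℕ.m≤m+n (proj₁ uniform ℕ.+ Xm) (Xλ d j m))) (ℕ.m≤n+m (Xλ d j m) (proj₁ uniform ℕ.+ Xm)) root golden c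
              (*-monoˡ-≤ (^-nonneg m₁ 0≤b) (½^-anti e≤) ⟨≤⟩ lower (≤-total (½^ (cc ℕ.* suc (suc t ℕ.+ p₀)) * b ^ m₁) ∣ a ^ n₁ - b ^ m₁ ∣))
            where
            lower : (½^ (cc ℕ.* suc (suc t ℕ.+ p₀)) * b ^ m₁ ≤ ∣ a ^ n₁ - b ^ m₁ ∣) ⊎ (∣ a ^ n₁ - b ^ m₁ ∣ ≤ ½^ (cc ℕ.* suc (suc t ℕ.+ p₀)) * b ^ m₁) →
                    ½^ (cc ℕ.* suc (suc t ℕ.+ p₀)) * b ^ m₁ ≤ ∣ a ^ n₁ - b ^ m₁ ∣
            lower (inj₁ p) = p
            lower (inj₂ p) = ⊥-elim (¬c p)
            e≤ : cc ℕ.* suc (suc t ℕ.+ p₀) ℕ.≤ 2 ℕ.* (cc ℕ.* suc (t ℕ.+ p₀))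
            e≤ = le (cc ℕ.* (t ℕ.+ p₀)) (lemma cc (t ℕ.+ p₀))
              where
              lemma : ∀ c x → c ℕ.* suc (suc x) ℕ.+ c ℕ.* x ≡ 2 ℕ.* (c ℕ.* suc x)
              lemma = solve-∀

      no-large-solution : ⊥
      no-large-solution = absurd (subst (λ z → Σ ℕ λ n → Σ ℕ λ m → 1 ℕ.≤ n × n ℕ.≤ z × ∣ a ^ n - b ^ m ∣ ≤ ½^ l * b ^ m) (sym Q≡) (small-unit l))

  private
    maximum : ∀ Q M (f : ℕ → ℕ → ℕ) → Σ ℕ λ b → ∀ i j → i ℕ.≤ Q → j ℕ.< M → f i j ℕ.≤ b
    maximum Q M f = SumN (suc Q) (λ i → SumN M (f i)) , λ i j i≤Q j<M →
        ℕ.≤-trans (term M (f i) j j<M) (term (suc Q) (λ i → SumN M (f i)) i (s≤s i≤Q))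
      where
      term : ∀ n f k → k ℕ.< n → f k ℕ.≤ SumN n f
      term (suc n) f zero _ = ℕ.m≤m+n _ _
      term (suc n) f (suc k) (s≤s p) = ℕ.≤-trans (term n (λ i → f (suc i)) k p) (ℕ.m≤n+m _ _)

  Bound : Set
  Bound = Σ ℕ λ B → ∀ j m → B ℕ.≤ j → Sumℤ (suc d) (λ i → g (j ℕ.+ i)) ≡ + v m → ⊥

  private
    bound-from : ∀ p₀ Q → (∀ t → (54 ℕ.+ 4 ℕ.* cc) ℕ.* suc (t ℕ.+ p₀) ℕ.≤ 2 ℕ.^ (t ℕ.+ p₀)) → Q ≡ 2 ℕ.^ (cc ℕ.* suc p₀) →
                 (Σ ℕ λ b → ∀ n m → n ℕ.≤ Q → m ℕ.< 2 ℕ.* Q ℕ.+ 3 → Independence.Amax n m ℕ.+ m ℕ.+ p₀ ℕ.≤ b) →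
                 (Σ ℕ λ b → ∀ n m → n ℕ.≤ Q → m ℕ.< 2 ℕ.* Q ℕ.+ 3 → Independence.Xmin n m ℕ.≤ b) → Bound
    bound-from p₀ Q room Q≡ (Pmax , Amax≤) (Xm , Xmin≤) = B , Bounded.no-large-solution p₀ Q (2 ℕ.* Q ℕ.+ 3) Pmax (2 ℕ.^ suc Pmax) (R₀ Q (2 ℕ.^ suc Pmax) ℕ.+ 2) Xm B
        room Q≡ ℕ.≤-refl Amax≤ Xmin≤ refl ℕ.≤-refl ℕ.≤-refl
      where
      B : ℕ
      B = (R₀ Q (2 ℕ.^ suc Pmax) ℕ.+ 2) ℕ.* (Q ℕ.* 2 ℕ.^ suc Pmax)

    bound-at : ∀ p₀ → (∀ t → (54 ℕ.+ 4 ℕ.* cc) ℕ.* suc (t ℕ.+ p₀) ℕ.≤ 2 ℕ.^ (t ℕ.+ p₀)) → ∀ Q → Q ≡ 2 ℕ.^ (cc ℕ.* suc p₀) → Bound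
    bound-at p₀ room Q Q≡ = bound-from p₀ Q room Q≡ (maximum Q (2 ℕ.* Q ℕ.+ 3) (λ n m → Independence.Amax n m ℕ.+ m ℕ.+ p₀)) (maximum Q (2 ℕ.* Q ℕ.+ 3) (λ n m → Independence.Xmin n m))

  bound : Bound
  bound = go (54 ℕ.+ 4 ℕ.* cc) refl
    where
    go : ∀ C → C ≡ 54 ℕ.+ 4 ℕ.* cc → Bound
    go C eq = bound-at (C ℕ.+ (C ℕ.+ 2)) (λ t → subst (λ z → z ℕ.* suc (t ℕ.+ (C ℕ.+ (C ℕ.+ 2))) ℕ.≤ 2 ℕ.^ (t ℕ.+ (C ℕ.+ (C ℕ.+ 2)))) eq (room-for C t))
      (2 ℕ.^ (cc ℕ.* suc (C ℕ.+ (C ℕ.+ 2)))) refl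

-- The k-generalized Fibonacci numbers and the theorem.

open import Defs
open import Data.Bool using (if_then_else_)
open import Data.List using (List; []; _∷_; take; map; applyUpTo)
open import Data.Nat.ListAction using (sum)
open import Relation.Nullary.Decidable using (does; dec-true; dec-false)
open IntegerSequences
open Combinatorics using (SumN; SumN-mono)
open Rational using (ℚ-orderedField)

private
  SumN-last : ∀ n f → SumN (suc n) f ≡ SumN n f ℕ.+ f n
  SumN-last zero f    = ℕ.+-identityʳ _
  SumN-last (suc n) f = trans (cong (f 0 ℕ.+_) (SumN-last n (λ i → f (suc i)))) (sym (ℕ.+-assoc (f 0) _ _))

  Sumℤ-pos : ∀ n f → Sumℤ n (λ i → + f i) ≡ + SumN n f
  Sumℤ-pos zero f    = refl
  Sumℤ-pos (suc n) f = cong (λ z → + f 0 ℤ.+ z) (Sumℤ-pos n (λ i → f (suc i)))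

  sum-applyUpTo : ∀ (h f : ℕ → ℕ) n → sum (map h (applyUpTo f n)) ≡ SumN n (λ i → h (f i))
  sum-applyUpTo h f zero    = refl
  sum-applyUpTo h f (suc n) = cong (h (f 0) ℕ.+_) (sum-applyUpTo h (λ i → f (suc i)) n)

  if-true : ∀ {P : Set} (P? : Dec P) {x y : ℕ} → P → (if does P? then x else y) ≡ x
  if-true P? p rewrite dec-true P? p = refl

  if-false : ∀ {P : Set} (P? : Dec P) {x y : ℕ} → ¬ P → (if does P? then x else y) ≡ y
  if-false P? p rewrite dec-false P? p = refl

module Concrete (k″ : ℕ) where
  k : ℕ
  k = suc (suc k″)

  -- The list handed to `kstep`, with the empty list at 0, so that `G-step` needs no case
  -- distinction in its statement.
  earlier : ℕ → List ℕ
  earlier zero    = []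
  earlier (suc j) = kgen k j

  G-step : ∀ j → G k j ≡ kstep k j (earlier j)
  G-step zero    = refl
  G-step (suc j) = refl

  earlier-suc : ∀ j → earlier (suc j) ≡ G k j ∷ earlier j
  earlier-suc zero    = refl
  earlier-suc (suc j) = refl

  sum-take : ∀ n N → sum (take n (earlier (N ℕ.+ n))) ≡ SumN n (λ i → G k (N ℕ.+ i))
  sum-take zero N    = refl
  sum-take (suc n) N = trans (cong (λ z → sum (take (suc n) (earlier z))) (ℕ.+-suc N n))
    (trans (cong (λ z → sum (take (suc n) z)) (earlier-suc (N ℕ.+ n)))
      (trans (cong (G k (N ℕ.+ n) ℕ.+_) (sum-take n N))
        (trans (ℕ.+-comm (G k (N ℕ.+ n)) _) (sym (SumN-last n (λ i → G k (N ℕ.+ i)))))))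

  G-zero : ∀ i → suc i ℕ.< k → G k i ≡ 0
  G-zero i (s≤s (s≤s i≤)) = trans (G-step i) (if-true (i ℕ.≤? k″) i≤)

  G-one : G k (suc k″) ≡ 1
  G-one = trans (if-false (suc k″ ℕ.≤? k″) ℕ.1+n≰n) (if-true (suc k″ ℕ.≤? suc k″) ℕ.≤-refl)

  G-rec : ∀ N → G k (N ℕ.+ k) ≡ SumN k (λ i → G k (N ℕ.+ i))
  G-rec N = trans (G-step (N ℕ.+ k)) (trans (if-false (N ℕ.+ k ℕ.≤? k″) (λ p → big (ℕ.≤-trans p (ℕ.n≤1+n k″))))
    (trans (if-false (N ℕ.+ k ℕ.≤? suc k″) big) (sum-take k N)))
    where
    big : ¬ (N ℕ.+ k ℕ.≤ suc k″)
    big p = ℕ.1+n≰n (ℕ.≤-trans (ℕ.m≤n+m k N) p)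

  private
    -- A geometric series; the extra 2^N on the left is what lets the induction close.
    sum-powers : ∀ n N (f : ℕ → ℕ) → (∀ i → i ℕ.< n → f i ℕ.≤ 2 ℕ.^ (N ℕ.+ i)) → SumN n f ℕ.+ 2 ℕ.^ N ℕ.≤ 2 ℕ.^ (N ℕ.+ n)
    sum-powers zero N f h    = ℕ.≤-reflexive (cong (2 ℕ.^_) (sym (ℕ.+-identityʳ N)))
    sum-powers (suc n) N f h = ℕ.≤-trans (ℕ.≤-reflexive (lemma (f 0) (SumN n (λ i → f (suc i))) (2 ℕ.^ N)))
      (ℕ.≤-trans (ℕ.+-monoˡ-≤ _ (ℕ.≤-trans (h 0 (s≤s z≤n)) (ℕ.≤-reflexive (cong (2 ℕ.^_) (ℕ.+-identityʳ N)))))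
        (ℕ.≤-trans (ℕ.≤-reflexive (lemma′ (SumN n (λ i → f (suc i))) (2 ℕ.^ N)))
          (ℕ.≤-trans (sum-powers n (suc N) (λ i → f (suc i)) (λ i p → ℕ.≤-trans (h (suc i) (s≤s p)) (ℕ.≤-reflexive (cong (2 ℕ.^_) (ℕ.+-suc N i)))))
            (ℕ.≤-reflexive (cong (2 ℕ.^_) (sym (ℕ.+-suc N n)))))))
      where
      lemma : ∀ a s p → a ℕ.+ s ℕ.+ p ≡ a ℕ.+ (s ℕ.+ p)
      lemma = solve-∀
      lemma′ : ∀ s p → p ℕ.+ (s ℕ.+ p) ≡ s ℕ.+ 2 ℕ.* p
      lemma′ = solve-∀

    window-bound : ∀ N i → i ℕ.< N ℕ.+ k → G k i ℕ.≤ 2 ℕ.^ i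
    window-bound zero i i<k = pick (ℕ.m≤n⇒m<n∨m≡n i<k)
      where
      pick : (suc i ℕ.< k) ⊎ (suc i ≡ k) → G k i ℕ.≤ 2 ℕ.^ i
      pick (inj₁ p)    = ℕ.≤-trans (ℕ.≤-reflexive (G-zero i p)) z≤n
      pick (inj₂ refl) = ℕ.≤-trans (ℕ.≤-reflexive G-one) (ℕ.m^n>0 2 (suc k″))
    window-bound (suc N) i (s≤s i≤) = pick (ℕ.m≤n⇒m<n∨m≡n i≤)
      where
      pick : (i ℕ.< N ℕ.+ k) ⊎ (i ≡ N ℕ.+ k) → G k i ℕ.≤ 2 ℕ.^ i
      pick (inj₁ p)    = window-bound N i p
      pick (inj₂ refl) = ℕ.≤-trans (ℕ.≤-reflexive (G-rec N)) (ℕ.≤-trans (ℕ.m≤m+n _ (2 ℕ.^ N))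
        (sum-powers k N (λ i → G k (N ℕ.+ i)) (λ i p → window-bound N (N ℕ.+ i) (ℕ.+-monoʳ-< N p))))

  G≤2^ : ∀ i → G k i ℕ.≤ 2 ℕ.^ i
  G≤2^ i = window-bound (suc i) i (ℕ.m≤m+n (suc i) k)

  private
    two-last : ∀ N → G k (N ℕ.+ k″) ℕ.+ G k (N ℕ.+ suc k″) ℕ.≤ G k (N ℕ.+ k)
    two-last N = ℕ.≤-trans (ℕ.+-monoˡ-≤ (f (suc k″)) (ℕ.m≤n+m (f k″) (SumN k″ f)))
      (ℕ.≤-reflexive (sym (trans (G-rec N) (trans (SumN-last (suc k″) f) (cong (ℕ._+ f (suc k″)) (SumN-last k″ f))))))
      where
      f : ℕ → ℕ
      f i = G k (N ℕ.+ i)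

    -- The two newest terms of the window suffice: one of them is positive and the other has already
    -- grown.
    growth : ∀ N → (1 ℕ.≤ G k (N ℕ.+ suc k″)) × (suc N ℕ.≤ G k (N ℕ.+ k))
    growth zero = ℕ.≤-reflexive (sym G-one) , ℕ.≤-trans (ℕ.≤-trans (ℕ.≤-reflexive (sym G-one)) (ℕ.m≤n+m _ (G k k″))) (two-last 0)
    growth (suc N) = ℕ.≤-trans (ℕ.≤-trans (s≤s z≤n) (proj₂ (growth N))) (ℕ.≤-reflexive (cong (G k) (ℕ.+-suc N (suc k″)))) ,
      ℕ.≤-trans (ℕ.≤-trans (ℕ.+-mono-≤ (proj₁ (growth N)) (proj₂ (growth N)))
        (ℕ.≤-reflexive (cong₂ (λ x y → G k x ℕ.+ G k y) (ℕ.+-suc N k″) (ℕ.+-suc N (suc k″))))) (two-last (suc N))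

  G-grows : ∀ N → N ℕ.≤ G k (N ℕ.+ k)
  G-grows N = ℕ.≤-trans (ℕ.n≤1+n N) (proj₂ (growth N))

  g : ℕ → ℤ
  g i = + G k i

  g-rec : Recℤ k g
  g-rec N = trans (drop-≡ N g k) (trans (cong +_ (G-rec N)) (trans (sym (Sumℤ-pos k (λ i → G k (N ℕ.+ i)))) (Sumℤ-cong k (λ i → sym (drop-≡ N g i)))))

private
  m≤1+fib : ∀ m → m ℕ.≤ suc (fib m)
  m≤1+fib 0 = z≤n
  m≤1+fib 1 = s≤s z≤n
  m≤1+fib (suc (suc zero)) = ℕ.≤-refl
  m≤1+fib (suc (suc (suc m))) = ℕ.≤-trans (s≤s (m≤1+fib (suc (suc m)))) (s≤s (ℕ.≤-trans (ℕ.≤-reflexive (ℕ.+-comm 1 _)) (ℕ.+-monoʳ-≤ (fib (suc (suc m))) (1≤fib m))))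
    where
    1≤fib : ∀ m → 1 ℕ.≤ fib (suc m)
    1≤fib zero    = ℕ.≤-refl
    1≤fib (suc m) = ℕ.≤-trans (1≤fib m) (ℕ.m≤m+n _ _)

  windowSum-SumN : ∀ k d j → windowSum k d j ≡ SumN (suc d) (λ i → G k (j ℕ.+ i))
  windowSum-SumN k d j = sum-applyUpTo (λ i → G k (j ℕ.+ i)) (λ i → i) (suc d)

  term≤SumN : ∀ n f i → i ℕ.< n → f i ℕ.≤ SumN n f
  term≤SumN (suc n) f zero _ = ℕ.m≤m+n _ _
  term≤SumN (suc n) f (suc i) (s≤s p) = ℕ.≤-trans (term≤SumN n (λ i → f (suc i)) i p) (ℕ.m≤n+m _ _)

open import Data.Nat using (_≤_; _+_; _∸_)

theorem3p2 : (d k : ℕ) → 3 ≤ k →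
    Σ ℕ (λ B → (m j : ℕ) → windowSum k d j ≡ fib m → (m ≤ B × j ≤ B))
theorem3p2 d (suc zero) (s≤s ())
theorem3p2 d (suc (suc k″)) 3≤k = finish P.bound
  where
  open Concrete k″
  one : ∀ i → suc i ≡ k → g i ≡ + 1
  one i refl = cong +_ G-one
  𝓖 : KBonacci
  𝓖 = record { k = k ; 3≤k = 3≤k ; g = g ; g-rec = g-rec ; g-bound = G≤2^
             ; g-zero = λ i p → cong +_ (G-zero i p) ; g-one = one ; g-grows = G-grows }
  module P = Bounding ℚ-orderedField 𝓖 d
  module F = MultiplicativeIndependence ℚ-orderedField 𝓖
  fib-v : ∀ m → (fib m ≡ F.v m) × (fib (suc m) ≡ F.v (suc m))
  fib-v zero    = refl , refl
  fib-v (suc m) = proj₂ (fib-v m) , trans (cong₂ ℕ._+_ (proj₂ (fib-v m)) (proj₁ (fib-v m))) (ℕ.+-comm (F.v (suc m)) (F.v m))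
  finish : P.Bound → Σ ℕ (λ B → (m j : ℕ) → windowSum k d j ≡ fib m → (m ℕ.≤ B × j ℕ.≤ B))
  -- No solution has j ≥ B. For j < B the sum over all windows stands in for their maximum, and m ≤
  -- fib m + 1 explains the successor.
  finish (B , large) = B ℕ.+ suc (SumN B (windowSum k d)) , λ m j eq → solution m j eq (ℕ.<-≤-connex j B)
    where
    solution : ∀ m j → windowSum k d j ≡ fib m → (j ℕ.< B) ⊎ (B ℕ.≤ j) →
               (m ℕ.≤ B ℕ.+ suc (SumN B (windowSum k d))) × (j ℕ.≤ B ℕ.+ suc (SumN B (windowSum k d)))
    solution m j eq (inj₁ j<B) =
      ℕ.≤-trans (m≤1+fib m) (ℕ.≤-trans (s≤s (ℕ.≤-trans (ℕ.≤-reflexive (sym eq)) (term≤SumN B (windowSum k d) j j<B))) (ℕ.m≤n+m _ B)) ,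
      ℕ.≤-trans (ℕ.<⇒≤ j<B) (ℕ.m≤m+n B _)
    solution m j eq (inj₂ B≤j) = ⊥-elim (large j m B≤j
      (trans (Sumℤ-pos (suc d) (λ i → G k (j ℕ.+ i))) (cong +_ (trans (sym (windowSum-SumN k d j)) (trans eq (proj₁ (fib-v m)))))))
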